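{- Let $p\ge 3$, $q\ge 3$ and $r\ge 2$ be integers. The graph $d(p,q,r)$ is determined by its Laplacian permanental polynomial; that is, for every graph $H$, if $\pi(L(H);x)=\pi(L(d(p,q,r));x)$ then $H$ is isomorphic to $d(p,q,r)$.
   Context: All graphs are finite, simple and undirected (not necessarily connected). For a graph $G$ with vertices $v_1,\dots,v_n$, let $A(G)$ be its $(0,1)$-adjacency matrix, $D(G)=\mathrm{diag}(d(v_1),\dots,d(v_n))$ the diagonal matrix of vertex degrees, and $L(G)=D(G)-A(G)$ the Laplacian matrix. The permanent of an $n\times n$ matrix $X=(x_{ij})$ is $\mathrm{per}(X)=\sum_{\sigma}\prod_{i=1}^n x_{i\sigma(i)}$, the sum being over all permutations $\sigma$ of $\{1,\dots,n\}$. The Laplacian permanental polynomial of $G$ is $\pi(L(G);x)=\mathrm{per}(xI-L(G))$, where $I$ is the $n\times n$ identity matrix. $C_n$ and $P_n$ denote the cycle and the path on $n$ vertices. The graph $d(p,q,r)$ is obtained from vertex-disjoint copies of the cycles $C_p$ ($p\ge 3$), $C_q$ ($q\ge 3$) and the path $P_r$ by identifying one end vertex of $P_r$ with a vertex of $C_p$ and the other (different) end vertex of $P_r$ with a vertex of $C_q$. -}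

module Defs where

open import Level using (0ℓ)
open import Algebra.Bundles.Raw using (RawRing)
import Algebra.Definitions.RawSemiring as RawSemiringDefs
open import Data.Bool.Base using (Bool; true; false; not; _∧_; _∨_; if_then_else_)
open import Data.Bool.Properties using (∨-comm)
open import Data.Fin.Base using (Fin; zero; suc; toℕ; fromℕ; splitAt; _↑ʳ_; _↑ˡ_; punchIn; punchOut)
open import Data.Fin.Permutation using (Permutation; Permutation′; _⟨$⟩ʳ_; insert; remove; insert-remove) renaming (_≈_ to _≈ₚ_; id to idₚ)
open import Data.Fin.Properties using (_≟_; punchIn-injective)
open import Data.Fin.Subset using (Subset; ∣_∣)
open import Data.Integer.Base as ℤ using (ℤ; +_; 0ℤ; 1ℤ)
open import Data.List.Base using (List; []; _∷_; map; foldr; concatMap; allFin)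
import Data.List.Relation.Unary.All as All
import Data.List.Relation.Unary.All.Properties as All
open import Data.List.Relation.Unary.AllPairs as AllPairs using (AllPairs; []; _∷_)
import Data.List.Relation.Unary.AllPairs.Properties as AllPairs
open import Data.List.Relation.Unary.Any as Any using (Any; here)
import Data.List.Relation.Unary.Any.Properties as Any
open import Data.List.Membership.Propositional.Properties using (∈-allFin)
open import Data.List.Membership.Propositional using (lose)
open import Data.List.Relation.Unary.Unique.Propositional.Properties using (allFin⁺)
open import Data.Nat.Base as ℕ using (ℕ; zero; suc; pred; _≤_; s≤s; _≡ᵇ_)
open import Data.Product.Base using (∃)
open import Data.Sum.Base using (_⊎_; inj₁; inj₂)
open import Data.Vec.Base using (tabulate)
open import Data.Vec.Functional using (Vector)
open import Relation.Nullary.Decidable using (does; yes; no)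
open import Relation.Nullary.Negation using (¬_; contradiction)
open import Relation.Binary.PropositionalEquality using (_≡_; refl; sym; trans; cong; cong₂)

private
  variable
    m n : ℕ

record Graph (n : ℕ) : Set where
  field
    adj         : Fin n → Fin n → Bool
    symmetric   : ∀ i j → adj i j ≡ adj j i
    irreflexive : ∀ i → adj i i ≡ false

open Graph public

infix 4 _≅_

_≅_ : Graph m → Graph n → Set
_≅_ {m} {n} G H = ∃ λ (π : Permutation m n) →
  ∀ i j → adj H (π ⟨$⟩ʳ i) (π ⟨$⟩ʳ j) ≡ adj G i j

neighbours : Graph n → Fin n → Subset n
neighbours G i = tabulate (adj G i)

degree : Graph n → Fin n → ℕ
degree G i = ∣ neighbours G i ∣

fromRel : (Fin n → Fin n → Bool) → Graph n
fromRel R = record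
  { adj         = λ i j → not (does (i ≟ j)) ∧ (R i j ∨ R j i)
  ; symmetric   = λ i j → cong₂ (λ b c → not b ∧ c) (≟-sym i j) (∨-comm (R i j) (R j i))
  ; irreflexive = λ i → cong (λ b → not b ∧ (R i i ∨ R i i)) (≟-refl i)
  }
  where
  ≟-refl : (i : Fin n) → does (i ≟ i) ≡ true
  ≟-refl i with i ≟ i
  ... | yes _  = refl
  ... | no i≢i = contradiction refl i≢i

  ≟-sym : (i j : Fin n) → does (i ≟ j) ≡ does (j ≟ i)
  ≟-sym i j with i ≟ j | j ≟ i
  ... | yes _   | yes _   = refl
  ... | no _    | no _    = refl
  ... | yes i≡j | no j≢i  = contradiction (sym i≡j) j≢i
  ... | no i≢j  | yes j≡i = contradiction (sym j≡i) i≢j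

path : ∀ n → Graph n
path n = fromRel λ i j → toℕ j ≡ᵇ suc (toℕ i)

-- Only meaningful as a cycle for n ≥ 3: cycle 1 and cycle 2 are P₁ and P₂.

cycle : ∀ n → Graph n
cycle n = fromRel λ i j →
  (toℕ j ≡ᵇ suc (toℕ i)) ∨ ((suc (toℕ i) ≡ᵇ n) ∧ (toℕ j ≡ᵇ 0))

-- The disjoint union of G and H with the vertex u of G and the vertex v
-- of H identified.  The first m vertices are those of G, the remaining
-- n are those of H other than v.

module _ (G : Graph m) (u : Fin m) (H : Graph (suc n)) (v : Fin (suc n)) where

  identifyAdj : Fin m ⊎ Fin n → Fin m ⊎ Fin n → Bool
  identifyAdj (inj₁ a) (inj₁ b) = adj G a b
  identifyAdj (inj₁ a) (inj₂ y) = does (a ≟ u) ∧ adj H v (punchIn v y)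
  identifyAdj (inj₂ x) (inj₁ b) = does (b ≟ u) ∧ adj H v (punchIn v x)
  identifyAdj (inj₂ x) (inj₂ y) = adj H (punchIn v x) (punchIn v y)

  identifyAdj-sym : ∀ s t → identifyAdj s t ≡ identifyAdj t s
  identifyAdj-sym (inj₁ a) (inj₁ b) = symmetric G a b
  identifyAdj-sym (inj₁ a) (inj₂ y) = refl
  identifyAdj-sym (inj₂ x) (inj₁ b) = refl
  identifyAdj-sym (inj₂ x) (inj₂ y) = symmetric H (punchIn v x) (punchIn v y)

  identifyAdj-irrefl : ∀ s → identifyAdj s s ≡ false
  identifyAdj-irrefl (inj₁ a) = irreflexive G a
  identifyAdj-irrefl (inj₂ x) = irreflexive H (punchIn v x)

  identify : Graph (m ℕ.+ n)
  identify = record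
    { adj         = λ i j → identifyAdj (splitAt m i) (splitAt m j)
    ; symmetric   = λ i j → identifyAdj-sym (splitAt m i) (splitAt m j)
    ; irreflexive = λ i → identifyAdj-irrefl (splitAt m i)
    }

  -- The image of a vertex of H under the identification.

  fromRight : Fin (suc n) → Fin (m ℕ.+ n)
  fromRight w with v ≟ w
  ... | yes _  = u ↑ˡ n
  ... | no v≢w = m ↑ʳ punchOut v≢w

-- Vertex 0 of the cycle of length p is identified with vertex 0 of the
-- path, and the other end r - 1 of the path with vertex 0 of the cycle
-- of length q.

d : ∀ p q r → 3 ≤ p → 3 ≤ q → 2 ≤ r → Graph (p ℕ.+ pred r ℕ.+ pred q)
d p@(suc _) q@(suc _) r@(suc r-1) (s≤s _) (s≤s _) (s≤s _) =
  identify
    (identify (cycle p) zero (path r) zero)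
    (fromRight (cycle p) zero (path r) zero (fromℕ r-1))
    (cycle q) zero

-- insert zero j π sends 0 to j and acts as π on the remaining elements.
-- The two lemmas below show that every permutation is listed exactly once,
-- up to pointwise equality.

permutations : ∀ n → List (Permutation′ n)
permutations zero    = idₚ ∷ []
permutations (suc n) =
  concatMap (λ j → map (insert zero j) (permutations n)) (allFin (suc n))

permutations-complete : ∀ n (π : Permutation′ n) → Any (π ≈ₚ_) (permutations n)
permutations-complete zero    π = here λ ()
permutations-complete (suc n) π =
  Any.concatMap⁺ _ (lose (∈-allFin (π ⟨$⟩ʳ zero))
    (Any.map⁺ (Any.map lemma (permutations-complete n (remove zero π)))))
  where
  lemma : ∀ {ρ} → remove zero π ≈ₚ ρ → π ≈ₚ insert zero (π ⟨$⟩ʳ zero) ρ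
  lemma eq zero    = refl
  lemma eq (suc k) = trans (sym (insert-remove zero π (suc k)))
                           (cong (punchIn (π ⟨$⟩ʳ zero)) (eq k))

permutations-distinct : ∀ n → AllPairs (λ π ρ → ¬ π ≈ₚ ρ) (permutations n)
permutations-distinct zero    = All.[] ∷ []
permutations-distinct (suc n) = AllPairs.concat⁺
  (All.map⁺ (All.universal same-image _))
  (AllPairs.map⁺ (AllPairs.map different-image (allFin⁺ (suc n))))
  where
  same-image : ∀ j → AllPairs (λ π ρ → ¬ π ≈ₚ ρ) (map (insert zero j) (permutations n))
  same-image j = AllPairs.map⁺ (AllPairs.map
    (λ {π} {ρ} π≉ρ eq →
      π≉ρ λ k → punchIn-injective j (π ⟨$⟩ʳ k) (ρ ⟨$⟩ʳ k) (eq (suc k)))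
    (permutations-distinct n))

  different-image : ∀ {i j} → ¬ i ≡ j →
    All.All (λ π → All.All (λ ρ → ¬ π ≈ₚ ρ) (map (insert zero j) (permutations n)))
      (map (insert zero i) (permutations n))
  different-image i≢j = All.map⁺ (All.universal
    (λ _ → All.map⁺ (All.universal (λ _ eq → i≢j (eq zero)) _)) _)

Matrix : ∀ {a} → Set a → ℕ → Set a
Matrix A n = Fin n → Fin n → A

module _ {c ℓ} (R : RawRing c ℓ) where
  open RawRing R
  open RawSemiringDefs rawSemiring using (product)

  per : Matrix Carrier n → Carrier
  per {n} X =
    foldr _+_ 0# (map (λ σ → product λ i → X i (σ ⟨$⟩ʳ i)) (permutations n))

-- Lists of coefficients, constant term first; trailing zeros are allowed,
-- so equality of polynomials is _≈_ rather than _≡_.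

Poly : Set
Poly = List ℤ

coeff : Poly → ℕ → ℤ
coeff []      _       = 0ℤ
coeff (a ∷ f) zero    = a
coeff (a ∷ f) (suc k) = coeff f k

infix  4 _≈_
infixl 6 _+_
infixl 7 _*_
infix  8 -_

_≈_ : Poly → Poly → Set
f ≈ g = ∀ k → coeff f k ≡ coeff g k

_+_ : Poly → Poly → Poly
[]      + g       = g
(a ∷ f) + []      = a ∷ f
(a ∷ f) + (b ∷ g) = a ℤ.+ b ∷ f + g

-_ : Poly → Poly
- f = map (λ a → ℤ.- a) f

_*_ : Poly → Poly → Poly
[]      * g = []
(a ∷ f) * g = map (a ℤ.*_) g + (0ℤ ∷ f * g)

const : ℤ → Poly
const a = a ∷ []

x : Poly
x = 0ℤ ∷ 1ℤ ∷ []

polyRing : RawRing 0ℓ 0ℓ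
polyRing = record
  { Carrier = Poly ; _≈_ = _≈_ ; _+_ = _+_ ; _*_ = _*_ ; -_ = -_
  ; 0# = [] ; 1# = const 1ℤ
  }

diag : Vector ℤ n → Matrix ℤ n
diag v i j = if does (i ≟ j) then v i else 0ℤ

identity : Matrix ℤ n
identity = diag λ _ → 1ℤ

adjacency : Graph n → Matrix ℤ n
adjacency G i j = if adj G i j then 1ℤ else 0ℤ

laplacian : Graph n → Matrix ℤ n
laplacian G i j = diag (λ k → + degree G k) i j ℤ.- adjacency G i j

permanentalPoly : Matrix ℤ n → Poly
permanentalPoly M = per polyRing λ i j → x * const (identity i j) + - const (M i j)

{-# OPTIONS --safe #-}
module Submission where

-- For x = 2 + 1/z - z, zⁿ π(L(G); x) is the permanent of the matrix with diagonal 1 + (2 - d)z - z² and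
-- entry z on every edge, which is a power series with constant term 1.  Its coefficients of z and z²
-- show that a graph with the polynomial of d(p,q,r) has two vertices of degree 3 and all others of
-- degree 2: it is a dumbbell or a theta graph together with disjoint cycles.  The permanents along a
-- path satisfy a recurrence with characteristic roots 1 and -z², which yields closed forms.  Let e be
-- the least cycle length that occurs on either side.  The coefficients of zᵉ, …, zᵉ⁺³ are even up to
-- the contributions of the arcs, which begin with ±1; this parity, together with the identity modulo 2,
-- excludes theta graphs and extra cycles and recovers p and q, and the number of vertices gives r.

open import Defs hiding (_+_; _*_; -_; x; const; diag; _≈_)
import Defs as D
open import Level using (0ℓ)
open import Algebra.Bundles using (CommutativeRing; RawRing)
import Algebra.Definitions.RawSemiring as RawSemiringDefs
import Algebra.Solver.CommutativeMonoid as CommutativeMonoidSolver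
import Algebra.Solver.Ring as RingSolver
import Algebra.Solver.Ring.NaturalCoefficients.Default as NatSolver
open import Algebra.Solver.Ring.AlmostCommutativeRing using (AlmostCommutativeRing; fromCommutativeRing; _-Raw-AlmostCommutative⟶_)
import Data.Bool.Base
open import Data.Bool.Base using (Bool; true; false; not; _∧_; _∨_; if_then_else_)
import Data.Bool.Properties
import Data.Vec.Base
open import Data.Empty using (⊥; ⊥-elim)
open import Data.Unit.Base using (tt)
open import Data.Fin.Base using (Fin; zero; suc; toℕ; fromℕ; fromℕ<; splitAt; _↑ʳ_; _↑ˡ_; punchIn; punchOut; inject₁)
import Data.Fin.Properties as Fin
open import Data.Fin.Permutation using (Permutation; Permutation′; _⟨$⟩ʳ_; insert; permutation)
open import Data.Fin.Subset using (∣_∣)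
open import Data.Integer.Base using (ℤ; +_; -[1+_]; 0ℤ; 1ℤ)
import Data.Integer.Base as ℤ
import Data.Integer.Properties as ℤ
import Data.Integer.Tactic.RingSolver as ℤ-Solver
open import Data.List.Base as List using (List; []; _∷_; _++_; map; foldr; concatMap; length; allFin; filter; reverse; [_]; _∷ʳ_)
import Data.List.Properties as List
open import Data.List.Membership.Propositional using (_∈_; _∉_)
import Data.List.Membership.Propositional.Properties as Mem
open import Data.List.Membership.Propositional.Properties using (∈-allFin; ∈-++⁺ˡ; ∈-++⁺ʳ; ∈-++⁻; ∈-∃++; ∈-map⁺; ∈-filter⁺; ∈-filter⁻)
open import Data.List.Relation.Unary.All as All using (All; []; _∷_)
import Data.List.Relation.Unary.All.Properties as All
open import Data.List.Relation.Unary.Any as Any using (here; there)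
import Data.List.Relation.Unary.Any.Properties as Any
open import Data.List.Relation.Unary.AllPairs using ([]; _∷_)
open import Data.List.Relation.Unary.Unique.Propositional using (Unique)
import Data.List.Relation.Unary.Unique.Propositional.Properties as Unique
open import Data.List.Relation.Binary.Permutation.Propositional using (_↭_; ↭-refl; ↭-sym; ↭-trans; ↭-prep; ↭-swap; ↭-reflexive)
import Data.List.Relation.Binary.Permutation.Propositional as Perm
import Data.List.Relation.Binary.Permutation.Propositional.Properties as Perm
import Data.List.Relation.Binary.Permutation.Setoid.Properties as SetoidPerm
open import Data.Maybe.Base using (Maybe; just; nothing)
open import Data.Nat.Base using (ℕ; zero; suc; pred; _+_; _*_; _∸_; _≤_; _<_; z≤n; s≤s; _≡ᵇ_)
open import Data.Nat.ListAction using (sum)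
open import Data.Nat.ListAction.Properties using (sum-↭)
import Data.Nat.Properties as ℕ
import Data.Nat.Tactic.RingSolver as ℕ-Solver
open import Data.Product.Base using (Σ; ∃; ∃₂; Σ-syntax; _×_; _,_; proj₁; proj₂)
open import Data.Sum.Base using (_⊎_; inj₁; inj₂; [_,_]′)
open import Function.Base using (_∘_; id)
open import Relation.Nullary.Decidable using (Dec; does; yes; no; ¬?; _⊎-dec_)
open import Relation.Nullary.Negation using (¬_; contradiction)
open import Relation.Binary.Definitions using (tri<; tri≈; tri>)
open import Relation.Binary.PropositionalEquality using (_≡_; _≢_; refl; sym; trans; cong; cong₂; subst; subst₂; module ≡-Reasoning)
import Relation.Binary.Reasoning.Setoid as SetoidReasoning
import Relation.Binary.PropositionalEquality as ≡

-- Power series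

record Series : Set where
  no-eta-equality
  constructor series
  infixl 9 _‼_
  field _‼_ : ℕ → ℤ
open Series public

infixl 6 _⊕_
infixl 7 _⊗_
infix  8 ⊝_
infix  4 _≗_

tl : Series → Series
tl f ‼ n = f ‼ suc n

_⊕_ : Series → Series → Series
(f ⊕ g) ‼ n = f ‼ n ℤ.+ g ‼ n

⊝_ : Series → Series
(⊝ f) ‼ n = ℤ.- f ‼ n

_⊗_ : Series → Series → Series
(f ⊗ g) ‼ zero  = f ‼ 0 ℤ.* g ‼ 0
(f ⊗ g) ‼ suc n = f ‼ 0 ℤ.* g ‼ suc n ℤ.+ (tl f ⊗ g) ‼ n

C : ℤ → Series
C a ‼ zero  = a
C a ‼ suc n = 0ℤ

Z : ℕ → Series
Z zero    = C 1ℤ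
Z (suc k) ‼ zero  = 0ℤ
Z (suc k) ‼ suc n = Z k ‼ n

_≗_ : Series → Series → Set
f ≗ g = ∀ n → f ‼ n ≡ g ‼ n

⊗-zeroˡ : ∀ f g → (∀ n → f ‼ n ≡ 0ℤ) → ∀ n → (f ⊗ g) ‼ n ≡ 0ℤ
⊗-zeroˡ f g f≡0 zero    rewrite f≡0 0 = refl
⊗-zeroˡ f g f≡0 (suc n) rewrite f≡0 0 | ⊗-zeroˡ (tl f) g (λ k → f≡0 (suc k)) n = refl

C-⊗ : ∀ a g n → (C a ⊗ g) ‼ n ≡ a ℤ.* g ‼ n
C-⊗ a g zero    = refl
C-⊗ a g (suc n) = trans (cong (λ t → a ℤ.* g ‼ suc n ℤ.+ t) (⊗-zeroˡ (tl (C a)) g (λ _ → refl) n)) (ℤ.+-identityʳ _)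

⊗-≗ : ∀ {f f′ g g′} → f ≗ f′ → g ≗ g′ → f ⊗ g ≗ f′ ⊗ g′
⊗-≗ p q zero    = cong₂ ℤ._*_ (p 0) (q 0)
⊗-≗ p q (suc n) = cong₂ ℤ._+_ (cong₂ ℤ._*_ (p 0) (q (suc n))) (⊗-≗ (λ i → p (suc i)) q n)

⊗-distribʳ : ∀ h f g → (f ⊕ g) ⊗ h ≗ f ⊗ h ⊕ g ⊗ h
⊗-distribʳ h f g zero    = ℤ.*-distribʳ-+ (h ‼ 0) (f ‼ 0) (g ‼ 0)
⊗-distribʳ h f g (suc n) = trans
  (cong (λ t → (f ‼ 0 ℤ.+ g ‼ 0) ℤ.* h ‼ suc n ℤ.+ t)
    (trans (⊗-≗ {tl (f ⊕ g)} {tl f ⊕ tl g} (λ _ → refl) (λ _ → refl) n) (⊗-distribʳ h (tl f) (tl g) n)))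
  (lemma (f ‼ 0) (g ‼ 0) (h ‼ suc n) _ _)
  where
  lemma : ∀ a b c d e → (a ℤ.+ b) ℤ.* c ℤ.+ (d ℤ.+ e) ≡ (a ℤ.* c ℤ.+ d) ℤ.+ (b ℤ.* c ℤ.+ e)
  lemma = ℤ-Solver.solve-∀

private
  scale : ℤ → Series → Series
  scale a f ‼ n = a ℤ.* f ‼ n

scale-⊗ : ∀ a f g n → (scale a f ⊗ g) ‼ n ≡ a ℤ.* (f ⊗ g) ‼ n
scale-⊗ a f g zero    = ℤ.*-assoc a (f ‼ 0) (g ‼ 0)
scale-⊗ a f g (suc n) = trans
  (cong (λ t → a ℤ.* f ‼ 0 ℤ.* g ‼ suc n ℤ.+ t)
    (trans (⊗-≗ {tl (scale a f)} {scale a (tl f)} (λ _ → refl) (λ _ → refl) n) (scale-⊗ a (tl f) g n)))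
  (lemma a (f ‼ 0) (g ‼ suc n) _)
  where
  lemma : ∀ a b c d → a ℤ.* b ℤ.* c ℤ.+ a ℤ.* d ≡ a ℤ.* (b ℤ.* c ℤ.+ d)
  lemma = ℤ-Solver.solve-∀

⊗-assoc : ∀ f g h → (f ⊗ g) ⊗ h ≗ f ⊗ (g ⊗ h)
⊗-assoc f g h zero    = ℤ.*-assoc (f ‼ 0) (g ‼ 0) (h ‼ 0)
⊗-assoc f g h (suc n) = begin
  f ‼ 0 ℤ.* g ‼ 0 ℤ.* h ‼ suc n ℤ.+ (tl (f ⊗ g) ⊗ h) ‼ n
    ≡⟨ cong (λ t → f ‼ 0 ℤ.* g ‼ 0 ℤ.* h ‼ suc n ℤ.+ t)
         (trans (⊗-≗ {tl (f ⊗ g)} {scale (f ‼ 0) (tl g) ⊕ tl f ⊗ g} {h} (λ _ → refl) (λ _ → refl) n)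
                (⊗-distribʳ h (scale (f ‼ 0) (tl g)) (tl f ⊗ g) n)) ⟩
  f ‼ 0 ℤ.* g ‼ 0 ℤ.* h ‼ suc n ℤ.+ ((scale (f ‼ 0) (tl g) ⊗ h) ‼ n ℤ.+ ((tl f ⊗ g) ⊗ h) ‼ n)
    ≡⟨ cong₂ (λ a b → f ‼ 0 ℤ.* g ‼ 0 ℤ.* h ‼ suc n ℤ.+ (a ℤ.+ b)) (scale-⊗ (f ‼ 0) (tl g) h n) (⊗-assoc (tl f) g h n) ⟩
  f ‼ 0 ℤ.* g ‼ 0 ℤ.* h ‼ suc n ℤ.+ (f ‼ 0 ℤ.* (tl g ⊗ h) ‼ n ℤ.+ (tl f ⊗ (g ⊗ h)) ‼ n)
    ≡⟨ lemma (f ‼ 0) (g ‼ 0) (h ‼ suc n) _ _ ⟩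
  f ‼ 0 ℤ.* (g ‼ 0 ℤ.* h ‼ suc n ℤ.+ (tl g ⊗ h) ‼ n) ℤ.+ (tl f ⊗ (g ⊗ h)) ‼ n ∎
  where
  open ≡-Reasoning
  lemma : ∀ a b c d e → a ℤ.* b ℤ.* c ℤ.+ (a ℤ.* d ℤ.+ e) ≡ a ℤ.* (b ℤ.* c ℤ.+ d) ℤ.+ e
  lemma = ℤ-Solver.solve-∀

⊗-sucʳ : ∀ f g n → (f ⊗ g) ‼ suc n ≡ (f ⊗ tl g) ‼ n ℤ.+ f ‼ suc n ℤ.* g ‼ 0
⊗-sucʳ f g zero    = refl
⊗-sucʳ f g (suc n) = trans (cong (λ t → f ‼ 0 ℤ.* g ‼ suc (suc n) ℤ.+ t) (⊗-sucʳ (tl f) g n))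
  (sym (ℤ.+-assoc (f ‼ 0 ℤ.* g ‼ suc (suc n)) _ _))

⊗-comm : ∀ f g → f ⊗ g ≗ g ⊗ f
⊗-comm f g zero    = ℤ.*-comm (f ‼ 0) (g ‼ 0)
⊗-comm f g (suc n) = begin
  f ‼ 0 ℤ.* g ‼ suc n ℤ.+ (tl f ⊗ g) ‼ n ≡⟨ cong₂ ℤ._+_ (ℤ.*-comm (f ‼ 0) (g ‼ suc n)) (⊗-comm (tl f) g n) ⟩
  g ‼ suc n ℤ.* f ‼ 0 ℤ.+ (g ⊗ tl f) ‼ n ≡⟨ ℤ.+-comm (g ‼ suc n ℤ.* f ‼ 0) _ ⟩
  (g ⊗ tl f) ‼ n ℤ.+ g ‼ suc n ℤ.* f ‼ 0 ≡⟨ ⊗-sucʳ g f n ⟨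
  (g ⊗ f) ‼ suc n ∎
  where open ≡-Reasoning

Z-shift : ∀ k f n → (Z k ⊗ f) ‼ (k + n) ≡ f ‼ n
Z-shift zero    f n = trans (C-⊗ 1ℤ f n) (ℤ.*-identityˡ _)
Z-shift (suc k) f n = trans (ℤ.+-identityˡ _) (trans (⊗-≗ {tl (Z (suc k))} {Z k} {f} (λ _ → refl) (λ _ → refl) (k + n)) (Z-shift k f n))

Z-below : ∀ k f n → n < k → (Z k ⊗ f) ‼ n ≡ 0ℤ
Z-below (suc k) f zero    _         = refl
Z-below (suc k) f (suc n) (s≤s n<k) = trans (ℤ.+-identityˡ _)
  (trans (⊗-≗ {tl (Z (suc k))} {Z k} {f} (λ _ → refl) (λ _ → refl) n) (Z-below k f n n<k))

Z-+ : ∀ j k → Z (j + k) ≗ Z j ⊗ Z k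
Z-+ zero    k n       = sym (trans (C-⊗ 1ℤ (Z k) n) (ℤ.*-identityˡ _))
Z-+ (suc j) k zero    = refl
Z-+ (suc j) k (suc n) = trans (Z-+ j k n) (sym (trans (ℤ.+-identityˡ _)
  (⊗-≗ {tl (Z (suc j))} {Z j} {Z k} (λ _ → refl) (λ _ → refl) n)))

Z-lt : ∀ k n → n < k → Z k ‼ n ≡ 0ℤ
Z-lt (suc k) zero    _         = refl
Z-lt (suc k) (suc n) (s≤s n<k) = Z-lt k n n<k

-- The relation on coefficients is a parameter: equality, or congruence mod 2.

record Modulus : Set₁ where
  infix 4 _~_
  field
    _~_    : ℤ → ℤ → Set
    reflex : ∀ {a b} → a ≡ b → a ~ b
    symm   : ∀ {a b} → a ~ b → b ~ a
    transi : ∀ {a b c} → a ~ b → b ~ c → a ~ c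
    add    : ∀ {a b c d} → a ~ b → c ~ d → (a ℤ.+ c) ~ (b ℤ.+ d)
    mul    : ∀ {a b c d} → a ~ b → c ~ d → (a ℤ.* c) ~ (b ℤ.* d)

exact : Modulus
exact = record
  { _~_ = _≡_ ; reflex = id ; symm = sym ; transi = trans ; add = cong₂ ℤ._+_ ; mul = cong₂ ℤ._*_ }

mod2 : Modulus
mod2 = record
  { _~_    = λ a b → ∃ λ k → a ≡ b ℤ.+ (k ℤ.+ k)
  ; reflex = λ { {a} refl → 0ℤ , sym (ℤ.+-identityʳ a) }
  ; symm   = λ { {a} {b} (k , refl) → ℤ.- k , sym-lemma b k }
  ; transi = λ { {c = c} (k , refl) (l , refl) → k ℤ.+ l , trans-lemma c k l }
  ; add    = λ { {b = b} {d = d} (k , refl) (l , refl) → k ℤ.+ l , add-lemma b d k l }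
  ; mul    = λ { {b = b} {d = d} (k , refl) (l , refl) → b ℤ.* l ℤ.+ k ℤ.* d ℤ.+ (k ℤ.+ k) ℤ.* l , mul-lemma b d k l }
  }
  where
  sym-lemma : ∀ b k → b ≡ b ℤ.+ (k ℤ.+ k) ℤ.+ (ℤ.- k ℤ.+ ℤ.- k)
  sym-lemma = ℤ-Solver.solve-∀
  trans-lemma : ∀ c k l → c ℤ.+ (l ℤ.+ l) ℤ.+ (k ℤ.+ k) ≡ c ℤ.+ (k ℤ.+ l ℤ.+ (k ℤ.+ l))
  trans-lemma = ℤ-Solver.solve-∀
  add-lemma : ∀ b d k l → b ℤ.+ (k ℤ.+ k) ℤ.+ (d ℤ.+ (l ℤ.+ l)) ≡ b ℤ.+ d ℤ.+ (k ℤ.+ l ℤ.+ (k ℤ.+ l))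
  add-lemma = ℤ-Solver.solve-∀
  mul-lemma : ∀ b d k l → (b ℤ.+ (k ℤ.+ k)) ℤ.* (d ℤ.+ (l ℤ.+ l)) ≡
    b ℤ.* d ℤ.+ (b ℤ.* l ℤ.+ k ℤ.* d ℤ.+ (k ℤ.+ k) ℤ.* l ℤ.+ (b ℤ.* l ℤ.+ k ℤ.* d ℤ.+ (k ℤ.+ k) ℤ.* l))
  mul-lemma = ℤ-Solver.solve-∀

C-*0 : ∀ a b i → 0ℤ ≡ (C a ⊗ C b) ‼ suc i
C-*0 a b i = sym (trans (C-⊗ a (C b) (suc i)) (ℤ.*-zeroʳ a))

ℤ-rawRing : RawRing 0ℓ 0ℓ
ℤ-rawRing = CommutativeRing.rawRing ℤ.+-*-commutativeRing

module Truncated (μ : Modulus) (m : ℕ) where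
  open Modulus μ public

  infix 4 _≋_

  record _≋_ (f g : Series) : Set where
    constructor eqs
    field at : ∀ i → i < m → f ‼ i ~ g ‼ i
  open _≋_ public

  ≗⇒≋ : ∀ {f g} → f ≗ g → f ≋ g
  ≗⇒≋ f≗g = eqs λ i _ → reflex (f≗g i)

  private
    ⊗-cong-at : ∀ {f f′ g g′} n → (∀ i → i ≤ n → f ‼ i ~ f′ ‼ i) → (∀ i → i ≤ n → g ‼ i ~ g′ ‼ i) →
                (f ⊗ g) ‼ n ~ (f′ ⊗ g′) ‼ n
    ⊗-cong-at zero    p q = mul (p 0 z≤n) (q 0 z≤n)
    ⊗-cong-at (suc n) p q = add (mul (p 0 z≤n) (q (suc n) ℕ.≤-refl))
      (⊗-cong-at n (λ i i≤n → p (suc i) (s≤s i≤n)) (λ i i≤n → q i (ℕ.m≤n⇒m≤1+n i≤n)))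

    neg : ∀ {a b} → a ~ b → (ℤ.- a) ~ (ℤ.- b)
    neg {a} {b} a~b = transi (reflex (sym (ℤ.-1*i≡-i a))) (transi (mul (reflex {ℤ.-1ℤ} refl) a~b) (reflex (ℤ.-1*i≡-i b)))

  ⊕-cong : ∀ {f f′ g g′} → f ≋ f′ → g ≋ g′ → f ⊕ g ≋ f′ ⊕ g′
  ⊕-cong p q = eqs λ i i<m → add (at p i i<m) (at q i i<m)

  ⊗-cong : ∀ {f f′ g g′} → f ≋ f′ → g ≋ g′ → f ⊗ g ≋ f′ ⊗ g′
  ⊗-cong p q = eqs λ i i<m → ⊗-cong-at i (λ j j≤i → at p j (ℕ.≤-<-trans j≤i i<m)) (λ j j≤i → at q j (ℕ.≤-<-trans j≤i i<m))

  ⊝-cong : ∀ {f g} → f ≋ g → ⊝ f ≋ ⊝ g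
  ⊝-cong p = eqs λ i i<m → neg (at p i i<m)

  ring : CommutativeRing 0ℓ 0ℓ
  ring = record
    { Carrier = Series ; _≈_ = _≋_ ; _+_ = _⊕_ ; _*_ = _⊗_ ; -_ = ⊝_ ; 0# = C 0ℤ ; 1# = C 1ℤ
    ; isCommutativeRing = record
      { isRing = record
        { +-isAbelianGroup = record
          { isGroup = record
            { isMonoid = record
              { isSemigroup = record
                { isMagma = record
                  { isEquivalence = record
                    { refl  = eqs λ _ _ → reflex refl
                    ; sym   = λ p → eqs λ i i<m → symm (at p i i<m)
                    ; trans = λ p q → eqs λ i i<m → transi (at p i i<m) (at q i i<m)
                    }
                  ; ∙-cong = ⊕-cong
                  }
                ; assoc = λ f g h → ≗⇒≋ λ i → ℤ.+-assoc (f ‼ i) (g ‼ i) (h ‼ i)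
                }
              ; identity = (λ f → ≗⇒≋ λ { zero → ℤ.+-identityˡ (f ‼ 0) ; (suc i) → ℤ.+-identityˡ (f ‼ suc i) })
                         , (λ f → ≗⇒≋ λ { zero → ℤ.+-identityʳ (f ‼ 0) ; (suc i) → ℤ.+-identityʳ (f ‼ suc i) })
              }
            ; inverse = (λ f → ≗⇒≋ λ { zero → ℤ.+-inverseˡ (f ‼ 0) ; (suc i) → ℤ.+-inverseˡ (f ‼ suc i) })
                      , (λ f → ≗⇒≋ λ { zero → ℤ.+-inverseʳ (f ‼ 0) ; (suc i) → ℤ.+-inverseʳ (f ‼ suc i) })
            ; ⁻¹-cong = ⊝-cong
            }
          ; comm = λ f g → ≗⇒≋ λ i → ℤ.+-comm (f ‼ i) (g ‼ i)
          }
        ; *-cong = ⊗-cong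
        ; *-assoc = λ f g h → ≗⇒≋ (⊗-assoc f g h)
        ; *-identity = (λ f → ≗⇒≋ (⊗-1ˡ f))
                     , (λ f → ≗⇒≋ λ i → trans (⊗-comm f (C 1ℤ) i) (⊗-1ˡ f i))
        ; distrib = (λ f g h → ≗⇒≋ λ i → trans (⊗-comm f (g ⊕ h) i)
                       (trans (⊗-distribʳ f g h i) (cong₂ ℤ._+_ (⊗-comm g f i) (⊗-comm h f i))))
                  , (λ f g h → ≗⇒≋ (⊗-distribʳ f g h))
        }
      ; *-comm = λ f g → ≗⇒≋ (⊗-comm f g)
      }
    }
    where
    ⊗-1ˡ : ∀ f → (C 1ℤ ⊗ f) ≗ f
    ⊗-1ˡ f i = trans (C-⊗ 1ℤ f i) (ℤ.*-identityˡ _)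

  open CommutativeRing ring public
    using (setoid)
    renaming (refl to ≋-refl; sym to ≋-sym; trans to ≋-trans; reflexive to ≋-reflexive)

  private
    almost : AlmostCommutativeRing 0ℓ 0ℓ
    almost = fromCommutativeRing ring

    morphism : ℤ-rawRing -Raw-AlmostCommutative⟶ almost
    morphism = record
      { ⟦_⟧ = C
      ; +-homo = λ a b → ≗⇒≋ λ { zero → refl ; (suc i) → refl }
      ; *-homo = λ a b → ≗⇒≋ λ { zero → refl ; (suc i) → C-*0 a b i }
      ; -‿homo = λ a → ≗⇒≋ λ { zero → refl ; (suc i) → refl }
      ; 0-homo = ≋-refl {C 0ℤ}
      ; 1-homo = ≋-refl {C 1ℤ}
      }

    C-≟ : ∀ a b → Maybe (C a ≋ C b)
    C-≟ a b with a ℤ.≟ b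
    ... | yes refl = just ≋-refl
    ... | no _     = nothing

  open RingSolver ℤ-rawRing almost morphism C-≟ public
    using (solve; con; _:+_; _:*_; _:-_; :-_; _:=_; _:^_; Polynomial)

  Z-hom : ∀ j k → Z (j + k) ≋ Z j ⊗ Z k
  Z-hom j k = ≗⇒≋ (Z-+ j k)

  Z≋0 : ∀ k → m ≤ k → Z k ≋ C 0ℤ
  Z≋0 k m≤k = eqs λ i i<m → reflex (trans (Z-lt k i (ℕ.<-≤-trans i<m m≤k)) (sym (C0 i)))
    where
    C0 : ∀ i → C 0ℤ ‼ i ≡ 0ℤ
    C0 zero    = refl
    C0 (suc i) = refl

-- Permanents over lists of rows and columns

module Permanent (R : CommutativeRing 0ℓ 0ℓ) {V : Set} (M : V → V → CommutativeRing.Carrier R) where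
  open CommutativeRing R
    renaming (Carrier to K; _+_ to _∔_; _*_ to _·_; refl to ≈-refl; sym to ≈-sym; trans to ≈-trans)
    hiding (_-_; zero)
  open NatSolver commutativeSemiring using (solve; _:+_; _:*_; _:=_)
  open SetoidReasoning setoid

  expand : (V → List V → K) → List V → K
  expand f []       = 0#
  expand f (c ∷ cs) = f c cs ∔ expand (λ d ds → f d (c ∷ ds)) cs

  -- Laplace expansion along the first row; rows and columns are given as lists.

  perm : List V → List V → K
  perm []       cs = 1#
  perm (r ∷ rs) cs = expand (λ c ds → M r c · perm rs ds) cs

  P : List V → K
  P vs = perm vs vs

  expand-cong : ∀ {f g} cs → (∀ c ds → c ∷ ds ↭ cs → f c ds ≈ g c ds) → expand f cs ≈ expand g cs
  expand-cong []       h = ≈-refl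
  expand-cong (x ∷ cs) h = +-cong (h x cs ↭-refl)
    (expand-cong cs λ c ds p → h c (x ∷ ds) (↭-trans (↭-swap c x ↭-refl) (↭-prep x p)))

  expand-0 : ∀ cs → expand (λ _ _ → 0#) cs ≈ 0#
  expand-0 []       = ≈-refl
  expand-0 (x ∷ cs) = ≈-trans (+-identityˡ _) (expand-0 cs)

  expand-zero : ∀ {f} cs → (∀ c ds → c ∈ cs → f c ds ≈ 0#) → expand f cs ≈ 0#
  expand-zero cs h = ≈-trans (expand-cong cs λ c ds p → h c ds (Perm.∈-resp-↭ p (here refl))) (expand-0 cs)

  expand-+ : ∀ f g cs → expand (λ c ds → f c ds ∔ g c ds) cs ≈ expand f cs ∔ expand g cs
  expand-+ f g []       = ≈-sym (+-identityˡ 0#)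
  expand-+ f g (x ∷ cs) = ≈-trans (+-congˡ (expand-+ _ _ cs))
    (solve 4 (λ a b c d → (a :+ b) :+ (c :+ d) := (a :+ c) :+ (b :+ d)) ≈-refl _ _ _ _)

  expand-*ˡ : ∀ a f cs → expand (λ c ds → a · f c ds) cs ≈ a · expand f cs
  expand-*ˡ a f []       = ≈-sym (zeroʳ a)
  expand-*ˡ a f (x ∷ cs) = ≈-trans (+-congˡ (expand-*ˡ a _ cs)) (≈-sym (distribˡ a _ _))

  expand-*ʳ : ∀ a f cs → expand (λ c ds → f c ds · a) cs ≈ expand f cs · a
  expand-*ʳ a f []       = ≈-sym (zeroˡ a)
  expand-*ʳ a f (x ∷ cs) = ≈-trans (+-congˡ (expand-*ʳ a _ cs)) (≈-sym (distribʳ a _ _))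

  expand-++ : ∀ f cs cs′ → expand f (cs ++ cs′) ≈
    expand (λ c ds → f c (ds ++ cs′)) cs ∔ expand (λ c ds → f c (cs ++ ds)) cs′
  expand-++ f []       cs′ = ≈-sym (+-identityˡ _)
  expand-++ f (x ∷ cs) cs′ = ≈-trans (+-congˡ (expand-++ _ cs cs′)) (≈-sym (+-assoc _ _ _))

  expand-↭ : ∀ f → (∀ c {ds ds′} → ds ↭ ds′ → f c ds ≈ f c ds′) → ∀ {cs cs′} → cs ↭ cs′ → expand f cs ≈ expand f cs′
  expand-↭ f resp Perm.refl         = ≈-refl
  expand-↭ f resp (Perm.prep x p)   = +-cong (resp x p) (expand-↭ _ (λ c q → resp c (↭-prep x q)) p)
  expand-↭ f resp (Perm.swap {_} {cs′} x y p) = ≈-trans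
    (+-cong (resp x (↭-prep y p)) (+-cong (resp y (↭-prep x p)) (≈-trans
      (expand-↭ _ (λ c q → resp c (↭-prep x (↭-prep y q))) p)
      (expand-cong cs′ λ c ds _ → resp c (↭-swap x y ↭-refl)))))
    (solve 3 (λ a b c → a :+ (b :+ c) := b :+ (a :+ c)) ≈-refl _ _ _)
  expand-↭ f resp (Perm.trans p q)  = ≈-trans (expand-↭ f resp p) (expand-↭ f resp q)

  expand-flip : ∀ (g : V → V → List V → K) cs →
    expand (λ c ds → expand (λ d es → g c d es) ds) cs ≈ expand (λ c ds → expand (λ d es → g d c es) ds) cs
  expand-flip g []       = ≈-refl
  expand-flip g (x ∷ cs) = begin
    expand (λ d es → g x d es) cs ∔ expand (λ c ds → g c x ds ∔ expand (λ d es → g c d (x ∷ es)) ds) cs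
      ≈⟨ +-congˡ (expand-+ _ _ cs) ⟩
    expand (λ d es → g x d es) cs ∔ (expand (λ c ds → g c x ds) cs ∔ expand (λ c ds → expand (λ d es → g c d (x ∷ es)) ds) cs)
      ≈⟨ +-congˡ (+-congˡ (expand-flip (λ c d es → g c d (x ∷ es)) cs)) ⟩
    expand (λ d es → g x d es) cs ∔ (expand (λ c ds → g c x ds) cs ∔ expand (λ c ds → expand (λ d es → g d c (x ∷ es)) ds) cs)
      ≈⟨ solve 3 (λ a b c → a :+ (b :+ c) := b :+ (a :+ c)) ≈-refl _ _ _ ⟩
    expand (λ c ds → g c x ds) cs ∔ (expand (λ d es → g x d es) cs ∔ expand (λ c ds → expand (λ d es → g d c (x ∷ es)) ds) cs)
      ≈⟨ +-congˡ (expand-+ _ _ cs) ⟨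
    expand (λ c ds → g c x ds) cs ∔ expand (λ c ds → g x c ds ∔ expand (λ d es → g d c (x ∷ es)) ds) cs ∎

  perm-cols : ∀ rs {cs cs′} → cs ↭ cs′ → perm rs cs ≈ perm rs cs′
  perm-cols []       p = ≈-refl
  perm-cols (r ∷ rs) p = expand-↭ _ (λ c q → *-congˡ (perm-cols rs q)) p

  perm-rows : ∀ {rs rs′} → rs ↭ rs′ → ∀ cs → perm rs cs ≈ perm rs′ cs
  perm-rows Perm.refl         cs = ≈-refl
  perm-rows (Perm.prep x p)   cs = expand-cong cs λ c ds _ → *-congˡ (perm-rows p ds)
  perm-rows (Perm.swap {rs} {rs′} x y p) cs = begin
    expand (λ c ds → M x c · expand (λ d es → M y d · perm rs es) ds) cs
      ≈⟨ expand-cong cs (λ c ds _ → ≈-sym (expand-*ˡ (M x c) _ ds)) ⟩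
    expand (λ c ds → expand (λ d es → M x c · (M y d · perm rs es)) ds) cs
      ≈⟨ expand-flip (λ c d es → M x c · (M y d · perm rs es)) cs ⟩
    expand (λ c ds → expand (λ d es → M x d · (M y c · perm rs es)) ds) cs
      ≈⟨ expand-cong cs (λ c ds _ → expand-cong ds λ d es _ →
           ≈-trans (*-congˡ (*-congˡ (perm-rows p es)))
             (solve 3 (λ a b k → a :* (b :* k) := b :* (a :* k)) ≈-refl _ _ _)) ⟩
    expand (λ c ds → expand (λ d es → M y c · (M x d · perm rs′ es)) ds) cs
      ≈⟨ expand-cong cs (λ c ds _ → expand-*ˡ (M y c) _ ds) ⟩
    expand (λ c ds → M y c · expand (λ d es → M x d · perm rs′ es) ds) cs ∎
  perm-rows (Perm.trans p q)  cs = ≈-trans (perm-rows p cs) (perm-rows q cs)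

  P-↭ : ∀ {vs ws} → vs ↭ ws → P vs ≈ P ws
  P-↭ {vs} {ws} p = ≈-trans (perm-cols vs p) (perm-rows p ws)

  block : ∀ rs rs′ cs cs′ → length rs ≡ length cs → (∀ {r c} → r ∈ rs → c ∈ cs′ → M r c ≈ 0#) →
    perm (rs ++ rs′) (cs ++ cs′) ≈ perm rs cs · perm rs′ cs′
  block []       rs′ []  cs′ _   _ = ≈-sym (*-identityˡ _)
  block (r ∷ rs) rs′ cs  cs′ len h = begin
    expand (λ c ds → M r c · perm (rs ++ rs′) ds) (cs ++ cs′)
      ≈⟨ expand-++ _ cs cs′ ⟩
    expand (λ c ds → M r c · perm (rs ++ rs′) (ds ++ cs′)) cs ∔ expand (λ c ds → M r c · perm (rs ++ rs′) (cs ++ ds)) cs′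
      ≈⟨ +-cong (expand-cong cs λ c ds p → ≈-trans
                  (*-congˡ (block rs rs′ ds cs′ (ℕ.suc-injective (trans len (sym (Perm.↭-length p)))) λ r∈ → h (there r∈)))
                  (≈-sym (*-assoc _ _ _)))
                (expand-zero cs′ λ c ds c∈ → ≈-trans (*-congʳ (h (here refl) c∈)) (zeroˡ _)) ⟩
    expand (λ c ds → M r c · perm rs ds · perm rs′ cs′) cs ∔ 0#
      ≈⟨ ≈-trans (+-identityʳ _) (expand-*ʳ _ _ cs) ⟩
    expand (λ c ds → M r c · perm rs ds) cs · perm rs′ cs′ ∎

  Separated : List V → List V → Set
  Separated xs ys = ∀ {x y} → x ∈ xs → y ∈ ys → (M x y ≈ 0#) × (M y x ≈ 0#)

  P-++ : ∀ xs ys → Separated xs ys → P (xs ++ ys) ≈ P xs · P ys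
  P-++ xs ys h = block xs ys xs ys refl λ x∈ y∈ → proj₁ (h x∈ y∈)

  P-bridge : ∀ u A r B → Separated A (r ∷ B) → Separated [ u ] B →
    P (u ∷ A ++ r ∷ B) ≈ P (u ∷ A) · P (r ∷ B) ∔ M u r · M r u · P A · P B
  P-bridge u A r B hA hu = begin
    expand (λ c ds → M u c · perm (A ++ r ∷ B) ds) (u ∷ A ++ r ∷ B)
      ≈⟨ expand-++ (λ c ds → M u c · perm (A ++ r ∷ B) ds) (u ∷ A) (r ∷ B) ⟩
    expand (λ c ds → M u c · perm (A ++ r ∷ B) (ds ++ r ∷ B)) (u ∷ A) ∔
      (M u r · perm (A ++ r ∷ B) (u ∷ A ++ B) ∔ expand (λ c ds → M u c · perm (A ++ r ∷ B) (u ∷ A ++ r ∷ ds)) B)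
      ≈⟨ +-cong inside (+-cong (*-congˡ across)
           (expand-zero B λ c ds c∈ → ≈-trans (*-congʳ (proj₁ (hu (here refl) c∈))) (zeroˡ _))) ⟩
    P (u ∷ A) · P (r ∷ B) ∔ (M u r · (P B · (M r u · 1# ∔ 0#) · P A) ∔ 0#)
      ≈⟨ +-congˡ (≈-trans (+-identityʳ _) (≈-trans (*-congˡ (*-congʳ (*-congˡ (≈-trans (+-identityʳ _) (*-identityʳ _)))))
           (solve 4 (λ a b p q → a :* (q :* b :* p) := a :* b :* p :* q) ≈-refl _ _ _ _))) ⟩
    P (u ∷ A) · P (r ∷ B) ∔ M u r · M r u · P A · P B ∎
    where
    inside : expand (λ c ds → M u c · perm (A ++ r ∷ B) (ds ++ r ∷ B)) (u ∷ A) ≈ P (u ∷ A) · P (r ∷ B)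
    inside = ≈-trans
      (expand-cong (u ∷ A) λ c ds p → ≈-trans
        (*-congˡ (block A (r ∷ B) ds (r ∷ B) (ℕ.suc-injective (sym (Perm.↭-length p))) λ x∈ y∈ → proj₁ (hA x∈ y∈)))
        (≈-sym (*-assoc _ _ _)))
      (expand-*ʳ _ (λ c ds → M u c · perm A ds) (u ∷ A))
    across : perm (A ++ r ∷ B) (u ∷ A ++ B) ≈ P B · (M r u · 1# ∔ 0#) · P A
    across = begin
      perm (A ++ r ∷ B) (u ∷ A ++ B)
        ≈⟨ ≈-trans (perm-rows (Perm.++-comm A (r ∷ B)) _) (perm-cols (r ∷ B ++ A) (↭-prep u (Perm.++-comm A B))) ⟩
      perm (r ∷ B ++ A) (u ∷ B ++ A)
        ≈⟨ block (r ∷ B) A (u ∷ B) A refl (λ y∈ x∈ → proj₂ (hA x∈ y∈)) ⟩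
      perm (r ∷ B) (u ∷ B) · P A
        ≈⟨ *-congʳ (≈-trans (perm-rows (Perm.∷↭∷ʳ r B) _) (perm-cols (B ++ r ∷ []) (Perm.∷↭∷ʳ u B))) ⟩
      perm (B ++ r ∷ []) (B ++ u ∷ []) · P A
        ≈⟨ *-congʳ (block B (r ∷ []) B (u ∷ []) refl λ { x∈ (here refl) → proj₂ (hu (here refl) x∈) }) ⟩
      P B · (M r u · 1# ∔ 0#) · P A ∎

module FinPermanent (R : CommutativeRing 0ℓ 0ℓ) {V : Set} (M : V → V → CommutativeRing.Carrier R) where
  open CommutativeRing R
    renaming (Carrier to K; _+_ to _∔_; _*_ to _·_; refl to ≈-refl; sym to ≈-sym; trans to ≈-trans)
    hiding (_-_; zero)
  open Permanent R M
  open RawSemiringDefs (RawRing.rawSemiring rawRing) using (product)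
  open SetoidReasoning setoid

  private
    sumL : List K → K
    sumL = foldr _∔_ 0#

    sumL-++ : ∀ as bs → sumL (as ++ bs) ≈ sumL as ∔ sumL bs
    sumL-++ []       bs = ≈-sym (+-identityˡ _)
    sumL-++ (a ∷ as) bs = ≈-trans (+-congˡ (sumL-++ as bs)) (≈-sym (+-assoc _ _ _))

    sumL-concatMap : ∀ {A B : Set} (F : B → K) (g : A → List B) as →
      sumL (map F (concatMap g as)) ≈ sumL (map (λ a → sumL (map F (g a))) as)
    sumL-concatMap F g []       = ≈-refl
    sumL-concatMap F g (a ∷ as) = begin
      sumL (map F (g a ++ concatMap g as))         ≡⟨ cong sumL (List.map-++ F (g a) _) ⟩
      sumL (map F (g a) ++ map F (concatMap g as)) ≈⟨ sumL-++ (map F (g a)) _ ⟩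
      sumL (map F (g a)) ∔ sumL (map F (concatMap g as)) ≈⟨ +-congˡ (sumL-concatMap F g as) ⟩
      _ ∎

    sumL-cong : ∀ {A : Set} {F G : A → K} as → (∀ a → F a ≈ G a) → sumL (map F as) ≈ sumL (map G as)
    sumL-cong []       h = ≈-refl
    sumL-cong (a ∷ as) h = +-cong (h a) (sumL-cong as h)

    sumL-*ˡ : ∀ {A : Set} (b : K) (F : A → K) as → sumL (map (λ a → b · F a) as) ≈ b · sumL (map F as)
    sumL-*ˡ b F []       = ≈-sym (zeroʳ b)
    sumL-*ˡ b F (a ∷ as) = ≈-trans (+-congˡ (sumL-*ˡ b F as)) (≈-sym (distribˡ b _ _))

    expand-tabulate : ∀ n (F : V → List V → K) (g : Fin (suc n) → V) →
      expand F (List.tabulate g) ≈ sumL (List.tabulate λ j → F (g j) (List.tabulate (g ∘ punchIn j)))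
    expand-tabulate zero    F g = ≈-refl
    expand-tabulate (suc n) F g = +-congˡ (expand-tabulate n (λ d ds → F d (g zero ∷ ds)) (g ∘ suc))

  per≈perm : ∀ {n} (f g : Fin n → V) →
    per rawRing (λ i j → M (f i) (g j)) ≈ perm (List.tabulate f) (List.tabulate g)
  per≈perm {zero}  f g = +-identityʳ _
  per≈perm {suc n} f g = begin
    sumL (map F (concatMap (λ j → map (insert zero j) (permutations n)) (allFin (suc n))))
      ≈⟨ sumL-concatMap F (λ j → map (insert zero j) (permutations n)) (allFin (suc n)) ⟩
    sumL (map (λ j → sumL (map F (map (insert zero j) (permutations n)))) (allFin (suc n)))
      ≈⟨ sumL-cong (allFin (suc n)) step ⟩
    sumL (map (λ j → G (g j) (List.tabulate (g ∘ punchIn j))) (allFin (suc n)))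
      ≡⟨ cong sumL (List.map-tabulate {n = suc n} id λ j → G (g j) (List.tabulate (g ∘ punchIn j))) ⟩
    sumL (List.tabulate λ j → G (g j) (List.tabulate (g ∘ punchIn j)))
      ≈⟨ expand-tabulate n G g ⟨
    expand G (List.tabulate g) ∎
    where
    F : Permutation′ (suc n) → K
    F σ = product λ i → M (f i) (g (σ ⟨$⟩ʳ i))
    G : V → List V → K
    G c ds = M (f zero) c · perm (List.tabulate (f ∘ suc)) ds
    step : ∀ j → sumL (map F (map (insert zero j) (permutations n))) ≈ G (g j) (List.tabulate (g ∘ punchIn j))
    step j = begin
      sumL (map F (map (insert zero j) (permutations n)))
        ≡⟨ cong sumL (sym (List.map-∘ (permutations n))) ⟩
      sumL (map (λ π → M (f zero) (g j) · product (λ i → M (f (suc i)) (g (punchIn j (π ⟨$⟩ʳ i))))) (permutations n))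
        ≈⟨ sumL-*ˡ _ _ (permutations n) ⟩
      M (f zero) (g j) · per rawRing (λ i k → M (f (suc i)) (g (punchIn j k)))
        ≈⟨ *-congˡ (per≈perm (f ∘ suc) (g ∘ punchIn j)) ⟩
      G (g j) (List.tabulate (g ∘ punchIn j)) ∎

-- The homogenisation Σ gₖ uᵏ zᴺ⁻ᵏ with u = 1 + 2z - z², that is zᴺ g(2 + 1/z - z).

U : Series
U = C 1ℤ ⊕ C (+ 2) ⊗ Z 1 ⊕ ⊝ (Z 1 ⊗ Z 1)

homog : ℕ → (ℕ → ℤ) → Series
homog zero    g = C (g 0)
homog (suc N) g = C (g 0) ⊗ Z (suc N) ⊕ U ⊗ homog N (g ∘ suc)

Degree≤ : ℕ → (ℕ → ℤ) → Set
Degree≤ N g = ∀ k → N < k → g k ≡ 0ℤ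

coeff-+ : ∀ f g k → coeff (f D.+ g) k ≡ coeff f k ℤ.+ coeff g k
coeff-+ []      g       k       = sym (ℤ.+-identityˡ _)
coeff-+ (a ∷ f) []      k       = sym (ℤ.+-identityʳ _)
coeff-+ (a ∷ f) (b ∷ g) zero    = refl
coeff-+ (a ∷ f) (b ∷ g) (suc k) = coeff-+ f g k

coeff-map : ∀ a f k → coeff (map (a ℤ.*_) f) k ≡ a ℤ.* coeff f k
coeff-map a []      k       = sym (ℤ.*-zeroʳ a)
coeff-map a (b ∷ f) zero    = refl
coeff-map a (b ∷ f) (suc k) = coeff-map a f k

delay : (ℕ → ℤ) → (ℕ → ℤ)
delay g zero    = 0ℤ
delay g (suc k) = g k

coeff-linear : ∀ b a f k → coeff ((b ∷ a ∷ []) D.* f) k ≡ b ℤ.* coeff f k ℤ.+ delay (λ j → a ℤ.* coeff f j) k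
coeff-linear b a f k = trans (coeff-+ (map (b ℤ.*_) f) _ k) (cong₂ ℤ._+_ (coeff-map b f k) (lemma k))
  where
  zero-tail : ∀ j → coeff (0ℤ ∷ []) j ≡ 0ℤ
  zero-tail zero    = refl
  zero-tail (suc j) = refl
  lemma : ∀ k → coeff (0ℤ ∷ (map (a ℤ.*_) f D.+ (0ℤ ∷ []))) k ≡ delay (λ j → a ℤ.* coeff f j) k
  lemma zero    = refl
  lemma (suc k) = trans (coeff-+ (map (a ℤ.*_) f) (0ℤ ∷ []) k)
    (trans (cong₂ ℤ._+_ (coeff-map a f k) (zero-tail k)) (ℤ.+-identityʳ _))

module Homogenise (m : ℕ) where
  open Truncated exact m
  open SetoidReasoning setoid

  C-cong : ∀ {a b} → a ≡ b → C a ≋ C b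
  C-cong refl = ≋-refl

  homog-cong : ∀ N {g h : ℕ → ℤ} → (∀ k → g k ≡ h k) → homog N g ≋ homog N h
  homog-cong zero    e = C-cong (e 0)
  homog-cong (suc N) e = ⊕-cong (⊗-cong (C-cong (e 0)) ≋-refl) (⊗-cong ≋-refl (homog-cong N (λ k → e (suc k))))

  homog-+ : ∀ N g h → homog N (λ k → g k ℤ.+ h k) ≋ homog N g ⊕ homog N h
  homog-+ zero    g h = ≗⇒≋ λ { zero → refl ; (suc _) → refl }
  homog-+ (suc N) g h = begin
    C (g 0 ℤ.+ h 0) ⊗ Z (suc N) ⊕ U ⊗ homog N (λ k → g (suc k) ℤ.+ h (suc k))
      ≈⟨ ⊕-cong (⊗-cong {f′ = C (g 0) ⊕ C (h 0)} (≗⇒≋ λ { zero → refl ; (suc _) → refl }) ≋-refl) (⊗-cong ≋-refl (homog-+ N (g ∘ suc) (h ∘ suc))) ⟩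
    (C (g 0) ⊕ C (h 0)) ⊗ Z (suc N) ⊕ U ⊗ (homog N (g ∘ suc) ⊕ homog N (h ∘ suc))
      ≈⟨ solve 6 (λ a b z u p q → (a :+ b) :* z :+ u :* (p :+ q) := a :* z :+ u :* p :+ (b :* z :+ u :* q)) ≋-refl _ _ _ _ _ _ ⟩
    homog (suc N) g ⊕ homog (suc N) h ∎

  C-* : ∀ a b → C (a ℤ.* b) ≋ C a ⊗ C b
  C-* a b = ≗⇒≋ λ { zero → refl ; (suc i) → C-*0 a b i }

  homog-scale : ∀ N a g → homog N (λ k → a ℤ.* g k) ≋ C a ⊗ homog N g
  homog-scale zero    a g = C-* a (g 0)
  homog-scale (suc N) a g = ≋-trans
    (⊕-cong (⊗-cong (C-* a (g 0)) ≋-refl) (⊗-cong ≋-refl (homog-scale N a (g ∘ suc))))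
    (solve 5 (λ a b z u p → a :* b :* z :+ u :* (a :* p) := a :* (b :* z :+ u :* p)) ≋-refl _ _ _ _ _)

  homog-0 : ∀ N g → (∀ k → g k ≡ 0ℤ) → homog N g ≋ C 0ℤ
  homog-0 zero    g e = C-cong (e 0)
  homog-0 (suc N) g e = ≋-trans (⊕-cong (⊗-cong (C-cong (e 0)) ≋-refl) (⊗-cong ≋-refl (homog-0 N (g ∘ suc) (λ k → e (suc k)))))
    (solve 2 (λ z u → con 0ℤ :* z :+ u :* con 0ℤ := con 0ℤ) ≋-refl _ _)

  homog-raise : ∀ N g → g (suc N) ≡ 0ℤ → homog (suc N) g ≋ Z 1 ⊗ homog N g
  homog-raise zero    g e = ≋-trans (⊕-cong ≋-refl (⊗-cong ≋-refl (C-cong e)))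
    (solve 3 (λ a z u → a :* z :+ u :* con 0ℤ := z :* a) ≋-refl _ _ _)
  homog-raise (suc N) g e = begin
    C (g 0) ⊗ Z (suc (suc N)) ⊕ U ⊗ homog (suc N) (g ∘ suc)
      ≈⟨ ⊕-cong (⊗-cong ≋-refl (Z-hom 1 (suc N))) (⊗-cong ≋-refl (homog-raise N (g ∘ suc) e)) ⟩
    C (g 0) ⊗ (Z 1 ⊗ Z (suc N)) ⊕ U ⊗ (Z 1 ⊗ homog N (g ∘ suc))
      ≈⟨ solve 5 (λ a z y u p → a :* (z :* y) :+ u :* (z :* p) := z :* (a :* y :+ u :* p)) ≋-refl _ _ _ _ _ ⟩
    Z 1 ⊗ homog (suc N) g ∎

  homog-linear : ∀ N b a f → coeff f (suc N) ≡ 0ℤ →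
    homog (suc N) (coeff ((b ∷ a ∷ []) D.* f)) ≋ (C b ⊗ Z 1 ⊕ C a ⊗ U) ⊗ homog N (coeff f)
  homog-linear N b a f e = begin
    homog (suc N) (coeff ((b ∷ a ∷ []) D.* f))
      ≈⟨ homog-cong (suc N) (coeff-linear b a f) ⟩
    homog (suc N) (λ k → b ℤ.* coeff f k ℤ.+ delay (λ j → a ℤ.* coeff f j) k)
      ≈⟨ homog-+ (suc N) (λ k → b ℤ.* coeff f k) (delay (λ j → a ℤ.* coeff f j)) ⟩
    homog (suc N) (λ k → b ℤ.* coeff f k) ⊕ (C 0ℤ ⊗ Z (suc N) ⊕ U ⊗ homog N (λ k → a ℤ.* coeff f k))
      ≈⟨ ⊕-cong (≋-trans (homog-scale (suc N) b (coeff f)) (⊗-cong ≋-refl (homog-raise N (coeff f) e)))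
                (⊕-cong ≋-refl (⊗-cong ≋-refl (homog-scale N a (coeff f)))) ⟩
    C b ⊗ (Z 1 ⊗ homog N (coeff f)) ⊕ (C 0ℤ ⊗ Z (suc N) ⊕ U ⊗ (C a ⊗ homog N (coeff f)))
      ≈⟨ solve 6 (λ b z p y u a → b :* (z :* p) :+ (con 0ℤ :* y :+ u :* (a :* p)) := (b :* z :+ a :* u) :* p) ≋-refl _ _ _ _ _ _ ⟩
    (C b ⊗ Z 1 ⊕ C a ⊗ U) ⊗ homog N (coeff f) ∎

  module _ {n : ℕ} (b a : Fin n → Fin n → ℤ) where

    entry : Fin n → Fin n → Series
    entry i j = C (b i j) ⊗ Z 1 ⊕ C (a i j) ⊗ U

    linear : Fin n → Fin n → Poly
    linear i j = b i j ∷ a i j ∷ []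

    private
      product′ = RawSemiringDefs.product (RawRing.rawSemiring (CommutativeRing.rawRing ring))

      productP : ∀ {k} → (Fin k → Poly) → Poly
      productP = RawSemiringDefs.product (RawRing.rawSemiring polyRing)

      degree-product : ∀ {k} (f g : Fin k → Fin n) → Degree≤ k (coeff (productP λ i → linear (f i) (g i)))
      degree-product {zero}  f g (suc k) _ = refl
      degree-product {suc l} f g (suc k) (s≤s l<k) = trans (coeff-linear (b (f zero) (g zero)) (a (f zero) (g zero)) (productP λ i → linear (f (suc i)) (g (suc i))) (suc k))
        (trans (cong₂ (λ s t → b (f zero) (g zero) ℤ.* s ℤ.+ a (f zero) (g zero) ℤ.* t)
           (degree-product (f ∘ suc) (g ∘ suc) (suc k) (ℕ.m≤n⇒m≤1+n l<k)) (degree-product (f ∘ suc) (g ∘ suc) k l<k))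
        (cong₂ ℤ._+_ (ℤ.*-zeroʳ (b (f zero) (g zero))) (ℤ.*-zeroʳ (a (f zero) (g zero)))))

      homog-product : ∀ {k} (f g : Fin k → Fin n) →
        homog k (coeff (productP λ i → linear (f i) (g i))) ≋ product′ (λ i → entry (f i) (g i))
      homog-product {zero}  f g = ≋-refl
      homog-product {suc k} f g = ≋-trans
        (homog-linear k _ _ (productP λ i → linear (f (suc i)) (g (suc i))) (degree-product (f ∘ suc) (g ∘ suc) (suc k) ℕ.≤-refl))
        (⊗-cong ≋-refl (homog-product (f ∘ suc) (g ∘ suc)))

      term : Permutation′ n → Poly
      term σ = productP λ i → linear i (σ ⟨$⟩ʳ i)

      total : List (Permutation′ n) → Poly
      total ps = foldr D._+_ [] (map term ps)

      homog-sum : ∀ (ps : List (Permutation′ n)) →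
        homog n (coeff (total ps)) ≋
        foldr _⊕_ (C 0ℤ) (map (λ σ → product′ λ i → entry i (σ ⟨$⟩ʳ i)) ps)
      homog-sum []       = homog-0 n _ (λ _ → refl)
      homog-sum (σ ∷ ps) = ≋-trans (homog-cong n (coeff-+ (term σ) (total ps))) (≋-trans (homog-+ n (coeff (term σ)) (coeff (total ps)))
        (⊕-cong (homog-product id (σ ⟨$⟩ʳ_)) (homog-sum ps)))

      degree-sum : ∀ (ps : List (Permutation′ n)) →
        Degree≤ n (coeff (total ps))
      degree-sum []       k _   = refl
      degree-sum (σ ∷ ps) k n<k = trans (coeff-+ (term σ) (total ps) k)
        (cong₂ ℤ._+_ (degree-product id (σ ⟨$⟩ʳ_) k n<k) (degree-sum ps k n<k))

    degree-per : Degree≤ n (coeff (per polyRing linear))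
    degree-per = degree-sum (permutations n)

    homog-per : homog n (coeff (per polyRing linear)) ≋
                Permanent.perm ring entry (allFin n) (allFin n)
    homog-per = ≋-trans (homog-sum (permutations n)) (FinPermanent.per≈perm ring entry id id)

-- Arcs

firstOf : ∀ {V : Set} → List V → V → V
firstOf []       b = b
firstOf (x ∷ xs) b = x

lastOf : ∀ {V : Set} → List V → V → V
lastOf []       a = a
lastOf (x ∷ xs) a = lastOf xs x

lastOf-∷ʳ : ∀ {V : Set} (xs : List V) y a → lastOf (xs ∷ʳ y) a ≡ y
lastOf-∷ʳ []       y a = refl
lastOf-∷ʳ (x ∷ xs) y a = lastOf-∷ʳ xs y x

module Arcs {V : Set} (_∼_ : V → V → Set) (∼-sym : ∀ {x y} → x ∼ y → y ∼ x) where

  -- A walk from a to b through xs whose inner vertices have no neighbours off the walk.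

  data Arc (a : V) : List V → V → Set where
    edge : ∀ {b} → a ∼ b → Arc a [] b
    step : ∀ {x xs b} → a ∼ x → (∀ {y} → x ∼ y → y ≡ a ⊎ y ≡ firstOf xs b) → Arc x xs b → Arc a (x ∷ xs) b

  swap⊎ : ∀ {A B : Set} → A ⊎ B → B ⊎ A
  swap⊎ (inj₁ a) = inj₂ a
  swap⊎ (inj₂ b) = inj₁ b

  arc-first : ∀ {a xs b} → Arc a xs b → a ∼ firstOf xs b
  arc-first (edge e)     = e
  arc-first (step e _ _) = e

  arc-last : ∀ {a xs b} → Arc a xs b → lastOf xs a ∼ b
  arc-last (edge e)       = e
  arc-last (step _ _ arc) = arc-last arc

  private
    reverse-onto : ∀ {a acc c xs b} → Arc a acc c → (∀ {y} → a ∼ y → y ≡ firstOf acc c ⊎ y ≡ firstOf xs b) →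
      Arc a xs b → Arc b (List.reverseAcc (a ∷ acc) xs) c
    reverse-onto done thin (edge e)          = step (∼-sym e) (swap⊎ ∘ thin) done
    reverse-onto done thin (step e thin′ arc) = reverse-onto (step (∼-sym e) (swap⊎ ∘ thin) done) thin′ arc

  arc-reverse : ∀ {a xs b} → Arc a xs b → Arc b (reverse xs) a
  arc-reverse (edge e)          = edge (∼-sym e)
  arc-reverse (step e thin arc) = reverse-onto (edge (∼-sym e)) thin arc

  first∈ : ∀ (xs : List V) b → firstOf xs b ∈ xs ⊎ firstOf xs b ≡ b
  first∈ []       b = inj₂ refl
  first∈ (x ∷ xs) b = inj₁ (here refl)

  arc-closed : ∀ {a xs b} → Arc a xs b → ∀ {w y} → w ∈ xs → w ∼ y → y ≡ a ⊎ y ∈ xs ⊎ y ≡ b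
  arc-closed {b = b} (step {xs = xs} e thin arc) (here refl) w∼y with thin w∼y
  ... | inj₁ y≡a  = inj₁ y≡a
  ... | inj₂ refl with first∈ xs b
  ...   | inj₁ y∈  = inj₂ (inj₁ (there y∈))
  ...   | inj₂ y≡b = inj₂ (inj₂ y≡b)
  arc-closed (step e thin arc) (there w∈) w∼y with arc-closed arc w∈ w∼y
  ... | inj₁ refl       = inj₂ (inj₁ (here refl))
  ... | inj₂ (inj₁ y∈)  = inj₂ (inj₁ (there y∈))
  ... | inj₂ (inj₂ y≡b) = inj₂ (inj₂ y≡b)

  arc-touch : ∀ {a xs b} → Arc a xs b → ∀ {w t} → w ∈ xs → w ∼ t → t ∉ xs →
    (w ≡ firstOf xs b × t ≡ a) ⊎ (w ≡ lastOf xs a × t ≡ b)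
  arc-touch (step {xs = xs} e thin arc) (here refl) w∼t t∉ with thin w∼t
  arc-touch (step {xs = xs} e thin arc) (here refl) w∼t t∉ | inj₁ t≡a = inj₁ (refl , t≡a)
  arc-touch (step {xs = []} e thin arc) (here refl) w∼t t∉ | inj₂ t≡b = inj₂ (refl , t≡b)
  arc-touch (step {xs = _ ∷ _} e thin arc) (here refl) w∼t t∉ | inj₂ refl = contradiction (there (here refl)) t∉
  arc-touch (step {xs = xs} e thin arc) (there w∈) w∼t t∉ with arc-touch arc w∈ w∼t (t∉ ∘ there)
  ... | inj₁ (_ , refl) = contradiction (here refl) t∉
  ... | inj₂ r          = inj₂ r

  record Dumbbell (u v : V) (α β γ : List V) : Set where
    field
      arc-α   : Arc u α u
      arc-β   : Arc u β v
      arc-γ   : Arc v γ v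
      unique  : Unique (u ∷ α ++ β ++ v ∷ γ)
      at-u    : ∀ {y} → u ∼ y → y ∈ α ⊎ y ≡ firstOf β v
      at-v    : ∀ {y} → v ∼ y → y ∈ γ ⊎ y ≡ lastOf β u

  record Theta (u v : V) (xs ys zs : List V) : Set where
    field
      arc-xs  : Arc u xs v
      arc-ys  : Arc u ys v
      arc-zs  : Arc u zs v
      unique  : Unique (u ∷ v ∷ xs ++ ys ++ zs)
      at-u    : ∀ {y} → u ∼ y → y ≡ firstOf xs v ⊎ y ≡ firstOf ys v ⊎ y ≡ firstOf zs v
      at-v    : ∀ {y} → v ∼ y → y ≡ lastOf xs u ⊎ y ≡ lastOf ys u ⊎ y ≡ lastOf zs u

module GraphArcs {n : ℕ} (G : Graph n) where

  _∼_ : Fin n → Fin n → Set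
  i ∼ j = adj G i j ≡ true

  ∼-sym : ∀ {i j} → i ∼ j → j ∼ i
  ∼-sym {i} {j} p = trans (symmetric G j i) p

  ∼-irrefl : ∀ {i} → ¬ (i ∼ i)
  ∼-irrefl {i} p = contradiction (trans (sym (irreflexive G i)) p) λ ()

  open Arcs _∼_ ∼-sym public

∉-Unique : ∀ {A : Set} {x : A} {xs} → Unique (x ∷ xs) → x ∉ xs
∉-Unique (x≢ ∷ _) x∈ = All.lookup x≢ x∈ refl

Unique-tail : ∀ {A : Set} {x : A} {xs} → Unique (x ∷ xs) → Unique xs
Unique-tail (_ ∷ u) = u

Unique-∉ : ∀ {A : Set} {x : A} {xs} → x ∉ xs → Unique xs → Unique (x ∷ xs)
Unique-∉ x∉ u = All.tabulate (λ { y∈ refl → x∉ y∈ }) ∷ u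

Unique-resp-↭ : ∀ {A : Set} {xs ys : List A} → xs ↭ ys → Unique xs → Unique ys
Unique-resp-↭ p = SetoidPerm.Unique-resp-↭ (≡.setoid _) (Perm.↭⇒↭ₛ p)

Unique-++ˡ : ∀ {A : Set} (xs : List A) {ys} → Unique (xs ++ ys) → Unique xs
Unique-++ˡ []       u = []
Unique-++ˡ (x ∷ xs) u = Unique-∉ (λ x∈ → ∉-Unique u (∈-++⁺ˡ x∈)) (Unique-++ˡ xs (Unique-tail u))

Unique-++ʳ : ∀ {A : Set} (xs : List A) {ys} → Unique (xs ++ ys) → Unique ys
Unique-++ʳ []       u = u
Unique-++ʳ (x ∷ xs) u = Unique-++ʳ xs (Unique-tail u)

Unique-disjoint : ∀ {A : Set} (xs : List A) {ys x} → Unique (xs ++ ys) → x ∈ xs → x ∉ ys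
Unique-disjoint (x ∷ xs) u (here refl) x∈ = ∉-Unique u (∈-++⁺ʳ xs x∈)
Unique-disjoint (x ∷ xs) u (there x∈)  y∈ = Unique-disjoint xs (Unique-tail u) x∈ y∈

module ↭-Solver {A : Set} where
  open CommutativeMonoidSolver (Perm.++-commutativeMonoid {A = A}) public
    using (solve; _⊜_) renaming (_⊕_ to _:++_)

module ArcPermanent
  (R : CommutativeRing 0ℓ 0ℓ) {V : Set} (M : V → V → CommutativeRing.Carrier R)
  (z δ : CommutativeRing.Carrier R)
  (_∼_ : V → V → Set) (∼-sym : ∀ {x y} → x ∼ y → y ∼ x)
  (M-edge : ∀ {x y} → x ∼ y → CommutativeRing._≈_ R (M x y) z)
  (M-none : ∀ {x y} → x ≢ y → ¬ (x ∼ y) → CommutativeRing._≈_ R (M x y) (CommutativeRing.0# R))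
  where
  open CommutativeRing R
    renaming (Carrier to K; _+_ to _∔_; _*_ to _·_; refl to ≈-refl; sym to ≈-sym; trans to ≈-trans)
    hiding (_-_; zero)
  open NatSolver commutativeSemiring using (solve; _:+_; _:*_; _:=_; con)
  open SetoidReasoning setoid
  open Permanent R M
  open Arcs _∼_ ∼-sym

  pow : ℕ → K
  pow zero    = 1#
  pow (suc k) = z · pow k

  -- The sequence with the recurrence of the permanents of paths and given first two terms.

  rec : K → K → ℕ → K
  rec f₀ f₁ zero          = f₀
  rec f₀ f₁ (suc zero)    = f₁
  rec f₀ f₁ (suc (suc k)) = δ · rec f₀ f₁ (suc k) ∔ z · z · rec f₀ f₁ k

  π : ℕ → K
  π = rec 0# 1#

  τ : ℕ → K
  τ = rec 1# 0#

  rec-cong : ∀ {f₀ f₁ g₀ g₁} → f₀ ≈ g₀ → f₁ ≈ g₁ → ∀ k → rec f₀ f₁ k ≈ rec g₀ g₁ k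
  rec-cong p q zero          = p
  rec-cong p q (suc zero)    = q
  rec-cong p q (suc (suc k)) = +-cong (*-congˡ (rec-cong p q (suc k))) (*-congˡ (rec-cong p q k))

  rec-basis : ∀ f₀ f₁ k → rec f₀ f₁ k ≈ f₁ · π k ∔ f₀ · τ k
  rec-basis f₀ f₁ zero          = solve 2 (λ a b → a := b :* con 0 :+ a :* con 1) ≈-refl f₀ f₁
  rec-basis f₀ f₁ (suc zero)    = solve 2 (λ a b → b := b :* con 1 :+ a :* con 0) ≈-refl f₀ f₁
  rec-basis f₀ f₁ (suc (suc k)) = ≈-trans (+-cong (*-congˡ (rec-basis f₀ f₁ (suc k))) (*-congˡ (rec-basis f₀ f₁ k)))
    (solve 8 (λ d z a b p t p′ t′ → d :* (b :* p :+ a :* t) :+ z :* z :* (b :* p′ :+ a :* t′) :=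
       b :* (d :* p :+ z :* z :* p′) :+ a :* (d :* t :+ z :* z :* t′)) ≈-refl δ z f₀ f₁ _ _ _ _)

  Q : V → V → List V → K
  Q a b W = perm (a ∷ W) (b ∷ W)

  Q-↭ : ∀ a b {W W′} → W ↭ W′ → Q a b W ≈ Q a b W′
  Q-↭ a b {W} {W′} p = ≈-trans (perm-rows (↭-prep a p) (b ∷ W)) (perm-cols (a ∷ W′) (↭-prep b p))

  private
    zero₂ : ∀ {x y} → x ≢ y → ¬ (x ∼ y) → (M x y ≈ 0#) × (M y x ≈ 0#)
    zero₂ x≢y ¬e = M-none x≢y ¬e , M-none (x≢y ∘ sym) (¬e ∘ ∼-sym)

    separated : ∀ {x W} → x ∉ W → (∀ {w} → w ∈ W → ¬ (x ∼ w)) → Separated [ x ] W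
    separated x∉ h (here refl) w∈ = zero₂ (λ { refl → x∉ w∈ }) (h w∈)

    expand-off : ∀ {x W} (f : V → List V → K) → x ∉ W → (∀ {w} → w ∈ W → ¬ (x ∼ w)) → expand (λ c ds → M x c · f c ds) W ≈ 0#
    expand-off {x} {W} f x∉ h = expand-zero W λ c ds c∈ → ≈-trans (*-congʳ (M-none (λ { refl → x∉ c∈ }) (h c∈))) (zeroˡ _)

  leaf : ∀ x y ys → x ∼ y → x ∉ ys → (∀ {w} → w ∈ ys → ¬ (x ∼ w)) →
    P (x ∷ y ∷ ys) ≈ M x x · P (y ∷ ys) ∔ z · z · P ys
  leaf x y ys e x∉ h = ≈-trans (P-bridge x [] y ys (λ ()) (separated x∉ h))
    (+-cong (*-congʳ (≈-trans (+-identityʳ _) (*-identityʳ _)))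
            (*-congʳ (≈-trans (*-identityʳ _) (*-cong (M-edge e) (M-edge (∼-sym e))))))

  tail : List V → List V
  tail []       = []
  tail (x ∷ xs) = xs

  chain : ∀ {a β v} γ → Arc a β v → Unique (a ∷ β ++ v ∷ γ) → (∀ {x} → x ∈ β → M x x ≈ δ) →
    P (β ++ v ∷ γ) ≈ rec (P γ) (P (v ∷ γ)) (suc (length β)) ×
    P (tail (β ++ v ∷ γ)) ≈ rec (P γ) (P (v ∷ γ)) (length β)
  chain γ (edge e) u d = ≈-refl , ≈-refl
  chain {a} {x ∷ β} {v} γ (step e thin arc) u d = goal , proj₁ IH
    where
    IH = chain γ arc (Unique-tail u) (d ∘ there)
    split : ∀ β → Arc x β v → (∀ {y} → x ∼ y → y ≡ a ⊎ y ≡ firstOf β v) → Unique (a ∷ x ∷ β ++ v ∷ γ) →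
      P (x ∷ β ++ v ∷ γ) ≈ M x x · P (β ++ v ∷ γ) ∔ z · z · P (tail (β ++ v ∷ γ))
    split []       arc thin u = leaf x v γ (arc-first arc) (∉-Unique (Unique-tail u) ∘ there) λ w∈ x∼w →
      [ (λ { refl → ∉-Unique u (there (there w∈)) }) , (λ { refl → ∉-Unique (Unique-tail (Unique-tail u)) w∈ }) ]′ (thin x∼w)
    split (y ∷ β) arc thin u = leaf x y (β ++ v ∷ γ) (arc-first arc) (∉-Unique (Unique-tail u) ∘ there) λ w∈ x∼w →
      [ (λ { refl → ∉-Unique u (there (there w∈)) }) , (λ { refl → ∉-Unique (Unique-tail (Unique-tail u)) w∈ }) ]′ (thin x∼w)
    goal : P (x ∷ β ++ v ∷ γ) ≈ rec (P γ) (P (v ∷ γ)) (suc (suc (length β)))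
    goal = ≈-trans (split β arc thin u) (+-cong (*-cong (d (here refl)) (proj₁ IH)) (*-congˡ (proj₂ IH)))

  P-path : ∀ {a xs b} → Arc a xs b → Unique (a ∷ xs) → (∀ {x} → x ∈ xs → M x x ≈ δ) → P xs ≈ π (suc (length xs))
  P-path (edge e) u d = ≈-refl
  P-path (step _ _ (edge e)) u d = +-cong (*-congʳ (d (here refl))) (≈-sym (zeroʳ _))
  P-path (step {x} e thin (step {y} {ys} e′ thin′ arc)) u d = ≈-trans
    (leaf x y ys e′ (∉-Unique (Unique-tail u) ∘ there) λ w∈ x∼w →
      [ (λ { refl → ∉-Unique u (there (there w∈)) }) , (λ { refl → ∉-Unique (Unique-tail (Unique-tail u)) w∈ }) ]′ (thin x∼w))
    (+-cong (*-cong (d (here refl)) (P-path (step e′ thin′ arc) (Unique-tail u) (d ∘ there)))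
            (*-congˡ (P-path arc (Unique-tail (Unique-tail u)) (d ∘ there ∘ there))))

  -- Q x b is a sum over walks from x to b, and an arc leaves a single one.

  Q-along : ∀ {a x xs b} W → Arc a (x ∷ xs) b → Unique (a ∷ x ∷ xs ++ b ∷ W) → Q x b (xs ++ W) ≈ pow (suc (length xs)) · P W
  Q-along {a} {x} {[]} {b} W (step e thin (edge e′)) u = begin
    M x b · P W ∔ expand (λ c ds → M x c · perm W (b ∷ ds)) W
      ≈⟨ +-cong (*-congʳ (M-edge e′)) (expand-off (λ c ds → perm W (b ∷ ds)) (∉-Unique (Unique-tail u) ∘ there) λ w∈ x∼w →
           [ (λ { refl → ∉-Unique u (there (there w∈)) }) , (λ { refl → ∉-Unique (Unique-tail (Unique-tail u)) w∈ }) ]′ (thin x∼w)) ⟩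
    z · P W ∔ 0#
      ≈⟨ solve 2 (λ z p → z :* p :+ con 0 := z :* con 1 :* p) ≈-refl z (P W) ⟩
    z · 1# · P W ∎
  Q-along {a} {x} {y ∷ xs} {b} W (step e thin arc) u = begin
    M x b · P (y ∷ xs ++ W) ∔ (M x y · Q y b (xs ++ W) ∔ expand (λ c ds → M x c · perm (y ∷ xs ++ W) (b ∷ y ∷ ds)) (xs ++ W))
      ≈⟨ +-cong (*-congʳ (M-none (λ { refl → ∉-Unique (Unique-tail u) (there (∈-++⁺ʳ xs (here refl))) })
                 λ x∼b → [ (λ { refl → ∉-Unique u (there (there (∈-++⁺ʳ xs (here refl)))) })
                         , (λ { refl → ∉-Unique (Unique-tail (Unique-tail u)) (∈-++⁺ʳ xs (here refl)) }) ]′ (thin x∼b)))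
           (+-cong (*-cong (M-edge (arc-first arc)) (Q-along W arc (Unique-tail u)))
             (expand-off (λ c ds → perm (y ∷ xs ++ W) (b ∷ y ∷ ds)) (λ x∈ → ∉-Unique (Unique-tail u) (there (weaken x∈))) λ w∈ x∼w →
               [ (λ { refl → ∉-Unique u (there (there (weaken w∈))) })
               , (λ { refl → ∉-Unique (Unique-tail (Unique-tail u)) (weaken w∈) }) ]′ (thin x∼w))) ⟩
    0# · P (y ∷ xs ++ W) ∔ (z · (pow (suc (length xs)) · P W) ∔ 0#)
      ≈⟨ solve 4 (λ q z s p → con 0 :* q :+ (z :* (s :* p) :+ con 0) := z :* s :* p) ≈-refl _ z _ (P W) ⟩
    z · pow (suc (length xs)) · P W ∎
    where
    weaken : ∀ {w} → w ∈ xs ++ W → w ∈ xs ++ b ∷ W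
    weaken w∈ = [ ∈-++⁺ˡ , (∈-++⁺ʳ xs ∘ there) ]′ (∈-++⁻ xs w∈)

  Q-through : ∀ {a x xs v t} W → Arc a (x ∷ xs) v → Unique (t ∷ a ∷ x ∷ xs ++ v ∷ W) →
    Q x t (xs ++ v ∷ W) ≈ pow (suc (length xs)) · Q v t W
  Q-through {a} {x} {[]} {v} {t} W (step e thin (edge e′)) (t≢ ∷ u) = begin
    M x t · P (v ∷ W) ∔ (M x v · Q v t W ∔ expand (λ c ds → M x c · perm (v ∷ W) (t ∷ v ∷ ds)) W)
      ≈⟨ +-cong (*-congʳ (M-none (λ { refl → ∉-Unique (t≢ ∷ u) (there (here refl)) })
                 λ x∼t → [ (λ { refl → ∉-Unique (t≢ ∷ u) (here refl) }) , (λ { refl → ∉-Unique (t≢ ∷ u) (there (there (here refl))) }) ]′ (thin x∼t)))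
           (+-cong (*-congʳ (M-edge e′))
             (expand-off (λ c ds → perm (v ∷ W) (t ∷ v ∷ ds)) (∉-Unique (Unique-tail u) ∘ there) λ w∈ x∼w →
               [ (λ { refl → ∉-Unique u (there (there w∈)) }) , (λ { refl → ∉-Unique (Unique-tail (Unique-tail u)) w∈ }) ]′ (thin x∼w))) ⟩
    0# · P (v ∷ W) ∔ (z · Q v t W ∔ 0#)
      ≈⟨ solve 3 (λ q z p → con 0 :* q :+ (z :* p :+ con 0) := z :* con 1 :* p) ≈-refl _ z _ ⟩
    z · 1# · Q v t W ∎
  Q-through {a} {x} {y ∷ xs} {v} {t} W (step e thin arc) (t≢ ∷ u) = begin
    M x t · P (y ∷ xs ++ v ∷ W) ∔ (M x y · Q y t (xs ++ v ∷ W) ∔ expand (λ c ds → M x c · perm (y ∷ xs ++ v ∷ W) (t ∷ y ∷ ds)) (xs ++ v ∷ W))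
      ≈⟨ +-cong (*-congʳ (M-none (λ { refl → ∉-Unique (t≢ ∷ u) (there (here refl)) })
                 λ x∼t → [ (λ { refl → ∉-Unique (t≢ ∷ u) (here refl) }) , (λ { refl → ∉-Unique (t≢ ∷ u) (there (there (here refl))) }) ]′ (thin x∼t)))
           (+-cong (*-cong (M-edge (arc-first arc)) (Q-through W arc (All.tail t≢ ∷ Unique-tail u)))
             (expand-off (λ c ds → perm (y ∷ xs ++ v ∷ W) (t ∷ y ∷ ds)) (∉-Unique (Unique-tail u) ∘ there) λ w∈ x∼w →
               [ (λ { refl → ∉-Unique u (there (there w∈)) }) , (λ { refl → ∉-Unique (Unique-tail (Unique-tail u)) w∈ }) ]′ (thin x∼w))) ⟩
    0# · P (y ∷ xs ++ v ∷ W) ∔ (z · (pow (suc (length xs)) · Q v t W) ∔ 0#)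
      ≈⟨ solve 4 (λ q z s p → con 0 :* q :+ (z :* (s :* p) :+ con 0) := z :* s :* p) ≈-refl _ z _ _ ⟩
    z · pow (suc (length xs)) · Q v t W ∎

  private
    Q-closed : ∀ {u x xs} → 0 < length xs → Arc u (x ∷ xs) u → Unique (u ∷ x ∷ xs) → (∀ {y} → y ∈ xs → M y y ≈ δ) →
      Q x u xs ≈ z · π (suc (length xs)) ∔ pow (suc (length xs))
    Q-closed {u} {x} {y ∷ ys} _ (step e thin arc) uq d = begin
      M x u · P (y ∷ ys) ∔ (M x y · Q y u ys ∔ expand (λ c ds → M x c · perm (y ∷ ys) (u ∷ y ∷ ds)) ys)
        ≈⟨ +-cong (*-cong (M-edge (∼-sym e)) (P-path arc (Unique-tail uq) d))
             (+-cong (*-cong (M-edge (arc-first arc)) along)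
               (expand-off (λ c ds → perm (y ∷ ys) (u ∷ y ∷ ds)) (∉-Unique (Unique-tail uq) ∘ there) λ w∈ x∼w →
                 [ (λ { refl → ∉-Unique uq (there (there w∈)) }) , (λ { refl → ∉-Unique (Unique-tail (Unique-tail uq)) w∈ }) ]′ (thin x∼w))) ⟩
      z · π (suc (suc (length ys))) ∔ (z · pow (suc (length ys)) ∔ 0#)
        ≈⟨ +-congˡ (+-identityʳ _) ⟩
      z · π (suc (suc (length ys))) ∔ pow (suc (suc (length ys))) ∎
      where
      along : Q y u ys ≈ pow (suc (length ys))
      along = ≈-trans (≈-trans (reflexive (cong (Q y u) (sym (List.++-identityʳ ys))))
        (Q-along [] arc (Unique-resp-↭ (↭-trans (Perm.∷↭∷ʳ u _) ↭-refl) uq))) (*-identityʳ _)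

  P-closed : ∀ {u α} → 2 ≤ length α → Arc u α u → Unique (u ∷ α) → (∀ {y} → y ∈ α → M y y ≈ δ) →
    P (u ∷ α) ≈ M u u · π (suc (length α)) ∔ (1# ∔ 1#) · (z · (z · π (length α) ∔ pow (length α)))
  P-closed {u} {x ∷ rest} (s≤s 1≤) arc uq d with List.initLast rest
  ... | mid List.∷ʳ′ y = begin
    M u u · P (x ∷ rest) ∔ (M u x · Q x u rest ∔ expand (λ c ds → M u c · perm (x ∷ rest) (u ∷ x ∷ ds)) rest)
      ≈⟨ +-cong (*-congˡ (P-path arc uq d)) (+-cong (*-cong (M-edge (arc-first arc)) (Q-closed 1≤ arc uq (d ∘ there)))
           (≈-trans (expand-↭ _ (λ c p → *-congˡ (perm-cols (x ∷ rest) (↭-prep u (↭-prep x p)))) rest↭)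
             (+-cong (*-cong (M-edge u∼y) back)
               (expand-off (λ c ds → perm (x ∷ rest) (u ∷ x ∷ y ∷ ds)) (λ u∈ → ∉-Unique uq (there (∈-++⁺ˡ u∈))) middle)))) ⟩
    M u u · π (suc (length α)) ∔ (z · (z · π (length α) ∔ pow (length α)) ∔ (z · (z · π (length α) ∔ pow (length α)) ∔ 0#))
      ≈⟨ solve 3 (λ m z q → m :+ (z :* q :+ (z :* q :+ con 0)) := m :+ (con 1 :+ con 1) :* (z :* q)) ≈-refl _ z _ ⟩
    M u u · π (suc (length α)) ∔ (1# ∔ 1#) · (z · (z · π (length α) ∔ pow (length α))) ∎
    where
    α = x ∷ rest
    rest↭ : rest ↭ y ∷ mid
    rest↭ = ↭-sym (Perm.∷↭∷ʳ y mid)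
    reversed : Arc u (y ∷ reverse (x ∷ mid)) u
    reversed = subst (λ ws → Arc u ws u) (List.reverse-++ (x ∷ mid) (y ∷ [])) (arc-reverse arc)
    u∼y : u ∼ y
    u∼y = arc-first reversed
    reverse↭ : reverse (x ∷ mid) ↭ x ∷ mid
    reverse↭ = Perm.↭-reverse (x ∷ mid)
    len : length (reverse (x ∷ mid)) ≡ length rest
    len = trans (List.length-reverse (x ∷ mid)) (sym (Perm.↭-length rest↭))
    back : perm (x ∷ rest) (u ∷ x ∷ mid) ≈ z · π (length α) ∔ pow (length α)
    back = begin
      perm (x ∷ rest) (u ∷ x ∷ mid)   ≈⟨ perm-rows (↭-trans (↭-prep x rest↭) (↭-swap x y ↭-refl)) (u ∷ x ∷ mid) ⟩
      Q y u (x ∷ mid)                 ≈⟨ Q-↭ y u reverse↭ ⟨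
      Q y u (reverse (x ∷ mid))
        ≈⟨ Q-closed (subst (0 <_) (sym len) 1≤) reversed
             (Unique-resp-↭ (↭-prep u (↭-trans (↭-prep x rest↭) (↭-trans (↭-swap x y ↭-refl) (↭-prep y (↭-sym reverse↭))))) uq)
             (λ w∈ → d (Perm.∈-resp-↭ (↭-prep x (↭-sym rest↭)) (there-mid (Perm.∈-resp-↭ reverse↭ w∈)))) ⟩
      z · π (suc (length (reverse (x ∷ mid)))) ∔ pow (suc (length (reverse (x ∷ mid))))
        ≡⟨ cong (λ k → z · π (suc k) ∔ pow (suc k)) len ⟩
      z · π (length α) ∔ pow (length α) ∎
      where
      there-mid : ∀ {w} → w ∈ x ∷ mid → w ∈ x ∷ y ∷ mid
      there-mid (here p)   = here p
      there-mid (there w∈) = there (there w∈)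
    middle : ∀ {w} → w ∈ mid → ¬ (u ∼ w)
    middle w∈ u∼w with arc-touch arc (there (∈-++⁺ˡ w∈)) (∼-sym u∼w) (∉-Unique uq)
    ... | inj₁ (refl , _) = ∉-Unique (Unique-tail uq) (∈-++⁺ˡ w∈)
    ... | inj₂ (w≡ , _)   = Unique-disjoint mid (Unique-tail (Unique-tail uq)) w∈ (here (trans w≡ (lastOf-∷ʳ mid y x)))

  P-dumbbell : ∀ {u v α β γ} → Dumbbell u v α β γ → (∀ {x} → x ∈ α → M x x ≈ δ) → (∀ {x} → x ∈ β → M x x ≈ δ) →
    P (u ∷ α ++ β ++ v ∷ γ) ≈ P (u ∷ α) · rec (P γ) (P (v ∷ γ)) (suc (length β)) ∔ z · z · P α · rec (P γ) (P (v ∷ γ)) (length β)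
  P-dumbbell {u} {v} {α} {β} {γ} dumbbell dα dβ = ≈-trans (bridge β arc-β at-u unique) (+-cong (*-congˡ (proj₁ chained)) (*-congˡ (proj₂ chained)))
    where
    open Dumbbell dumbbell
    chained = chain γ arc-β (Unique-∉ (λ u∈ → ∉-Unique unique (∈-++⁺ʳ α u∈)) (Unique-++ʳ α (Unique-tail unique))) dβ
    bridge-at : ∀ r B → u ∼ r → Unique (u ∷ α ++ r ∷ B) → (∀ {y} → u ∼ y → y ∈ α ⊎ y ≡ r) →
      P (u ∷ α ++ r ∷ B) ≈ P (u ∷ α) · P (r ∷ B) ∔ z · z · P α · P B
    bridge-at r B u∼r uq N = ≈-trans
      (P-bridge u α r B
        (λ x∈ y∈ → zero₂ (λ { refl → Unique-disjoint α (Unique-tail uq) x∈ y∈ }) λ x∼y →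
          [ (λ { refl → ∉-Unique uq (∈-++⁺ʳ α y∈) }) , [ (λ y∈′ → Unique-disjoint α (Unique-tail uq) y∈′ y∈) , (λ { refl → ∉-Unique uq (∈-++⁺ʳ α y∈) }) ]′ ]′
            (arc-closed arc-α x∈ x∼y))
        (separated (λ u∈ → ∉-Unique uq (∈-++⁺ʳ α (there u∈))) λ w∈ u∼w →
          [ (λ w∈′ → Unique-disjoint α (Unique-tail uq) w∈′ (there w∈)) , (λ { refl → ∉-Unique (Unique-++ʳ α (Unique-tail uq)) w∈ }) ]′ (N u∼w)))
      (+-congˡ (*-congʳ (*-congʳ (*-cong (M-edge u∼r) (M-edge (∼-sym u∼r))))))
    bridge : ∀ β → Arc u β v → (∀ {y} → u ∼ y → y ∈ α ⊎ y ≡ firstOf β v) → Unique (u ∷ α ++ β ++ v ∷ γ) →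
      P (u ∷ α ++ β ++ v ∷ γ) ≈ P (u ∷ α) · P (β ++ v ∷ γ) ∔ z · z · P α · P (tail (β ++ v ∷ γ))
    bridge []      arc N uq = bridge-at v γ (arc-first arc) uq N
    bridge (y ∷ β) arc N uq = bridge-at y (β ++ v ∷ γ) (arc-first arc) uq N

  Q′ : V → V → List V → K
  Q′ u v W = expand (λ c ds → M v c · perm W (u ∷ ds)) W

  module _ {u v : V} where

    Q′-one : ∀ {zs} → 0 < length zs → Arc u zs v → Unique (u ∷ v ∷ zs) → Q′ u v zs ≈ pow (suc (length zs))
    Q′-one {zs} 0< arc uq with List.initLast zs
    ... | mid List.∷ʳ′ y = begin
      expand (λ c ds → M v c · perm zs (u ∷ ds)) zs
        ≈⟨ expand-↭ _ (λ c p → *-congˡ (perm-cols zs (↭-prep u p))) zs↭ ⟩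
      M v y · perm zs (u ∷ mid) ∔ expand (λ c ds → M v c · perm zs (u ∷ y ∷ ds)) mid
        ≈⟨ +-cong (*-cong (M-edge (arc-first reversed)) along)
             (expand-off (λ c ds → perm zs (u ∷ y ∷ ds)) (λ v∈ → ∉-Unique (Unique-tail uq) (∈-++⁺ˡ v∈)) middle) ⟩
      z · pow (suc (length mid)) ∔ 0#
        ≈⟨ ≈-trans (+-identityʳ _) (reflexive (cong (λ k → z · pow k) (sym (Perm.↭-length zs↭)))) ⟩
      pow (suc (length zs)) ∎
      where
      zs↭ : zs ↭ y ∷ mid
      zs↭ = ↭-sym (Perm.∷↭∷ʳ y mid)
      reversed : Arc v (y ∷ reverse mid) u
      reversed = subst (λ ws → Arc v ws u) (List.reverse-++ mid (y ∷ [])) (arc-reverse arc)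
      mid↭ : mid ↭ reverse mid ++ []
      mid↭ = ↭-trans (↭-sym (Perm.↭-reverse mid)) (↭-reflexive (sym (List.++-identityʳ _)))
      along : perm zs (u ∷ mid) ≈ pow (suc (length mid))
      along = begin
        perm zs (u ∷ mid)          ≈⟨ perm-rows zs↭ _ ⟩
        Q y u mid                  ≈⟨ Q-↭ y u mid↭ ⟩
        Q y u (reverse mid ++ [])
          ≈⟨ Q-along [] reversed (Unique-resp-↭ (↭-trans (↭-swap u v ↭-refl) (↭-prep v
               (↭-trans (↭-prep u zs↭) (↭-trans (↭-swap u y ↭-refl) (↭-prep y (↭-trans (Perm.∷↭∷ʳ u mid) (Perm.++⁺ʳ _ (↭-sym (Perm.↭-reverse mid))))))))) uq) ⟩
        pow (suc (length (reverse mid))) · 1#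
          ≈⟨ ≈-trans (*-identityʳ _) (reflexive (cong (pow ∘ suc) (List.length-reverse mid))) ⟩
        pow (suc (length mid)) ∎
      middle : ∀ {w} → w ∈ mid → ¬ (v ∼ w)
      middle w∈ v∼w with arc-touch arc (∈-++⁺ˡ w∈) (∼-sym v∼w) (∉-Unique (Unique-tail uq))
      ... | inj₁ (_ , refl) = ∉-Unique uq (here refl)
      ... | inj₂ (w≡ , _)   = Unique-disjoint mid (Unique-tail (Unique-tail uq)) w∈ (here (trans w≡ (lastOf-∷ʳ mid y u)))

    qv : ℕ → ℕ → K
    qv j k = pow (suc j) · π (suc k) ∔ pow (suc k) · π (suc j)

    Q′-two : ∀ {ys zs} → 0 < length ys → 0 < length zs → Arc u ys v → Arc u zs v → Unique (u ∷ v ∷ ys ++ zs) →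
      (∀ {w} → w ∈ ys ++ zs → M w w ≈ δ) → Q′ u v (ys ++ zs) ≈ qv (length ys) (length zs)
    Q′-two {ys} {zs} 0<ys 0<zs arc-ys arc-zs uq d with List.initLast ys | List.initLast zs
    ... | mid List.∷ʳ′ y | mid′ List.∷ʳ′ y′ = begin
      expand (λ c ds → M v c · perm W (u ∷ ds)) W
        ≈⟨ expand-↭ _ (λ c p → *-congˡ (perm-cols W (↭-prep u p))) W↭ ⟩
      M v y · perm W (u ∷ y′ ∷ rest) ∔ (M v y′ · perm W (u ∷ y ∷ rest) ∔ expand (λ c ds → M v c · perm W (u ∷ y ∷ y′ ∷ ds)) rest)
        ≈⟨ +-cong (*-cong (M-edge (arc-first reversed)) (≈-trans (perm-rows W↭ _) (≈-trans (Q-↭ y u rest₁↭) along₁)))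
           (+-cong (*-cong (M-edge (arc-first reversed′)) (≈-trans (perm-rows (↭-trans W↭ (↭-swap y y′ ↭-refl)) _) (≈-trans (Q-↭ y′ u rest₂↭) along₂)))
             (expand-off (λ c ds → perm W (u ∷ y ∷ y′ ∷ ds)) (λ v∈ → ∉-Unique (Unique-tail uq) (Perm.∈-resp-↭ (↭-sym W↭) (there (there v∈)))) middle)) ⟩
      z · (pow (suc (length (reverse mid))) · P zs) ∔ (z · (pow (suc (length (reverse mid′))) · P ys) ∔ 0#)
        ≈⟨ +-cong (*-congˡ (*-cong (reflexive (cong pow len)) (P-path arc-zs uq-zs (d ∘ ∈-++⁺ʳ ys))))
             (≈-trans (+-identityʳ _) (*-congˡ (*-cong (reflexive (cong pow len′)) (P-path arc-ys uq-ys (d ∘ ∈-++⁺ˡ))))) ⟩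
      z · (pow (length ys) · π (suc (length zs))) ∔ z · (pow (length zs) · π (suc (length ys)))
        ≈⟨ +-cong (≈-sym (*-assoc _ _ _)) (≈-sym (*-assoc _ _ _)) ⟩
      qv (length ys) (length zs) ∎
      where
      open ↭-Solver {V} renaming (solve to ↭-solve)
      W rest : List V
      W = ys ++ zs
      rest = mid ++ mid′
      W↭ : W ↭ y ∷ y′ ∷ rest
      W↭ = ↭-solve 4 (λ m y m′ y′ → (m :++ y) :++ (m′ :++ y′) ⊜ y :++ (y′ :++ (m :++ m′))) ↭-refl mid (y ∷ []) mid′ (y′ ∷ [])
      rest₁↭ : y′ ∷ rest ↭ reverse mid ++ zs
      rest₁↭ = ↭-trans (↭-solve 3 (λ y′ m m′ → y′ :++ (m :++ m′) ⊜ m :++ (m′ :++ y′)) ↭-refl (y′ ∷ []) mid mid′)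
        (Perm.++⁺ʳ _ (↭-sym (Perm.↭-reverse mid)))
      rest₂↭ : y ∷ rest ↭ reverse mid′ ++ ys
      rest₂↭ = ↭-trans (↭-solve 3 (λ y m m′ → y :++ (m :++ m′) ⊜ m′ :++ (m :++ y)) ↭-refl (y ∷ []) mid mid′)
        (Perm.++⁺ʳ _ (↭-sym (Perm.↭-reverse mid′)))
      reversed : Arc v (y ∷ reverse mid) u
      reversed = subst (λ ws → Arc v ws u) (List.reverse-++ mid (y ∷ [])) (arc-reverse arc-ys)
      reversed′ : Arc v (y′ ∷ reverse mid′) u
      reversed′ = subst (λ ws → Arc v ws u) (List.reverse-++ mid′ (y′ ∷ [])) (arc-reverse arc-zs)
      len : suc (length (reverse mid)) ≡ length ys
      len = trans (cong suc (List.length-reverse mid)) (Perm.↭-length (Perm.∷↭∷ʳ y mid))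
      len′ : suc (length (reverse mid′)) ≡ length zs
      len′ = trans (cong suc (List.length-reverse mid′)) (Perm.↭-length (Perm.∷↭∷ʳ y′ mid′))
      along₁ : Q y u (reverse mid ++ zs) ≈ pow (suc (length (reverse mid))) · P zs
      along₁ = Q-along zs reversed (Unique-resp-↭ (↭-trans (↭-swap u v ↭-refl) (↭-prep v (↭-trans
        (↭-solve 5 (λ u m y m′ y′ → u :++ ((m :++ y) :++ (m′ :++ y′)) ⊜ y :++ (m :++ (u :++ (m′ :++ y′)))) ↭-refl (u ∷ []) mid (y ∷ []) mid′ (y′ ∷ []))
        (↭-prep y (Perm.++⁺ʳ _ (↭-sym (Perm.↭-reverse mid))))))) uq)
      along₂ : Q y′ u (reverse mid′ ++ ys) ≈ pow (suc (length (reverse mid′))) · P ys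
      along₂ = Q-along ys reversed′ (Unique-resp-↭ (↭-trans (↭-swap u v ↭-refl) (↭-prep v (↭-trans
        (↭-solve 5 (λ u m y m′ y′ → u :++ ((m :++ y) :++ (m′ :++ y′)) ⊜ y′ :++ (m′ :++ (u :++ (m :++ y)))) ↭-refl (u ∷ []) mid (y ∷ []) mid′ (y′ ∷ []))
        (↭-prep y′ (Perm.++⁺ʳ _ (↭-sym (Perm.↭-reverse mid′))))))) uq)
      uq-ys : Unique (u ∷ ys)
      uq-ys = Unique-∉ (λ u∈ → ∉-Unique uq (there (∈-++⁺ˡ u∈))) (Unique-++ˡ ys (Unique-tail (Unique-tail uq)))
      uq-zs : Unique (u ∷ zs)
      uq-zs = Unique-∉ (λ u∈ → ∉-Unique uq (there (∈-++⁺ʳ ys u∈))) (Unique-++ʳ ys (Unique-tail (Unique-tail uq)))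
      middle : ∀ {w} → w ∈ rest → ¬ (v ∼ w)
      middle {w} w∈ v∼w with ∈-++⁻ mid w∈
      ... | inj₁ w∈mid with arc-touch arc-ys (∈-++⁺ˡ w∈mid) (∼-sym v∼w) (λ v∈ → ∉-Unique (Unique-tail uq) (∈-++⁺ˡ v∈))
      ...   | inj₁ (_ , refl) = ∉-Unique uq (here refl)
      ...   | inj₂ (w≡ , _)   = Unique-disjoint mid (Unique-tail uq-ys) w∈mid (here (trans w≡ (lastOf-∷ʳ mid y u)))
      middle {w} w∈ v∼w | inj₂ w∈mid′ with arc-touch arc-zs (∈-++⁺ˡ w∈mid′) (∼-sym v∼w) (λ v∈ → ∉-Unique (Unique-tail uq) (∈-++⁺ʳ ys v∈))
      ...   | inj₁ (_ , refl) = ∉-Unique uq (here refl)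
      ...   | inj₂ (w≡ , _)   = Unique-disjoint mid′ (Unique-tail uq-zs) w∈mid′ (here (trans w≡ (lastOf-∷ʳ mid′ y′ u)))

    sp : ℕ → ℕ → ℕ → K
    sp k b c = rec (π (suc b) · π (suc c)) (rec (π (suc c)) (rec 1# (M v v) (suc c)) (suc b)) k

    P-hub : ∀ {ys zs} → Arc u ys v → Arc u zs v → Unique (u ∷ v ∷ ys ++ zs) → (∀ {w} → w ∈ ys ++ zs → M w w ≈ δ) →
      P (v ∷ ys ++ zs) ≈ rec (π (suc (length zs))) (rec 1# (M v v) (suc (length zs))) (suc (length ys))
    P-hub {ys} {zs} arc-ys arc-zs uq d = begin
      P (v ∷ ys ++ zs)
        ≈⟨ P-↭ (↭-sym (Perm.shift _ ys zs)) ⟩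
      P (ys ++ v ∷ zs)
        ≈⟨ proj₁ (chain zs arc-ys (Unique-resp-↭ (↭-prep u (↭-sym (Perm.shift _ ys zs))) uq) (d ∘ ∈-++⁺ˡ)) ⟩
      rec (P zs) (P (v ∷ zs)) (suc (length ys))
        ≈⟨ rec-cong (P-path arc-zs (Unique-tail-≢ uq-zs) (d ∘ ∈-++⁺ʳ ys)) spoke (suc (length ys)) ⟩
      rec (π (suc (length zs))) (rec 1# (M v v) (suc (length zs))) (suc (length ys)) ∎
      where
      Unique-tail-≢ : ∀ {zs} → Unique (u ∷ v ∷ zs) → Unique (u ∷ zs)
      Unique-tail-≢ uq = Unique-∉ (λ u∈ → ∉-Unique uq (there u∈)) (Unique-tail (Unique-tail uq))
      uq-zs : Unique (u ∷ v ∷ zs)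
      uq-zs = Unique-++ʳ ys (Unique-resp-↭ (↭-sym (↭-trans (Perm.shift _ ys (v ∷ zs)) (↭-prep u (Perm.shift _ ys zs)))) uq)
      spoke : P (v ∷ zs) ≈ rec 1# (M v v) (suc (length zs))
      spoke = ≈-trans (P-↭ (Perm.∷↭∷ʳ v zs)) (≈-trans
        (proj₁ (chain [] arc-zs (Unique-resp-↭ (↭-prep u (Perm.∷↭∷ʳ v zs)) uq-zs) (d ∘ ∈-++⁺ʳ ys)))
        (rec-cong ≈-refl (≈-trans (+-identityʳ _) (*-identityʳ _)) (suc (length zs))))

    spokes : ∀ {xs ys zs} → Arc u xs v → Arc u ys v → Arc u zs v → Unique (u ∷ v ∷ xs ++ ys ++ zs) →
      (∀ {w} → w ∈ xs ++ ys ++ zs → M w w ≈ δ) →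
      P (xs ++ v ∷ ys ++ zs) ≈ sp (suc (length xs)) (length ys) (length zs) ×
      P (tail (xs ++ v ∷ ys ++ zs)) ≈ sp (length xs) (length ys) (length zs)
    spokes {xs} {ys} {zs} arc-xs arc-ys arc-zs uq d =
      ≈-trans (proj₁ both) (rec-cong ends hub (suc (length xs))) , ≈-trans (proj₂ both) (rec-cong ends hub (length xs))
      where
      uq′ : Unique (u ∷ v ∷ ys ++ zs)
      uq′ = Unique-++ʳ xs (Unique-resp-↭ (↭-sym (↭-trans (Perm.shift _ xs (v ∷ ys ++ zs)) (↭-prep u (Perm.shift _ xs (ys ++ zs))))) uq)
      uq-ys : Unique (u ∷ ys)
      uq-ys = Unique-∉ (λ u∈ → ∉-Unique uq′ (there (∈-++⁺ˡ u∈))) (Unique-++ˡ ys (Unique-tail (Unique-tail uq′)))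
      uq-zs : Unique (u ∷ zs)
      uq-zs = Unique-∉ (λ u∈ → ∉-Unique uq′ (there (∈-++⁺ʳ ys u∈))) (Unique-++ʳ ys (Unique-tail (Unique-tail uq′)))
      both = chain (ys ++ zs) arc-xs (Unique-resp-↭ (↭-prep u (↭-sym (Perm.shift _ xs (ys ++ zs)))) uq) (d ∘ ∈-++⁺ˡ)
      hub = P-hub arc-ys arc-zs uq′ (d ∘ ∈-++⁺ʳ xs)
      ends : P (ys ++ zs) ≈ π (suc (length ys)) · π (suc (length zs))
      ends = ≈-trans
        (P-++ ys zs λ y∈ z∈ → zero₂ (λ { refl → Unique-disjoint ys (Unique-tail (Unique-tail uq′)) y∈ z∈ }) λ y∼z →
          [ (λ { refl → ∉-Unique uq-zs z∈ }) , [ (λ z∈′ → Unique-disjoint ys (Unique-tail (Unique-tail uq′)) z∈′ z∈)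
          , (λ { refl → ∉-Unique (Unique-tail uq′) (∈-++⁺ʳ ys z∈) }) ]′ ]′ (arc-closed arc-ys y∈ y∼z))
        (*-cong (P-path arc-ys uq-ys (d ∘ ∈-++⁺ʳ xs ∘ ∈-++⁺ˡ)) (P-path arc-zs uq-zs (d ∘ ∈-++⁺ʳ xs ∘ ∈-++⁺ʳ ys)))

    row₃ : ∀ c₁ c₂ c₃ W → u ∼ c₁ → u ∼ c₂ → u ∼ c₃ → u ∉ W → (∀ {w} → w ∈ W → ¬ (u ∼ w)) →
      P (u ∷ c₁ ∷ c₂ ∷ c₃ ∷ W) ≈ M u u · P (c₁ ∷ c₂ ∷ c₃ ∷ W) ∔
        (z · Q c₁ u (c₂ ∷ c₃ ∷ W) ∔ (z · Q c₂ u (c₁ ∷ c₃ ∷ W) ∔ z · Q c₃ u (c₁ ∷ c₂ ∷ W)))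
    row₃ c₁ c₂ c₃ W e₁ e₂ e₃ u∉ h = +-congˡ (+-cong (*-congʳ (M-edge e₁))
      (+-cong (*-cong (M-edge e₂) (perm-rows (↭-swap c₁ c₂ (↭-refl {x = c₃ ∷ W})) (u ∷ c₁ ∷ c₃ ∷ W)))
        (≈-trans (+-cong (*-cong (M-edge e₃) (perm-rows (↭-trans (↭-prep c₁ (↭-swap c₂ c₃ (↭-refl {x = W}))) (↭-swap c₁ c₃ ↭-refl)) (u ∷ c₁ ∷ c₂ ∷ W)))
          (expand-off (λ c ds → perm (c₁ ∷ c₂ ∷ c₃ ∷ W) (u ∷ c₁ ∷ c₂ ∷ c₃ ∷ ds)) u∉ h)) (+-identityʳ _))))

    arm : ∀ {x xs ys zs} → Arc u (x ∷ xs) v → Arc u ys v → Arc u zs v → Unique (u ∷ v ∷ (x ∷ xs) ++ ys ++ zs) →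
      (∀ {w} → w ∈ (x ∷ xs) ++ ys ++ zs → M w w ≈ δ) → ∀ {E} → Q v u (ys ++ zs) ≈ E →
      Q x u (xs ++ v ∷ ys ++ zs) ≈ z · sp (suc (length xs)) (length ys) (length zs) ∔ pow (suc (length xs)) · E
    arm {x} {[]} {ys} {zs} arc@(step e thin (edge e′)) arc-ys arc-zs uq d E≈ = begin
      M x u · P (v ∷ W) ∔ (M x v · Q v u W ∔ expand (λ c ds → M x c · perm (v ∷ W) (u ∷ v ∷ ds)) W)
        ≈⟨ +-cong (*-cong (M-edge (∼-sym e)) (proj₂ (spokes arc arc-ys arc-zs uq d)))
             (≈-trans (+-cong (*-cong (M-edge e′) E≈) (expand-off (λ c ds → perm (v ∷ W) (u ∷ v ∷ ds)) (∉-Unique (Unique-tail (Unique-tail uq))) λ w∈ x∼w →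
               [ (λ { refl → ∉-Unique uq (there (there w∈)) }) , (λ { refl → ∉-Unique (Unique-tail uq) (there w∈) }) ]′ (thin x∼w))) (+-identityʳ _)) ⟩
      z · sp 1 (length ys) (length zs) ∔ z · _
        ≈⟨ +-congˡ (*-congʳ (≈-sym (*-identityʳ z))) ⟩
      z · sp 1 (length ys) (length zs) ∔ z · 1# · _ ∎
      where W = ys ++ zs
    arm {x} {y ∷ xs} {ys} {zs} arc@(step e thin arc′@(step e′ thin′ arc″)) arc-ys arc-zs uq d {E} E≈ = begin
      M x u · P (y ∷ xs ++ v ∷ W) ∔ (M x y · Q y u (xs ++ v ∷ W) ∔ expand (λ c ds → M x c · perm (y ∷ xs ++ v ∷ W) (u ∷ y ∷ ds)) (xs ++ v ∷ W))
        ≈⟨ +-cong (*-cong (M-edge (∼-sym e)) (proj₂ (spokes arc arc-ys arc-zs uq d)))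
             (≈-trans (+-cong (*-cong (M-edge e′) (≈-trans (Q-through W arc′ uq″) (*-congˡ E≈)))
               (expand-off (λ c ds → perm (y ∷ xs ++ v ∷ W) (u ∷ y ∷ ds)) (∉-Unique (Unique-tail uq″) ∘ there) λ w∈ x∼w →
               [ (λ { refl → ∉-Unique uq″ (there (there w∈)) }) , (λ { refl → ∉-Unique (Unique-tail (Unique-tail uq″)) w∈ }) ]′ (thin x∼w))) (+-identityʳ _)) ⟩
      z · sp (suc (suc (length xs))) (length ys) (length zs) ∔ z · (pow (suc (length xs)) · E)
        ≈⟨ +-congˡ (≈-sym (*-assoc _ _ _)) ⟩
      z · sp (suc (suc (length xs))) (length ys) (length zs) ∔ z · pow (suc (length xs)) · E ∎
      where
      W = ys ++ zs
      uq″ : Unique (u ∷ x ∷ y ∷ xs ++ v ∷ W)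
      uq″ = Unique-resp-↭ (↭-prep u (↭-sym (Perm.shift _ (x ∷ y ∷ xs) W))) uq

  P-theta : ∀ {u v xs ys zs} → 0 < length ys → 0 < length zs → Theta u v xs ys zs → (∀ {w} → w ∈ xs ++ ys ++ zs → M w w ≈ δ) →
    let a = length xs ; b = length ys ; c = length zs in
    P (u ∷ v ∷ xs ++ ys ++ zs) ≈ M u u · sp {u} {v} (suc a) b c ∔
      (z · (z · sp {u} {v} a b c ∔ pow a · qv {u} {v} b c) ∔
      (z · (z · sp {u} {v} b a c ∔ pow b · qv {u} {v} a c) ∔
       z · (z · sp {u} {v} c a b ∔ pow c · qv {u} {v} a b)))
  P-theta {u} {v} {[]} {y ∷ ys} {t ∷ zs} 0<b 0<c θ d = ≈-trans (P-↭ (↭-prep u (↭-prep v (↭-prep y (Perm.shift _ ys zs)))))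
    (≈-trans (row₃ {u} {v} v y t (ys ++ zs) (arc-first arc-xs) (arc-first arc-ys) (arc-first arc-zs)
        (λ u∈ → ∉-Unique unique′ (there (there (there u∈)))) off)
      (+-cong (*-congˡ (≈-trans (P-↭ (↭-prep v (↭-prep y (↭-sym (Perm.shift _ ys zs))))) (proj₁ own)))
      (+-cong (*-congˡ first) (+-cong (*-congˡ second) (*-congˡ third)))))
    where
    open Theta θ
    unique′ : Unique (u ∷ v ∷ y ∷ t ∷ ys ++ zs)
    unique′ = Unique-resp-↭ (↭-prep u (↭-prep v (↭-prep y (Perm.shift _ ys zs)))) unique
    off : ∀ {w} → w ∈ ys ++ zs → ¬ (u ∼ w)
    off w∈ u∼w with at-u u∼w
    ... | inj₁ refl        = ∉-Unique (Unique-tail unique′) (there (there w∈))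
    ... | inj₂ (inj₁ refl) = ∉-Unique (Unique-tail (Unique-tail unique′)) (there w∈)
    ... | inj₂ (inj₂ refl) = ∉-Unique (Unique-tail (Unique-tail (Unique-tail unique′))) w∈
    own = spokes arc-xs arc-ys arc-zs unique d
    uq-ys : Unique (u ∷ v ∷ y ∷ ys)
    uq-ys = Unique-++ˡ (u ∷ v ∷ y ∷ ys) unique
    swapped : (y ∷ ys) ++ t ∷ zs ↭ (t ∷ zs) ++ y ∷ ys
    swapped = Perm.++-comm (y ∷ ys) (t ∷ zs)
    uq-zs : Unique (u ∷ v ∷ t ∷ zs)
    uq-zs = Unique-++ˡ (u ∷ v ∷ t ∷ zs) (Unique-resp-↭ (↭-prep u (↭-prep v swapped)) unique)
    v∼u : v ∼ u
    v∼u = ∼-sym (arc-first arc-xs)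
    first : Q v u (y ∷ t ∷ ys ++ zs) ≈ z · sp {u} {v} 0 (suc (length ys)) (suc (length zs)) ∔ 1# · qv {u} {v} (suc (length ys)) (suc (length zs))
    first = ≈-trans (Q-↭ v u (↭-prep y (↭-sym (Perm.shift _ ys zs))))
      (+-cong (*-cong (M-edge v∼u) (proj₂ own)) (≈-trans (Q′-two 0<b 0<c arc-ys arc-zs unique d) (≈-sym (*-identityˡ _))))
    loop : ∀ {ws} → 0 < length ws → Arc u ws v → Unique (u ∷ v ∷ ws) → (∀ {w} → w ∈ ws → M w w ≈ δ) → Q v u ws ≈ qv {u} {v} 0 (length ws)
    loop 0< arc uq dw = +-cong
      (≈-trans (*-cong (M-edge v∼u) (P-path arc (Unique-∉ (λ u∈ → ∉-Unique uq (there u∈)) (Unique-tail (Unique-tail uq))) dw)) (*-congʳ (≈-sym (*-identityʳ z))))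
      (≈-trans (Q′-one 0< arc uq) (≈-sym (*-identityʳ _)))
    second : Q y u (v ∷ t ∷ ys ++ zs) ≈ z · sp {u} {v} (suc (length ys)) 0 (suc (length zs)) ∔ pow (suc (length ys)) · qv {u} {v} 0 (suc (length zs))
    second = ≈-trans (Q-↭ y u (↭-solve 4 (λ v t ys zs → v :++ (t :++ (ys :++ zs)) ⊜ ys :++ (v :++ (t :++ zs))) ↭-refl (v ∷ []) (t ∷ []) ys zs))
      (arm arc-ys arc-xs arc-zs unique d (loop 0<c arc-zs uq-zs (λ w∈ → d (∈-++⁺ʳ (y ∷ ys) w∈))))
      where open ↭-Solver {V} renaming (solve to ↭-solve)
    third : Q t u (v ∷ y ∷ ys ++ zs) ≈ z · sp {u} {v} (suc (length zs)) 0 (suc (length ys)) ∔ pow (suc (length zs)) · qv {u} {v} 0 (suc (length ys))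
    third = ≈-trans (Q-↭ t u (↭-solve 4 (λ v y ys zs → v :++ (y :++ (ys :++ zs)) ⊜ zs :++ (v :++ (y :++ ys))) ↭-refl (v ∷ []) (y ∷ []) ys zs))
      (arm arc-zs arc-xs arc-ys (Unique-resp-↭ (↭-prep u (↭-prep v swapped)) unique) (λ w∈ → d (Perm.∈-resp-↭ (↭-sym swapped) w∈))
        (loop 0<b arc-ys uq-ys (d ∘ ∈-++⁺ˡ)))
      where open ↭-Solver {V} renaming (solve to ↭-solve)
  P-theta {u} {v} {x ∷ xs} {y ∷ ys} {t ∷ zs} 0<b 0<c θ d = ≈-trans (P-↭ (↭-prep u lift))
    (≈-trans (row₃ {u} {v} x y t (v ∷ xs ++ ys ++ zs) (arc-first arc-xs) (arc-first arc-ys) (arc-first arc-zs)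
        (λ u∈ → ∉-Unique unique′ (there (there (there u∈)))) off)
      (+-cong (*-congˡ (≈-trans (P-↭ (↭-trans (↭-sym lift) (↭-sym (Perm.shift _ (x ∷ xs) _)))) (proj₁ own)))
      (+-cong (*-congˡ first) (+-cong (*-congˡ second) (*-congˡ third)))))
    where
    open Theta θ
    open ↭-Solver {V} renaming (solve to ↭-solve)
    lift : v ∷ (x ∷ xs) ++ (y ∷ ys) ++ t ∷ zs ↭ x ∷ y ∷ t ∷ v ∷ xs ++ ys ++ zs
    lift = ↭-solve 7 (λ v x xs y ys t zs → v :++ ((x :++ xs) :++ ((y :++ ys) :++ (t :++ zs))) ⊜ x :++ (y :++ (t :++ (v :++ (xs :++ (ys :++ zs))))))
      ↭-refl (v ∷ []) (x ∷ []) xs (y ∷ []) ys (t ∷ []) zs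
    unique′ : Unique (u ∷ x ∷ y ∷ t ∷ v ∷ xs ++ ys ++ zs)
    unique′ = Unique-resp-↭ (↭-prep u lift) unique
    off : ∀ {w} → w ∈ v ∷ xs ++ ys ++ zs → ¬ (u ∼ w)
    off w∈ u∼w with at-u u∼w
    ... | inj₁ refl        = ∉-Unique (Unique-tail unique′) (there (there w∈))
    ... | inj₂ (inj₁ refl) = ∉-Unique (Unique-tail (Unique-tail unique′)) (there w∈)
    ... | inj₂ (inj₂ refl) = ∉-Unique (Unique-tail (Unique-tail (Unique-tail unique′))) w∈
    own = spokes arc-xs arc-ys arc-zs unique d
    order₂ : (x ∷ xs) ++ (y ∷ ys) ++ t ∷ zs ↭ (y ∷ ys) ++ (x ∷ xs) ++ t ∷ zs
    order₂ = ↭-solve 3 (λ a b c → a :++ (b :++ c) ⊜ b :++ (a :++ c)) ↭-refl (x ∷ xs) (y ∷ ys) (t ∷ zs)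
    order₃ : (x ∷ xs) ++ (y ∷ ys) ++ t ∷ zs ↭ (t ∷ zs) ++ (x ∷ xs) ++ y ∷ ys
    order₃ = ↭-solve 3 (λ a b c → a :++ (b :++ c) ⊜ c :++ (a :++ b)) ↭-refl (x ∷ xs) (y ∷ ys) (t ∷ zs)
    v≁u : ¬ (v ∼ u)
    v≁u v∼u with at-u (∼-sym v∼u)
    ... | inj₁ refl        = ∉-Unique (Unique-tail unique) (here refl)
    ... | inj₂ (inj₁ refl) = ∉-Unique (Unique-tail unique) (there (∈-++⁺ʳ xs (here refl)))
    ... | inj₂ (inj₂ refl) = ∉-Unique (Unique-tail unique) (there (∈-++⁺ʳ xs (there (∈-++⁺ʳ ys (here refl)))))
    v≢u : v ≢ u
    v≢u refl = ∉-Unique unique (here refl)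
    loop : ∀ {ws ws′} → 0 < length ws → 0 < length ws′ → Arc u ws v → Arc u ws′ v → Unique (u ∷ v ∷ ws ++ ws′) →
      (∀ {w} → w ∈ ws ++ ws′ → M w w ≈ δ) → Q v u (ws ++ ws′) ≈ qv {u} {v} (length ws) (length ws′)
    loop 0< 0<′ arc arc′ uq dw = ≈-trans (+-cong (≈-trans (*-congʳ (M-none v≢u v≁u)) (zeroˡ _)) (Q′-two 0< 0<′ arc arc′ uq dw)) (+-identityˡ _)
    drop : ∀ ws {ws′} → Unique (u ∷ v ∷ ws ++ ws′) → Unique (u ∷ v ∷ ws′)
    drop ws {ws′} uq = Unique-++ʳ ws (Unique-resp-↭
      (↭-solve 4 (λ u v ws ws′ → u :++ (v :++ (ws :++ ws′)) ⊜ ws :++ (u :++ (v :++ ws′))) ↭-refl (u ∷ []) (v ∷ []) ws ws′) uq)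
    uq₂ = Unique-resp-↭ (↭-prep u (↭-prep v order₂)) unique
    uq₃ = Unique-resp-↭ (↭-prep u (↭-prep v order₃)) unique
    d₂ : ∀ {w} → w ∈ (y ∷ ys) ++ (x ∷ xs) ++ t ∷ zs → M w w ≈ δ
    d₂ w∈ = d (Perm.∈-resp-↭ (↭-sym order₂) w∈)
    d₃ : ∀ {w} → w ∈ (t ∷ zs) ++ (x ∷ xs) ++ y ∷ ys → M w w ≈ δ
    d₃ w∈ = d (Perm.∈-resp-↭ (↭-sym order₃) w∈)
    first = ≈-trans (Q-↭ x u (↭-solve 6 (λ v xs y ys t zs → y :++ (t :++ (v :++ (xs :++ (ys :++ zs)))) ⊜ xs :++ (v :++ ((y :++ ys) :++ (t :++ zs))))
        ↭-refl (v ∷ []) xs (y ∷ []) ys (t ∷ []) zs))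
      (arm arc-xs arc-ys arc-zs unique d (loop 0<b 0<c arc-ys arc-zs (drop (x ∷ xs) unique) (λ w∈ → d (∈-++⁺ʳ (x ∷ xs) w∈))))
    second = ≈-trans (Q-↭ y u (↭-solve 6 (λ v x xs ys t zs → x :++ (t :++ (v :++ (xs :++ (ys :++ zs)))) ⊜ ys :++ (v :++ ((x :++ xs) :++ (t :++ zs))))
        ↭-refl (v ∷ []) (x ∷ []) xs ys (t ∷ []) zs))
      (arm arc-ys arc-xs arc-zs uq₂ d₂ (loop (s≤s z≤n) 0<c arc-xs arc-zs (drop (y ∷ ys) uq₂) (λ w∈ → d₂ (∈-++⁺ʳ (y ∷ ys) w∈))))
    third = ≈-trans (Q-↭ t u (↭-solve 6 (λ v x xs y ys zs → x :++ (y :++ (v :++ (xs :++ (ys :++ zs)))) ⊜ zs :++ (v :++ ((x :++ xs) :++ (y :++ ys))))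
        ↭-refl (v ∷ []) (x ∷ []) xs (y ∷ []) ys zs))
      (arm arc-zs arc-xs arc-ys uq₃ d₃ (loop (s≤s z≤n) 0<b arc-xs arc-ys (drop (t ∷ zs) uq₃) (λ w∈ → d₃ (∈-++⁺ʳ (t ∷ zs) w∈))))

-- Closed forms for cycles, dumbbells and theta graphs

z² B e b κ u v w : Series
z² = Z 1 ⊗ Z 1
B  = C 1ℤ ⊕ ⊝ Z 1 ⊕ C (+ 2) ⊗ z²
e  = C 1ℤ ⊕ z²

b ‼ zero        = 1ℤ
b ‼ suc zero    = 1ℤ
b ‼ suc (suc n) = b ‼ suc n ℤ.- (b ‼ n ℤ.+ b ‼ n)

κ = (Z 1 ⊕ ⊝ z²) ⊗ b
u = C 1ℤ ⊕ κ
v = C (+ 2) ⊗ u ⊕ ⊝ C 1ℤ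
w = C (+ 2) ⊗ u ⊕ κ

-- s k = (-1)ᵏ z²ᵏ.

s : ℕ → Series
s zero    = C 1ℤ
s (suc k) = ⊝ (z² ⊗ s k)

X Y c : ℕ → Series
X k = C 1ℤ ⊕ C (+ 2) ⊗ u ⊗ Z k ⊕ v ⊗ s k
Y k = ⊝ κ ⊕ C (+ 2) ⊗ u ⊗ Z k ⊕ w ⊗ s k
c k = C 1ℤ ⊕ C (+ 2) ⊗ Z k ⊕ s k

-- Up to the factor (1 + z²) u², Δ p q l is the series of the dumbbell with cycles of lengths p and q
-- joined by a path with l edges, and Θ i j k that of the theta graph with arcs of i, j and k edges.

Δ : ℕ → ℕ → ℕ → Series
Δ p q l = X p ⊗ X q ⊕ ⊝ (s l ⊗ (Y p ⊗ Y q))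

Θ : ℕ → ℕ → ℕ → Series
Θ i j k = C 1ℤ ⊕ ⊝ (κ ⊗ κ ⊗ (s i ⊕ s j ⊕ s k)) ⊕ v ⊗ v ⊗ (s i ⊗ s j ⊕ s i ⊗ s k ⊕ s j ⊗ s k)
  ⊕ ⊝ (w ⊗ w ⊗ (s i ⊗ s j ⊗ s k))
  ⊕ C (+ 2) ⊗ (u ⊗ u) ⊗ (Z i ⊗ Z j ⊗ (C 1ℤ ⊕ ⊝ s k) ⊕ Z i ⊗ Z k ⊗ (C 1ℤ ⊕ ⊝ s j) ⊕ Z j ⊗ Z k ⊗ (C 1ℤ ⊕ ⊝ s i))

cycles : List ℕ → Series
cycles []       = C 1ℤ
cycles (k ∷ ks) = c k ⊗ cycles ks

module SpecialSeries (m : ℕ) where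
  open Truncated exact m
  open SetoidReasoning setoid

  b-inverse : B ⊗ b ≋ C 1ℤ
  b-inverse = begin
    B ⊗ b ≈⟨ solve 2 (λ z b → (con 1ℤ :- z :+ con (+ 2) :* (z :* z)) :* b :=
               b :- (z :* b :- (z :* (z :* b) :+ z :* (z :* b)))) ≋-refl (Z 1) b ⟩
    b ⊕ ⊝ (Z 1 ⊗ b ⊕ ⊝ (Z 1 ⊗ (Z 1 ⊗ b) ⊕ Z 1 ⊗ (Z 1 ⊗ b))) ≈⟨ ≗⇒≋ pointwise ⟩
    C 1ℤ ∎
    where
    lemma : ∀ x y → x ℤ.- y ℤ.+ ℤ.- (x ℤ.+ ℤ.- y) ≡ 0ℤ
    lemma = ℤ-Solver.solve-∀
    pointwise : b ⊕ ⊝ (Z 1 ⊗ b ⊕ ⊝ (Z 1 ⊗ (Z 1 ⊗ b) ⊕ Z 1 ⊗ (Z 1 ⊗ b))) ≗ C 1ℤ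
    pointwise zero          = refl
    pointwise (suc zero)    = refl
    pointwise (suc (suc n)) = trans
      (cong₂ (λ x y → b ‼ suc (suc n) ℤ.+ ℤ.- (x ℤ.+ ℤ.- (y ℤ.+ y))) (Z-shift 1 b (suc n))
        (trans (Z-shift 1 (Z 1 ⊗ b) (suc n)) (Z-shift 1 b n)))
      (lemma (b ‼ suc n) (b ‼ n ℤ.+ b ‼ n))

  u-fraction : u ≋ e ⊗ b
  u-fraction = begin
    C 1ℤ ⊕ κ  ≈⟨ ⊕-cong (≋-sym b-inverse) ≋-refl ⟩
    B ⊗ b ⊕ κ
      ≈⟨ solve 2 (λ z b → (con 1ℤ :- z :+ con (+ 2) :* (z :* z)) :* b :+ (z :- z :* z) :* b := (con 1ℤ :+ z :* z) :* b) ≋-refl (Z 1) b ⟩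
    e ⊗ b ∎

module GraphSeries (m : ℕ) {n : ℕ} (G : Graph n) where
  open Truncated exact m
  open SetoidReasoning setoid
  open SpecialSeries m

  open GraphArcs G public

  coeff₀ coeff₁ : Fin n → Fin n → ℤ
  coeff₀ i j = 0ℤ ℤ.* identity i j ℤ.+ 0ℤ ℤ.+ ℤ.- laplacian G i j
  coeff₁ i j = 1ℤ ℤ.* identity i j ℤ.+ 0ℤ

  M : Fin n → Fin n → Series
  M = Homogenise.entry m coeff₀ coeff₁

  M-edge : ∀ {i j} → i ∼ j → M i j ≋ Z 1
  M-edge {i} {j} i∼j with i Fin.≟ j
  ... | yes refl = contradiction (trans (sym (irreflexive G i)) i∼j) λ ()
  ... | no _ rewrite i∼j = solve 2 (λ z U → con 1ℤ :* z :+ con 0ℤ :* U := z) ≋-refl (Z 1) U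

  M-none : ∀ {i j} → i ≢ j → ¬ (i ∼ j) → M i j ≋ C 0ℤ
  M-none {i} {j} i≢j i≁j with i Fin.≟ j
  ... | yes i≡j = contradiction i≡j i≢j
  ... | no _ with adj G i j
  ...   | true  = contradiction refl i≁j
  ...   | false = solve 2 (λ z U → con 0ℤ :* z :+ con 0ℤ :* U := con 0ℤ) ≋-refl (Z 1) U

  M-diagonal : ∀ i → M i i ≋ U ⊕ ⊝ (C (+ degree G i) ⊗ Z 1)
  M-diagonal i with i Fin.≟ i
  ... | no i≢i = contradiction refl i≢i
  ... | yes _ rewrite irreflexive G i = ≋-trans
    (⊕-cong (⊗-cong (≋-trans (≗⇒≋ {g = C (ℤ.- (+ degree G i))} λ k → cong (λ t → C t ‼ k) (lemma (+ degree G i))) (≗⇒≋ λ { zero → refl ; (suc _) → refl })) ≋-refl) ≋-refl)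
    (solve 3 (λ d z U → :- d :* z :+ con 1ℤ :* U := U :- d :* z) ≋-refl (C (+ degree G i)) (Z 1) U)
    where
    lemma : ∀ d → 0ℤ ℤ.* 1ℤ ℤ.+ 0ℤ ℤ.+ ℤ.- (d ℤ.- 0ℤ) ≡ ℤ.- d
    lemma = ℤ-Solver.solve-∀

  δ : Series
  δ = C 1ℤ ⊕ ⊝ z²

  M-degree-2 : ∀ {i} → degree G i ≡ 2 → M i i ≋ δ
  M-degree-2 {i} p = ≋-trans (M-diagonal i) (≋-trans (⊕-cong ≋-refl (⊝-cong (⊗-cong (≗⇒≋ λ k → cong (λ t → C (+ t) ‼ k) p) ≋-refl)))
    (solve 1 (λ z → con 1ℤ :+ con (+ 2) :* z :- z :* z :- con (+ 2) :* z := con 1ℤ :- z :* z) ≋-refl (Z 1)))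

  M-degree-3 : ∀ {i} → degree G i ≡ 3 → M i i ≋ δ ⊕ ⊝ Z 1
  M-degree-3 {i} p = ≋-trans (M-diagonal i) (≋-trans (⊕-cong ≋-refl (⊝-cong (⊗-cong (≗⇒≋ λ k → cong (λ t → C (+ t) ‼ k) p) ≋-refl)))
    (solve 1 (λ z → con 1ℤ :+ con (+ 2) :* z :- z :* z :- con (+ 3) :* z := con 1ℤ :- z :* z :- z) ≋-refl (Z 1)))

  open Permanent ring M public
  open ArcPermanent ring M (Z 1) δ _∼_ ∼-sym M-edge M-none public

  charSeries : Series
  charSeries = homog n (coeff (permanentalPoly (laplacian G)))

  charSeries-P : charSeries ≋ P (allFin n)
  charSeries-P = Homogenise.homog-per m coeff₀ coeff₁

  pow-Z : ∀ k → pow k ≋ Z k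
  pow-Z zero    = ≋-refl
  pow-Z (suc k) = ≋-trans (⊗-cong ≋-refl (pow-Z k)) (≋-sym (Z-hom 1 k))

  e-π : ∀ k → e ⊗ π k ≋ C 1ℤ ⊕ ⊝ s k
  e-π zero          = solve 1 (λ z → (con 1ℤ :+ z :* z) :* con 0ℤ := con 1ℤ :- con 1ℤ) ≋-refl (Z 1)
  e-π (suc zero)    = solve 1 (λ z → (con 1ℤ :+ z :* z) :* con 1ℤ := con 1ℤ :- :- (z :* z :* con 1ℤ)) ≋-refl (Z 1)
  e-π (suc (suc k)) = begin
    e ⊗ π (suc (suc k))
      ≈⟨ solve 3 (λ z p q → (con 1ℤ :+ z :* z) :* ((con 1ℤ :- z :* z) :* p :+ z :* z :* q) :=
           (con 1ℤ :- z :* z) :* ((con 1ℤ :+ z :* z) :* p) :+ z :* z :* ((con 1ℤ :+ z :* z) :* q)) ≋-refl (Z 1) (π (suc k)) (π k) ⟩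
    δ ⊗ (e ⊗ π (suc k)) ⊕ z² ⊗ (e ⊗ π k)
      ≈⟨ ⊕-cong (⊗-cong ≋-refl (e-π (suc k))) (⊗-cong ≋-refl (e-π k)) ⟩
    δ ⊗ (C 1ℤ ⊕ ⊝ s (suc k)) ⊕ z² ⊗ (C 1ℤ ⊕ ⊝ s k)
      ≈⟨ solve 2 (λ z s → (con 1ℤ :- z :* z) :* (con 1ℤ :- :- (z :* z :* s)) :+ z :* z :* (con 1ℤ :- s) :=
           con 1ℤ :- :- (z :* z :* :- (z :* z :* s))) ≋-refl (Z 1) (s k) ⟩
    C 1ℤ ⊕ ⊝ s (suc (suc k)) ∎

  e-τ : ∀ k → e ⊗ τ k ≋ z² ⊕ s k
  e-τ zero          = solve 1 (λ z → (con 1ℤ :+ z :* z) :* con 1ℤ := z :* z :+ con 1ℤ) ≋-refl (Z 1)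
  e-τ (suc zero)    = solve 1 (λ z → (con 1ℤ :+ z :* z) :* con 0ℤ := z :* z :+ :- (z :* z :* con 1ℤ)) ≋-refl (Z 1)
  e-τ (suc (suc k)) = begin
    e ⊗ τ (suc (suc k))
      ≈⟨ solve 3 (λ z p q → (con 1ℤ :+ z :* z) :* ((con 1ℤ :- z :* z) :* p :+ z :* z :* q) :=
           (con 1ℤ :- z :* z) :* ((con 1ℤ :+ z :* z) :* p) :+ z :* z :* ((con 1ℤ :+ z :* z) :* q)) ≋-refl (Z 1) (τ (suc k)) (τ k) ⟩
    δ ⊗ (e ⊗ τ (suc k)) ⊕ z² ⊗ (e ⊗ τ k)
      ≈⟨ ⊕-cong (⊗-cong ≋-refl (e-τ (suc k))) (⊗-cong ≋-refl (e-τ k)) ⟩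
    δ ⊗ (z² ⊕ s (suc k)) ⊕ z² ⊗ (z² ⊕ s k)
      ≈⟨ solve 2 (λ z s → (con 1ℤ :- z :* z) :* (z :* z :+ :- (z :* z :* s)) :+ z :* z :* (z :* z :+ s) :=
           z :* z :+ :- (z :* z :* :- (z :* z :* s))) ≋-refl (Z 1) (s k) ⟩
    z² ⊕ s (suc (suc k)) ∎

  e-rec : ∀ f₀ f₁ k → e ⊗ rec f₀ f₁ k ≋ f₁ ⊗ (C 1ℤ ⊕ ⊝ s k) ⊕ f₀ ⊗ (z² ⊕ s k)
  e-rec f₀ f₁ k = begin
    e ⊗ rec f₀ f₁ k             ≈⟨ ⊗-cong ≋-refl (rec-basis f₀ f₁ k) ⟩
    e ⊗ (f₁ ⊗ π k ⊕ f₀ ⊗ τ k)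
      ≈⟨ solve 5 (λ e a p b t → e :* (a :* p :+ b :* t) := a :* (e :* p) :+ b :* (e :* t)) ≋-refl e f₁ (π k) f₀ (τ k) ⟩
    f₁ ⊗ (e ⊗ π k) ⊕ f₀ ⊗ (e ⊗ τ k) ≈⟨ ⊕-cong (⊗-cong ≋-refl (e-π k)) (⊗-cong ≋-refl (e-τ k)) ⟩
    f₁ ⊗ (C 1ℤ ⊕ ⊝ s k) ⊕ f₀ ⊗ (z² ⊕ s k) ∎

  cycle-sum : ∀ k → δ ⊗ π (suc k) ⊕ C (+ 2) ⊗ (z² ⊗ π k) ≋ C 1ℤ ⊕ s (suc k)
  cycle-sum zero          = solve 1 (λ z → (con 1ℤ :- z :* z) :* con 1ℤ :+ con (+ 2) :* (z :* z :* con 0ℤ) := con 1ℤ :+ :- (z :* z :* con 1ℤ)) ≋-refl (Z 1)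
  cycle-sum (suc zero)    = solve 1 (λ z → (con 1ℤ :- z :* z) :* ((con 1ℤ :- z :* z) :* con 1ℤ :+ z :* z :* con 0ℤ) :+ con (+ 2) :* (z :* z :* con 1ℤ) :=
    con 1ℤ :+ :- (z :* z :* :- (z :* z :* con 1ℤ))) ≋-refl (Z 1)
  cycle-sum (suc (suc k)) = begin
    δ ⊗ π (suc (suc (suc k))) ⊕ C (+ 2) ⊗ (z² ⊗ π (suc (suc k)))
      ≈⟨ solve 4 (λ z p q r → let d = con 1ℤ :- z :* z ; y = z :* z in
           d :* (d :* p :+ y :* q) :+ con (+ 2) :* (y :* (d :* q :+ y :* r)) :=
           d :* (d :* p :+ con (+ 2) :* (y :* q)) :+ y :* (d :* q :+ con (+ 2) :* (y :* r))) ≋-refl (Z 1) (π (suc (suc k))) (π (suc k)) (π k) ⟩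
    δ ⊗ (δ ⊗ π (suc (suc k)) ⊕ C (+ 2) ⊗ (z² ⊗ π (suc k))) ⊕ z² ⊗ (δ ⊗ π (suc k) ⊕ C (+ 2) ⊗ (z² ⊗ π k))
      ≈⟨ ⊕-cong (⊗-cong ≋-refl (cycle-sum (suc k))) (⊗-cong ≋-refl (cycle-sum k)) ⟩
    δ ⊗ (C 1ℤ ⊕ s (suc (suc k))) ⊕ z² ⊗ (C 1ℤ ⊕ s (suc k))
      ≈⟨ solve 2 (λ z t → (con 1ℤ :- z :* z) :* (con 1ℤ :+ :- (z :* z :* t)) :+ z :* z :* (con 1ℤ :+ t) :=
           con 1ℤ :+ :- (z :* z :* :- (z :* z :* t))) ≋-refl (Z 1) (s (suc k)) ⟩
    C 1ℤ ⊕ s (suc (suc (suc k))) ∎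

  P-cycle : ∀ {x xs} → 2 ≤ length xs → Arc x xs x → Unique (x ∷ xs) → (∀ {y} → y ∈ x ∷ xs → degree G y ≡ 2) →
    P (x ∷ xs) ≋ c (suc (length xs))
  P-cycle {x} {xs} 2≤ arc uq d = begin
    P (x ∷ xs)
      ≈⟨ P-closed 2≤ arc uq (M-degree-2 ∘ d ∘ there) ⟩
    M x x ⊗ π (suc k) ⊕ (C 1ℤ ⊕ C 1ℤ) ⊗ (Z 1 ⊗ (Z 1 ⊗ π k ⊕ pow k))
      ≈⟨ ⊕-cong (⊗-cong (M-degree-2 (d (here refl))) ≋-refl) ≋-refl ⟩
    δ ⊗ π (suc k) ⊕ (C 1ℤ ⊕ C 1ℤ) ⊗ (Z 1 ⊗ (Z 1 ⊗ π k ⊕ pow k))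
      ≈⟨ solve 4 (λ z p q r → (con 1ℤ :- z :* z) :* p :+ (con 1ℤ :+ con 1ℤ) :* (z :* (z :* q :+ r)) :=
           (con 1ℤ :- z :* z) :* p :+ con (+ 2) :* (z :* z :* q) :+ con (+ 2) :* (z :* r)) ≋-refl (Z 1) (π (suc k)) (π k) (pow k) ⟩
    δ ⊗ π (suc k) ⊕ C (+ 2) ⊗ (z² ⊗ π k) ⊕ C (+ 2) ⊗ pow (suc k)
      ≈⟨ ⊕-cong (cycle-sum k) (⊗-cong ≋-refl (pow-Z (suc k))) ⟩
    C 1ℤ ⊕ s (suc k) ⊕ C (+ 2) ⊗ Z (suc k)
      ≈⟨ solve 2 (λ a b → con 1ℤ :+ a :+ b := con 1ℤ :+ b :+ a) ≋-refl (s (suc k)) (C (+ 2) ⊗ Z (suc k)) ⟩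
    c (suc k) ∎
    where k = length xs

  private
    X-b : ∀ k → X k ≋ b ⊗ (B ⊕ C (+ 2) ⊗ e ⊗ Z k ⊕ (C 1ℤ ⊕ Z 1) ⊗ s k)
    X-b k = begin
      C 1ℤ ⊕ C (+ 2) ⊗ u ⊗ Z k ⊕ (C (+ 2) ⊗ u ⊕ ⊝ C 1ℤ) ⊗ s k
        ≈⟨ ⊕-cong (⊕-cong (≋-sym b-inverse) (⊗-cong (⊗-cong ≋-refl u-fraction) ≋-refl))
             (⊗-cong (⊕-cong (⊗-cong ≋-refl u-fraction) (⊝-cong (≋-sym b-inverse))) ≋-refl) ⟩
      B ⊗ b ⊕ C (+ 2) ⊗ (e ⊗ b) ⊗ Z k ⊕ (C (+ 2) ⊗ (e ⊗ b) ⊕ ⊝ (B ⊗ b)) ⊗ s k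
        ≈⟨ solve 4 (λ z b y t → let B = con 1ℤ :- z :+ con (+ 2) :* (z :* z) ; e = con 1ℤ :+ z :* z in
             B :* b :+ con (+ 2) :* (e :* b) :* y :+ (con (+ 2) :* (e :* b) :- B :* b) :* t :=
             b :* (B :+ con (+ 2) :* e :* y :+ (con 1ℤ :+ z) :* t)) ≋-refl (Z 1) b (Z k) (s k) ⟩
      b ⊗ (B ⊕ C (+ 2) ⊗ e ⊗ Z k ⊕ (C 1ℤ ⊕ Z 1) ⊗ s k) ∎

    Y-b : ∀ k → Y k ≋ b ⊗ (z² ⊕ ⊝ Z 1 ⊕ C (+ 2) ⊗ e ⊗ Z k ⊕ (C (+ 2) ⊕ Z 1 ⊕ z²) ⊗ s k)
    Y-b k = begin
      ⊝ κ ⊕ C (+ 2) ⊗ u ⊗ Z k ⊕ (C (+ 2) ⊗ u ⊕ κ) ⊗ s k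
        ≈⟨ ⊕-cong (⊕-cong ≋-refl (⊗-cong (⊗-cong ≋-refl u-fraction) ≋-refl)) (⊗-cong (⊕-cong (⊗-cong ≋-refl u-fraction) ≋-refl) ≋-refl) ⟩
      ⊝ κ ⊕ C (+ 2) ⊗ (e ⊗ b) ⊗ Z k ⊕ (C (+ 2) ⊗ (e ⊗ b) ⊕ κ) ⊗ s k
        ≈⟨ solve 4 (λ z b y t → let κ = (z :- z :* z) :* b ; e = con 1ℤ :+ z :* z in
             :- κ :+ con (+ 2) :* (e :* b) :* y :+ (con (+ 2) :* (e :* b) :+ κ) :* t :=
             b :* (z :* z :- z :+ con (+ 2) :* e :* y :+ (con (+ 2) :+ z :+ z :* z) :* t)) ≋-refl (Z 1) b (Z k) (s k) ⟩
      b ⊗ (z² ⊕ ⊝ Z 1 ⊕ C (+ 2) ⊗ e ⊗ Z k ⊕ (C (+ 2) ⊕ Z 1 ⊕ z²) ⊗ s k) ∎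

    -- The permanent of a cycle of length suc k with one vertex of degree 3.

    lobe : ℕ → Series
    lobe k = (δ ⊕ ⊝ Z 1) ⊗ π (suc k) ⊕ (C 1ℤ ⊕ C 1ℤ) ⊗ (Z 1 ⊗ (Z 1 ⊗ π k ⊕ pow k))

    e-lobe : ∀ k → e ⊗ lobe k ≋ C 1ℤ ⊕ z² ⊕ ⊝ Z 1 ⊕ (C 1ℤ ⊕ z² ⊕ Z 1) ⊗ s (suc k) ⊕ C (+ 2) ⊗ e ⊗ Z (suc k)
    e-lobe k = begin
      e ⊗ lobe k
        ≈⟨ solve 4 (λ z p q y → let e = con 1ℤ :+ z :* z ; d = con 1ℤ :- z :* z :- z in
             e :* (d :* p :+ (con 1ℤ :+ con 1ℤ) :* (z :* (z :* q :+ y))) :=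
             d :* (e :* p) :+ con (+ 2) :* (z :* z :* (e :* q)) :+ con (+ 2) :* e :* (z :* y)) ≋-refl (Z 1) (π (suc k)) (π k) (pow k) ⟩
      (δ ⊕ ⊝ Z 1) ⊗ (e ⊗ π (suc k)) ⊕ C (+ 2) ⊗ (z² ⊗ (e ⊗ π k)) ⊕ C (+ 2) ⊗ e ⊗ pow (suc k)
        ≈⟨ ⊕-cong (⊕-cong (⊗-cong ≋-refl (e-π (suc k))) (⊗-cong ≋-refl (⊗-cong ≋-refl (e-π k)))) (⊗-cong ≋-refl (pow-Z (suc k))) ⟩
      (δ ⊕ ⊝ Z 1) ⊗ (C 1ℤ ⊕ ⊝ s (suc k)) ⊕ C (+ 2) ⊗ (z² ⊗ (C 1ℤ ⊕ ⊝ s k)) ⊕ C (+ 2) ⊗ e ⊗ Z (suc k)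
        ≈⟨ solve 3 (λ z t y → let d = con 1ℤ :- z :* z :- z ; t′ = :- (z :* z :* t) in
             d :* (con 1ℤ :- t′) :+ con (+ 2) :* (z :* z :* (con 1ℤ :- t)) :+ y :=
             con 1ℤ :+ z :* z :- z :+ (con 1ℤ :+ z :* z :+ z) :* t′ :+ y) ≋-refl (Z 1) (s k) (C (+ 2) ⊗ e ⊗ Z (suc k)) ⟩
      C 1ℤ ⊕ z² ⊕ ⊝ Z 1 ⊕ (C 1ℤ ⊕ z² ⊕ Z 1) ⊗ s (suc k) ⊕ C (+ 2) ⊗ e ⊗ Z (suc k) ∎

    X-lobe : ∀ k → X (suc k) ≋ b ⊗ (e ⊗ lobe k ⊕ z² ⊗ (e ⊗ π (suc k)))
    X-lobe k = ≋-trans (X-b (suc k)) (⊗-cong ≋-refl (begin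
      B ⊕ C (+ 2) ⊗ e ⊗ Z (suc k) ⊕ (C 1ℤ ⊕ Z 1) ⊗ s (suc k)
        ≈⟨ solve 3 (λ z y t → con 1ℤ :- z :+ con (+ 2) :* (z :* z) :+ y :+ (con 1ℤ :+ z) :* t :=
             con 1ℤ :+ z :* z :- z :+ (con 1ℤ :+ z :* z :+ z) :* t :+ y :+ z :* z :* (con 1ℤ :- t)) ≋-refl (Z 1) (C (+ 2) ⊗ e ⊗ Z (suc k)) (s (suc k)) ⟩
      C 1ℤ ⊕ z² ⊕ ⊝ Z 1 ⊕ (C 1ℤ ⊕ z² ⊕ Z 1) ⊗ s (suc k) ⊕ C (+ 2) ⊗ e ⊗ Z (suc k) ⊕ z² ⊗ (C 1ℤ ⊕ ⊝ s (suc k))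
        ≈⟨ ⊕-cong (e-lobe k) (⊗-cong ≋-refl (e-π (suc k))) ⟨
      e ⊗ lobe k ⊕ z² ⊗ (e ⊗ π (suc k)) ∎))

    Y-lobe : ∀ k → Y (suc k) ≋ b ⊗ (e ⊗ lobe k ⊕ ⊝ (e ⊗ π (suc k)))
    Y-lobe k = ≋-trans (Y-b (suc k)) (⊗-cong ≋-refl (begin
      z² ⊕ ⊝ Z 1 ⊕ C (+ 2) ⊗ e ⊗ Z (suc k) ⊕ (C (+ 2) ⊕ Z 1 ⊕ z²) ⊗ s (suc k)
        ≈⟨ solve 3 (λ z y t → z :* z :- z :+ y :+ (con (+ 2) :+ z :+ z :* z) :* t :=
             con 1ℤ :+ z :* z :- z :+ (con 1ℤ :+ z :* z :+ z) :* t :+ y :- (con 1ℤ :- t)) ≋-refl (Z 1) (C (+ 2) ⊗ e ⊗ Z (suc k)) (s (suc k)) ⟩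
      C 1ℤ ⊕ z² ⊕ ⊝ Z 1 ⊕ (C 1ℤ ⊕ z² ⊕ Z 1) ⊗ s (suc k) ⊕ C (+ 2) ⊗ e ⊗ Z (suc k) ⊕ ⊝ (C 1ℤ ⊕ ⊝ s (suc k))
        ≈⟨ ⊕-cong (e-lobe k) (⊝-cong (e-π (suc k))) ⟨
      e ⊗ lobe k ⊕ ⊝ (e ⊗ π (suc k)) ∎))

  Δ-dumbbell : ∀ {x y α β γ} → Dumbbell x y α β γ → 2 ≤ length α → 2 ≤ length γ → degree G x ≡ 3 → degree G y ≡ 3 →
    (∀ {t} → t ∈ α ++ β ++ γ → degree G t ≡ 2) →
    e ⊗ u ⊗ u ⊗ P (x ∷ α ++ β ++ y ∷ γ) ≋ Δ (suc (length α)) (suc (length γ)) (suc (length β))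
  Δ-dumbbell {x} {y} {α} {β} {γ} dumbbell 2≤α 2≤γ dx dy d = begin
    e ⊗ u ⊗ u ⊗ P (x ∷ α ++ β ++ y ∷ γ)
      ≈⟨ ⊗-cong (⊗-cong (⊗-cong ≋-refl u-fraction) u-fraction) (P-dumbbell dumbbell dα dβ) ⟩
    e ⊗ (e ⊗ b) ⊗ (e ⊗ b) ⊗ (P (x ∷ α) ⊗ rec (P γ) (P (y ∷ γ)) (suc l) ⊕ z² ⊗ P α ⊗ rec (P γ) (P (y ∷ γ)) l)
      ≈⟨ ⊗-cong ≋-refl (⊕-cong (⊗-cong Pα (rec-cong Pγ′ Pγ (suc l))) (⊗-cong (⊗-cong ≋-refl Pα′) (rec-cong Pγ′ Pγ l))) ⟩
    e ⊗ (e ⊗ b) ⊗ (e ⊗ b) ⊗ (lobe i ⊗ rec (π (suc j)) (lobe j) (suc l) ⊕ z² ⊗ π (suc i) ⊗ rec (π (suc j)) (lobe j) l)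
      ≈⟨ solve 7 (λ e b z p r q r′ → e :* (e :* b) :* (e :* b) :* (p :* r :+ z :* q :* r′) :=
           b :* b :* e :* ((e :* p) :* (e :* r) :+ z :* ((e :* q) :* (e :* r′)))) ≋-refl e b z² _ _ _ _ ⟩
    b ⊗ b ⊗ e ⊗ (A ⊗ (e ⊗ rec (π (suc j)) (lobe j) (suc l)) ⊕ z² ⊗ (p ⊗ (e ⊗ rec (π (suc j)) (lobe j) l)))
      ≈⟨ ⊗-cong ≋-refl (⊕-cong (⊗-cong ≋-refl (e-rec (π (suc j)) (lobe j) (suc l))) (⊗-cong ≋-refl (⊗-cong ≋-refl (e-rec (π (suc j)) (lobe j) l)))) ⟩
    b ⊗ b ⊗ e ⊗ (A ⊗ (lobe j ⊗ (C 1ℤ ⊕ ⊝ s (suc l)) ⊕ π (suc j) ⊗ (z² ⊕ s (suc l))) ⊕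
                 z² ⊗ (p ⊗ (lobe j ⊗ (C 1ℤ ⊕ ⊝ s l) ⊕ π (suc j) ⊗ (z² ⊕ s l))))
      ≈⟨ solve 8 (λ b e z A p A′ p′ t →
           b :* b :* e :* (A :* (A′ :* (con 1ℤ :- :- (z :* t)) :+ p′ :* (z :+ :- (z :* t))) :+
             z :* (p :* (A′ :* (con 1ℤ :- t) :+ p′ :* (z :+ t)))) :=
           b :* (A :+ z :* p) :* (b :* (e :* A′ :+ z :* (e :* p′))) :- :- (z :* t) :* (b :* (A :- p) :* (b :* (e :* A′ :- e :* p′))))
           ≋-refl b e z² A p (lobe j) (π (suc j)) (s l) ⟩
    b ⊗ (A ⊕ z² ⊗ p) ⊗ (b ⊗ (e ⊗ lobe j ⊕ z² ⊗ (e ⊗ π (suc j)))) ⊕ ⊝ (s (suc l) ⊗ (b ⊗ (A ⊕ ⊝ p) ⊗ (b ⊗ (e ⊗ lobe j ⊕ ⊝ (e ⊗ π (suc j))))))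
      ≈⟨ ⊕-cong (⊗-cong (X-lobe i) (X-lobe j)) (⊝-cong (⊗-cong ≋-refl (⊗-cong (Y-lobe i) (Y-lobe j)))) ⟨
    Δ (suc i) (suc j) (suc l) ∎
    where
    open Dumbbell dumbbell
    i = length α
    j = length γ
    l = length β
    A p : Series
    A = e ⊗ lobe i
    p = e ⊗ π (suc i)
    dα : ∀ {t} → t ∈ α → M t t ≋ δ
    dα t∈ = M-degree-2 (d (∈-++⁺ˡ t∈))
    dβ : ∀ {t} → t ∈ β → M t t ≋ δ
    dβ t∈ = M-degree-2 (d (∈-++⁺ʳ α (∈-++⁺ˡ t∈)))
    dγ : ∀ {t} → t ∈ γ → M t t ≋ δ
    dγ t∈ = M-degree-2 (d (∈-++⁺ʳ α (∈-++⁺ʳ β t∈)))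
    uqα : Unique (x ∷ α)
    uqα = Unique-++ˡ (x ∷ α) unique
    uqγ : Unique (y ∷ γ)
    uqγ = Unique-++ʳ β (Unique-++ʳ (x ∷ α) unique)
    Pα : P (x ∷ α) ≋ lobe i
    Pα = ≋-trans (P-closed 2≤α arc-α uqα dα) (⊕-cong (⊗-cong (M-degree-3 dx) ≋-refl) ≋-refl)
    Pα′ : P α ≋ π (suc i)
    Pα′ = P-path arc-α uqα dα
    Pγ : P (y ∷ γ) ≋ lobe j
    Pγ = ≋-trans (P-closed 2≤γ arc-γ uqγ dγ) (⊕-cong (⊗-cong (M-degree-3 dy) ≋-refl) ≋-refl)
    Pγ′ : P γ ≋ π (suc j)
    Pγ′ = P-path arc-γ uqγ dγ

  private
    Θ-b : ∀ i j k → Θ i j k ≋ b ⊗ b ⊗ (B ⊗ B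
      ⊕ ⊝ ((Z 1 ⊕ ⊝ z²) ⊗ (Z 1 ⊕ ⊝ z²) ⊗ (s i ⊕ s j ⊕ s k))
      ⊕ (C 1ℤ ⊕ Z 1) ⊗ (C 1ℤ ⊕ Z 1) ⊗ (s i ⊗ s j ⊕ s i ⊗ s k ⊕ s j ⊗ s k)
      ⊕ ⊝ ((C (+ 2) ⊕ Z 1 ⊕ z²) ⊗ (C (+ 2) ⊕ Z 1 ⊕ z²) ⊗ (s i ⊗ s j ⊗ s k))
      ⊕ C (+ 2) ⊗ (e ⊗ e) ⊗ (Z i ⊗ Z j ⊗ (C 1ℤ ⊕ ⊝ s k) ⊕ Z i ⊗ Z k ⊗ (C 1ℤ ⊕ ⊝ s j) ⊕ Z j ⊗ Z k ⊗ (C 1ℤ ⊕ ⊝ s i)))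
    Θ-b i j k = begin
      Θ i j k
        ≈⟨ ⊕-cong (⊕-cong (⊕-cong (⊕-cong one ≋-refl) (⊗-cong (⊗-cong v-b v-b) ≋-refl)) (⊝-cong (⊗-cong (⊗-cong w-b w-b) ≋-refl)))
             (⊗-cong (⊗-cong ≋-refl (⊗-cong u-fraction u-fraction)) ≋-refl) ⟩
      B ⊗ b ⊗ (B ⊗ b) ⊕ ⊝ (κ ⊗ κ ⊗ S₁) ⊕ (C 1ℤ ⊕ Z 1) ⊗ b ⊗ ((C 1ℤ ⊕ Z 1) ⊗ b) ⊗ S₂
        ⊕ ⊝ ((C (+ 2) ⊕ Z 1 ⊕ z²) ⊗ b ⊗ ((C (+ 2) ⊕ Z 1 ⊕ z²) ⊗ b) ⊗ S₃) ⊕ C (+ 2) ⊗ (e ⊗ b ⊗ (e ⊗ b)) ⊗ T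
        ≈⟨ solve 10 (λ B b f g h e S₁ S₂ S₃ T →
             B :* b :* (B :* b) :+ :- (f :* b :* (f :* b) :* S₁) :+ g :* b :* (g :* b) :* S₂ :+ :- (h :* b :* (h :* b) :* S₃) :+ con (+ 2) :* (e :* b :* (e :* b)) :* T :=
             b :* b :* (B :* B :+ :- (f :* f :* S₁) :+ g :* g :* S₂ :+ :- (h :* h :* S₃) :+ con (+ 2) :* (e :* e) :* T))
             ≋-refl B b (Z 1 ⊕ ⊝ z²) (C 1ℤ ⊕ Z 1) (C (+ 2) ⊕ Z 1 ⊕ z²) e S₁ S₂ S₃ T ⟩
      _ ∎
      where
      S₁ S₂ S₃ T : Series
      S₁ = s i ⊕ s j ⊕ s k
      S₂ = s i ⊗ s j ⊕ s i ⊗ s k ⊕ s j ⊗ s k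
      S₃ = s i ⊗ s j ⊗ s k
      T = Z i ⊗ Z j ⊗ (C 1ℤ ⊕ ⊝ s k) ⊕ Z i ⊗ Z k ⊗ (C 1ℤ ⊕ ⊝ s j) ⊕ Z j ⊗ Z k ⊗ (C 1ℤ ⊕ ⊝ s i)
      one : C 1ℤ ≋ B ⊗ b ⊗ (B ⊗ b)
      one = ≋-sym (≋-trans (⊗-cong b-inverse b-inverse) (solve 0 (con 1ℤ :* con 1ℤ := con 1ℤ) ≋-refl))
      v-b : v ≋ (C 1ℤ ⊕ Z 1) ⊗ b
      v-b = ≋-trans (⊕-cong (⊗-cong ≋-refl u-fraction) (⊝-cong (≋-sym b-inverse)))
        (solve 2 (λ z b → con (+ 2) :* ((con 1ℤ :+ z :* z) :* b) :- (con 1ℤ :- z :+ con (+ 2) :* (z :* z)) :* b := (con 1ℤ :+ z) :* b) ≋-refl (Z 1) b)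
      w-b : w ≋ (C (+ 2) ⊕ Z 1 ⊕ z²) ⊗ b
      w-b = ≋-trans (⊕-cong (⊗-cong ≋-refl u-fraction) ≋-refl)
        (solve 2 (λ z b → con (+ 2) :* ((con 1ℤ :+ z :* z) :* b) :+ (z :- z :* z) :* b := (con (+ 2) :+ z :+ z :* z) :* b) ≋-refl (Z 1) b)

    hub : Series → Series → Series
    hub sb sc = ((δ ⊕ ⊝ Z 1) ⊗ (C 1ℤ ⊕ ⊝ sc) ⊕ (z² ⊕ sc)) ⊗ (C 1ℤ ⊕ ⊝ sb) ⊕ (C 1ℤ ⊕ ⊝ sc) ⊗ (z² ⊕ sb)

    e³-sp : ∀ {x y} → degree G y ≡ 3 → ∀ k i j → e ⊗ e ⊗ e ⊗ sp {x} {y} k i j ≋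
      hub (s (suc i)) (s (suc j)) ⊗ (C 1ℤ ⊕ ⊝ s k) ⊕ (C 1ℤ ⊕ ⊝ s (suc i)) ⊗ (C 1ℤ ⊕ ⊝ s (suc j)) ⊗ (z² ⊕ s k)
    e³-sp {x} {y} dy k i j = begin
      e ⊗ e ⊗ e ⊗ sp {x} {y} k i j
        ≈⟨ solve 2 (λ e p → e :* e :* e :* p := e :* e :* (e :* p)) ≋-refl e _ ⟩
      e ⊗ e ⊗ (e ⊗ sp {x} {y} k i j)
        ≈⟨ ⊗-cong ≋-refl (e-rec _ R₁ k) ⟩
      e ⊗ e ⊗ (R₁ ⊗ (C 1ℤ ⊕ ⊝ s k) ⊕ π (suc i) ⊗ π (suc j) ⊗ (z² ⊕ s k))
        ≈⟨ solve 6 (λ e r p q x y → e :* e :* (r :* x :+ p :* q :* y) := e :* (e :* r) :* x :+ (e :* p) :* (e :* q) :* y) ≋-refl e R₁ _ _ _ _ ⟩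
      e ⊗ (e ⊗ R₁) ⊗ (C 1ℤ ⊕ ⊝ s k) ⊕ (e ⊗ π (suc i)) ⊗ (e ⊗ π (suc j)) ⊗ (z² ⊕ s k)
        ≈⟨ ⊕-cong (⊗-cong e²-hub ≋-refl) (⊗-cong (⊗-cong (e-π (suc i)) (e-π (suc j))) ≋-refl) ⟩
      hub (s (suc i)) (s (suc j)) ⊗ (C 1ℤ ⊕ ⊝ s k) ⊕ (C 1ℤ ⊕ ⊝ s (suc i)) ⊗ (C 1ℤ ⊕ ⊝ s (suc j)) ⊗ (z² ⊕ s k) ∎
      where
      R₂ R₁ : Series
      R₂ = rec (C 1ℤ) (M y y) (suc j)
      R₁ = rec (π (suc j)) R₂ (suc i)
      e²-hub : e ⊗ (e ⊗ R₁) ≋ hub (s (suc i)) (s (suc j))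
      e²-hub = begin
        e ⊗ (e ⊗ R₁)
          ≈⟨ ⊗-cong ≋-refl (e-rec (π (suc j)) R₂ (suc i)) ⟩
        e ⊗ (R₂ ⊗ (C 1ℤ ⊕ ⊝ s (suc i)) ⊕ π (suc j) ⊗ (z² ⊕ s (suc i)))
          ≈⟨ solve 5 (λ e r x p y → e :* (r :* x :+ p :* y) := (e :* r) :* x :+ (e :* p) :* y) ≋-refl e R₂ _ _ _ ⟩
        (e ⊗ R₂) ⊗ (C 1ℤ ⊕ ⊝ s (suc i)) ⊕ (e ⊗ π (suc j)) ⊗ (z² ⊕ s (suc i))
          ≈⟨ ⊕-cong (⊗-cong (≋-trans (e-rec (C 1ℤ) (M y y) (suc j)) (⊕-cong (⊗-cong (M-degree-3 dy) ≋-refl)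
               (solve 1 (λ t → con 1ℤ :* t := t) ≋-refl (z² ⊕ s (suc j))))) ≋-refl) (⊗-cong (e-π (suc j)) ≋-refl) ⟩
        hub (s (suc i)) (s (suc j)) ∎

    z²e³-sp : ∀ {x y} → degree G y ≡ 3 → ∀ k i j → e ⊗ e ⊗ e ⊗ (z² ⊗ sp {x} {y} k i j) ≋
      hub (s (suc i)) (s (suc j)) ⊗ (z² ⊕ s (suc k)) ⊕ (C 1ℤ ⊕ ⊝ s (suc i)) ⊗ (C 1ℤ ⊕ ⊝ s (suc j)) ⊗ (z² ⊗ z² ⊕ ⊝ s (suc k))
    z²e³-sp {x} {y} dy k i j = begin
      e ⊗ e ⊗ e ⊗ (z² ⊗ sp {x} {y} k i j)
        ≈⟨ solve 3 (λ e y p → e :* e :* e :* (y :* p) := y :* (e :* e :* e :* p)) ≋-refl e z² _ ⟩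
      z² ⊗ (e ⊗ e ⊗ e ⊗ sp {x} {y} k i j)
        ≈⟨ ⊗-cong ≋-refl (e³-sp {x} {y} dy k i j) ⟩
      z² ⊗ (hub (s (suc i)) (s (suc j)) ⊗ (C 1ℤ ⊕ ⊝ s k) ⊕ (C 1ℤ ⊕ ⊝ s (suc i)) ⊗ (C 1ℤ ⊕ ⊝ s (suc j)) ⊗ (z² ⊕ s k))
        ≈⟨ solve 4 (λ y h g t → y :* (h :* (con 1ℤ :- t) :+ g :* (y :+ t)) := h :* (y :+ :- (y :* t)) :+ g :* (y :* y :- :- (y :* t))) ≋-refl z² _ _ (s k) ⟩
      hub (s (suc i)) (s (suc j)) ⊗ (z² ⊕ s (suc k)) ⊕ (C 1ℤ ⊕ ⊝ s (suc i)) ⊗ (C 1ℤ ⊕ ⊝ s (suc j)) ⊗ (z² ⊗ z² ⊕ ⊝ s (suc k)) ∎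

    e-qv : ∀ {x y} k i j → e ⊗ (Z 1 ⊗ (pow k ⊗ qv {x} {y} i j)) ≋
      Z (suc k) ⊗ (Z (suc i) ⊗ (C 1ℤ ⊕ ⊝ s (suc j)) ⊕ Z (suc j) ⊗ (C 1ℤ ⊕ ⊝ s (suc i)))
    e-qv k i j = begin
      e ⊗ (Z 1 ⊗ (pow k ⊗ (pow (suc i) ⊗ π (suc j) ⊕ pow (suc j) ⊗ π (suc i))))
        ≈⟨ solve 7 (λ e z p x q y r → e :* (z :* (p :* (x :* q :+ y :* r))) := z :* p :* (x :* (e :* q) :+ y :* (e :* r))) ≋-refl e (Z 1) _ _ _ _ _ ⟩
      pow (suc k) ⊗ (pow (suc i) ⊗ (e ⊗ π (suc j)) ⊕ pow (suc j) ⊗ (e ⊗ π (suc i)))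
        ≈⟨ ⊗-cong (pow-Z (suc k)) (⊕-cong (⊗-cong (pow-Z (suc i)) (e-π (suc j))) (⊗-cong (pow-Z (suc j)) (e-π (suc i)))) ⟩
      Z (suc k) ⊗ (Z (suc i) ⊗ (C 1ℤ ⊕ ⊝ s (suc j)) ⊕ Z (suc j) ⊗ (C 1ℤ ⊕ ⊝ s (suc i))) ∎

    hub-identity : ∀ sa sb sc →
      (δ ⊕ ⊝ Z 1) ⊗ (hub sb sc ⊗ (C 1ℤ ⊕ ⊝ sa) ⊕ (C 1ℤ ⊕ ⊝ sb) ⊗ (C 1ℤ ⊕ ⊝ sc) ⊗ (z² ⊕ sa)) ⊕
      ((hub sb sc ⊗ (z² ⊕ sa) ⊕ (C 1ℤ ⊕ ⊝ sb) ⊗ (C 1ℤ ⊕ ⊝ sc) ⊗ (z² ⊗ z² ⊕ ⊝ sa)) ⊕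
       (hub sa sc ⊗ (z² ⊕ sb) ⊕ (C 1ℤ ⊕ ⊝ sa) ⊗ (C 1ℤ ⊕ ⊝ sc) ⊗ (z² ⊗ z² ⊕ ⊝ sb)) ⊕
       (hub sa sb ⊗ (z² ⊕ sc) ⊕ (C 1ℤ ⊕ ⊝ sa) ⊗ (C 1ℤ ⊕ ⊝ sb) ⊗ (z² ⊗ z² ⊕ ⊝ sc))) ≋
      B ⊗ B ⊕ ⊝ ((Z 1 ⊕ ⊝ z²) ⊗ (Z 1 ⊕ ⊝ z²) ⊗ (sa ⊕ sb ⊕ sc))
      ⊕ (C 1ℤ ⊕ Z 1) ⊗ (C 1ℤ ⊕ Z 1) ⊗ (sa ⊗ sb ⊕ sa ⊗ sc ⊕ sb ⊗ sc)
      ⊕ ⊝ ((C (+ 2) ⊕ Z 1 ⊕ z²) ⊗ (C (+ 2) ⊕ Z 1 ⊕ z²) ⊗ (sa ⊗ sb ⊗ sc))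
    hub-identity sa sb sc = solve 4 (λ z a b c →
      let y = z :* z ; D = con 1ℤ :- y :- z ; ¬_ = λ t → con 1ℤ :- t
          B = con 1ℤ :- z :+ con (+ 2) :* y
          H = λ b c → (D :* ¬ c :+ (y :+ c)) :* ¬ b :+ ¬ c :* (y :+ b) in
      D :* (H b c :* ¬ a :+ ¬ b :* ¬ c :* (y :+ a)) :+
        ((H b c :* (y :+ a) :+ ¬ b :* ¬ c :* (y :* y :- a)) :+ (H a c :* (y :+ b) :+ ¬ a :* ¬ c :* (y :* y :- b)) :+
         (H a b :* (y :+ c) :+ ¬ a :* ¬ b :* (y :* y :- c))) :=
      B :* B :+ :- ((z :- y) :* (z :- y) :* (a :+ b :+ c)) :+ (con 1ℤ :+ z) :* (con 1ℤ :+ z) :* (a :* b :+ a :* c :+ b :* c)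
        :+ :- ((con (+ 2) :+ z :+ y) :* (con (+ 2) :+ z :+ y) :* (a :* b :* c))) ≋-refl (Z 1) sa sb sc

  Θ-theta : ∀ {x y xs ys zs} → 0 < length ys → 0 < length zs → Theta x y xs ys zs → degree G x ≡ 3 → degree G y ≡ 3 →
    (∀ {t} → t ∈ xs ++ ys ++ zs → degree G t ≡ 2) →
    e ⊗ u ⊗ u ⊗ P (x ∷ y ∷ xs ++ ys ++ zs) ≋ Θ (suc (length xs)) (suc (length ys)) (suc (length zs))
  Θ-theta {x} {y} {xs} {ys} {zs} 0<b 0<c theta dx dy d = begin
    e ⊗ u ⊗ u ⊗ P (x ∷ y ∷ xs ++ ys ++ zs)
      ≈⟨ ⊗-cong (⊗-cong (⊗-cong ≋-refl u-fraction) u-fraction) (≋-trans (P-theta 0<b 0<c theta (M-degree-2 ∘ d))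
           (⊕-cong (⊗-cong (M-degree-3 dx) ≋-refl) ≋-refl)) ⟩
    e ⊗ (e ⊗ b) ⊗ (e ⊗ b) ⊗ ((δ ⊕ ⊝ Z 1) ⊗ sp {x} {y} (suc i) j k ⊕
      (Z 1 ⊗ (Z 1 ⊗ sp {x} {y} i j k ⊕ q₁) ⊕ (Z 1 ⊗ (Z 1 ⊗ sp {x} {y} j i k ⊕ q₂) ⊕ Z 1 ⊗ (Z 1 ⊗ sp {x} {y} k i j ⊕ q₃))))
      ≈⟨ solve 11 (λ e b z D p p₁ q₁ p₂ q₂ p₃ q₃ → let E = e :* e :* e ; y = z :* z in
           e :* (e :* b) :* (e :* b) :* (D :* p :+ (z :* (z :* p₁ :+ q₁) :+ (z :* (z :* p₂ :+ q₂) :+ z :* (z :* p₃ :+ q₃)))) :=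
           b :* b :* (D :* (E :* p) :+ (E :* (y :* p₁) :+ E :* (y :* p₂) :+ E :* (y :* p₃)) :+
             (e :* e) :* (e :* (z :* q₁) :+ e :* (z :* q₂) :+ e :* (z :* q₃)))) ≋-refl e b (Z 1) (δ ⊕ ⊝ Z 1) _ _ q₁ _ q₂ _ q₃ ⟩
    b ⊗ b ⊗ ((δ ⊕ ⊝ Z 1) ⊗ (e ⊗ e ⊗ e ⊗ sp {x} {y} (suc i) j k) ⊕
      (e ⊗ e ⊗ e ⊗ (z² ⊗ sp {x} {y} i j k) ⊕ e ⊗ e ⊗ e ⊗ (z² ⊗ sp {x} {y} j i k) ⊕ e ⊗ e ⊗ e ⊗ (z² ⊗ sp {x} {y} k i j)) ⊕
      (e ⊗ e) ⊗ (e ⊗ (Z 1 ⊗ q₁) ⊕ e ⊗ (Z 1 ⊗ q₂) ⊕ e ⊗ (Z 1 ⊗ q₃)))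
      ≈⟨ ⊗-cong ≋-refl (⊕-cong
           (≋-trans (⊕-cong (⊗-cong ≋-refl (e³-sp {x} {y} dy (suc i) j k))
             (⊕-cong (⊕-cong (z²e³-sp {x} {y} dy i j k) (z²e³-sp {x} {y} dy j i k)) (z²e³-sp {x} {y} dy k i j)))
             (hub-identity (s (suc i)) (s (suc j)) (s (suc k))))
           (⊗-cong ≋-refl (⊕-cong (⊕-cong (e-qv {x} {y} i j k) (e-qv {x} {y} j i k)) (e-qv {x} {y} k i j)))) ⟩
    b ⊗ b ⊗ (_ ⊕ (e ⊗ e) ⊗ (Z (suc i) ⊗ (Z (suc j) ⊗ co k ⊕ Z (suc k) ⊗ co j) ⊕ Z (suc j) ⊗ (Z (suc i) ⊗ co k ⊕ Z (suc k) ⊗ co i) ⊕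
      Z (suc k) ⊗ (Z (suc i) ⊗ co j ⊕ Z (suc j) ⊗ co i)))
      ≈⟨ ⊗-cong ≋-refl (⊕-cong ≋-refl (solve 7 (λ E x y z p q r →
           E :* (x :* (y :* r :+ z :* q) :+ y :* (x :* r :+ z :* p) :+ z :* (x :* q :+ y :* p)) :=
           con (+ 2) :* E :* (x :* y :* r :+ x :* z :* q :+ y :* z :* p)) ≋-refl (e ⊗ e) (Z (suc i)) (Z (suc j)) (Z (suc k)) (co i) (co j) (co k))) ⟩
    b ⊗ b ⊗ (_ ⊕ C (+ 2) ⊗ (e ⊗ e) ⊗ (Z (suc i) ⊗ Z (suc j) ⊗ co k ⊕ Z (suc i) ⊗ Z (suc k) ⊗ co j ⊕ Z (suc j) ⊗ Z (suc k) ⊗ co i))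
      ≈⟨ Θ-b (suc i) (suc j) (suc k) ⟨
    Θ (suc i) (suc j) (suc k) ∎
    where
    i = length xs
    j = length ys
    k = length zs
    co : ℕ → Series
    co l = C 1ℤ ⊕ ⊝ s (suc l)
    q₁ q₂ q₃ : Series
    q₁ = pow i ⊗ qv {x} {y} j k
    q₂ = pow j ⊗ qv {x} {y} i k
    q₃ = pow k ⊗ qv {x} {y} i j

-- Degrees

∑ : ∀ {A : Set} → (A → ℤ) → List A → ℤ
∑ f []       = 0ℤ
∑ f (x ∷ xs) = f x ℤ.+ ∑ f xs

∑-cong : ∀ {A : Set} {f g : A → ℤ} xs → (∀ {x} → x ∈ xs → f x ≡ g x) → ∑ f xs ≡ ∑ g xs
∑-cong []       h = refl
∑-cong (x ∷ xs) h = cong₂ ℤ._+_ (h (here refl)) (∑-cong xs (h ∘ there))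

∑-+ : ∀ {A : Set} (f g : A → ℤ) xs → ∑ (λ x → f x ℤ.+ g x) xs ≡ ∑ f xs ℤ.+ ∑ g xs
∑-+ f g []       = refl
∑-+ f g (x ∷ xs) = trans (cong (λ t → f x ℤ.+ g x ℤ.+ t) (∑-+ f g xs)) (lemma (f x) (g x) _ _)
  where
  lemma : ∀ a b c d → a ℤ.+ b ℤ.+ (c ℤ.+ d) ≡ a ℤ.+ c ℤ.+ (b ℤ.+ d)
  lemma = ℤ-Solver.solve-∀

∑-0 : ∀ {A : Set} (xs : List A) → ∑ (λ _ → 0ℤ) xs ≡ 0ℤ
∑-0 []       = refl
∑-0 (x ∷ xs) = trans (ℤ.+-identityˡ _) (∑-0 xs)

∑-++ : ∀ {A : Set} (f : A → ℤ) xs ys → ∑ f (xs ++ ys) ≡ ∑ f xs ℤ.+ ∑ f ys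
∑-++ f []       ys = sym (ℤ.+-identityˡ _)
∑-++ f (x ∷ xs) ys = trans (cong (λ t → f x ℤ.+ t) (∑-++ f xs ys)) (sym (ℤ.+-assoc (f x) _ _))

∑-↭ : ∀ {A : Set} (f : A → ℤ) {xs ys} → xs ↭ ys → ∑ f xs ≡ ∑ f ys
∑-↭ f Perm.refl         = refl
∑-↭ f (Perm.prep x p)   = cong (λ t → f x ℤ.+ t) (∑-↭ f p)
∑-↭ f (Perm.swap x y p) = trans (cong (λ t → f x ℤ.+ (f y ℤ.+ t)) (∑-↭ f p)) (lemma (f x) (f y) _)
  where
  lemma : ∀ a b c → a ℤ.+ (b ℤ.+ c) ≡ b ℤ.+ (a ℤ.+ c)
  lemma = ℤ-Solver.solve-∀
∑-↭ f (Perm.trans p q)  = trans (∑-↭ f p) (∑-↭ f q)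

∑-nonneg-zero : ∀ {A : Set} (f : A → ℤ) → (∀ x → 0ℤ ℤ.≤ f x) → ∀ xs → 0ℤ ℤ.≤ ∑ f xs × (∑ f xs ≡ 0ℤ → ∀ {x} → x ∈ xs → f x ≡ 0ℤ)
∑-nonneg-zero f h []       = ℤ.≤-refl , λ _ ()
∑-nonneg-zero f h (x ∷ xs) = ℤ.+-mono-≤ (h x) (proj₁ IH) , λ e → λ
  { (here refl) → ℤ.≤-antisym (subst (f x ℤ.≤_) e (subst (ℤ._≤ f x ℤ.+ ∑ f xs) (ℤ.+-identityʳ _) (ℤ.+-monoʳ-≤ (f x) (proj₁ IH)))) (h x)
  ; (there x∈)  → proj₂ IH (ℤ.≤-antisym (subst (∑ f xs ℤ.≤_) e (subst (ℤ._≤ f x ℤ.+ ∑ f xs) (ℤ.+-identityˡ _) (ℤ.+-monoˡ-≤ (∑ f xs) (h x)))) (proj₁ IH)) x∈ }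
  where IH = ∑-nonneg-zero f h xs

extract : ∀ {A : Set} {x : A} {xs} → x ∈ xs → ∃ λ ys → xs ↭ x ∷ ys
extract x∈ with ∈-∃++ x∈
... | ys , zs , refl = ys ++ zs , Perm.shift _ ys zs

complement : ∀ {A : Set} (xs : List A) {ys} → Unique xs → (∀ {x} → x ∈ xs → x ∈ ys) → ∃ λ zs → ys ↭ xs ++ zs
complement []       {ys} u h = ys , ↭-refl
complement (x ∷ xs) {ys} u h with extract (h (here refl))
... | ys′ , p with complement xs {ys′} (Unique-tail u) (λ y∈ → drop-x (λ { refl → ∉-Unique u y∈ }) (Perm.∈-resp-↭ p (h (there y∈))))
  where
  drop-x : ∀ {y} → y ≢ x → y ∈ x ∷ ys′ → y ∈ ys′
  drop-x y≢x (here y≡x) = contradiction y≡x y≢x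
  drop-x y≢x (there y∈) = y∈
... | zs , q = zs , ↭-trans p (↭-prep x q)

same-members : ∀ {A : Set} {xs ys : List A} → Unique xs → Unique ys → (∀ {x} → x ∈ xs → x ∈ ys) → (∀ {x} → x ∈ ys → x ∈ xs) → xs ↭ ys
same-members {xs = xs} ux uy h k with complement xs ux h
... | []     , p = ↭-sym (subst (_ ↭_) (List.++-identityʳ xs) p)
... | z ∷ zs , p = contradiction (here refl) (Unique-disjoint xs (Unique-resp-↭ p uy) (k (Perm.∈-resp-↭ (↭-sym p) (∈-++⁺ʳ xs (here refl)))))

subset-full : ∀ {A : Set} {xs ys : List A} → Unique xs → (∀ {x} → x ∈ xs → x ∈ ys) → length ys ≡ length xs → ∀ {y} → y ∈ ys → y ∈ xs
subset-full {xs = xs} {ys} ux h len y∈ with complement xs ux h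
... | []     , p = subst (_ ∈_) (List.++-identityʳ xs) (Perm.∈-resp-↭ p y∈)
... | z ∷ zs , p = contradiction (trans (sym len) (trans (Perm.↭-length p) (List.length-++ xs))) (ℕ.m≢1+m+n (length xs) ∘ λ q → trans q (ℕ.+-suc (length xs) (length zs)))

module Degrees {n : ℕ} (G : Graph n) where

  neighbourList : Fin n → List (Fin n)
  neighbourList i = filter (λ j → adj G i j Data.Bool.Properties.≟ true) (allFin n)

  degree-length : ∀ i → degree G i ≡ length (neighbourList i)
  degree-length i = go n id
    where
    go : ∀ k (g : Fin k → Fin n) → ∣ Data.Vec.Base.tabulate (adj G i ∘ g) ∣ ≡
         length (filter (λ j → adj G i j Data.Bool.Properties.≟ true) (List.tabulate g))
    go zero    g = refl
    go (suc k) g with adj G i (g zero)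
    ... | true  = cong suc (go k (g ∘ suc))
    ... | false = go k (g ∘ suc)

  neighbours-unique : ∀ i → Unique (neighbourList i)
  neighbours-unique i = Unique.filter⁺ _ (Unique.allFin⁺ n)

  ∈-neighbours : ∀ {i j} → adj G i j ≡ true → j ∈ neighbourList i
  ∈-neighbours {j = j} p = ∈-filter⁺ _ (∈-allFin j) p

  neighbours-∈ : ∀ {i j} → j ∈ neighbourList i → adj G i j ≡ true
  neighbours-∈ {i} j∈ = proj₂ (∈-filter⁻ (λ j → adj G i j Data.Bool.Properties.≟ true) {xs = allFin n} j∈)

  degree-from-list : ∀ i ys → Unique ys → (∀ {y} → y ∈ ys → adj G i y ≡ true) → (∀ {y} → adj G i y ≡ true → y ∈ ys) → degree G i ≡ length ys
  degree-from-list i ys uq h k = trans (degree-length i)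
    (Perm.↭-length (same-members (neighbours-unique i) uq (k ∘ neighbours-∈) (∈-neighbours ∘ h)))

  row-sum : ∀ i xs → ∑ (λ j → adjacency G i j) xs ≡ + length (filter (λ j → adj G i j Data.Bool.Properties.≟ true) xs)
  row-sum i []       = refl
  row-sum i (x ∷ xs) with adj G i x
  ... | true  = cong (λ t → 1ℤ ℤ.+ t) (row-sum i xs)
  ... | false = trans (ℤ.+-identityˡ _) (row-sum i xs)

module LowCoefficients {n : ℕ} (G : Graph n) where
  open GraphSeries 3 G
  open Truncated exact 3
  open Degrees G

  deficit : Fin n → ℤ
  deficit i = + 2 ℤ.- + degree G i

  private
    expand-closed : (Pr : Series → Set) → Pr (C 0ℤ) → (∀ {f g} → Pr f → Pr g → Pr (f ⊕ g)) →
      ∀ {f} cs → (∀ c ds → c ∷ ds ↭ cs → Pr (f c ds)) → Pr (expand f cs)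
    expand-closed Pr p0 p+ []       h = p0
    expand-closed Pr p0 p+ (x ∷ cs) h = p+ (h x cs ↭-refl)
      (expand-closed Pr p0 p+ cs λ c ds p → h c (x ∷ ds) (↭-trans (↭-swap c x ↭-refl) (↭-prep x p)))

    expand-sum : ∀ k {f} g cs → (∀ c ds → c ∷ ds ↭ cs → f c ds ‼ k ≡ g c) → expand f cs ‼ k ≡ ∑ g cs
    expand-sum zero    g []       h = refl
    expand-sum (suc k) g []       h = refl
    expand-sum k       g (x ∷ cs) h = cong₂ ℤ._+_ (h x cs ↭-refl)
      (expand-sum k g cs λ c ds p → h c (x ∷ ds) (↭-trans (↭-swap c x ↭-refl) (↭-prep x p)))

    off-0 : ∀ {i j} → i ≢ j → M i j ‼ 0 ≡ 0ℤ × M i j ‼ 1 ≡ adjacency G i j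
    off-0 {i} {j} i≢j = go (adj G i j) refl
      where
      go : ∀ t → adj G i j ≡ t → M i j ‼ 0 ≡ 0ℤ × M i j ‼ 1 ≡ (if t then 1ℤ else 0ℤ)
      go true  eq = at (M-edge eq) 0 (s≤s z≤n) , at (M-edge eq) 1 (s≤s (s≤s z≤n))
      go false eq = at zero-entry 0 (s≤s z≤n) , at zero-entry 1 (s≤s (s≤s z≤n))
        where
        zero-entry : M i j ≋ C 0ℤ
        zero-entry = M-none i≢j λ p → contradiction (trans (sym eq) p) λ ()

    diagonal : ∀ i → M i i ‼ 0 ≡ 1ℤ × M i i ‼ 1 ≡ deficit i × M i i ‼ 2 ≡ ℤ.-1ℤ
    diagonal i = trans (at (M-diagonal i) 0 (s≤s z≤n)) (lemma₀ dg) , trans (at (M-diagonal i) 1 (s≤s (s≤s z≤n))) (lemma₁ dg) ,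
      trans (at (M-diagonal i) 2 (s≤s (s≤s (s≤s z≤n)))) (lemma₂ dg)
      where
      dg = + degree G i
      lemma₀ : ∀ d → U ‼ 0 ℤ.+ ℤ.- (d ℤ.* 0ℤ) ≡ 1ℤ
      lemma₀ = ℤ-Solver.solve-∀
      lemma₁ : ∀ d → U ‼ 1 ℤ.+ ℤ.- (d ℤ.* 1ℤ ℤ.+ 0ℤ ℤ.* 0ℤ) ≡ + 2 ℤ.- d
      lemma₁ = ℤ-Solver.solve-∀
      lemma₂ : ∀ d → U ‼ 2 ℤ.+ ℤ.- (d ℤ.* 0ℤ ℤ.+ (0ℤ ℤ.* 1ℤ ℤ.+ 0ℤ ℤ.* 0ℤ)) ≡ ℤ.-1ℤ
      lemma₂ = ℤ-Solver.solve-∀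

    absent-column : ∀ x r rs cs → length rs ≡ length cs → x ∉ r ∷ rs → perm (r ∷ rs) (x ∷ cs) ‼ 0 ≡ 0ℤ
    absent-column x r []       []  len x∉ rewrite proj₁ (off-0 {r} {x} λ { refl → x∉ (here refl) }) = refl
    absent-column x r (t ∷ rs) cs  len x∉ = cong₂ ℤ._+_
      (cong (ℤ._* (perm (t ∷ rs) cs ‼ 0)) (proj₁ (off-0 {r} {x} λ { refl → x∉ (here refl) })))
      (expand-closed (λ f → f ‼ 0 ≡ 0ℤ) refl (λ p q → cong₂ ℤ._+_ p q) cs λ c ds p → trans
        (cong (λ t → M r c ‼ 0 ℤ.* t) (absent-column x t rs ds (ℕ.suc-injective (trans len (sym (Perm.↭-length p)))) (x∉ ∘ there)))
        (ℤ.*-zeroʳ (M r c ‼ 0)))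

    adjacency-sym : ∀ i j → adjacency G i j ℤ.* adjacency G j i ≡ adjacency G i j
    adjacency-sym i j rewrite symmetric G j i with adj G i j
    ... | true  = refl
    ... | false = refl

  P-0 : ∀ W → Unique W → P W ‼ 0 ≡ 1ℤ
  P-0 []      uq = refl
  P-0 (x ∷ W) uq = cong₂ ℤ._+_ (cong₂ ℤ._*_ (proj₁ (diagonal x)) (P-0 W (Unique-tail uq)))
    (expand-closed (λ f → f ‼ 0 ≡ 0ℤ) refl (λ p q → cong₂ ℤ._+_ p q) W λ c ds p →
      cong (ℤ._* (perm W (x ∷ ds) ‼ 0)) (proj₁ (off-0 {x} {c} λ { refl → ∉-Unique uq (Perm.∈-resp-↭ p (here refl)) })))

  private
    Q-low : ∀ x c ds → Unique (x ∷ c ∷ ds) → Q c x ds ‼ 0 ≡ 0ℤ × Q c x ds ‼ 1 ≡ adjacency G c x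
    Q-low x c ds uq = absent-column x c ds ds refl (∉-Unique uq) , trans
      (cong₂ ℤ._+_ (cong₂ (λ s t → s ℤ.* P ds ‼ 1 ℤ.+ t) (proj₁ (off-0 c≢x)) (cong₂ ℤ._*_ (proj₂ (off-0 c≢x)) (P-0 ds (Unique-tail (Unique-tail uq)))))
        (expand-closed (λ f → f ‼ 1 ≡ 0ℤ) refl (λ p q → cong₂ ℤ._+_ p q) ds λ c′ ds′ p →
          trans (cong₂ (λ s t → s ℤ.* perm ds (x ∷ ds′) ‼ 1 ℤ.+ M c c′ ‼ 1 ℤ.* t)
            (proj₁ (off-0 {c} {c′} λ { refl → ∉-Unique (Unique-tail uq) (Perm.∈-resp-↭ p (here refl)) }))
            (column ds ds′ p (λ x∈ → ∉-Unique uq (there x∈))))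
          (lemma₁ (perm ds (x ∷ ds′) ‼ 1) (M c c′ ‼ 1))))
      (lemma₂ (P ds ‼ 1) (adjacency G c x))
      where
      c≢x : c ≢ x
      c≢x refl = ∉-Unique uq (here refl)
      column : ∀ ds {c′} ds′ → c′ ∷ ds′ ↭ ds → x ∉ ds → perm ds (x ∷ ds′) ‼ 0 ≡ 0ℤ
      column []       ds′ p x∉ = contradiction (Perm.↭-length p) λ ()
      column (t ∷ ds) ds′ p x∉ = absent-column x t ds ds′ (ℕ.suc-injective (sym (Perm.↭-length p))) x∉
      lemma₁ : ∀ a b → 0ℤ ℤ.* a ℤ.+ b ℤ.* 0ℤ ≡ 0ℤ
      lemma₁ = ℤ-Solver.solve-∀
      lemma₂ : ∀ a b → 0ℤ ℤ.* a ℤ.+ b ℤ.* 1ℤ ℤ.+ 0ℤ ≡ b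
      lemma₂ = ℤ-Solver.solve-∀

    terms : ∀ x W → Unique (x ∷ W) → ∀ c ds → c ∷ ds ↭ W →
      (M x c ⊗ perm W (x ∷ ds)) ‼ 1 ≡ 0ℤ × (M x c ⊗ perm W (x ∷ ds)) ‼ 2 ≡ adjacency G x c
    terms x W uq c ds p =
      trans (cong₂ (λ s t → s ℤ.* perm W (x ∷ ds) ‼ 1 ℤ.+ M x c ‼ 1 ℤ.* t) (proj₁ off) q0) (lemma₁ (perm W (x ∷ ds) ‼ 1) (M x c ‼ 1)) ,
      trans (cong₂ (λ s t → s ℤ.* perm W (x ∷ ds) ‼ 2 ℤ.+ (M x c ‼ 1 ℤ.* perm W (x ∷ ds) ‼ 1 ℤ.+ M x c ‼ 2 ℤ.* t)) (proj₁ off) q0)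
      (trans (cong₂ (λ s t → 0ℤ ℤ.* perm W (x ∷ ds) ‼ 2 ℤ.+ (s ℤ.* t ℤ.+ M x c ‼ 2 ℤ.* 0ℤ)) (proj₂ off) q1)
      (trans (lemma₂ (perm W (x ∷ ds) ‼ 2) _ (M x c ‼ 2)) (adjacency-sym x c)))
      where
      uq′ : Unique (x ∷ c ∷ ds)
      uq′ = Unique-resp-↭ (↭-prep x (↭-sym p)) uq
      off = off-0 {x} {c} λ { refl → ∉-Unique uq′ (here refl) }
      q≋ : perm W (x ∷ ds) ≋ Q c x ds
      q≋ = perm-rows (↭-sym p) (x ∷ ds)
      q0 : perm W (x ∷ ds) ‼ 0 ≡ 0ℤ
      q0 = trans (at q≋ 0 (s≤s z≤n)) (proj₁ (Q-low x c ds uq′))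
      q1 : perm W (x ∷ ds) ‼ 1 ≡ adjacency G c x
      q1 = trans (at q≋ 1 (s≤s (s≤s z≤n))) (proj₂ (Q-low x c ds uq′))
      lemma₁ : ∀ a b → 0ℤ ℤ.* a ℤ.+ b ℤ.* 0ℤ ≡ 0ℤ
      lemma₁ = ℤ-Solver.solve-∀
      lemma₂ : ∀ a b c → 0ℤ ℤ.* a ℤ.+ (b ℤ.+ c ℤ.* 0ℤ) ≡ b
      lemma₂ = ℤ-Solver.solve-∀

  P-1 : ∀ W → Unique W → P W ‼ 1 ≡ ∑ deficit W
  P-1 []      uq = refl
  P-1 (x ∷ W) uq = trans
    (cong₂ ℤ._+_
      (cong₂ ℤ._+_ (cong₂ ℤ._*_ (proj₁ (diagonal x)) (P-1 W (Unique-tail uq))) (cong₂ ℤ._*_ (proj₁ (proj₂ (diagonal x))) (P-0 W (Unique-tail uq))))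
      (expand-closed (λ f → f ‼ 1 ≡ 0ℤ) refl (λ p q → cong₂ ℤ._+_ p q) W λ c ds p → proj₁ (terms x W uq c ds p)))
    (lemma (deficit x) (∑ deficit W))
    where
    lemma : ∀ a b → 1ℤ ℤ.* b ℤ.+ a ℤ.* 1ℤ ℤ.+ 0ℤ ≡ a ℤ.+ b
    lemma = ℤ-Solver.solve-∀

  P-2 : ∀ x W → Unique (x ∷ W) → P (x ∷ W) ‼ 2 ≡ P W ‼ 2 ℤ.+ deficit x ℤ.* ∑ deficit W ℤ.- 1ℤ ℤ.+ ∑ (adjacency G x) W
  P-2 x W uq = trans
    (cong₂ ℤ._+_
      (cong₂ ℤ._+_ (cong (ℤ._* (P W ‼ 2)) (proj₁ (diagonal x))) (cong₂ ℤ._+_ (cong₂ ℤ._*_ (proj₁ (proj₂ (diagonal x))) (P-1 W (Unique-tail uq)))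
        (cong₂ ℤ._*_ (proj₂ (proj₂ (diagonal x))) (P-0 W (Unique-tail uq)))))
      (expand-sum 2 (adjacency G x) W λ c ds p → proj₂ (terms x W uq c ds p)))
    (lemma (P W ‼ 2) _ _)
    where
    lemma : ∀ a b c → 1ℤ ℤ.* a ℤ.+ (b ℤ.+ ℤ.-1ℤ ℤ.* 1ℤ) ℤ.+ c ≡ a ℤ.+ b ℤ.- 1ℤ ℤ.+ c
    lemma = ℤ-Solver.solve-∀

  twice-P-2 : ∀ W → Unique W → P W ‼ 2 ℤ.+ P W ‼ 2 ℤ.+ ∑ (λ x → deficit x ℤ.* deficit x) W ℤ.+ ∑ (λ _ → + 2) W ≡
    ∑ deficit W ℤ.* ∑ deficit W ℤ.+ ∑ (λ x → ∑ (adjacency G x) W) W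
  twice-P-2 []      uq = refl
  twice-P-2 (x ∷ W) uq = begin
    P (x ∷ W) ‼ 2 ℤ.+ P (x ∷ W) ‼ 2 ℤ.+ (a ℤ.* a ℤ.+ S) ℤ.+ (+ 2 ℤ.+ T)
      ≡⟨ cong (λ t → t ℤ.+ t ℤ.+ (a ℤ.* a ℤ.+ S) ℤ.+ (+ 2 ℤ.+ T)) (P-2 x W uq) ⟩
    (p ℤ.+ a ℤ.* E ℤ.- 1ℤ ℤ.+ r) ℤ.+ (p ℤ.+ a ℤ.* E ℤ.- 1ℤ ℤ.+ r) ℤ.+ (a ℤ.* a ℤ.+ S) ℤ.+ (+ 2 ℤ.+ T)
      ≡⟨ lemma₁ p a E r S T ⟩
    (p ℤ.+ p ℤ.+ S ℤ.+ T) ℤ.+ (a ℤ.* E ℤ.+ a ℤ.* E ℤ.+ a ℤ.* a ℤ.+ r ℤ.+ r)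
      ≡⟨ cong (λ t → t ℤ.+ (a ℤ.* E ℤ.+ a ℤ.* E ℤ.+ a ℤ.* a ℤ.+ r ℤ.+ r)) (twice-P-2 W (Unique-tail uq)) ⟩
    E ℤ.* E ℤ.+ N ℤ.+ (a ℤ.* E ℤ.+ a ℤ.* E ℤ.+ a ℤ.* a ℤ.+ r ℤ.+ r)
      ≡⟨ lemma₂ E N a r ⟩
    (a ℤ.+ E) ℤ.* (a ℤ.+ E) ℤ.+ (0ℤ ℤ.+ r ℤ.+ (r ℤ.+ N))
      ≡⟨ cong₂ (λ s t → (a ℤ.+ E) ℤ.* (a ℤ.+ E) ℤ.+ (s ℤ.+ r ℤ.+ t)) (sym diag0) (trans (cong (λ t → t ℤ.+ N) col) (sym (∑-+ (λ y → adjacency G y x) (λ y → ∑ (adjacency G y) W) W))) ⟩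
    (a ℤ.+ E) ℤ.* (a ℤ.+ E) ℤ.+ (adjacency G x x ℤ.+ r ℤ.+ ∑ (λ y → ∑ (adjacency G y) (x ∷ W)) W) ∎
    where
    open ≡-Reasoning
    a = deficit x
    p = P W ‼ 2
    E = ∑ deficit W
    S = ∑ (λ x → deficit x ℤ.* deficit x) W
    T = ∑ (λ _ → + 2) W
    r = ∑ (adjacency G x) W
    N = ∑ (λ y → ∑ (adjacency G y) W) W
    diag0 : adjacency G x x ≡ 0ℤ
    diag0 rewrite irreflexive G x = refl
    col : r ≡ ∑ (λ y → adjacency G y x) W
    col = ∑-cong W λ {y} _ → cong (λ t → if t then 1ℤ else 0ℤ) (symmetric G x y)
    lemma₁ : ∀ p a E r S T → (p ℤ.+ a ℤ.* E ℤ.- 1ℤ ℤ.+ r) ℤ.+ (p ℤ.+ a ℤ.* E ℤ.- 1ℤ ℤ.+ r) ℤ.+ (a ℤ.* a ℤ.+ S) ℤ.+ (+ 2 ℤ.+ T) ≡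
      (p ℤ.+ p ℤ.+ S ℤ.+ T) ℤ.+ (a ℤ.* E ℤ.+ a ℤ.* E ℤ.+ a ℤ.* a ℤ.+ r ℤ.+ r)
    lemma₁ = ℤ-Solver.solve-∀
    lemma₂ : ∀ E N a r → E ℤ.* E ℤ.+ N ℤ.+ (a ℤ.* E ℤ.+ a ℤ.* E ℤ.+ a ℤ.* a ℤ.+ r ℤ.+ r) ≡
      (a ℤ.+ E) ℤ.* (a ℤ.+ E) ℤ.+ (0ℤ ℤ.+ r ℤ.+ (r ℤ.+ N))
    lemma₂ = ℤ-Solver.solve-∀

  charSeries-0 : charSeries ‼ 0 ≡ 1ℤ
  charSeries-0 = trans (at charSeries-P 0 (s≤s z≤n)) (P-0 (allFin n) (Unique.allFin⁺ n))

  charSeries-1 : charSeries ‼ 1 ≡ ∑ deficit (allFin n)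
  charSeries-1 = trans (at charSeries-P 1 (s≤s (s≤s z≤n))) (P-1 (allFin n) (Unique.allFin⁺ n))

  charSeries-2 : charSeries ‼ 2 ℤ.+ charSeries ‼ 2 ℤ.+ ∑ (λ x → deficit x ℤ.* deficit x) (allFin n) ≡
    ∑ deficit (allFin n) ℤ.* ∑ deficit (allFin n) ℤ.- ∑ deficit (allFin n)
  charSeries-2 = trans (cong (λ t → t ℤ.+ t ℤ.+ S) (at charSeries-P 2 (s≤s (s≤s (s≤s z≤n)))))
    (lemma (P (allFin n) ‼ 2) S E (∑ (λ x → + degree G x) (allFin n)) (trans (twice-P-2 (allFin n) (Unique.allFin⁺ n)) (cong (λ t → E ℤ.* E ℤ.+ t) sums)) (∑-+ deficit (λ x → + degree G x) (allFin n)))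
    where
    E = ∑ deficit (allFin n)
    S = ∑ (λ x → deficit x ℤ.* deficit x) (allFin n)
    sums : ∑ (λ x → ∑ (adjacency G x) (allFin n)) (allFin n) ≡ ∑ (λ x → + degree G x) (allFin n)
    sums = ∑-cong (allFin n) λ {x} _ → trans (row-sum x (allFin n)) (cong +_ (sym (degree-length x)))
    two : ∑ (λ _ → + 2) (allFin n) ≡ ∑ (λ x → deficit x ℤ.+ + degree G x) (allFin n)
    two = ∑-cong (allFin n) λ {x} _ → eq (+ degree G x)
      where
      eq : ∀ d → + 2 ≡ + 2 ℤ.- d ℤ.+ d
      eq = ℤ-Solver.solve-∀
    lemma : ∀ p S E D → p ℤ.+ p ℤ.+ S ℤ.+ ∑ (λ _ → + 2) (allFin n) ≡ E ℤ.* E ℤ.+ D →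
      ∑ (λ x → deficit x ℤ.+ + degree G x) (allFin n) ≡ E ℤ.+ D → p ℤ.+ p ℤ.+ S ≡ E ℤ.* E ℤ.- E
    lemma p S E D h k = trans (eq₁ (p ℤ.+ p ℤ.+ S) (∑ (λ _ → + 2) (allFin n))) (trans (cong₂ ℤ._-_ h (trans two k)) (eq₂ E D))
      where
      eq₁ : ∀ a b → a ≡ a ℤ.+ b ℤ.- b
      eq₁ = ℤ-Solver.solve-∀
      eq₂ : ∀ E D → E ℤ.* E ℤ.+ D ℤ.- (E ℤ.+ D) ≡ E ℤ.* E ℤ.- E
      eq₂ = ℤ-Solver.solve-∀

  deficit-term : Fin n → ℤ
  deficit-term x = deficit x ℤ.* deficit x ℤ.+ deficit x

  private
    big-degree : ∀ k → (+ 2 ℤ.- + (4 + k)) ℤ.* (+ 2 ℤ.- + (4 + k)) ℤ.+ (+ 2 ℤ.- + (4 + k)) ≡ + ((2 + k) * (1 + k))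
    big-degree k = trans (lemma (+ k)) (sym (ℤ.pos-* (2 + k) (1 + k)))
      where
      lemma : ∀ x → (+ 2 ℤ.- (+ 4 ℤ.+ x)) ℤ.* (+ 2 ℤ.- (+ 4 ℤ.+ x)) ℤ.+ (+ 2 ℤ.- (+ 4 ℤ.+ x)) ≡ (+ 2 ℤ.+ x) ℤ.* (1ℤ ℤ.+ x)
      lemma = ℤ-Solver.solve-∀

    at-degree : ∀ d′ → let a = + 2 ℤ.- + d′ in 0ℤ ℤ.≤ a ℤ.* a ℤ.+ a × (a ℤ.* a ℤ.+ a ≡ 0ℤ → d′ ≡ 2 ⊎ d′ ≡ 3)
    at-degree 0 = ℤ.+≤+ z≤n , λ ()
    at-degree 1 = ℤ.+≤+ z≤n , λ ()
    at-degree 2 = ℤ.+≤+ z≤n , λ _ → inj₁ refl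
    at-degree 3 = ℤ.+≤+ z≤n , λ _ → inj₂ refl
    at-degree (suc (suc (suc (suc k)))) = subst (0ℤ ℤ.≤_) (sym (big-degree k)) (ℤ.+≤+ z≤n) ,
      λ p → contradiction (trans (sym (big-degree k)) p) λ ()

  degrees-2-3 : ∑ (λ x → deficit x ℤ.* deficit x) (allFin n) ℤ.+ ∑ deficit (allFin n) ≡ 0ℤ → ∀ x → degree G x ≡ 2 ⊎ degree G x ≡ 3
  degrees-2-3 p x = proj₂ (at-degree (degree G x)) (proj₂ (∑-nonneg-zero deficit-term (λ x → proj₁ (at-degree (degree G x))) (allFin n))
    (trans (∑-+ (λ x → deficit x ℤ.* deficit x) deficit (allFin n)) p) (∈-allFin x))

  cubic : List (Fin n) → List (Fin n)
  cubic = filter (λ x → degree G x ℕ.≟ 3)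

  ∑-deficit : (∀ x → degree G x ≡ 2 ⊎ degree G x ≡ 3) → ∀ xs → ∑ deficit xs ≡ ℤ.- + length (cubic xs)
  ∑-deficit h []       = refl
  ∑-deficit h (x ∷ xs) with degree G x ℕ.≟ 3
  ... | yes p = trans (cong₂ (λ s t → (+ 2 ℤ.- + s) ℤ.+ t) p (∑-deficit h xs))
    (trans (lemma (+ length (cubic xs))) (cong (λ ys → ℤ.- + length ys) (sym (List.filter-accept (λ x → degree G x ℕ.≟ 3) p))))
    where
    lemma : ∀ t → ℤ.-1ℤ ℤ.+ ℤ.- t ≡ ℤ.- (1ℤ ℤ.+ t)
    lemma = ℤ-Solver.solve-∀
  ... | no ¬p = trans (cong₂ (λ s t → (+ 2 ℤ.- + s) ℤ.+ t) ([ id , (λ p → contradiction p ¬p) ]′ (h x)) (∑-deficit h xs))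
    (trans (ℤ.+-identityˡ _) (cong (λ ys → ℤ.- + length ys) (sym (List.filter-reject (λ x → degree G x ℕ.≟ 3) ¬p))))

  two-cubic : (∀ x → degree G x ≡ 2 ⊎ degree G x ≡ 3) → ∑ deficit (allFin n) ≡ ℤ.- + 2 →
    ∃₂ λ x y → x ≢ y × degree G x ≡ 3 × degree G y ≡ 3 × (∀ t → t ≢ x → t ≢ y → degree G t ≡ 2)
  two-cubic h p = go (cubic (allFin n)) refl (ℤ.+-injective (ℤ.neg-injective (trans (sym (∑-deficit h (allFin n))) p)))
    where
    go : ∀ L → cubic (allFin n) ≡ L → length L ≡ 2 → ∃₂ λ x y → x ≢ y × degree G x ≡ 3 × degree G y ≡ 3 × (∀ t → t ≢ x → t ≢ y → degree G t ≡ 2)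
    go (x ∷ y ∷ []) eq _ = x , y , (λ { refl → ∉-Unique (subst Unique eq (Unique.filter⁺ _ (Unique.allFin⁺ n))) (here refl) }) ,
      member (here refl) , member (there (here refl)) , λ t t≢x t≢y → [ id , (λ q → contradiction (subst (t ∈_) eq (∈-filter⁺ (λ x → degree G x ℕ.≟ 3) (∈-allFin t) q))
        (λ { (here r) → t≢x r ; (there (here r)) → t≢y r })) ]′ (h t)
      where
      member : ∀ {t} → t ∈ x ∷ y ∷ [] → degree G t ≡ 3
      member t∈ = proj₂ (∈-filter⁻ (λ x → degree G x ℕ.≟ 3) {xs = allFin n} (subst (_ ∈_) (sym eq) t∈))
    go []              eq ()
    go (_ ∷ [])        eq ()
    go (_ ∷ _ ∷ _ ∷ _) eq ()

-- The component with the vertices of degree 3 and the free cycles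

module Decomposition {n : ℕ} (G : Graph n) where
  open GraphArcs G
  open Degrees G

  private
    V = Fin n

  degree-2-next : ∀ {x a} → degree G x ≡ 2 → x ∼ a → ∃ λ y → y ≢ a × x ∼ y × (∀ {t} → x ∼ t → t ≡ a ⊎ t ≡ y)
  degree-2-next {x} {a} deg x∼a = go (neighbourList x) (trans (sym (degree-length x)) deg) (neighbours-unique x) ∈-neighbours neighbours-∈
    where
    go : ∀ L → length L ≡ 2 → Unique L → (∀ {y} → x ∼ y → y ∈ L) → (∀ {y} → y ∈ L → x ∼ y) →
      ∃ λ y → y ≢ a × x ∼ y × (∀ {t} → x ∼ t → t ≡ a ⊎ t ≡ y)
    go (p ∷ q ∷ []) _ uq h k with h x∼a
    ... | here refl         = q , (λ { refl → ∉-Unique uq (here refl) }) , k (there (here refl)) ,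
      λ x∼t → [ inj₁ , inj₂ ]′ (two (h x∼t))
      where
      two : ∀ {t} → t ∈ p ∷ q ∷ [] → t ≡ p ⊎ t ≡ q
      two (here e)         = inj₁ e
      two (there (here e)) = inj₂ e
    ... | there (here refl) = p , (λ { refl → ∉-Unique uq (here refl) }) , k (here refl) ,
      λ x∼t → two (h x∼t)
      where
      two : ∀ {t} → t ∈ p ∷ q ∷ [] → t ≡ q ⊎ t ≡ p
      two (here e)         = inj₂ e
      two (there (here e)) = inj₁ e

  member? : ∀ (x : V) xs → Dec (x ∈ xs)
  member? x xs = Any.any? (x Fin.≟_) xs

  last∈ : ∀ (xs : List V) a → lastOf xs a ∈ xs ⊎ xs ≡ []
  last∈ []       a = inj₂ refl
  last∈ (x ∷ xs) a with last∈ xs x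
  ... | inj₁ l∈   = inj₁ (there l∈)
  ... | inj₂ refl = inj₁ (here refl)

  module Walk (T : V → Set) (T? : ∀ x → Dec (T x)) (degree-2 : ∀ {x} → ¬ T x → degree G x ≡ 2) where

    record Walk (F : List V) (a x : V) : Set where
      field
        {inner}  : List V
        {end}    : V
        end-T    : T end
        arc      : Arc a inner end
        start    : firstOf inner end ≡ x
        outside  : ∀ {w} → w ∈ inner → ¬ T w × w ∉ F
        distinct : Unique inner

    Closed : List V → Set
    Closed F = ∀ {w y} → w ∈ F → w ∼ y → y ∈ F ⊎ T y

    private
      -- F holds the vertices met so far, the last one being a unless a is in T.
      go : ∀ k (rem : List V) → length rem ≤ k → ∀ F a x → a ∼ x → (∀ y → y ∈ F ⊎ y ∈ rem) → a ∈ F ⊎ T a → (¬ T x → x ∉ F) →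
        (∀ {w y} → w ∈ F → w ≢ a → w ∼ y → y ∈ F ⊎ T y) → (∀ {y} → a ∈ F → a ∼ y → y ≡ x ⊎ y ∈ F ⊎ T y) → Walk F a x
      go k rem len F a x a∼x cover a∈ x∉ inv₁ inv₂ with T? x
      ... | yes Tx = record { end-T = Tx ; arc = edge a∼x ; start = refl ; outside = λ () ; distinct = [] }
      go zero    [] len F a x a∼x cover a∈ x∉ inv₁ inv₂ | no ¬Tx = contradiction ([ id , (λ ()) ]′ (cover x)) (x∉ ¬Tx)
      go (suc k) rem len F a x a∼x cover a∈ x∉ inv₁ inv₂ | no ¬Tx with degree-2-next (degree-2 ¬Tx) (∼-sym a∼x)
      ... | y , y≢a , x∼y , thin = record
        { end-T    = end-T
        ; arc      = step a∼x (λ x∼t → [ inj₁ , (λ t≡y → inj₂ (trans t≡y (sym start))) ]′ (thin x∼t)) arc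
        ; start    = refl
        ; outside  = λ { (here refl) → ¬Tx , x∉ ¬Tx ; (there w∈) → proj₁ (outside w∈) , proj₂ (outside w∈) ∘ there }
        ; distinct = Unique-∉ (λ x∈ → proj₂ (outside x∈) (here refl)) distinct
        }
        where
        rem′ : List V
        rem′ = filter (λ t → ¬? (t Fin.≟ x)) rem
        x∈rem : x ∈ rem
        x∈rem = [ (λ x∈ → contradiction x∈ (x∉ ¬Tx)) , id ]′ (cover x)
        shorter : length rem′ ≤ k
        shorter = ℕ.≤-pred (ℕ.≤-trans (List.filter-notAll (λ t → ¬? (t Fin.≟ x)) rem (Any.map (λ { refl ¬x≡x → ¬x≡x refl }) x∈rem)) len)
        cover′ : ∀ t → t ∈ x ∷ F ⊎ t ∈ rem′
        cover′ t with t Fin.≟ x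
        ... | yes refl = inj₁ (here refl)
        ... | no t≢x   = [ inj₁ ∘ there , (λ t∈ → inj₂ (∈-filter⁺ (λ t → ¬? (t Fin.≟ x)) t∈ t≢x)) ]′ (cover t)
        y∉ : ¬ T y → y ∉ x ∷ F
        y∉ ¬Ty (here refl) = ∼-irrefl x∼y
        y∉ ¬Ty (there y∈)  = [ x∉ ¬Tx , ¬Tx ]′ (inv₁ y∈ y≢a (∼-sym x∼y))
        inv₁′ : ∀ {w t} → w ∈ x ∷ F → w ≢ x → w ∼ t → t ∈ x ∷ F ⊎ T t
        inv₁′ (here refl) w≢x w∼t = contradiction refl w≢x
        inv₁′ {w} (there w∈) w≢x w∼t with w Fin.≟ a
        ... | yes refl = [ (λ { refl → inj₁ (here refl) }) , [ inj₁ ∘ there , inj₂ ]′ ]′ (inv₂ w∈ w∼t)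
        ... | no w≢a   = [ inj₁ ∘ there , inj₂ ]′ (inv₁ w∈ w≢a w∼t)
        inv₂′ : ∀ {t} → x ∈ x ∷ F → x ∼ t → t ≡ y ⊎ t ∈ x ∷ F ⊎ T t
        inv₂′ _ x∼t with thin x∼t
        ... | inj₁ refl = inj₂ ([ inj₁ ∘ there , inj₂ ]′ a∈)
        ... | inj₂ t≡y  = inj₁ t≡y
        open Walk (go k rem′ shorter (x ∷ F) x y x∼y cover′ (inj₁ (here refl)) y∉ inv₁′ inv₂′)

    walk : ∀ F a x → T a → a ∼ x → Closed F → a ∉ F → x ∉ F → Walk F a x
    walk F a x Ta a∼x closed a∉ x∉ = go (length (allFin n)) (allFin n) ℕ.≤-refl F a x a∼x (λ y → inj₂ (∈-allFin y)) (inj₂ Ta)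
      (λ _ → x∉) (λ w∈ _ → closed w∈) (λ a∈ → contradiction a∈ a∉)

    arc-Closed : ∀ {a xs b} → T a → T b → Arc a xs b → Closed xs
    arc-Closed Ta Tb arc w∈ w∼y with arc-closed arc w∈ w∼y
    ... | inj₁ refl        = inj₂ Ta
    ... | inj₂ (inj₁ y∈)   = inj₁ y∈
    ... | inj₂ (inj₂ refl) = inj₂ Tb

    Closed-++ : ∀ xs {ys} → Closed xs → Closed ys → Closed (xs ++ ys)
    Closed-++ xs cx cy w∈ w∼y = [ (λ w∈ → [ inj₁ ∘ ∈-++⁺ˡ , inj₂ ]′ (cx w∈ w∼y)) , (λ w∈ → [ inj₁ ∘ ∈-++⁺ʳ xs , inj₂ ]′ (cy w∈ w∼y)) ]′ (∈-++⁻ xs w∈)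

  closed-long : ∀ {a xs} → Arc a xs a → (∀ {x} → x ∈ xs → degree G x ≡ 2) → 2 ≤ length xs
  closed-long (edge e) d = contradiction e ∼-irrefl
  closed-long (step e thin (edge e′)) d with degree-2-next (d (here refl)) e′
  ... | y , y≢a , x∼y , _ = contradiction ([ id , id ]′ (thin x∼y)) y≢a
  closed-long (step _ _ (step _ _ _)) d = s≤s (s≤s z≤n)

  first≢last : ∀ {xs : List V} {a} → 2 ≤ length xs → Unique xs → firstOf xs a ≢ lastOf xs a
  first≢last {x ∷ xs} (s≤s 1≤) uq e with last∈ xs x
  ... | inj₁ l∈   = ∉-Unique uq (subst (_∈ xs) (sym e) l∈)
  ... | inj₂ refl = contradiction 1≤ λ ()

  module _ (u v : V) (u≢v : u ≢ v) (degree-u : degree G u ≡ 3) (degree-v : degree G v ≡ 3)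
           (degree-2 : ∀ t → t ≢ u → t ≢ v → degree G t ≡ 2) where

    private
      T : V → Set
      T x = x ≡ u ⊎ x ≡ v

      open Walk T (λ x → (x Fin.≟ u) ⊎-dec (x Fin.≟ v)) (λ {x} ¬T → degree-2 x (¬T ∘ inj₁) (¬T ∘ inj₂))

    data Main : Set where
      dumbbell : ∀ {x y α β γ} → Dumbbell x y α β γ → x ≡ u → y ≡ v → 2 ≤ length α → 2 ≤ length γ → Main
      theta    : ∀ {xs ys zs} → Theta u v xs ys zs → Main

    private
      third : ∀ {w x y} → degree G w ≡ 3 → x ≢ y → w ∼ x → w ∼ y → ∃ λ t → t ≢ x × t ≢ y × w ∼ t × (∀ {s} → w ∼ s → s ≡ x ⊎ s ≡ y ⊎ s ≡ t)
      third {w} {x} {y} deg x≢y w∼x w∼y with complement (x ∷ y ∷ []) (Unique-∉ (λ { (here e) → x≢y e }) (Unique-∉ (λ ()) [])) (λ { (here refl) → ∈-neighbours w∼x ; (there (here refl)) → ∈-neighbours w∼y })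
      ... | zs , p = go zs p (ℕ.suc-injective (ℕ.suc-injective (trans (sym (Perm.↭-length p)) (trans (sym (degree-length w)) deg))))
        where
        go : ∀ zs → neighbourList w ↭ x ∷ y ∷ zs → length zs ≡ 1 → ∃ λ t → t ≢ x × t ≢ y × w ∼ t × (∀ {s} → w ∼ s → s ≡ x ⊎ s ≡ y ⊎ s ≡ t)
        go (t ∷ []) p _ = t , (λ { refl → ∉-Unique uq (there (here refl)) }) , (λ { refl → ∉-Unique (Unique-tail uq) (here refl) }) ,
          neighbours-∈ (Perm.∈-resp-↭ (↭-sym p) (there (there (here refl)))) , λ w∼s → cases (Perm.∈-resp-↭ p (∈-neighbours w∼s))
          where
          uq : Unique (x ∷ y ∷ t ∷ [])
          uq = Unique-resp-↭ p (neighbours-unique w)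
          cases : ∀ {s} → s ∈ x ∷ y ∷ t ∷ [] → s ≡ x ⊎ s ≡ y ⊎ s ≡ t
          cases (here e)                 = inj₁ e
          cases (there (here e))         = inj₂ (inj₁ e)
          cases (there (there (here e))) = inj₂ (inj₂ e)

      d₂ : ∀ {x} → ¬ T x → degree G x ≡ 2
      d₂ {x} ¬T = degree-2 x (¬T ∘ inj₁) (¬T ∘ inj₂)

      end-in : ∀ {a xs b} → Arc a xs b → lastOf xs a ∈ xs ⊎ (xs ≡ [] × a ∼ b)
      end-in {a} {xs} arc with last∈ xs a
      ... | inj₁ l∈   = inj₁ l∈
      ... | inj₂ refl = inj₂ (refl , arc-last arc)

      first∈-closed : ∀ {a} {xs : List V} → 2 ≤ length xs → firstOf xs a ∈ xs
      first∈-closed {xs = x ∷ xs} _ = here refl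

      last∈-closed : ∀ {a} {xs : List V} → 2 ≤ length xs → lastOf xs a ∈ xs
      last∈-closed {a} {xs} 2≤ = [ id , (λ { refl → contradiction 2≤ λ () }) ]′ (last∈ xs a)

      two-others : ∀ {w m} → degree G w ≡ 3 → w ∼ m →
        ∃₂ λ s t → s ≢ m × t ≢ m × t ≢ s × w ∼ s × w ∼ t × (∀ {r} → w ∼ r → r ≡ m ⊎ r ≡ s ⊎ r ≡ t)
      two-others {w} {m} deg w∼m with complement (m ∷ []) (Unique-∉ (λ ()) []) (λ { (here refl) → ∈-neighbours w∼m })
      ... | zs , p = go zs p (ℕ.suc-injective (trans (sym (Perm.↭-length p)) (trans (sym (degree-length w)) deg)))
        where
        go : ∀ zs → neighbourList w ↭ m ∷ zs → length zs ≡ 2 →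
          ∃₂ λ s t → s ≢ m × t ≢ m × t ≢ s × w ∼ s × w ∼ t × (∀ {r} → w ∼ r → r ≡ m ⊎ r ≡ s ⊎ r ≡ t)
        go (s ∷ t ∷ []) p _ = s , t , (λ { refl → ∉-Unique uq (here refl) }) , (λ { refl → ∉-Unique uq (there (here refl)) }) ,
          (λ { refl → ∉-Unique (Unique-tail uq) (here refl) }) ,
          neighbours-∈ (Perm.∈-resp-↭ (↭-sym p) (there (here refl))) , neighbours-∈ (Perm.∈-resp-↭ (↭-sym p) (there (there (here refl)))) ,
          λ w∼r → cases (Perm.∈-resp-↭ p (∈-neighbours w∼r))
          where
          uq = Unique-resp-↭ p (neighbours-unique w)
          cases : ∀ {r} → r ∈ m ∷ s ∷ t ∷ [] → r ≡ m ⊎ r ≡ s ⊎ r ≡ t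
          cases (here e)                 = inj₁ e
          cases (there (here e))         = inj₂ (inj₁ e)
          cases (there (there (here e))) = inj₂ (inj₂ e)

      module FromClosed {α} (arc-α : Arc u α u) (outside-α : ∀ {w} → w ∈ α → ¬ T w) (uq-α : Unique α) where
        2≤α : 2 ≤ length α
        2≤α = closed-long arc-α (d₂ ∘ outside-α)

        u∉α : u ∉ α
        u∉α u∈ = outside-α u∈ (inj₁ refl)

        v∉α : v ∉ α
        v∉α v∈ = outside-α v∈ (inj₂ refl)

        closed-α : Closed α
        closed-α = arc-Closed (inj₁ refl) (inj₁ refl) arc-α

        module FromBridge {t β} (at-u : ∀ {s} → u ∼ s → s ≡ firstOf α u ⊎ s ≡ lastOf α u ⊎ s ≡ t)
          (arc-β : Arc u β v) (start : firstOf β v ≡ t) (outside-β : ∀ {w} → w ∈ β → ¬ T w × w ∉ α) (uq-β : Unique β) where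

          u∉β : u ∉ β
          u∉β u∈ = proj₁ (outside-β u∈) (inj₁ refl)

          v∉β : v ∉ β
          v∉β v∈ = proj₁ (outside-β v∈) (inj₂ refl)

          u-neighbour : ∀ {y} → u ∼ y → y ∈ α ⊎ y ≡ firstOf β v
          u-neighbour u∼y = [ (λ { refl → inj₁ (first∈-closed 2≤α) }) , [ (λ { refl → inj₁ (last∈-closed 2≤α) }) , (λ { refl → inj₂ (sym start) }) ]′ ]′ (at-u u∼y)

          back : ∀ {s γ} → s ≢ lastOf β u → Arc v γ u → firstOf γ u ≡ s → (∀ {w} → w ∈ γ → ¬ T w × w ∉ α ++ β) → ⊥
          back {γ = []} s≢m (edge v∼u) refl out with u-neighbour (∼-sym v∼u)
          ... | inj₁ v∈α = v∉α v∈α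
          ... | inj₂ e   = bridge-empty β v∉β e s≢m
            where
            bridge-empty : ∀ β → v ∉ β → v ≡ firstOf β v → u ≢ lastOf β u → ⊥
            bridge-empty []      _   _    u≢u = u≢u refl
            bridge-empty (y ∷ β) v∉β refl _   = v∉β (here refl)
          back {γ = y ∷ γ} s≢m arc st out with u-neighbour (∼-sym (arc-last arc))
          ... | inj₁ l∈α = proj₂ (out l∈) (∈-++⁺ˡ l∈α)
            where l∈ = [ id , (λ ()) ]′ (last∈ (y ∷ γ) v)
          ... | inj₂ e   = [ (λ f∈β → proj₂ (out l∈) (∈-++⁺ʳ α (subst (_∈ β) (sym e) f∈β))) , (λ f≡v → proj₁ (out l∈) (inj₂ (trans e f≡v))) ]′ (first∈ β v)
            where l∈ = [ id , (λ ()) ]′ (last∈ (y ∷ γ) v)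

          result : Main
          result with two-others degree-v (∼-sym (arc-last arc-β))
          ... | s , s′ , s≢m , s′≢m , s′≢s , v∼s , v∼s′ , at-v = finish (walk (α ++ β) v s (inj₂ refl) v∼s
                (Closed-++ α closed-α (arc-Closed (inj₁ refl) (inj₂ refl) arc-β))
                (λ v∈ → [ v∉α , v∉β ]′ (∈-++⁻ α v∈)) (λ s∈ → [ s∉α , s∉β ]′ (∈-++⁻ α s∈)))
            where
            s∉α : s ∉ α
            s∉α s∈ = [ (λ { (_ , e) → u≢v (sym e) }) , (λ { (_ , e) → u≢v (sym e) }) ]′ (arc-touch arc-α s∈ (∼-sym v∼s) v∉α)
            s∉β : s ∉ β
            s∉β s∈ = [ (λ { (_ , e) → u≢v (sym e) }) , (λ { (e , _) → s≢m e }) ]′ (arc-touch arc-β s∈ (∼-sym v∼s) v∉β)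
            finish : Walk (α ++ β) v s → Main
            finish record { end-T = inj₁ refl ; arc = arc-γ ; start = st ; outside = out } = ⊥-elim (back s≢m arc-γ st out)
            finish record { inner = γ ; end-T = inj₂ refl ; arc = arc-γ ; start = st ; outside = out ; distinct = uq-γ } = dumbbell
              record
                { arc-α = arc-α ; arc-β = arc-β ; arc-γ = arc-γ
                ; unique = Unique-∉ (λ u∈ → [ u∉α , (λ u∈ → [ u∉β , (λ { (here e) → u≢v e ; (there u∈) → proj₁ (out u∈) (inj₁ refl) }) ]′ (∈-++⁻ β u∈)) ]′ (∈-++⁻ α u∈))
                    (Unique.++⁺ uq-α (Unique.++⁺ uq-β (Unique-∉ (λ v∈ → proj₁ (out v∈) (inj₂ refl)) uq-γ)
                      (λ { (w∈ , here refl) → v∉β w∈ ; (w∈ , there w∈′) → proj₂ (out w∈′) (∈-++⁺ʳ α w∈) }))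
                      λ { (w∈ , w∈′) → [ (λ w∈β → proj₂ (outside-β w∈β) w∈) , (λ { (here refl) → v∉α w∈ ; (there w∈γ) → proj₂ (out w∈γ) (∈-++⁺ˡ w∈) }) ]′ (∈-++⁻ β w∈′) })
                ; at-u = u-neighbour
                ; at-v = λ v∼y → [ inj₂ , [ (λ { refl → inj₁ (subst (_∈ γ) st (first∈-closed 2≤γ)) }) , (λ { refl → inj₁ s′∈γ }) ]′ ]′ (at-v v∼y)
                } refl refl 2≤α 2≤γ
              where
              2≤γ : 2 ≤ length γ
              2≤γ = closed-long arc-γ (d₂ ∘ proj₁ ∘ out)
              l∈γ : lastOf γ v ∈ γ
              l∈γ = last∈-closed 2≤γ
              s′∈γ : s′ ∈ γ
              s′∈γ with at-v (∼-sym (arc-last arc-γ))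
              ... | inj₁ e        = contradiction (subst (_∈ γ) e l∈γ)
                (λ m∈ → [ (λ m∈β → proj₂ (out m∈) (∈-++⁺ʳ α m∈β)) , (λ { (β≡[] , _) → proj₁ (out m∈) (inj₁ (cong (λ b → lastOf b u) β≡[])) }) ]′ (end-in arc-β))
              ... | inj₂ (inj₁ e) = contradiction (trans st (sym e)) (first≢last 2≤γ uq-γ)
              ... | inj₂ (inj₂ e) = subst (_∈ γ) e l∈γ

        result : Main
        result with third degree-u (first≢last 2≤α uq-α) (arc-first arc-α) (∼-sym (arc-last arc-α))
        ... | t , t≢x , t≢l , u∼t , at-u = finish (walk α u t (inj₁ refl) u∼t closed-α u∉α t∉α)
          where
          t∉α : t ∉ α
          t∉α t∈ = [ (λ { (e , _) → t≢x e }) , (λ { (e , _) → t≢l e }) ]′ (arc-touch arc-α t∈ (∼-sym u∼t) u∉α)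
          finish : Walk α u t → Main
          finish record { inner = β ; end-T = inj₁ refl ; arc = arc-β ; start = start ; outside = outside-β ; distinct = uq-β } =
            ⊥-elim ([ (λ e → proj₂ (outside-β l∈) (subst (_∈ α) (sym e) (first∈-closed 2≤α)))
                    , [ (λ e → proj₂ (outside-β l∈) (subst (_∈ α) (sym e) (last∈-closed 2≤α)))
                      , (λ e → first≢last 2≤β uq-β (trans start (sym e))) ]′ ]′ (at-u (∼-sym (arc-last arc-β))))
            where
            2≤β = closed-long arc-β (d₂ ∘ proj₁ ∘ outside-β)
            l∈ : lastOf β u ∈ β
            l∈ = last∈-closed 2≤β
          finish record { end-T = inj₂ refl ; arc = arc-β ; start = start ; outside = outside-β ; distinct = uq-β } =
            FromBridge.result at-u arc-β start outside-β uq-β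

    module FromTheta {x₁ x₂ x₃ xs ys zs} (x₂≢x₁ : x₂ ≢ x₁) (x₃≢x₁ : x₃ ≢ x₁) (x₃≢x₂ : x₃ ≢ x₂)
      (at-u : ∀ {s} → u ∼ s → s ≡ x₁ ⊎ s ≡ x₂ ⊎ s ≡ x₃)
      (arc-xs : Arc u xs v) (arc-ys : Arc u ys v) (arc-zs : Arc u zs v)
      (st-xs : firstOf xs v ≡ x₁) (st-ys : firstOf ys v ≡ x₂) (st-zs : firstOf zs v ≡ x₃)
      (out-xs : ∀ {w} → w ∈ xs → ¬ T w) (out-ys : ∀ {w} → w ∈ ys → ¬ T w × w ∉ xs) (out-zs : ∀ {w} → w ∈ zs → ¬ T w × w ∉ xs ++ ys)
      (uq-xs : Unique xs) (uq-ys : Unique ys) (uq-zs : Unique zs) where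

      lasts-differ : ∀ {ps qs} → Arc u ps v → Arc u qs v → firstOf ps v ≢ firstOf qs v → (∀ {w} → w ∈ ps → ¬ T w) → (∀ {w} → w ∈ qs → ¬ T w × w ∉ ps) →
        lastOf ps u ≢ lastOf qs u
      lasts-differ {ps} {qs} arc arc′ f≢ out out′ e with end-in arc | end-in arc′
      ... | inj₁ l∈         | inj₁ l∈′         = proj₂ (out′ l∈′) (subst (_∈ ps) e l∈)
      ... | inj₁ l∈         | inj₂ (refl , _)  = out l∈ (inj₁ e)
      ... | inj₂ (refl , _) | inj₁ l∈′         = proj₁ (out′ l∈′) (inj₁ (sym e))
      ... | inj₂ (refl , _) | inj₂ (refl , _)  = f≢ refl

      result : Main
      result = theta record
        { arc-xs = arc-xs ; arc-ys = arc-ys ; arc-zs = arc-zs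
        ; unique = Unique-∉ (λ { (here e) → u≢v e ; (there u∈) → off (inj₁ refl) u∈ }) (Unique-∉ (off (inj₂ refl))
            (Unique.++⁺ uq-xs (Unique.++⁺ uq-ys uq-zs λ { (y∈ , z∈) → proj₂ (out-zs z∈) (∈-++⁺ʳ xs y∈) })
              λ { (x∈ , yz∈) → [ (λ y∈ → proj₂ (out-ys y∈) x∈) , (λ z∈ → proj₂ (out-zs z∈) (∈-++⁺ˡ x∈)) ]′ (∈-++⁻ ys yz∈) }))
        ; at-u = λ u∼y → [ (λ e → inj₁ (trans e (sym st-xs))) , [ (λ e → inj₂ (inj₁ (trans e (sym st-ys)))) , (λ e → inj₂ (inj₂ (trans e (sym st-zs)))) ]′ ]′ (at-u u∼y)
        ; at-v = λ v∼y → cases (subset-full uq-ends ends⊆ (trans (sym (degree-length v)) degree-v) (∈-neighbours v∼y))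
        }
        where
        off : ∀ {w} → T w → w ∉ xs ++ ys ++ zs
        off Tw w∈ = [ (λ w∈ → out-xs w∈ Tw) , (λ w∈ → [ (λ w∈ → proj₁ (out-ys w∈) Tw) , (λ w∈ → proj₁ (out-zs w∈) Tw) ]′ (∈-++⁻ ys w∈)) ]′ (∈-++⁻ xs w∈)
        ends : List V
        ends = lastOf xs u ∷ lastOf ys u ∷ lastOf zs u ∷ []
        f₁₂ : firstOf xs v ≢ firstOf ys v
        f₁₂ e = x₂≢x₁ (trans (sym st-ys) (trans (sym e) st-xs))
        f₁₃ : firstOf xs v ≢ firstOf zs v
        f₁₃ e = x₃≢x₁ (trans (sym st-zs) (trans (sym e) st-xs))
        f₂₃ : firstOf ys v ≢ firstOf zs v
        f₂₃ e = x₃≢x₂ (trans (sym st-zs) (trans (sym e) st-ys))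
        uq-ends : Unique ends
        uq-ends = Unique-∉ (λ { (here e) → lasts-differ arc-xs arc-ys f₁₂ out-xs out-ys e
                              ; (there (here e)) → lasts-differ arc-xs arc-zs f₁₃ out-xs (λ z∈ → proj₁ (out-zs z∈) , proj₂ (out-zs z∈) ∘ ∈-++⁺ˡ) e })
          (Unique-∉ (λ { (here e) → lasts-differ arc-ys arc-zs f₂₃ (proj₁ ∘ out-ys) (λ z∈ → proj₁ (out-zs z∈) , proj₂ (out-zs z∈) ∘ ∈-++⁺ʳ xs) e })
            (Unique-∉ (λ ()) []))
        ends⊆ : ∀ {y} → y ∈ ends → y ∈ neighbourList v
        ends⊆ (here refl)                 = ∈-neighbours (∼-sym (arc-last arc-xs))
        ends⊆ (there (here refl))         = ∈-neighbours (∼-sym (arc-last arc-ys))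
        ends⊆ (there (there (here refl))) = ∈-neighbours (∼-sym (arc-last arc-zs))
        cases : ∀ {y} → y ∈ ends → y ≡ lastOf xs u ⊎ y ≡ lastOf ys u ⊎ y ≡ lastOf zs u
        cases (here e)                 = inj₁ e
        cases (there (here e))         = inj₂ (inj₁ e)
        cases (there (there (here e))) = inj₂ (inj₂ e)

    main : Main
    main with some-neighbour
      where
      some-neighbour : ∃ λ x → u ∼ x
      some-neighbour with neighbourList u in eq | trans (sym (degree-length u)) degree-u
      ... | x ∷ _ | _ = x , neighbours-∈ (subst (x ∈_) (sym eq) (here refl))
    ... | x₁ , u∼x₁ with two-others degree-u u∼x₁
    ...   | x₂ , x₃ , x₂≢x₁ , x₃≢x₁ , x₃≢x₂ , u∼x₂ , u∼x₃ , at-u = after₁ (walk [] u x₁ (inj₁ refl) u∼x₁ (λ ()) (λ ()) (λ ()))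
      where
      off : ∀ {x y xs} → Arc u xs v → firstOf xs v ≡ x → (∀ {w} → w ∈ xs → ¬ T w) → y ≢ x → u ∼ y → y ∉ xs
      off arc st out y≢x u∼y y∈ = [ (λ { (e , _) → y≢x (trans e st) }) , (λ { (_ , e) → u≢v e }) ]′
        (arc-touch arc y∈ (∼-sym u∼y) (λ u∈ → out u∈ (inj₁ refl)))
      after₁ : Walk [] u x₁ → Main
      after₁ record { end-T = inj₁ refl ; arc = arc ; outside = out ; distinct = uq } = FromClosed.result arc (proj₁ ∘ out) uq
      after₁ record { inner = xs ; end-T = inj₂ refl ; arc = arc ; start = st ; outside = out ; distinct = uq } =
        after₂ (walk xs u x₂ (inj₁ refl) u∼x₂ (arc-Closed (inj₁ refl) (inj₂ refl) arc) (λ u∈ → proj₁ (out u∈) (inj₁ refl)) (off arc st (proj₁ ∘ out) x₂≢x₁ u∼x₂))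
        where
        after₂ : Walk xs u x₂ → Main
        after₂ record { end-T = inj₁ refl ; arc = arc′ ; outside = out′ ; distinct = uq′ } = FromClosed.result arc′ (proj₁ ∘ out′) uq′
        after₂ record { inner = ys ; end-T = inj₂ refl ; arc = arc′ ; start = st′ ; outside = out′ ; distinct = uq′ } =
          after₃ (walk (xs ++ ys) u x₃ (inj₁ refl) u∼x₃
            (Closed-++ xs (arc-Closed (inj₁ refl) (inj₂ refl) arc) (arc-Closed (inj₁ refl) (inj₂ refl) arc′))
            (λ u∈ → [ (λ u∈ → proj₁ (out u∈) (inj₁ refl)) , (λ u∈ → proj₁ (out′ u∈) (inj₁ refl)) ]′ (∈-++⁻ xs u∈))
            (λ x∈ → [ off arc st (proj₁ ∘ out) x₃≢x₁ u∼x₃ , off arc′ st′ (proj₁ ∘ out′) x₃≢x₂ u∼x₃ ]′ (∈-++⁻ xs x∈)))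
          where
          after₃ : Walk (xs ++ ys) u x₃ → Main
          after₃ record { end-T = inj₁ refl ; arc = arc″ ; outside = out″ ; distinct = uq″ } = FromClosed.result arc″ (proj₁ ∘ out″) uq″
          after₃ record { end-T = inj₂ refl ; arc = arc″ ; start = st″ ; outside = out″ ; distinct = uq″ } =
            FromTheta.result x₂≢x₁ x₃≢x₁ x₃≢x₂ at-u arc arc′ arc″ st st′ st″ (proj₁ ∘ out) out′ out″ uq uq′ uq″

  Saturated : List V → Set
  Saturated F = ∀ {w y} → w ∈ F → w ∼ y → y ∈ F

  data FreeCycles (F : List V) : Set where
    done : (∀ x → x ∈ F) → FreeCycles F
    more : ∀ x xs → Arc x xs x → 2 ≤ length xs → Unique (x ∷ xs) → (∀ {y} → y ∈ x ∷ xs → y ∉ F × degree G y ≡ 2) →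
      FreeCycles (x ∷ xs ++ F) → FreeCycles F

  cycleLengths : ∀ {F} → FreeCycles F → List ℕ
  cycleLengths (done _)               = []
  cycleLengths (more x xs _ _ _ _ fc) = suc (length xs) ∷ cycleLengths fc

  free-cycles : ∀ F → Unique F → Saturated F → (∀ {x} → x ∉ F → degree G x ≡ 2) → FreeCycles F
  free-cycles F uq sat d = go n F uq sat d (proj₁ rest) (proj₂ rest)
      (ℕ.≤-trans (ℕ.m≤n+m _ (length F)) (ℕ.≤-reflexive (trans (sym (trans (Perm.↭-length (proj₂ rest)) (List.length-++ F))) (List.length-tabulate {n = n} id))))
    where
    rest = complement F uq (λ {x} _ → ∈-allFin x)
    go : ∀ k F → Unique F → Saturated F → (∀ {x} → x ∉ F → degree G x ≡ 2) → ∀ zs → allFin n ↭ F ++ zs → length zs ≤ k → FreeCycles F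
    go k F uq sat d [] p len = done λ x → subst (x ∈_) (List.++-identityʳ F) (Perm.∈-resp-↭ p (∈-allFin x))
    go (suc k) F uq sat d (a ∷ zs) p (s≤s len) = from (neighbourList a) refl (trans (sym (degree-length a)) (d a∉F))
      where
      a∉F : a ∉ F
      a∉F a∈ = Unique-disjoint F (Unique-resp-↭ p (Unique.allFin⁺ n)) a∈ (here refl)
      T′ : V → Set
      T′ x = x ≡ a ⊎ x ∈ F
      open Walk T′ (λ x → (x Fin.≟ a) ⊎-dec member? x F) (λ ¬T → d (¬T ∘ inj₂))
      from : ∀ L → neighbourList a ≡ L → length L ≡ 2 → FreeCycles F
      from (x ∷ _) eq _ = build (walk [] a x (inj₁ refl) a∼x (λ ()) (λ ()) (λ ()))
        where
        a∼x : a ∼ x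
        a∼x = neighbours-∈ (subst (x ∈_) (sym eq) (here refl))
        build : Walk [] a x → FreeCycles F
        build record { inner = xs ; end-T = inj₂ b∈F ; arc = arc ; outside = out } = ⊥-elim ([ (λ l∈ → proj₁ (out l∈) (inj₂ l∈F)) , (λ { refl → a∉F l∈F }) ]′ (last∈ xs a))
          where
          l∈F : lastOf xs a ∈ F
          l∈F = sat b∈F (∼-sym (arc-last arc))
        build record { inner = xs ; end-T = inj₁ refl ; arc = arc ; outside = out ; distinct = uq-xs } =
          more a xs arc 2≤ uq-a fresh (go k F′ uq′ sat′ (λ x∉ → d (λ x∈ → x∉ (∈-++⁺ʳ (a ∷ xs) x∈))) (proj₁ rest′) (proj₂ rest′) shorter)
          where
          F′ : List V
          F′ = a ∷ xs ++ F
          dxs : ∀ {y} → y ∈ xs → degree G y ≡ 2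
          dxs y∈ = d (proj₁ (out y∈) ∘ inj₂)
          2≤ : 2 ≤ length xs
          2≤ = closed-long arc dxs
          uq-a : Unique (a ∷ xs)
          uq-a = Unique-∉ (λ a∈ → proj₁ (out a∈) (inj₁ refl)) uq-xs
          fresh : ∀ {y} → y ∈ a ∷ xs → y ∉ F × degree G y ≡ 2
          fresh (here refl) = a∉F , d a∉F
          fresh (there y∈)  = proj₁ (out y∈) ∘ inj₂ , dxs y∈
          uq′ : Unique F′
          uq′ = Unique.++⁺ uq-a uq λ { (y∈ , y∈F) → proj₁ (fresh y∈) y∈F }
          ends : ∀ {y} → a ∼ y → y ∈ xs
          ends {y} a∼y with degree-2-next (d a∉F) (arc-first arc)
          ... | t , t≢f , a∼t , thin with thin a∼y
          ...   | inj₁ refl = [ id , (λ e → contradiction (subst (2 ≤_) (cong length (empty e)) 2≤) λ ()) ]′ (first∈ xs a)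
            where
            empty : firstOf xs a ≡ a → xs ≡ []
            empty e = contradiction (subst (a ∼_) e (arc-first arc)) ∼-irrefl
          ...   | inj₂ refl with thin (∼-sym (arc-last arc))
          ...     | inj₁ e = contradiction (sym e) (first≢last 2≤ uq-xs)
          ...     | inj₂ e = [ subst (_∈ xs) e , (λ { refl → contradiction 2≤ λ () }) ]′ (last∈ xs a)
          sat′ : Saturated F′
          sat′ (here refl) a∼y = there (∈-++⁺ˡ (ends a∼y))
          sat′ (there w∈) w∼y with ∈-++⁻ xs w∈
          ... | inj₂ w∈F  = there (∈-++⁺ʳ xs (sat w∈F w∼y))
          ... | inj₁ w∈xs with arc-closed arc w∈xs w∼y
          ...   | inj₁ refl        = here refl
          ...   | inj₂ (inj₁ y∈)   = there (∈-++⁺ˡ y∈)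
          ...   | inj₂ (inj₂ refl) = here refl
          rest′ = complement F′ uq′ (λ {x} _ → ∈-allFin x)
          sizes : length F + suc (length zs) ≡ suc (length xs + length F) + length (proj₁ rest′)
          sizes = trans (sym (trans (Perm.↭-length p) (List.length-++ F)))
            (trans (trans (Perm.↭-length (proj₂ rest′)) (List.length-++ F′)) (cong (λ l → suc l + length (proj₁ rest′)) (List.length-++ xs)))
          shorter : length (proj₁ rest′) ≤ k
          shorter = ℕ.≤-trans (ℕ.+-cancelˡ-≤ (length F) _ _ (ℕ.≤-pred (ℕ.≤-trans (ℕ.≤-trans
            (s≤s (ℕ.+-monoˡ-≤ (length (proj₁ rest′)) (ℕ.m≤n+m (length F) (length xs)))) (ℕ.≤-reflexive (sym sizes)))
            (ℕ.≤-reflexive (ℕ.+-suc (length F) (length zs)))))) len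

  dumbbell-saturated : ∀ {x y α β γ} → Dumbbell x y α β γ → Saturated (x ∷ α ++ β ++ y ∷ γ)
  dumbbell-saturated {x} {y} {α} {β} {γ} D = sat
    where
    open Dumbbell D
    inα : ∀ {t} → t ∈ α → t ∈ x ∷ α ++ β ++ y ∷ γ
    inα t∈ = there (∈-++⁺ˡ t∈)
    inβ : ∀ {t} → t ∈ β → t ∈ x ∷ α ++ β ++ y ∷ γ
    inβ t∈ = there (∈-++⁺ʳ α (∈-++⁺ˡ t∈))
    inγ : ∀ {t} → t ∈ y ∷ γ → t ∈ x ∷ α ++ β ++ y ∷ γ
    inγ t∈ = there (∈-++⁺ʳ α (∈-++⁺ʳ β t∈))
    sat : Saturated (x ∷ α ++ β ++ y ∷ γ)
    sat (here refl) e with at-u e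
    ... | inj₁ t∈   = inα t∈
    ... | inj₂ refl = [ inβ , (λ p → inγ (here p)) ]′ (first∈ β y)
    sat (there w∈) e with ∈-++⁻ α w∈
    ... | inj₁ w∈α = [ here , [ inα , here ]′ ]′ (arc-closed arc-α w∈α e)
    ... | inj₂ w∈  with ∈-++⁻ β w∈
    ...   | inj₁ w∈β         = [ here , [ inβ , inγ ∘ here ]′ ]′ (arc-closed arc-β w∈β e)
    ...   | inj₂ (there w∈γ) = [ inγ ∘ here , [ inγ ∘ there , inγ ∘ here ]′ ]′ (arc-closed arc-γ w∈γ e)
    ...   | inj₂ (here refl) with at-v e
    ...     | inj₁ t∈   = inγ (there t∈)
    ...     | inj₂ refl = [ inβ , (λ { refl → here refl }) ]′ (last∈ β x)

  theta-saturated : ∀ {x y xs ys zs} → Theta x y xs ys zs → Saturated (x ∷ y ∷ xs ++ ys ++ zs)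
  theta-saturated {x} {y} {xs} {ys} {zs} D = sat
    where
    open Theta D
    L : List V
    L = x ∷ y ∷ xs ++ ys ++ zs
    in₁ : ∀ {t} → t ∈ xs → t ∈ L
    in₁ t∈ = there (there (∈-++⁺ˡ t∈))
    in₂ : ∀ {t} → t ∈ ys → t ∈ L
    in₂ t∈ = there (there (∈-++⁺ʳ xs (∈-++⁺ˡ t∈)))
    in₃ : ∀ {t} → t ∈ zs → t ∈ L
    in₃ t∈ = there (there (∈-++⁺ʳ xs (∈-++⁺ʳ ys t∈)))
    head-in : ∀ ps → (∀ {t} → t ∈ ps → t ∈ L) → firstOf ps y ∈ L
    head-in ps h = [ h , (λ p → there (here p)) ]′ (first∈ ps y)
    last-in : ∀ ps → (∀ {t} → t ∈ ps → t ∈ L) → lastOf ps x ∈ L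
    last-in ps h = [ h , (λ { refl → here refl }) ]′ (last∈ ps x)
    inner : ∀ {ps w t} → (∀ {t} → t ∈ ps → t ∈ L) → Arc x ps y → w ∈ ps → w ∼ t → t ∈ L
    inner h arc w∈ e = [ here , [ h , there ∘ here ]′ ]′ (arc-closed arc w∈ e)
    sat : Saturated L
    sat (here refl) e with at-u e
    ... | inj₁ refl        = head-in xs in₁
    ... | inj₂ (inj₁ refl) = head-in ys in₂
    ... | inj₂ (inj₂ refl) = head-in zs in₃
    sat (there (here refl)) e with at-v e
    ... | inj₁ refl        = last-in xs in₁
    ... | inj₂ (inj₁ refl) = last-in ys in₂
    ... | inj₂ (inj₂ refl) = last-in zs in₃
    sat (there (there w∈)) e with ∈-++⁻ xs w∈
    ... | inj₁ w∈xs = inner in₁ arc-xs w∈xs e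
    ... | inj₂ w∈′  with ∈-++⁻ ys w∈′
    ...   | inj₁ w∈ys = inner in₂ arc-ys w∈ys e
    ...   | inj₂ w∈zs = inner in₃ arc-zs w∈zs e

module CycleProduct (m : ℕ) {n : ℕ} (G : Graph n) where
  open Truncated exact m
  open SetoidReasoning setoid
  open GraphSeries m G
  open Decomposition G

  charSeries-main : ∀ {F} → Unique F → Saturated F → (fc : FreeCycles F) → charSeries ≋ P F ⊗ cycles (cycleLengths fc)
  charSeries-main uq sat fc = ≋-trans charSeries-P (go uq sat fc)
    where
    go : ∀ {F} → Unique F → Saturated F → (fc : FreeCycles F) → P (allFin n) ≋ P F ⊗ cycles (cycleLengths fc)
    go {F} uq sat (done h) = ≋-trans (P-↭ (same-members (Unique.allFin⁺ n) uq (λ {x} _ → h x) (λ {x} _ → ∈-allFin x)))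
      (solve 1 (λ p → p := p :* con 1ℤ) ≋-refl (P F))
    go {F} uq sat (more x xs arc 2≤ uq-x fresh fc) = begin
      P (allFin n)                                                   ≈⟨ go uq′ sat′ fc ⟩
      P (x ∷ xs ++ F) ⊗ cycles (cycleLengths fc)               ≈⟨ ⊗-cong (P-++ (x ∷ xs) F sep) ≋-refl ⟩
      P (x ∷ xs) ⊗ P F ⊗ cycles (cycleLengths fc)              ≈⟨ ⊗-cong (⊗-cong (P-cycle 2≤ arc uq-x (proj₂ ∘ fresh)) ≋-refl) ≋-refl ⟩
      c (suc (length xs)) ⊗ P F ⊗ cycles (cycleLengths fc)
        ≈⟨ solve 3 (λ a p q → a :* p :* q := p :* (a :* q)) ≋-refl _ _ _ ⟩
      P F ⊗ (c (suc (length xs)) ⊗ cycles (cycleLengths fc)) ∎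
      where
      uq′ : Unique (x ∷ xs ++ F)
      uq′ = Unique.++⁺ uq-x uq λ { (y∈ , y∈F) → proj₁ (fresh y∈) y∈F }
      apart : ∀ {y t} → y ∈ x ∷ xs → t ∈ F → ¬ (y ∼ t)
      apart y∈ t∈ y∼t = proj₁ (fresh y∈) (sat t∈ (∼-sym y∼t))
      sep : Separated (x ∷ xs) F
      sep y∈ t∈ = M-none (λ { refl → proj₁ (fresh y∈) t∈ }) (apart y∈ t∈) , M-none (λ { refl → proj₁ (fresh y∈) t∈ }) (apart y∈ t∈ ∘ ∼-sym)
      ends : ∀ {y} → x ∼ y → y ∈ xs
      ends x∼y with degree-2-next (proj₂ (fresh (here refl))) (arc-first arc)
      ... | t , t≢f , _ , thin with thin x∼y
      ...   | inj₁ refl = [ id , (λ e → contradiction (subst (x ∼_) e (arc-first arc)) ∼-irrefl) ]′ (first∈ xs x)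
      ...   | inj₂ refl with thin (∼-sym (arc-last arc))
      ...     | inj₁ e = contradiction (sym e) (first≢last 2≤ (Unique-tail uq-x))
      ...     | inj₂ e = [ subst (_∈ xs) e , (λ { refl → contradiction 2≤ λ () }) ]′ (last∈ xs x)
      sat′ : Saturated (x ∷ xs ++ F)
      sat′ (here refl) e = there (∈-++⁺ˡ (ends e))
      sat′ (there w∈) e with ∈-++⁻ xs w∈
      ... | inj₂ w∈F  = there (∈-++⁺ʳ xs (sat w∈F e))
      ... | inj₁ w∈xs with arc-closed arc w∈xs e
      ...   | inj₁ refl        = here refl
      ...   | inj₂ (inj₁ y∈)   = there (∈-++⁺ˡ y∈)
      ...   | inj₂ (inj₂ refl) = here refl

-- The structure of d p q r

module DumbbellDegrees {n : ℕ} (G : Graph n) where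
  open GraphArcs G
  open Degrees G
  open Decomposition G using (first≢last; last∈)

  arc-degree : ∀ {a xs b} → Arc a xs b → a ∉ xs → b ∉ xs → Unique xs → a ≢ b ⊎ 2 ≤ length xs → ∀ {w} → w ∈ xs → degree G w ≡ 2
  arc-degree {a} {x ∷ xs} {b} (step e thin arc) a∉ b∉ uq apart (here refl) = degree-from-list x (a ∷ firstOf xs b ∷ [])
    (Unique-∉ (λ { (here p) → differ apart p }) (Unique-∉ (λ ()) []))
    (λ { (here refl) → ∼-sym e ; (there (here refl)) → arc-first arc })
    (λ x∼y → [ here , there ∘ here ]′ (thin x∼y))
    where
    nonempty : ∀ ys → 2 ≤ length (x ∷ ys) → firstOf ys b ≡ b → b ∉ ys → ⊥
    nonempty []       (s≤s ()) _    _
    nonempty (y ∷ ys) _        refl b∉ = b∉ (here refl)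
    differ : a ≢ b ⊎ 2 ≤ length (x ∷ xs) → a ≢ firstOf xs b
    differ apart p with first∈ xs b
    ... | inj₁ f∈  = a∉ (there (subst (_∈ xs) (sym p) f∈))
    ... | inj₂ f≡b = [ (λ a≢b → a≢b (trans p f≡b)) , (λ 2≤ → nonempty xs 2≤ f≡b (b∉ ∘ there)) ]′ apart
  arc-degree {a} {x ∷ xs} {b} (step e thin arc) a∉ b∉ uq apart (there w∈) =
    arc-degree arc (∉-Unique uq) (b∉ ∘ there) (Unique-tail uq) (inj₁ λ { refl → b∉ (here refl) }) w∈

  module _ {x y α β γ} (D : Dumbbell x y α β γ) (2≤α : 2 ≤ length α) (2≤γ : 2 ≤ length γ) where
    open Dumbbell D

    private
      uq-α : Unique α
      uq-α = Unique-++ˡ α (Unique-tail unique)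

      uq-β : Unique β
      uq-β = Unique-++ˡ β (Unique-++ʳ α (Unique-tail unique))

      uq-γ : Unique (y ∷ γ)
      uq-γ = Unique-++ʳ β (Unique-++ʳ α (Unique-tail unique))

      x∉ : x ∉ α ++ β ++ y ∷ γ
      x∉ = ∉-Unique unique

      y∉α : y ∉ α
      y∉α y∈ = Unique-disjoint α (Unique-tail unique) y∈ (∈-++⁺ʳ β (here refl))

      y∉β : y ∉ β
      y∉β y∈ = Unique-disjoint β (Unique-++ʳ α (Unique-tail unique)) y∈ (here refl)

      x≢y : x ≢ y
      x≢y refl = x∉ (∈-++⁺ʳ α (∈-++⁺ʳ β (here refl)))

      first-in : ∀ {a} {xs : List (Fin n)} → 2 ≤ length xs → firstOf xs a ∈ xs
      first-in {xs = _ ∷ _} _ = here refl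

      last-in : ∀ {a : Fin n} {xs} → 2 ≤ length xs → lastOf xs a ∈ xs
      last-in {a} {xs} 2≤ = [ id , (λ { refl → contradiction 2≤ λ () }) ]′ (last∈ xs a)

      cubic-degree : ∀ {w xs t} → Arc w xs w → w ∉ xs → Unique xs → 2 ≤ length xs → w ∼ t → t ∉ xs → (∀ {s} → w ∼ s → s ∈ xs ⊎ s ≡ t) → degree G w ≡ 3
      cubic-degree {w} {xs} {t} arc w∉ uq 2≤ w∼t t∉ at-w = degree-from-list w (firstOf xs w ∷ lastOf xs w ∷ t ∷ [])
        (Unique-∉ (λ { (here p) → first≢last 2≤ uq p ; (there (here p)) → t∉ (subst (_∈ xs) p (first-in 2≤)) })
          (Unique-∉ (λ { (here p) → t∉ (subst (_∈ xs) p (last-in 2≤)) }) (Unique-∉ (λ ()) [])))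
        (λ { (here refl) → arc-first arc ; (there (here refl)) → ∼-sym (arc-last arc) ; (there (there (here refl))) → w∼t })
        λ w∼s → [ (λ s∈ → [ here ∘ proj₁ , there ∘ here ∘ proj₁ ]′ (arc-touch arc s∈ (∼-sym w∼s) w∉)) , (λ p → there (there (here p))) ]′ (at-w w∼s)

    degree-hub₁ : degree G x ≡ 3
    degree-hub₁ = cubic-degree arc-α (x∉ ∘ ∈-++⁺ˡ) uq-α 2≤α (arc-first arc-β)
      (λ f∈ → [ (λ f∈β → Unique-disjoint α (Unique-tail unique) f∈ (∈-++⁺ˡ f∈β)) , (λ f≡y → y∉α (subst (_∈ α) f≡y f∈)) ]′ (first∈ β y)) at-u

    degree-hub₂ : degree G y ≡ 3
    degree-hub₂ = cubic-degree arc-γ (∉-Unique uq-γ) (Unique-tail uq-γ) 2≤γ (∼-sym (arc-last arc-β))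
      (λ l∈ → [ (λ l∈β → Unique-disjoint β (Unique-++ʳ α (Unique-tail unique)) l∈β (there l∈))
              , (λ { refl → x∉ (∈-++⁺ʳ α (∈-++⁺ʳ β (there l∈))) }) ]′ (last∈ β x)) at-v

    degree-inner : ∀ {t} → t ∈ α ++ β ++ γ → degree G t ≡ 2
    degree-inner t∈ with ∈-++⁻ α t∈
    ... | inj₁ t∈α = arc-degree arc-α (x∉ ∘ ∈-++⁺ˡ) (x∉ ∘ ∈-++⁺ˡ) uq-α (inj₂ 2≤α) t∈α
    ... | inj₂ t∈′ with ∈-++⁻ β t∈′
    ...   | inj₁ t∈β = arc-degree arc-β (x∉ ∘ ∈-++⁺ʳ α ∘ ∈-++⁺ˡ) y∉β uq-β (inj₁ x≢y) t∈β
    ...   | inj₂ t∈γ = arc-degree arc-γ (∉-Unique uq-γ) (∉-Unique uq-γ) (Unique-tail uq-γ) (inj₂ 2≤γ) t∈γ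

private
  ∨-true : ∀ a b → a ∨ b ≡ true → a ≡ true ⊎ b ≡ true
  ∨-true true  b p = inj₁ refl
  ∨-true false b p = inj₂ p

  ∧-true : ∀ a b → a ∧ b ≡ true → a ≡ true × b ≡ true
  ∧-true true b p = refl , p

  ≡ᵇ-true : ∀ {i j} → (i ≡ᵇ j) ≡ true → i ≡ j
  ≡ᵇ-true {i} {j} p = ℕ.≡ᵇ⇒≡ i j (subst Data.Bool.Base.T (sym p) tt)

  true-≡ᵇ : ∀ {i j} → i ≡ j → (i ≡ᵇ j) ≡ true
  true-≡ᵇ {i} refl with i ≡ᵇ i | ℕ.≡⇒≡ᵇ i i refl
  ... | true | _ = refl

  ∨-true⁺ : ∀ {a b} → a ≡ true ⊎ b ≡ true → a ∨ b ≡ true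
  ∨-true⁺ {true}          _        = refl
  ∨-true⁺ {false} {true}  _        = refl
  ∨-true⁺ {false} {false} (inj₁ p) = p
  ∨-true⁺ {false} {false} (inj₂ p) = p

  fromRel-edge : ∀ {n} (R : Fin n → Fin n → Bool) {i j} → adj (fromRel R) i j ≡ true → R i j ≡ true ⊎ R j i ≡ true
  fromRel-edge R {i} {j} p = ∨-true (R i j) (R j i) (proj₂ (∧-true (not (does (i Fin.≟ j))) _ p))

  edge-fromRel : ∀ {n} (R : Fin n → Fin n → Bool) {i j} → i ≢ j → R i j ≡ true ⊎ R j i ≡ true → adj (fromRel R) i j ≡ true
  edge-fromRel R {i} {j} i≢j p with i Fin.≟ j
  ... | yes i≡j = contradiction i≡j i≢j
  ... | no _    = ∨-true⁺ p

module PathArc (r : ℕ) where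
  open GraphArcs (path (suc (suc r)))

  path-edge : ∀ {i j} → i ∼ j → toℕ j ≡ suc (toℕ i) ⊎ toℕ i ≡ suc (toℕ j)
  path-edge {i} {j} p = [ (λ q → inj₁ (≡ᵇ-true {toℕ j} {suc (toℕ i)} q)) , (λ q → inj₂ (≡ᵇ-true {toℕ i} {suc (toℕ j)} q)) ]′
    (fromRel-edge (λ i j → toℕ j ≡ᵇ suc (toℕ i)) {i} {j} p)

  edge-path : ∀ {i j} → toℕ j ≡ suc (toℕ i) → i ∼ j
  edge-path {i} {j} p = edge-fromRel (λ i j → toℕ j ≡ᵇ suc (toℕ i)) {i} {j} (λ { refl → ℕ.1+n≢n (sym p) }) (inj₁ (true-≡ᵇ {toℕ j} p))

  private
    go : ∀ k (f : Fin k → Fin (suc (suc r))) a → (∀ i → toℕ (f i) ≡ suc (toℕ a + toℕ i)) → toℕ a + k ≡ r → Arc a (List.tabulate f) (fromℕ (suc r))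
    go zero    f a idx len = edge (edge-path {a} {fromℕ (suc r)} (trans (Fin.toℕ-fromℕ (suc r)) (cong suc (trans (sym len) (ℕ.+-identityʳ _)))))
    go (suc k) f a idx len = step (edge-path {a} {f zero} at-0) thin (go k (f ∘ suc) (f zero) idx′ len′)
      where
      at-0 : toℕ (f zero) ≡ suc (toℕ a)
      at-0 = trans (idx zero) (cong suc (ℕ.+-identityʳ _))
      idx′ : ∀ i → toℕ (f (suc i)) ≡ suc (toℕ (f zero) + toℕ i)
      idx′ i = trans (idx (suc i)) (cong suc (trans (ℕ.+-suc _ _) (cong (_+ toℕ i) (sym at-0))))
      len′ : toℕ (f zero) + k ≡ r
      len′ = trans (cong (_+ k) at-0) (trans (sym (ℕ.+-suc _ _)) len)
      next : ∀ k (f : Fin (suc k) → Fin (suc (suc r))) → (∀ i → toℕ (f (suc i)) ≡ suc (toℕ (f zero) + toℕ i)) → toℕ (f zero) + k ≡ r →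
        ∀ {y} → toℕ y ≡ suc (toℕ (f zero)) → y ≡ firstOf (List.tabulate (f ∘ suc)) (fromℕ (suc r))
      next zero    f idx len p = Fin.toℕ-injective (trans p (sym (trans (Fin.toℕ-fromℕ (suc r)) (cong suc (trans (sym len) (ℕ.+-identityʳ _))))))
      next (suc k) f idx len p = Fin.toℕ-injective (trans p (sym (trans (idx zero) (cong suc (ℕ.+-identityʳ _)))))
      thin : ∀ {y} → f zero ∼ y → y ≡ a ⊎ y ≡ firstOf (List.tabulate (f ∘ suc)) (fromℕ (suc r))
      thin {y} e with path-edge {f zero} {y} e
      ... | inj₁ p = inj₂ (next k f idx′ len′ p)
      ... | inj₂ p = inj₁ (Fin.toℕ-injective (ℕ.suc-injective (trans (sym p) at-0)))

  inner : List (Fin (suc (suc r)))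
  inner = List.tabulate {n = r} (λ i → suc (inject₁ i))

  path-arc : Arc zero inner (fromℕ (suc r))
  path-arc = go r (λ i → suc (inject₁ i)) zero (λ i → cong suc (Fin.toℕ-inject₁ i)) refl

  start-edge : ∀ {y} → zero ∼ y → y ≡ firstOf inner (fromℕ (suc r))
  start-edge {y} e with path-edge {zero} {y} e
  ... | inj₁ p = first r refl p
    where
    first : ∀ r′ → r′ ≡ r → toℕ y ≡ 1 → y ≡ firstOf inner (fromℕ (suc r))
    first zero     refl p = Fin.toℕ-injective p
    first (suc r′) refl p = Fin.toℕ-injective p

  final-edge : ∀ {y} → fromℕ (suc r) ∼ y → y ≡ lastOf inner zero
  final-edge {y} e with path-edge {fromℕ (suc r)} {y} e | path-edge {lastOf inner zero} {fromℕ (suc r)} (arc-last path-arc)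
  ... | inj₁ p | _      = contradiction (Fin.toℕ<n y) (ℕ.≤⇒≯ (ℕ.≤-reflexive (sym (trans p (cong suc (Fin.toℕ-fromℕ (suc r)))))))
  ... | inj₂ p | inj₁ q = Fin.toℕ-injective (ℕ.suc-injective (trans (sym p) q))
  ... | inj₂ p | inj₂ q = contradiction (Fin.toℕ<n (lastOf inner zero)) (ℕ.≤⇒≯ (ℕ.≤-reflexive (sym (trans q (cong suc (Fin.toℕ-fromℕ (suc r)))))))

  inner-complete : ∀ y → y ≡ zero ⊎ y ∈ inner ⊎ y ≡ fromℕ (suc r)
  inner-complete zero = inj₁ refl
  inner-complete (suc i) with toℕ i ℕ.<? r
  ... | yes i<r = inj₂ (inj₁ (subst (_∈ inner) (cong suc (Fin.toℕ-injective (trans (Fin.toℕ-inject₁ _) (Fin.toℕ-fromℕ< i<r)))) (Mem.∈-tabulate⁺ {f = λ i → suc (inject₁ i)} (fromℕ< i<r))))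
  ... | no i≮r  = inj₂ (inj₂ (cong suc (Fin.toℕ-injective (trans (ℕ.≤-antisym (ℕ.≤-pred (Fin.toℕ<n i)) (ℕ.≮⇒≥ i≮r)) (sym (Fin.toℕ-fromℕ r))))))

module CycleArc (p : ℕ) where
  open GraphArcs (cycle (suc (suc (suc p))))

  private
    N : ℕ
    N = suc (suc p)

    R : Fin (suc N) → Fin (suc N) → Bool
    R i j = (toℕ j ≡ᵇ suc (toℕ i)) ∨ ((suc (toℕ i) ≡ᵇ suc N) ∧ (toℕ j ≡ᵇ 0))

  cycle-edge : ∀ {i j} → i ∼ j → (toℕ j ≡ suc (toℕ i) ⊎ toℕ i ≡ N × toℕ j ≡ 0) ⊎ (toℕ i ≡ suc (toℕ j) ⊎ toℕ j ≡ N × toℕ i ≡ 0)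
  cycle-edge {i} {j} e = [ (λ t → inj₁ (decode {i} {j} t)) , (λ t → inj₂ (decode {j} {i} t)) ]′
    (fromRel-edge R {i} {j} e)
    where
    decode : ∀ {i j : Fin (suc N)} → R i j ≡ true → toℕ j ≡ suc (toℕ i) ⊎ toℕ i ≡ N × toℕ j ≡ 0
    decode {i} {j} q = [ (λ t → inj₁ (≡ᵇ-true {toℕ j} {suc (toℕ i)} t)) , (λ t → let s = ∧-true (toℕ i ≡ᵇ N) (toℕ j ≡ᵇ 0) t in
          inj₂ (≡ᵇ-true {toℕ i} {N} (proj₁ s) , ≡ᵇ-true {toℕ j} {0} (proj₂ s))) ]′
      (∨-true (toℕ j ≡ᵇ suc (toℕ i)) ((toℕ i ≡ᵇ N) ∧ (toℕ j ≡ᵇ 0)) q)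

  edge-cycle : ∀ {i j} → toℕ j ≡ suc (toℕ i) → i ∼ j
  edge-cycle {i} {j} q = edge-fromRel R {i} {j} (λ { refl → ℕ.1+n≢n (sym q) }) (inj₁ (∨-true⁺ {toℕ j ≡ᵇ suc (toℕ i)} {(suc (toℕ i) ≡ᵇ suc N) ∧ (toℕ j ≡ᵇ 0)} (inj₁ (true-≡ᵇ {toℕ j} {suc (toℕ i)} q))))

  closing-edge : ∀ {i} → toℕ i ≡ N → i ∼ zero
  closing-edge {i} q = edge-fromRel R {i} {zero} (λ { refl → contradiction q λ () }) (inj₁ (cong (_∧ true) (true-≡ᵇ {toℕ i} {N} q)))

  private
    go : ∀ k (f : Fin k → Fin (suc N)) a → (∀ i → toℕ (f i) ≡ suc (toℕ a + toℕ i)) → toℕ a + k ≡ N → Arc a (List.tabulate f) zero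
    go zero    f a idx len = edge (closing-edge {a} (trans (sym (ℕ.+-identityʳ _)) len))
    go (suc k) f a idx len = step (edge-cycle {a} {f zero} at-0) thin (go k (f ∘ suc) (f zero) idx′ len′)
      where
      at-0 : toℕ (f zero) ≡ suc (toℕ a)
      at-0 = trans (idx zero) (cong suc (ℕ.+-identityʳ _))
      idx′ : ∀ i → toℕ (f (suc i)) ≡ suc (toℕ (f zero) + toℕ i)
      idx′ i = trans (idx (suc i)) (cong suc (trans (ℕ.+-suc _ _) (cong (_+ toℕ i) (sym at-0))))
      len′ : toℕ (f zero) + k ≡ N
      len′ = trans (cong (_+ k) at-0) (trans (sym (ℕ.+-suc _ _)) len)
      next : ∀ k (f : Fin (suc k) → Fin (suc N)) → (∀ i → toℕ (f (suc i)) ≡ suc (toℕ (f zero) + toℕ i)) → toℕ (f zero) + k ≡ N →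
        ∀ {y} → toℕ y ≡ suc (toℕ (f zero)) ⊎ toℕ (f zero) ≡ N × toℕ y ≡ 0 → y ≡ firstOf (List.tabulate (f ∘ suc)) zero
      next zero    f idx len {y} (inj₁ q) = contradiction (Fin.toℕ<n y) (ℕ.≤⇒≯ (ℕ.≤-reflexive (sym (trans q (cong suc (trans (sym (ℕ.+-identityʳ _)) len))))))
      next zero    f idx len (inj₂ (_ , q)) = Fin.toℕ-injective q
      next (suc k) f idx len (inj₁ q) = Fin.toℕ-injective (trans q (sym (trans (idx zero) (cong suc (ℕ.+-identityʳ _)))))
      next (suc k) f idx len (inj₂ (q , _)) = contradiction (trans len (sym q)) (ℕ.m+1+n≢m (toℕ (f zero)))
      thin : ∀ {y} → f zero ∼ y → y ≡ a ⊎ y ≡ firstOf (List.tabulate (f ∘ suc)) zero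
      thin {y} e with cycle-edge {f zero} {y} e
      ... | inj₁ q              = inj₂ (next k f idx′ len′ q)
      ... | inj₂ (inj₁ q)       = inj₁ (Fin.toℕ-injective (ℕ.suc-injective (trans (sym q) at-0)))
      ... | inj₂ (inj₂ (_ , q)) = contradiction (trans (sym at-0) q) λ ()

  inner : List (Fin (suc N))
  inner = List.tabulate suc

  cycle-arc : Arc zero inner zero
  cycle-arc = go N suc zero (λ i → refl) refl

  inner-complete : ∀ y → y ≡ zero ⊎ y ∈ inner
  inner-complete zero    = inj₁ refl
  inner-complete (suc i) = inj₂ (Mem.∈-tabulate⁺ {f = suc} i)

module ArcMap {m n : ℕ} (G : Graph m) (H : Graph n) (f : Fin m → Fin n)
  (preserve : ∀ {i j} → adj G i j ≡ true → adj H (f i) (f j) ≡ true) where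

  firstOf-map : ∀ xs b → firstOf (map f xs) (f b) ≡ f (firstOf xs b)
  firstOf-map []       b = refl
  firstOf-map (x ∷ xs) b = refl

  lastOf-map : ∀ xs a → lastOf (map f xs) (f a) ≡ f (lastOf xs a)
  lastOf-map []       a = refl
  lastOf-map (x ∷ xs) a = lastOf-map xs x

  map-arc : ∀ {a xs b} → GraphArcs.Arc G a xs b → (∀ {i} → i ∈ xs → ∀ {y} → adj H (f i) y ≡ true → ∃ λ j → y ≡ f j × adj G i j ≡ true) →
    GraphArcs.Arc H (f a) (map f xs) (f b)
  map-arc (Arcs.edge e) local = Arcs.edge (preserve {_} {_} e)
  map-arc {a} {_} {b} (Arcs.step {x} {xs} e thin arc) local = Arcs.step (preserve e) thin′ (map-arc arc (local ∘ there))
    where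
    thin′ : ∀ {y} → adj H (f x) y ≡ true → y ≡ f a ⊎ y ≡ firstOf (map f xs) (f b)
    thin′ {y} e with local (here refl) {y} e
    ... | j , refl , e′ with thin e′
    ...   | inj₁ refl = inj₁ refl
    ...   | inj₂ refl = inj₂ (sym (firstOf-map xs b))

module Identified {m n : ℕ} (G : Graph m) (u₀ : Fin m) (H : Graph (suc n)) (v₀ : Fin (suc n)) where

  I : Graph (m + n)
  I = identify G u₀ H v₀

  inl : Fin m → Fin (m + n)
  inl i = i ↑ˡ n

  inr : Fin (suc n) → Fin (m + n)
  inr = fromRight G u₀ H v₀

  data View : Fin (m + n) → Set where
    left  : ∀ i → View (inl i)
    right : ∀ k → View (m ↑ʳ k)

  view : ∀ x → View x
  view x = subst View (Fin.join-splitAt m n x) (go (splitAt m x))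
    where
    go : ∀ t → View (Data.Fin.Base.join m n t)
    go (inj₁ i) = left i
    go (inj₂ k) = right k

  inr-v : inr v₀ ≡ inl u₀
  inr-v with v₀ Fin.≟ v₀
  ... | yes _  = refl
  ... | no v≢v = contradiction refl v≢v

  inr-right : ∀ k → inr (punchIn v₀ k) ≡ m ↑ʳ k
  inr-right k with v₀ Fin.≟ punchIn v₀ k
  ... | yes e = contradiction (sym e) (Fin.punchInᵢ≢i v₀ k)
  ... | no ne = cong (m ↑ʳ_) (trans (Fin.punchOut-cong v₀ refl) (Fin.punchOut-punchIn v₀))

  data ViewR : Fin (suc n) → Set where
    base  : ViewR v₀
    other : ∀ k → ViewR (punchIn v₀ k)

  viewR : ∀ w → ViewR w
  viewR w with v₀ Fin.≟ w
  ... | yes refl = base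
  ... | no ne    = subst ViewR (Fin.punchIn-punchOut ne) (other (punchOut ne))

  private
    ll : ∀ i j → adj I (inl i) (inl j) ≡ adj G i j
    ll i j rewrite Fin.splitAt-↑ˡ m i n | Fin.splitAt-↑ˡ m j n = refl

    rr : ∀ k l → adj I (m ↑ʳ k) (m ↑ʳ l) ≡ adj H (punchIn v₀ k) (punchIn v₀ l)
    rr k l rewrite Fin.splitAt-↑ʳ m n k | Fin.splitAt-↑ʳ m n l = refl

    lr : ∀ i l → adj I (inl i) (m ↑ʳ l) ≡ does (i Fin.≟ u₀) ∧ adj H v₀ (punchIn v₀ l)
    lr i l rewrite Fin.splitAt-↑ˡ m i n | Fin.splitAt-↑ʳ m n l = refl

    rl : ∀ k j → adj I (m ↑ʳ k) (inl j) ≡ does (j Fin.≟ u₀) ∧ adj H v₀ (punchIn v₀ k)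
    rl k j rewrite Fin.splitAt-↑ʳ m n k | Fin.splitAt-↑ˡ m j n = refl

    does-true : ∀ {i j : Fin m} → does (i Fin.≟ j) ≡ true → i ≡ j
    does-true {i} {j} p with i Fin.≟ j
    does-true refl | yes e = e

    hub-∧ : ∀ t → t ≡ true → does (u₀ Fin.≟ u₀) ∧ t ≡ true
    hub-∧ t p with u₀ Fin.≟ u₀
    ... | yes _ = p
    ... | no ne = contradiction refl ne

  left-edge : ∀ {i j} → adj G i j ≡ true → adj I (inl i) (inl j) ≡ true
  left-edge {i} {j} e = trans (ll i j) e

  right-edge : ∀ {i j} → adj H i j ≡ true → adj I (inr i) (inr j) ≡ true
  right-edge {i} {j} e with viewR i | viewR j
  ... | base    | base    = contradiction (trans (sym (irreflexive H v₀)) e) λ ()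
  ... | base    | other l = subst₂ (λ s t → adj I s t ≡ true) (sym inr-v) (sym (inr-right l)) (trans (lr u₀ l) (hub-∧ (adj H v₀ (punchIn v₀ l)) e))
  ... | other k | base    = subst₂ (λ s t → adj I s t ≡ true) (sym (inr-right k)) (sym inr-v)
    (trans (rl k u₀) (hub-∧ (adj H v₀ (punchIn v₀ k)) (trans (symmetric H v₀ (punchIn v₀ k)) e)))
  ... | other k | other l = subst₂ (λ s t → adj I s t ≡ true) (sym (inr-right k)) (sym (inr-right l)) (trans (rr k l) e)

  left-local : ∀ {i} → i ≢ u₀ → ∀ {y} → adj I (inl i) y ≡ true → ∃ λ j → y ≡ inl j × adj G i j ≡ true
  left-local {i} i≢u {y} e with view y
  ... | left j  = j , refl , trans (sym (ll i j)) e
  ... | right l = contradiction (does-true {i} {u₀} (proj₁ (∧-true (does (i Fin.≟ u₀)) (adj H v₀ (punchIn v₀ l)) (trans (sym (lr i l)) e)))) i≢u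

  hub-local : ∀ {y} → adj I (inl u₀) y ≡ true → (∃ λ j → y ≡ inl j × adj G u₀ j ≡ true) ⊎ (∃ λ w → y ≡ inr w × adj H v₀ w ≡ true)
  hub-local {y} e with view y
  ... | left j  = inj₁ (j , refl , trans (sym (ll u₀ j)) e)
  ... | right l = inj₂ (punchIn v₀ l , sym (inr-right l) , proj₂ (∧-true (does (u₀ Fin.≟ u₀)) (adj H v₀ (punchIn v₀ l)) (trans (sym (lr u₀ l)) e)))

  right-local : ∀ {w} → w ≢ v₀ → ∀ {y} → adj I (inr w) y ≡ true → ∃ λ w′ → y ≡ inr w′ × adj H w w′ ≡ true
  right-local {w} w≢v {y} e with viewR w
  ... | base    = contradiction refl w≢v
  ... | other k with view y
  ...   | right l = punchIn v₀ l , sym (inr-right l) , trans (sym (rr k l)) (subst (λ s → adj I s (m ↑ʳ l) ≡ true) (inr-right k) e)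
  ...   | left j  with ∧-true (does (j Fin.≟ u₀)) (adj H v₀ (punchIn v₀ k)) (trans (sym (rl k j)) (subst (λ s → adj I s (inl j) ≡ true) (inr-right k) e))
  ...     | dj , e′ with does-true {j} {u₀} dj
  ...       | refl = v₀ , sym inr-v , trans (symmetric H _ _) e′

  inr≢inl : ∀ {w i} → w ≢ v₀ → inr w ≢ inl i
  inr≢inl {w} {i} w≢v p with viewR w
  ... | base    = w≢v refl
  ... | other k with trans (sym (Fin.splitAt-↑ʳ m n k)) (trans (cong (splitAt m) (trans (sym (inr-right k)) p)) (Fin.splitAt-↑ˡ m i n))
  ...   | ()

  inr-injective : ∀ {w w′} → w ≢ v₀ → inr w ≡ inr w′ → w ≡ w′
  inr-injective {w} {w′} w≢v p with viewR w | viewR w′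
  ... | base    | _        = contradiction refl w≢v
  ... | other k | base     = contradiction (trans p inr-v) (inr≢inl w≢v)
  ... | other k | other k′ = cong (punchIn v₀) (Fin.↑ʳ-injective m k k′ (trans (sym (inr-right k)) (trans p (inr-right k′))))

all-members-unique : ∀ {n} (L : List (Fin n)) → (∀ x → x ∈ L) → length L ≡ n → Unique L
all-members-unique {n} L h len with complement (allFin n) (Unique.allFin⁺ n) (λ {x} _ → h x)
... | []     , p = Unique-resp-↭ (↭-sym (subst (L ↭_) (List.++-identityʳ (allFin n)) p)) (Unique.allFin⁺ n)
... | z ∷ zs , p = contradiction (trans (sym (trans (Perm.↭-length p) (trans (List.length-++ (allFin n)) (cong (_+ length (z ∷ zs)) (List.length-tabulate {n = n} id))))) len)
  (ℕ.m+1+n≢m n)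

module DumbbellGraph (p q r : ℕ) where
  private
    module Left  = Identified (cycle (3 + p)) zero (path (2 + r)) zero
    hub : Fin (3 + p + suc r)
    hub = Left.inr (fromℕ (suc r))
    module Right = Identified Left.I hub (cycle (3 + q)) zero
    module A = CycleArc p
    module B′ = PathArc r
    module Γ = CycleArc q

  D : Graph (3 + p + suc r + (2 + q))
  D = Right.I

  private
    fα : Fin (3 + p) → Fin (3 + p + suc r + (2 + q))
    fα = Right.inl ∘ Left.inl

    fβ : Fin (2 + r) → Fin (3 + p + suc r + (2 + q))
    fβ = Right.inl ∘ Left.inr

    fγ : Fin (3 + q) → Fin (3 + p + suc r + (2 + q))
    fγ = Right.inr

    hub≢left : ∀ {i} → Left.inl i ≢ hub
    hub≢left p = Left.inr≢inl {fromℕ (suc r)} (λ ()) (sym p)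

    module Mα = ArcMap (cycle (3 + p)) D fα (λ {i} {j} e → Right.left-edge {Left.inl i} {Left.inl j} (Left.left-edge {i} {j} e))
    module Mβ = ArcMap (path (2 + r)) D fβ (λ {i} {j} e → Right.left-edge {Left.inr i} {Left.inr j} (Left.right-edge {i} {j} e))
    module Mγ = ArcMap (cycle (3 + q)) D fγ (λ {i} {j} e → Right.right-edge {i} {j} e)

    local-α : ∀ {i} → i ∈ A.inner → ∀ {y} → adj D (fα i) y ≡ true → ∃ λ j → y ≡ fα j × adj (cycle (3 + p)) i j ≡ true
    local-α {i} i∈ {y} e with Right.left-local {Left.inl i} (hub≢left {i}) {y} e
    ... | y′ , refl , e₁ with Left.left-local {i} (nonzero i∈) {y′} e₁
      where
      nonzero : ∀ {i} → i ∈ A.inner → i ≢ zero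
      nonzero i∈ refl with Mem.∈-tabulate⁻ {f = suc} i∈
      ... | _ , ()
    ...   | j , refl , e₂ = j , refl , e₂

    local-β : ∀ {i} → i ≢ zero → i ≢ fromℕ (suc r) → ∀ {y} → adj D (fβ i) y ≡ true → ∃ λ j → y ≡ fβ j × adj (path (2 + r)) i j ≡ true
    local-β {i} i≢0 i≢last {y} e with Right.left-local {Left.inr i} (λ p → i≢last (Left.inr-injective i≢0 p)) {y} e
    ... | y′ , refl , e₁ with Left.right-local {i} i≢0 {y′} e₁
    ...   | j , refl , e₂ = j , refl , e₂

    inner≢0 : ∀ {i} → i ∈ B′.inner → i ≢ zero
    inner≢0 i∈ refl with Mem.∈-tabulate⁻ {f = λ i → suc (inject₁ i)} i∈
    ... | _ , ()

    inner≢last : ∀ {i} → i ∈ B′.inner → i ≢ fromℕ (suc r)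
    inner≢last i∈ e with Mem.∈-tabulate⁻ {f = λ i → suc (inject₁ i)} i∈
    ... | j , refl = Fin.fromℕ≢inject₁ (sym (Fin.suc-injective e))

    local-γ : ∀ {i} → i ∈ Γ.inner → ∀ {y} → adj D (fγ i) y ≡ true → ∃ λ j → y ≡ fγ j × adj (cycle (3 + q)) i j ≡ true
    local-γ {i} i∈ {y} e = Right.right-local {i} (nonzero i∈) {y} e
      where
      nonzero : ∀ {i} → i ∈ Γ.inner → i ≢ zero
      nonzero i∈ refl with Mem.∈-tabulate⁻ {f = suc} i∈
      ... | _ , ()

  α γ β : List (Fin (3 + p + suc r + (2 + q)))
  α = map fα A.inner
  β = map fβ B′.inner
  γ = map fγ Γ.inner

  u₁ v₁ : Fin (3 + p + suc r + (2 + q))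
  u₁ = fα zero
  v₁ = Right.inl hub

  vertices : List (Fin (3 + p + suc r + (2 + q)))
  vertices = u₁ ∷ α ++ β ++ v₁ ∷ γ

  complete : ∀ x → x ∈ vertices
  complete x with Right.view x
  ... | Right.right k = there (∈-++⁺ʳ α (∈-++⁺ʳ β (there (subst (_∈ γ) (Right.inr-right k) (∈-map⁺ fγ (Mem.∈-tabulate⁺ {f = suc} k))))))
  ... | Right.left y with Left.view y
  ...   | Left.left i with A.inner-complete i
  ...     | inj₁ refl = here refl
  ...     | inj₂ i∈   = there (∈-++⁺ˡ (∈-map⁺ fα i∈))
  complete x | Right.left y | Left.right k with B′.inner-complete (suc k)
  ...     | inj₁ ()
  ...     | inj₂ (inj₁ i∈) = there (∈-++⁺ʳ α (∈-++⁺ˡ (subst (_∈ β) (cong Right.inl (Left.inr-right k)) (∈-map⁺ fβ i∈))))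
  ...     | inj₂ (inj₂ e)  = there (∈-++⁺ʳ α (∈-++⁺ʳ β (here (cong Right.inl (trans (sym (Left.inr-right k)) (cong Left.inr e))))))

  length-α : length α ≡ 2 + p
  length-α = trans (List.length-map fα A.inner) (List.length-tabulate {n = 2 + p} suc)

  length-β : length β ≡ r
  length-β = trans (List.length-map fβ B′.inner) (List.length-tabulate {n = r} (λ i → suc (inject₁ i)))

  length-γ : length γ ≡ 2 + q
  length-γ = trans (List.length-map fγ Γ.inner) (List.length-tabulate {n = 2 + q} suc)

  length-vertices : length vertices ≡ 3 + p + suc r + (2 + q)
  length-vertices = trans (cong suc (trans (List.length-++ α) (cong₂ _+_ length-α (trans (List.length-++ β) (cong₂ _+_ length-β (cong suc length-γ))))))
    (lemma p q r)
    where
    lemma : ∀ p q r → suc (2 + p + (r + suc (2 + q))) ≡ 3 + p + suc r + (2 + q)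
    lemma = ℕ-Solver.solve-∀

  structure : GraphArcs.Dumbbell D u₁ v₁ α β γ
  structure = record
    { arc-α  = Mα.map-arc A.cycle-arc local-α
    ; arc-β  = subst (λ s → GraphArcs.Arc D s β v₁) (cong Right.inl Left.inr-v)
                 (Mβ.map-arc B′.path-arc (λ i∈ → local-β (inner≢0 i∈) (inner≢last i∈)))
    ; arc-γ  = subst (λ s → GraphArcs.Arc D s γ s) Right.inr-v (Mγ.map-arc Γ.cycle-arc local-γ)
    ; unique = all-members-unique vertices complete length-vertices
    ; at-u   = at-u
    ; at-v   = at-v
    }
    where
    cycle-neighbour : ∀ {N} {y : Fin (suc N)} → adj (cycle (suc N)) zero y ≡ true → y ∈ List.tabulate suc
    cycle-neighbour {N} {zero} e  = contradiction (trans (sym (irreflexive (cycle (suc N)) zero)) e) λ ()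
    cycle-neighbour {N} {suc i} e = Mem.∈-tabulate⁺ i
    at-u : ∀ {y} → adj D u₁ y ≡ true → y ∈ α ⊎ y ≡ firstOf β v₁
    at-u {y} e with Right.left-local {Left.inl zero} (hub≢left {zero}) {y} e
    ... | y′ , refl , e₁ with Left.hub-local {y′} e₁
    ...   | inj₁ (j , refl , e₂) = inj₁ (∈-map⁺ fα (cycle-neighbour {2 + p} {j} e₂))
    ...   | inj₂ (w , refl , e₂) = inj₂ (trans (cong fβ (B′.start-edge {w} e₂)) (sym (Mβ.firstOf-map B′.inner (fromℕ (suc r)))))
    at-v : ∀ {y} → adj D v₁ y ≡ true → y ∈ γ ⊎ y ≡ lastOf β u₁
    at-v {y} e with Right.hub-local {y} e
    ... | inj₂ (w , refl , e₁) = inj₁ (∈-map⁺ fγ (cycle-neighbour {2 + q} {w} e₁))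
    ... | inj₁ (y′ , refl , e₁) with Left.right-local {fromℕ (suc r)} (λ ()) {y′} e₁
    ...   | w , refl , e₂ = inj₂ (trans (cong fβ (B′.final-edge {w} e₂))
      (trans (sym (Mβ.lastOf-map B′.inner zero)) (cong (lastOf β) (cong Right.inl Left.inr-v))))

-- Coefficients of low order

sgn : ℕ → ℤ
sgn zero    = 1ℤ
sgn (suc k) = ℤ.- sgn k

ind : ℕ → ℕ → ℕ
ind zero    zero    = 1
ind zero    (suc t) = 0
ind (suc i) zero    = 0
ind (suc i) (suc t) = ind i t

Z-ind : ∀ i t → Z i ‼ t ≡ + ind i t
Z-ind zero    zero    = refl
Z-ind zero    (suc t) = refl
Z-ind (suc i) zero    = refl
Z-ind (suc i) (suc t) = Z-ind i t

infix 4 _≐_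

record _≐_ (f g : Series) : Set where
  constructor exactly
  field mod : ∀ m → Truncated._≋_ exact m f g
  coefficient : ∀ i → f ‼ i ≡ g ‼ i
  coefficient i = Truncated.at (mod (suc i)) i ℕ.≤-refl
open _≐_ public

s-Z : ∀ k → s k ≐ C (sgn k) ⊗ Z (k + k)
s-Z k = exactly λ m → go m k
  where
  go : ∀ m k → Truncated._≋_ exact m (s k) (C (sgn k) ⊗ Z (k + k))
  go m zero    = solve 0 (con 1ℤ := con 1ℤ :* con 1ℤ) ≋-refl
    where open Truncated exact m
  go m (suc k) = begin
    ⊝ (z² ⊗ s k)                            ≈⟨ ⊝-cong (⊗-cong ≋-refl (go m k)) ⟩
    ⊝ (z² ⊗ (C (sgn k) ⊗ Z (k + k)))
      ≈⟨ solve 3 (λ z a y → :- (z :* z :* (a :* y)) := :- a :* (z :* (z :* y))) ≋-refl (Z 1) (C (sgn k)) (Z (k + k)) ⟩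
    ⊝ C (sgn k) ⊗ (Z 1 ⊗ (Z 1 ⊗ Z (k + k)))
      ≈⟨ ⊗-cong (≗⇒≋ λ { zero → refl ; (suc _) → refl })
           (≋-trans (⊗-cong ≋-refl (≋-sym (Z-hom 1 (k + k)))) (≋-trans (≋-sym (Z-hom 1 (suc (k + k)))) (≋-reflexive (cong (Z ∘ suc) (sym (ℕ.+-suc k k)))))) ⟩
    C (ℤ.- sgn k) ⊗ Z (suc (k + suc k))     ∎
    where
    open Truncated exact m
    open SetoidReasoning setoid

sgn-cases : ∀ k → sgn k ≡ 1ℤ ⊎ sgn k ≡ ℤ.-1ℤ
sgn-cases zero    = inj₁ refl
sgn-cases (suc k) = [ (λ e → inj₂ (cong ℤ.-_ e)) , (λ e → inj₁ (cong ℤ.-_ e)) ]′ (sgn-cases k)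

Even : ℤ → Set
Even a = ∃ λ k → a ≡ k ℤ.+ k

even-+ : ∀ {a b} → Even a → Even b → Even (a ℤ.+ b)
even-+ (k , refl) (l , refl) = k ℤ.+ l , lemma k l
  where
  lemma : ∀ k l → k ℤ.+ k ℤ.+ (l ℤ.+ l) ≡ k ℤ.+ l ℤ.+ (k ℤ.+ l)
  lemma = ℤ-Solver.solve-∀

even-neg : ∀ {a} → Even a → Even (ℤ.- a)
even-neg (k , refl) = ℤ.- k , ℤ.neg-distrib-+ k k

odd-1 : ¬ Even 1ℤ
odd-1 (k , e) = lemma k e
  where
  lemma : ∀ k → 1ℤ ≢ k ℤ.+ k
  lemma (+ zero)     ()
  lemma (+ suc n)    e = contradiction (ℤ.+-injective e) λ q → contradiction (trans q (cong suc (ℕ.+-suc n n))) λ ()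
  lemma (-[1+ n ])   ()

Unit : ℤ → Set
Unit a = a ≡ 1ℤ ⊎ a ≡ ℤ.-1ℤ

unit-odd : ∀ {a} → Unit a → ¬ Even a
unit-odd (inj₁ refl) ev = odd-1 ev
unit-odd (inj₂ refl) ev = odd-1 (even-neg ev)

unit-neg : ∀ {a} → Unit a → Unit (ℤ.- a)
unit-neg (inj₁ refl) = inj₂ refl
unit-neg (inj₂ refl) = inj₁ refl

-- The first non-zero coefficient is a unit: an even coefficient whose predecessors vanish must vanish.

record Leading (F : Series) : Set where
  constructor leading
  field unit : ∀ N → (∀ i → i < N → F ‼ i ≡ 0ℤ) → F ‼ N ≡ 0ℤ ⊎ Unit (F ‼ N)
  vanish : ∀ N → (∀ i → i < N → F ‼ i ≡ 0ℤ) → Even (F ‼ N) → F ‼ N ≡ 0ℤ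
  vanish N zeros ev = [ id , (λ un → contradiction ev (unit-odd un)) ]′ (unit N zeros)
open Leading public

Z-coefficient : ∀ k h N → k ≤ N → (Z k ⊗ h) ‼ N ≡ h ‼ (N ∸ k)
Z-coefficient k h N k≤N = subst (λ M → (Z k ⊗ h) ‼ M ≡ h ‼ (N ∸ k)) (ℕ.m+[n∸m]≡n k≤N) (Z-shift k h (N ∸ k))

unit-start : ∀ F M → Unit (F ‼ M) → (∀ i → i < M → F ‼ i ≡ 0ℤ) → Leading F
unit-start F M un below = leading go
  where
  go : ∀ N → (∀ i → i < N → F ‼ i ≡ 0ℤ) → F ‼ N ≡ 0ℤ ⊎ Unit (F ‼ N)
  go N zeros with ℕ.<-cmp N M
  ... | tri< N<M _ _  = inj₁ (below N N<M)
  ... | tri≈ _ refl _ = inj₂ un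
  ... | tri> _ _ M<N  = contradiction (subst Even (sym (zeros M M<N)) (0ℤ , refl)) (unit-odd un)

private
  low-product : ∀ l h → s l ⊗ h ≐ (Z (l + l) ⊗ (C (sgn l) ⊗ h))
  low-product l h = exactly λ m → let open Truncated exact m in
    ≋-trans (⊗-cong (mod (s-Z l) m) ≋-refl) (solve 3 (λ a y h → a :* y :* h := y :* (a :* h)) ≋-refl (C (sgn l)) (Z (l + l)) h)

s-below : ∀ l V → V ‼ 0 ≡ 0ℤ → V ‼ 1 ≡ 0ℤ → ∀ i → i < 2 + (l + l) → (s l ⊗ V) ‼ i ≡ 0ℤ
s-below l V V0 V1 i i< with i ℕ.<? l + l
... | yes i<2l = trans (coefficient (low-product l V) i) (Z-below (l + l) _ i i<2l)
... | no i≮2l  = trans (coefficient (low-product l V) i) (trans (Z-coefficient (l + l) _ i (ℕ.≮⇒≥ i≮2l)) (trans (C-⊗ (sgn l) V (i ∸ (l + l)))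
  (trans (cong (sgn l ℤ.*_) (small (i ∸ (l + l)) (ℕ.+-cancelʳ-< (l + l) _ _ (subst (_< 2 + (l + l)) (sym (ℕ.m∸n+n≡m (ℕ.≮⇒≥ i≮2l))) i<)))) (ℤ.*-zeroʳ (sgn l)))))
  where
  small : ∀ j → j < 2 → V ‼ j ≡ 0ℤ
  small 0 _ = V0
  small 1 _ = V1
  small (suc (suc j)) (s≤s (s≤s ()))

s-at : ∀ l V j → (s l ⊗ V) ‼ (l + l + j) ≡ sgn l ℤ.* V ‼ j
s-at l V j = trans (coefficient (low-product l V) (l + l + j)) (trans (Z-shift (l + l) _ j) (C-⊗ (sgn l) V j))

s-start : ∀ l V → V ‼ 2 ≡ 1ℤ → (s l ⊗ V) ‼ (l + l + 2) ≡ sgn l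
s-start l V V2 = trans (s-at l V 2) (trans (cong (sgn l ℤ.*_) V2) (ℤ.*-identityʳ (sgn l)))

leading-s : ∀ l V → V ‼ 0 ≡ 0ℤ → V ‼ 1 ≡ 0ℤ → V ‼ 2 ≡ 1ℤ → Leading (s l ⊗ V)
leading-s l V V0 V1 V2 = unit-start (s l ⊗ V) (l + l + 2) (subst Unit (sym (s-start l V V2)) (sgn-cases l))
  λ i i< → s-below l V V0 V1 i (subst (i <_) (ℕ.+-comm (l + l) 2) i<)

s-difference-start : ∀ l l′ V → V ‼ 0 ≡ 0ℤ → V ‼ 1 ≡ 0ℤ → V ‼ 2 ≡ 1ℤ → l < l′ →
  Unit ((s l ⊗ V ⊕ ⊝ (s l′ ⊗ V)) ‼ (l + l + 2)) × (∀ i → i < l + l + 2 → (s l ⊗ V ⊕ ⊝ (s l′ ⊗ V)) ‼ i ≡ 0ℤ)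
s-difference-start l l′ V V0 V1 V2 l<l′ =
  subst Unit (sym (trans (cong₂ (λ a b → a ℤ.+ ℤ.- b) (s-start l V V2) (s-below l′ V V0 V1 _ (later (ℕ.n<1+n _)))) (ℤ.+-identityʳ (sgn l)))) (sgn-cases l) ,
  λ i i< → cong₂ (λ a b → a ℤ.+ ℤ.- b) (s-below l V V0 V1 i (subst (i <_) (ℕ.+-comm (l + l) 2) i<)) (s-below l′ V V0 V1 i (later (ℕ.<-trans i< (ℕ.n<1+n _))))
  where
  later : ∀ {i} → i < suc (l + l + 2) → i < 2 + (l′ + l′)
  later i< = ℕ.<-≤-trans i< (subst (_≤ 2 + (l′ + l′)) (lemma l) (s≤s (s≤s (ℕ.<⇒≤ (ℕ.≤-trans (ℕ.≤-reflexive (sym (ℕ.+-suc (suc l) l))) (ℕ.+-mono-≤ l<l′ l<l′))))) )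
    where
    lemma : ∀ l → 2 + suc (l + l) ≡ suc (l + l + 2)
    lemma = ℕ-Solver.solve-∀

leading-neg : ∀ {F G} → F ≐ ⊝ G → Leading G → Leading F
leading-neg {F} {G} p lead = leading λ N zeros → [ (λ e₀ → inj₁ (trans (coefficient p N) (cong ℤ.-_ e₀)))
  , (λ un → inj₂ (subst Unit (sym (coefficient p N)) (unit-neg un))) ]′
  (unit lead N λ i i<N → trans (sym (ℤ.neg-involutive (G ‼ i))) (cong ℤ.-_ (trans (sym (coefficient p i)) (zeros i i<N))))

leading-≐ : ∀ {F G} → F ≐ G → Leading G → Leading F
leading-≐ p lead = leading λ N zeros → [ (λ e₀ → inj₁ (trans (coefficient p N) e₀)) , (λ un → inj₂ (subst Unit (sym (coefficient p N)) un)) ]′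
  (unit lead N λ i i<N → trans (sym (coefficient p i)) (zeros i i<N))

leading-difference : ∀ l l′ V → V ‼ 0 ≡ 0ℤ → V ‼ 1 ≡ 0ℤ → V ‼ 2 ≡ 1ℤ → Leading (s l ⊗ V ⊕ ⊝ (s l′ ⊗ V))
leading-difference l l′ V V0 V1 V2 with ℕ.<-cmp l l′
... | tri< l<l′ _ _ = let un , below = s-difference-start l l′ V V0 V1 V2 l<l′ in unit-start (s l ⊗ V ⊕ ⊝ (s l′ ⊗ V)) (l + l + 2) un below
... | tri≈ _ refl _ = leading λ N _ → inj₁ (ℤ.+-inverseʳ ((s l ⊗ V) ‼ N))
... | tri> _ _ l′<l = let un , below = s-difference-start l′ l V V0 V1 V2 l′<l in
  leading-neg (exactly λ m → let open Truncated exact m in solve 2 (λ a b → a :- b := :- (b :- a)) ≋-refl (s l ⊗ V) (s l′ ⊗ V))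
    (unit-start (s l′ ⊗ V ⊕ ⊝ (s l ⊗ V)) (l′ + l′ + 2) un below)

module _ (e : ℕ) where

  offset-1 : C 1ℤ ≐ C 1ℤ ⊕ Z e ⊗ C 0ℤ
  offset-1 = exactly λ m → let open Truncated exact m in solve 1 (λ z → con 1ℤ := con 1ℤ :+ z :* con 0ℤ) ≋-refl (Z e)

  offset-mul : ∀ {f f′ y y′} → f ≐ C 1ℤ ⊕ Z e ⊗ y → f′ ≐ C 1ℤ ⊕ Z e ⊗ y′ → f ⊗ f′ ≐ C 1ℤ ⊕ Z e ⊗ (y ⊕ y′ ⊕ Z e ⊗ (y ⊗ y′))
  offset-mul {y = y} {y′} p q = exactly λ m → let open Truncated exact m in ≋-trans (⊗-cong (mod p m) (mod q m))
    (solve 3 (λ z a b → (con 1ℤ :+ z :* a) :* (con 1ℤ :+ z :* b) := con 1ℤ :+ z :* (a :+ b :+ z :* (a :* b))) ≋-refl (Z e) y y′)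

  s-offset : ℕ → Series
  s-offset i = C (sgn (e + i)) ⊗ Z (e + (i + i))

  s-split : ∀ i → s (e + i) ≐ Z e ⊗ s-offset i
  s-split i = exactly λ m → let open Truncated exact m in ≋-trans (mod (s-Z (e + i)) m)
    (≋-trans (⊗-cong ≋-refl (≋-trans (≋-reflexive (cong Z (lemma e i))) (Z-hom e (e + (i + i)))))
      (solve 3 (λ a y z → a :* (z :* y) := z :* (a :* y)) ≋-refl (C (sgn (e + i))) (Z (e + (i + i))) (Z e)))
    where
    lemma : ∀ e i → e + i + (e + i) ≡ e + (e + (i + i))
    lemma = ℕ-Solver.solve-∀

  c-split : ∀ i → c (e + i) ≐ C 1ℤ ⊕ Z e ⊗ (C (+ 2) ⊗ Z i ⊕ C 1ℤ ⊗ s-offset i)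
  c-split i = exactly λ m → let open Truncated exact m in ≋-trans (⊕-cong (⊕-cong ≋-refl (⊗-cong ≋-refl (Z-hom e i))) (mod (s-split i) m))
    (solve 3 (λ z y t → con 1ℤ :+ con (+ 2) :* (z :* y) :+ z :* t := con 1ℤ :+ z :* (con (+ 2) :* y :+ con 1ℤ :* t)) ≋-refl (Z e) (Z i) (s-offset i))

  X-split : ∀ i → X (e + i) ≐ C 1ℤ ⊕ Z e ⊗ (C (+ 2) ⊗ (u ⊗ Z i) ⊕ v ⊗ s-offset i)
  X-split i = exactly λ m → let open Truncated exact m in ≋-trans (⊕-cong (⊕-cong ≋-refl (⊗-cong ≋-refl (Z-hom e i))) (⊗-cong ≋-refl (mod (s-split i) m)))
    (solve 5 (λ z y t u v → con 1ℤ :+ con (+ 2) :* u :* (z :* y) :+ v :* (z :* t) := con 1ℤ :+ z :* (con (+ 2) :* (u :* y) :+ v :* t))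
      ≋-refl (Z e) (Z i) (s-offset i) u v)

  Y-offset : ℕ → Series
  Y-offset i = C (+ 2) ⊗ (u ⊗ Z i) ⊕ w ⊗ s-offset i

  Y-split : ∀ i → Y (e + i) ≐ ⊝ κ ⊕ Z e ⊗ Y-offset i
  Y-split i = exactly λ m → let open Truncated exact m in ≋-trans (⊕-cong (⊕-cong ≋-refl (⊗-cong ≋-refl (Z-hom e i))) (⊗-cong ≋-refl (mod (s-split i) m)))
    (solve 6 (λ z y t u v k → :- k :+ con (+ 2) :* u :* (z :* y) :+ v :* (z :* t) := :- k :+ z :* (con (+ 2) :* (u :* y) :+ v :* t))
      ≋-refl (Z e) (Z i) (s-offset i) u w κ)

count : List ℕ → ℕ → ℕ
count []       t = 0
count (i ∷ is) t = ind i t + count is t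

total : List ℕ → Series
total []       = C 0ℤ
total (i ∷ is) = Z i ⊕ total is

total-count : ∀ is t → total is ‼ t ≡ + count is t
total-count []       zero    = refl
total-count []       (suc t) = refl
total-count (i ∷ is) t       = cong₂ ℤ._+_ (Z-ind i t) (total-count is t)

-- Series of the form 1 + zᵉ y, with y known modulo z⁴.  For e ≥ 3 the second-order term zᵉ · zᵉ
-- matters only through the constant g.

module Window (e : ℕ) (3≤e : 3 ≤ e) where
  open Truncated exact 4
  open SetoidReasoning setoid

  Ze-⊗ : ∀ h → Z e ⊗ h ≋ C (h ‼ 0) ⊗ Z e
  Ze-⊗ h = eqs coefficients
    where
    coefficients : ∀ i → i < 4 → (Z e ⊗ h) ‼ i ≡ (C (h ‼ 0) ⊗ Z e) ‼ i
    coefficients i i<4 with ℕ.<-cmp i e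
    ... | tri< i<e _ _  = trans (Z-below e h i i<e) (sym (trans (C-⊗ (h ‼ 0) (Z e) i) (trans (cong (h ‼ 0 ℤ.*_) (Z-lt e i i<e)) (ℤ.*-zeroʳ (h ‼ 0)))))
    ... | tri≈ _ refl _ = trans (trans (Z-coefficient e h e ℕ.≤-refl) (cong (h ‼_) (ℕ.n∸n≡0 e)))
      (sym (trans (C-⊗ (h ‼ 0) (Z e) e) (trans (cong (h ‼ 0 ℤ.*_) (trans (Z-ind e e) (cong +_ (ind-refl e)))) (ℤ.*-identityʳ _))))
      where
      ind-refl : ∀ e → ind e e ≡ 1
      ind-refl zero    = refl
      ind-refl (suc e) = ind-refl e
    ... | tri> _ _ e<i  = contradiction (ℕ.≤-trans (s≤s (s≤s 3≤e)) (ℕ.≤-trans (s≤s e<i) i<4)) λ { (s≤s (s≤s (s≤s (s≤s ())))) }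

  Ze-0 : Z e ‼ 0 ≡ 0ℤ
  Ze-0 = Z-lt e 0 (ℕ.≤-trans (s≤s z≤n) 3≤e)

  Z≋0-from : ∀ k → 4 ≤ k → Z k ≋ C 0ℤ
  Z≋0-from k 4≤k = Z≋0 k 4≤k

  C-cong₄ : ∀ {a b} → a ≡ b → C a ≋ C b
  C-cong₄ refl = ≋-refl

  C-+ : ∀ a b → C (a ℤ.+ b) ≋ C a ⊕ C b
  C-+ a b = ≗⇒≋ λ { zero → refl ; (suc _) → refl }

  C-*₄ : ∀ a b → C (a ℤ.* b) ≋ C a ⊗ C b
  C-*₄ a b = ≗⇒≋ λ { zero → refl ; (suc i) → C-*0 a b i }

  record Win (f lin : Series) (g : ℤ) : Set where
    field
      y      : Series
      expand : f ≐ C 1ℤ ⊕ Z e ⊗ y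
      low    : y ≋ C (+ 2) ⊗ lin ⊕ C g ⊗ Z e
    y-0 : y ‼ 0 ≡ + 2 ℤ.* lin ‼ 0
    y-0 = trans (at low 0 (s≤s z≤n)) (trans (cong (λ t → + 2 ℤ.* lin ‼ 0 ℤ.+ g ℤ.* t) Ze-0) (trans (cong (λ t → + 2 ℤ.* lin ‼ 0 ℤ.+ t) (ℤ.*-zeroʳ g)) (ℤ.+-identityʳ _)))
  open Win

  win-1 : Win (C 1ℤ) (C 0ℤ) 0ℤ
  win-1 = record
    { y = C 0ℤ
    ; expand = offset-1 e
    ; low = solve 1 (λ z → con 0ℤ := con (+ 2) :* con 0ℤ :+ con 0ℤ :* z) ≋-refl (Z e) }

  win-mul : ∀ {f f′ lin lin′ g g′} → Win f lin g → Win f′ lin′ g′ →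
    Win (f ⊗ f′) (lin ⊕ lin′) (g ℤ.+ g′ ℤ.+ (+ 2 ℤ.* lin ‼ 0) ℤ.* (+ 2 ℤ.* lin′ ‼ 0))
  win-mul {f} {f′} {lin} {lin′} {g} {g′} W W′ = record
    { y = y W ⊕ y W′ ⊕ Z e ⊗ (y W ⊗ y W′)
    ; expand = offset-mul e (expand W) (expand W′)
    ; low = begin
        y W ⊕ y W′ ⊕ Z e ⊗ (y W ⊗ y W′)
          ≈⟨ ⊕-cong (⊕-cong (low W) (low W′)) (≋-trans (Ze-⊗ (y W ⊗ y W′)) (⊗-cong (C-cong₄ (cong₂ ℤ._*_ (y-0 W) (y-0 W′))) ≋-refl)) ⟩
        (C (+ 2) ⊗ lin ⊕ C g ⊗ Z e) ⊕ (C (+ 2) ⊗ lin′ ⊕ C g′ ⊗ Z e) ⊕ C q ⊗ Z e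
          ≈⟨ solve 6 (λ a b g h q z → (con (+ 2) :* a :+ g :* z) :+ (con (+ 2) :* b :+ h :* z) :+ q :* z :=
               con (+ 2) :* (a :+ b) :+ (g :+ h :+ q) :* z) ≋-refl lin lin′ (C g) (C g′) (C q) (Z e) ⟩
        C (+ 2) ⊗ (lin ⊕ lin′) ⊕ (C g ⊕ C g′ ⊕ C q) ⊗ Z e
          ≈⟨ ⊕-cong ≋-refl (⊗-cong (≋-sym (≋-trans (C-+ (g ℤ.+ g′) q) (⊕-cong (C-+ g g′) ≋-refl))) ≋-refl) ⟩
        C (+ 2) ⊗ (lin ⊕ lin′) ⊕ C (g ℤ.+ g′ ℤ.+ q) ⊗ Z e ∎
    }
    where q = (+ 2 ℤ.* lin ‼ 0) ℤ.* (+ 2 ℤ.* lin′ ‼ 0)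

  second-order : ∀ i h → h ‼ 0 ≡ 1ℤ → h ⊗ s-offset e i ≋ C (sgn e ℤ.* + ind i 0) ⊗ Z e
  second-order zero    h h0 = begin
    h ⊗ (C (sgn (e + 0)) ⊗ Z (e + 0))
      ≈⟨ ⊗-cong ≋-refl (⊗-cong (C-cong₄ (cong sgn (ℕ.+-identityʳ e))) (≋-reflexive (cong Z (ℕ.+-identityʳ e)))) ⟩
    h ⊗ (C (sgn e) ⊗ Z e)             ≈⟨ solve 3 (λ h a z → h :* (a :* z) := a :* (z :* h)) ≋-refl h (C (sgn e)) (Z e) ⟩
    C (sgn e) ⊗ (Z e ⊗ h)             ≈⟨ ⊗-cong ≋-refl (≋-trans (Ze-⊗ h) (⊗-cong (C-cong₄ h0) ≋-refl)) ⟩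
    C (sgn e) ⊗ (C 1ℤ ⊗ Z e)          ≈⟨ solve 2 (λ a z → a :* (con 1ℤ :* z) := a :* z) ≋-refl (C (sgn e)) (Z e) ⟩
    C (sgn e) ⊗ Z e                   ≈⟨ ⊗-cong (C-cong₄ (sym (ℤ.*-identityʳ (sgn e)))) ≋-refl ⟩
    C (sgn e ℤ.* 1ℤ) ⊗ Z e            ∎
  second-order (suc i) h h0 = begin
    h ⊗ (C (sgn (e + suc i)) ⊗ Z (e + (suc i + suc i)))
      ≈⟨ ⊗-cong ≋-refl (⊗-cong ≋-refl (Z≋0-from _ (ℕ.+-mono-≤ 3≤e (s≤s z≤n)))) ⟩
    h ⊗ (C (sgn (e + suc i)) ⊗ C 0ℤ)  ≈⟨ solve 3 (λ h a z → h :* (a :* con 0ℤ) := con 0ℤ :* z) ≋-refl h (C (sgn (e + suc i))) (Z e) ⟩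
    C 0ℤ ⊗ Z e                        ≈⟨ ⊗-cong (C-cong₄ (sym (ℤ.*-zeroʳ (sgn e)))) ≋-refl ⟩
    C (sgn e ℤ.* 0ℤ) ⊗ Z e            ∎

  win-c : ∀ i → Win (c (e + i)) (Z i) (sgn e ℤ.* + ind i 0)
  win-c i = record { expand = c-split e i ; low = ⊕-cong ≋-refl (second-order i (C 1ℤ) refl) }

  win-X : ∀ i → Win (X (e + i)) (u ⊗ Z i) (sgn e ℤ.* + ind i 0)
  win-X i = record { expand = X-split e i ; low = ⊕-cong ≋-refl (second-order i v refl) }

  second : ℕ → ℤ
  second zero    = 0ℤ
  second (suc n) = second n ℤ.+ sgn e ℤ.+ + 4 ℤ.* + n

  second-+ : ∀ j k → second (j + k) ≡ second j ℤ.+ second k ℤ.+ (+ 2 ℤ.* + j) ℤ.* (+ 2 ℤ.* + k)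
  second-+ zero    k = lemma (second k) (+ k)
    where
    lemma : ∀ a k → a ≡ 0ℤ ℤ.+ a ℤ.+ (+ 2 ℤ.* 0ℤ) ℤ.* (+ 2 ℤ.* k)
    lemma = ℤ-Solver.solve-∀
  second-+ (suc j) k = trans (cong (λ t → t ℤ.+ sgn e ℤ.+ + 4 ℤ.* + (j + k)) (second-+ j k))
    (lemma (second j) (second k) (sgn e) (+ j) (+ k))
    where
    lemma : ∀ a b e j k → a ℤ.+ b ℤ.+ (+ 2 ℤ.* j) ℤ.* (+ 2 ℤ.* k) ℤ.+ e ℤ.+ + 4 ℤ.* (j ℤ.+ k) ≡
      a ℤ.+ e ℤ.+ + 4 ℤ.* j ℤ.+ b ℤ.+ (+ 2 ℤ.* (1ℤ ℤ.+ j)) ℤ.* (+ 2 ℤ.* k)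
    lemma = ℤ-Solver.solve-∀

  ind-second : ∀ i → sgn e ℤ.* + ind i 0 ≡ second (ind i 0)
  ind-second zero    = lemma (sgn e)
    where
    lemma : ∀ a → a ℤ.* 1ℤ ≡ 0ℤ ℤ.+ a ℤ.+ + 4 ℤ.* 0ℤ
    lemma = ℤ-Solver.solve-∀
  ind-second (suc i) = ℤ.*-zeroʳ (sgn e)

  win-cong : ∀ {f lin lin′ g g′} → lin ≋ lin′ → g ≡ g′ → Win f lin g → Win f lin′ g′
  win-cong p q W = record { y = y W ; expand = expand W ; low = ≋-trans (low W) (⊕-cong (⊗-cong ≋-refl p) (⊗-cong (C-cong₄ q) ≋-refl)) }

  win-cycles : ∀ is → Win (cycles (map (λ i → e + i) is)) (total is) (second (count is 0))
  win-cycles []       = win-1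
  win-cycles (i ∷ is) = win-cong ≋-refl
    (trans (cong₂ (λ a b → a ℤ.+ second (count is 0) ℤ.+ b) (ind-second i)
      (cong₂ (λ a b → (+ 2 ℤ.* a) ℤ.* (+ 2 ℤ.* b)) (Z-ind i 0) (total-count is 0)))
      (sym (second-+ (ind i 0) (count is 0)))) (win-mul (win-c i) (win-cycles is))

-- lam l is 1 exactly when the hubs are adjacent; only then does the path interact with cycles modulo z⁴.

lam : ℕ → ℕ
lam zero          = 0
lam (suc zero)    = 1
lam (suc (suc l)) = 0

lam≤1 : ∀ l → lam l ≤ 1
lam≤1 zero          = z≤n
lam≤1 (suc zero)    = s≤s z≤n
lam≤1 (suc (suc l)) = z≤n

offset-difference : ∀ e U S T S′ T′ W {f f′ k y y′ q} → f ≐ C 1ℤ ⊕ Z e ⊗ y → f′ ≐ C 1ℤ ⊕ Z e ⊗ y′ → k ≐ C 1ℤ ⊕ Z e ⊗ q →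
  U ⊗ f ⊕ ⊝ (S ⊗ (W ⊕ Z e ⊗ T)) ≐ (U ⊗ f′ ⊕ ⊝ (S′ ⊗ (W ⊕ Z e ⊗ T′))) ⊗ k →
  Z e ⊗ (U ⊗ (y ⊕ ⊝ (y′ ⊕ q ⊕ Z e ⊗ (y′ ⊗ q))) ⊕ ⊝ (S ⊗ T) ⊕ S′ ⊗ T′ ⊗ (C 1ℤ ⊕ Z e ⊗ q) ⊕ S′ ⊗ (W ⊗ q)) ≐ S ⊗ W ⊕ ⊝ (S′ ⊗ W)
offset-difference e U S T S′ T′ W {y = y} {y′} {q} pf pf′ pk equation = exactly λ m → let open Truncated exact m in ≋-trans
  (solve 10 (λ z U y y′ q s t s′ t′ W →
     z :* (U :* (y :- (y′ :+ q :+ z :* (y′ :* q))) :+ :- (s :* t) :+ s′ :* t′ :* (con 1ℤ :+ z :* q) :+ s′ :* (W :* q)) :=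
     (U :* (con 1ℤ :+ z :* y) :+ :- (s :* (W :+ z :* t))) :+ :- ((U :* (con 1ℤ :+ z :* y′) :+ :- (s′ :* (W :+ z :* t′))) :* (con 1ℤ :+ z :* q))
       :+ (s :* W :+ :- (s′ :* W))) ≋-refl (Z e) U y y′ q S T S′ T′ W)
  (≋-trans (⊕-cong (⊕-cong (≋-trans (⊕-cong (⊗-cong ≋-refl (≋-sym (mod pf m))) ≋-refl) (mod equation m))
     (⊝-cong (⊗-cong (⊕-cong (⊗-cong ≋-refl (≋-sym (mod pf′ m))) ≋-refl) (≋-sym (mod pk m))))) ≋-refl)
  (solve 2 (λ p q → p :+ :- p :+ q := q) ≋-refl _ _))

module LowOrder (e : ℕ) (3≤e : 3 ≤ e) where
  open Window e 3≤e
  open Truncated exact 4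
  open SetoidReasoning setoid
  open Win

  private
    Z3-⊗ : ∀ h → Z 3 ⊗ h ≋ C (h ‼ 0) ⊗ Z 3
    Z3-⊗ = Window.Ze-⊗ 3 ℕ.≤-refl

  s-⊗-low : ∀ l t → 1 ≤ l → t ‼ 0 ≡ 0ℤ → s l ⊗ t ≋ C (ℤ.- (+ lam l ℤ.* t ‼ 1)) ⊗ Z 3
  s-⊗-low (suc zero) t _ t0 = eqs coefficients
    where
    coefficients : ∀ i → i < 4 → (s 1 ⊗ t) ‼ i ≡ (C (ℤ.- (1ℤ ℤ.* t ‼ 1)) ⊗ Z 3) ‼ i
    coefficients 0 _ = lemma (t ‼ 0) (t ‼ 1)
      where
      lemma : ∀ a b → 0ℤ ℤ.* a ≡ ℤ.- (1ℤ ℤ.* b) ℤ.* 0ℤ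
      lemma = ℤ-Solver.solve-∀
    coefficients 1 _ = lemma (t ‼ 0) (t ‼ 1)
      where
      lemma : ∀ a b → 0ℤ ℤ.* b ℤ.+ 0ℤ ℤ.* a ≡ ℤ.- (1ℤ ℤ.* b) ℤ.* 0ℤ ℤ.+ 0ℤ ℤ.* 0ℤ
      lemma = ℤ-Solver.solve-∀
    coefficients 2 _ = trans (s-at 1 t 0) (trans (cong (ℤ.-1ℤ ℤ.*_) t0) (lemma (t ‼ 1)))
      where
      lemma : ∀ b → ℤ.-1ℤ ℤ.* 0ℤ ≡ ℤ.- (1ℤ ℤ.* b) ℤ.* 0ℤ ℤ.+ (0ℤ ℤ.* 0ℤ ℤ.+ 0ℤ ℤ.* 0ℤ)
      lemma = ℤ-Solver.solve-∀
    coefficients 3 _ = trans (s-at 1 t 1) (lemma (t ‼ 1))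
      where
      lemma : ∀ b → ℤ.-1ℤ ℤ.* b ≡ ℤ.- (1ℤ ℤ.* b) ℤ.* 1ℤ ℤ.+ (0ℤ ℤ.* 0ℤ ℤ.+ (0ℤ ℤ.* 0ℤ ℤ.+ 0ℤ ℤ.* 0ℤ))
      lemma = ℤ-Solver.solve-∀
    coefficients (suc (suc (suc (suc i)))) (s≤s (s≤s (s≤s (s≤s ()))))
  s-⊗-low (suc (suc l)) t _ t0 = begin
    s (2 + l) ⊗ t
      ≈⟨ ⊗-cong (≋-trans (mod (s-Z (2 + l)) 4) (⊗-cong ≋-refl (Z≋0-from _ (ℕ.+-mono-≤ {2} {2 + l} {2} {2 + l} (s≤s (s≤s z≤n)) (s≤s (s≤s z≤n)))))) ≋-refl ⟩
    C (sgn (2 + l)) ⊗ C 0ℤ ⊗ t  ≈⟨ solve 3 (λ a t z → a :* con 0ℤ :* t := con 0ℤ :* z) ≋-refl (C (sgn (2 + l))) t (Z 3) ⟩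
    C 0ℤ ⊗ Z 3                  ∎

  record LowForm (E L : Series) (G h : ℤ) : Set where
    constructor lowForm
    field form : E ≋ C (+ 2) ⊗ L ⊕ C G ⊗ Z e ⊕ C (+ 2 ℤ.* h) ⊗ Z 3

    private
      C-at : ∀ a k i → (C a ⊗ Z k) ‼ i ≡ a ℤ.* Z k ‼ i
      C-at a k i = C-⊗ a (Z k) i

    at-i : ∀ i → i < 3 → E ‼ i ≡ + 2 ℤ.* L ‼ i
    at-i i i<3 = trans (at form i (ℕ.m≤n⇒m≤1+n i<3))
      (trans (cong₂ (λ a b → (C (+ 2) ⊗ L) ‼ i ℤ.+ a ℤ.+ b)
        (trans (C-at G e i) (trans (cong (G ℤ.*_) (Z-lt e i (ℕ.<-≤-trans i<3 3≤e))) (ℤ.*-zeroʳ G)))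
        (trans (C-at (+ 2 ℤ.* h) 3 i) (trans (cong (+ 2 ℤ.* h ℤ.*_) (Z-lt 3 i i<3)) (ℤ.*-zeroʳ (+ 2 ℤ.* h)))))
      (trans (ℤ.+-identityʳ _) (trans (ℤ.+-identityʳ _) (C-⊗ (+ 2) L i))))

    at-3 : G ≡ 0ℤ → E ‼ 3 ≡ + 2 ℤ.* (L ‼ 3 ℤ.+ h)
    at-3 G0 = trans (at form 3 ℕ.≤-refl)
      (trans (cong₂ (λ a b → (C (+ 2) ⊗ L) ‼ 3 ℤ.+ a ℤ.+ b)
        (trans (C-at G e 3) (cong (ℤ._* Z e ‼ 3) G0)) (C-at (+ 2 ℤ.* h) 3 3))
      (trans (cong (λ a → a ℤ.+ 0ℤ ℤ.* Z e ‼ 3 ℤ.+ + 2 ℤ.* h ℤ.* 1ℤ) (C-⊗ (+ 2) L 3)) (lemma (L ‼ 3) (Z e ‼ 3) h)))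
      where
      lemma : ∀ a z h → + 2 ℤ.* a ℤ.+ 0ℤ ℤ.* z ℤ.+ + 2 ℤ.* h ℤ.* 1ℤ ≡ + 2 ℤ.* (a ℤ.+ h)
      lemma = ℤ-Solver.solve-∀
  open LowForm public

  twice-even : ∀ a → Even (+ 2 ℤ.* a)
  twice-even a = a , lemma a
    where
    lemma : ∀ a → + 2 ℤ.* a ≡ a ℤ.+ a
    lemma = ℤ-Solver.solve-∀

  twice-zero : ∀ {a} → + 2 ℤ.* a ≡ 0ℤ → a ≡ 0ℤ
  twice-zero {a} p = ℤ.*-cancelˡ-≡ (+ 2) a 0ℤ p

  offset-at : ∀ E i → (Z e ⊗ E) ‼ (e + i) ≡ E ‼ i
  offset-at E i = Z-shift e E i

  offset-zeros : ∀ E i → (∀ j → j < i → E ‼ j ≡ 0ℤ) → ∀ k → k < e + i → (Z e ⊗ E) ‼ k ≡ 0ℤ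
  offset-zeros E i h k k< with k ℕ.<? e
  ... | yes k<e = Z-below e E k k<e
  ... | no k≮e  = trans (Z-coefficient e E k (ℕ.≮⇒≥ k≮e)) (h (k ∸ e) (ℕ.+-cancelʳ-< e _ _
    (subst₂ _<_ (sym (ℕ.m∸n+n≡m (ℕ.≮⇒≥ k≮e))) (ℕ.+-comm e i) k<)))

  climb : ∀ E → Leading (Z e ⊗ E) → ∀ i → (∀ j → j < i → E ‼ j ≡ 0ℤ) → Even (E ‼ i) → E ‼ i ≡ 0ℤ
  climb E lead i zeros ev = trans (sym (offset-at E i)) (vanish lead (e + i) (offset-zeros E i zeros) (subst Even (sym (offset-at E i)) ev))

  all-vanish : ∀ {E L G h} → Leading (Z e ⊗ E) → LowForm E L G h → (L ‼ 0 ≡ 0ℤ → G ≡ 0ℤ) → L ‼ 0 ≡ 0ℤ × L ‼ 3 ℤ.+ h ≡ 0ℤ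
  all-vanish {E} {L} {G} {h} lead F G0 = L0 , twice-zero (trans (sym (at-3 F (G0 L0))) E3)
    where
    step-i : ∀ i → i < 3 → (∀ j → j < i → E ‼ j ≡ 0ℤ) → E ‼ i ≡ 0ℤ
    step-i i i<3 zeros = climb E lead i zeros (subst Even (sym (at-i F i i<3)) (twice-even (L ‼ i)))
    E0 : E ‼ 0 ≡ 0ℤ
    E0 = step-i 0 (s≤s z≤n) λ _ ()
    E1 : E ‼ 1 ≡ 0ℤ
    E1 = step-i 1 (s≤s (s≤s z≤n)) λ { 0 _ → E0 ; (suc _) (s≤s ()) }
    E2 : E ‼ 2 ≡ 0ℤ
    E2 = step-i 2 (s≤s (s≤s (s≤s z≤n))) λ { 0 _ → E0 ; 1 _ → E1 ; (suc (suc _)) (s≤s (s≤s ())) }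
    L0 : L ‼ 0 ≡ 0ℤ
    L0 = twice-zero (trans (sym (at-i F 0 (s≤s z≤n))) E0)
    E3 : E ‼ 3 ≡ 0ℤ
    E3 = climb E lead 3 (λ { 0 _ → E0 ; 1 _ → E1 ; 2 _ → E2 ; (suc (suc (suc _))) (s≤s (s≤s (s≤s ()))) })
      (subst Even (sym (at-3 F (G0 L0))) (twice-even (L ‼ 3 ℤ.+ h)))

  difference-low : ∀ {f f′ lin lin′ g g′} (W : Win f lin g) (W′ : Win f′ lin′ g′) →
    y W ⊕ ⊝ y W′ ≋ C (+ 2) ⊗ (lin ⊕ ⊝ lin′) ⊕ C (g ℤ.- g′) ⊗ Z e
  difference-low {lin = lin} {lin′} {g} {g′} W W′ = begin
    y W ⊕ ⊝ y W′ ≈⟨ ⊕-cong (low W) (⊝-cong (low W′)) ⟩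
    C (+ 2) ⊗ lin ⊕ C g ⊗ Z e ⊕ ⊝ (C (+ 2) ⊗ lin′ ⊕ C g′ ⊗ Z e)
      ≈⟨ solve 5 (λ a b g h z → con (+ 2) :* a :+ g :* z :- (con (+ 2) :* b :+ h :* z) := con (+ 2) :* (a :- b) :+ (g :- h) :* z) ≋-refl lin lin′ (C g) (C g′) (Z e) ⟩
    C (+ 2) ⊗ (lin ⊕ ⊝ lin′) ⊕ (C g ⊕ ⊝ C g′) ⊗ Z e
      ≈⟨ ⊕-cong ≋-refl (⊗-cong (≗⇒≋ λ { zero → refl ; (suc _) → refl }) ≋-refl) ⟩
    C (+ 2) ⊗ (lin ⊕ ⊝ lin′) ⊕ C (g ℤ.- g′) ⊗ Z e ∎

  module Compare {U W f f′ k A A′ K t t′ g g′ gk μ} (l l′ : ℕ) (1≤l : 1 ≤ l) (1≤l′ : 1 ≤ l′)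
    (U-low : U ≋ C 1ℤ ⊕ C (+ 2 ℤ.* μ) ⊗ Z 3) (W0 : W ‼ 0 ≡ 0ℤ) (W1 : W ‼ 1 ≡ 0ℤ) (W2 : W ‼ 2 ≡ 1ℤ)
    (wf : Win f (u ⊗ A) g) (wf′ : Win f′ (u ⊗ A′) g′) (wk : Win k K gk)
    (t0 : t ‼ 0 ≡ 0ℤ) (t1 : t ‼ 1 ≡ ℤ.- (+ 2 ℤ.* A ‼ 0)) (t0′ : t′ ‼ 0 ≡ 0ℤ) (t1′ : t′ ‼ 1 ≡ ℤ.- (+ 2 ℤ.* A′ ‼ 0))
    (equation : U ⊗ f ⊕ ⊝ (s l ⊗ (W ⊕ Z e ⊗ t)) ≐ (U ⊗ f′ ⊕ ⊝ (s l′ ⊗ (W ⊕ Z e ⊗ t′))) ⊗ k) where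

    private
      wf′k : Win (f′ ⊗ k) (u ⊗ A′ ⊕ K) (g′ ℤ.+ gk ℤ.+ (+ 2 ℤ.* (u ⊗ A′) ‼ 0) ℤ.* (+ 2 ℤ.* K ‼ 0))
      wf′k = win-mul wf′ wk

      D E L : Series
      D = y wf ⊕ ⊝ y wf′k
      E = U ⊗ D ⊕ ⊝ (s l ⊗ t) ⊕ s l′ ⊗ t′ ⊗ (C 1ℤ ⊕ Z e ⊗ y wk) ⊕ s l′ ⊗ (W ⊗ y wk)
      L = u ⊗ A ⊕ ⊝ (u ⊗ A′ ⊕ K)

      G h : ℤ
      G = g ℤ.- (g′ ℤ.+ gk ℤ.+ (+ 2 ℤ.* (u ⊗ A′) ‼ 0) ℤ.* (+ 2 ℤ.* K ‼ 0))
      h = + 2 ℤ.* (μ ℤ.* L ‼ 0) ℤ.- + lam l ℤ.* A ‼ 0 ℤ.+ + lam l′ ℤ.* A′ ‼ 0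

      shifted : Z e ⊗ E ≐ s l ⊗ W ⊕ ⊝ (s l′ ⊗ W)
      shifted = offset-difference e U (s l) t (s l′) t′ W (expand wf) (expand wf′) (expand wk) equation

      D-0 : D ‼ 0 ≡ + 2 ℤ.* L ‼ 0
      D-0 = trans (cong₂ (λ a b → a ℤ.- b) (y-0 wf) (y-0 wf′k)) (lemma ((u ⊗ A) ‼ 0) ((u ⊗ A′) ‼ 0) (K ‼ 0))
        where
        lemma : ∀ a b c → + 2 ℤ.* a ℤ.- + 2 ℤ.* (b ℤ.+ c) ≡ + 2 ℤ.* (a ℤ.- (b ℤ.+ c))
        lemma = ℤ-Solver.solve-∀

      E-low : LowForm E L G h
      E-low = lowForm (begin
        U ⊗ D ⊕ ⊝ (s l ⊗ t) ⊕ s l′ ⊗ t′ ⊗ (C 1ℤ ⊕ Z e ⊗ y wk) ⊕ s l′ ⊗ (W ⊗ y wk)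
          ≈⟨ ⊕-cong (⊕-cong (⊕-cong UD (⊝-cong st)) st′) sW ⟩
        (D ⊕ C (+ 2 ℤ.* μ ℤ.* (+ 2 ℤ.* L ‼ 0)) ⊗ Z 3) ⊕ ⊝ (C (+ 2 ℤ.* (+ lam l ℤ.* A ‼ 0)) ⊗ Z 3) ⊕ C (+ 2 ℤ.* (+ lam l′ ℤ.* A′ ‼ 0)) ⊗ Z 3 ⊕ C 0ℤ
          ≈⟨ solve 5 (λ d a b c z → (d :+ a :* z) :+ :- (b :* z) :+ c :* z :+ con 0ℤ := d :+ (a :- b :+ c) :* z) ≋-refl D _ _ _ (Z 3) ⟩
        D ⊕ (C (+ 2 ℤ.* μ ℤ.* (+ 2 ℤ.* L ‼ 0)) ⊕ ⊝ C (+ 2 ℤ.* (+ lam l ℤ.* A ‼ 0)) ⊕ C (+ 2 ℤ.* (+ lam l′ ℤ.* A′ ‼ 0))) ⊗ Z 3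
          ≈⟨ ⊕-cong (difference-low wf wf′k) (⊗-cong (≗⇒≋ λ { zero → lemma μ (L ‼ 0) (+ lam l ℤ.* A ‼ 0) (+ lam l′ ℤ.* A′ ‼ 0) ; (suc _) → refl }) ≋-refl) ⟩
        C (+ 2) ⊗ L ⊕ C G ⊗ Z e ⊕ C (+ 2 ℤ.* h) ⊗ Z 3 ∎)
        where
        lemma : ∀ μ a b c → + 2 ℤ.* μ ℤ.* (+ 2 ℤ.* a) ℤ.+ ℤ.- (+ 2 ℤ.* b) ℤ.+ + 2 ℤ.* c ≡ + 2 ℤ.* (+ 2 ℤ.* (μ ℤ.* a) ℤ.- b ℤ.+ c)
        lemma = ℤ-Solver.solve-∀
        UD : U ⊗ D ≋ D ⊕ C (+ 2 ℤ.* μ ℤ.* (+ 2 ℤ.* L ‼ 0)) ⊗ Z 3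
        UD = begin
          U ⊗ D ≈⟨ ⊗-cong U-low ≋-refl ⟩
          (C 1ℤ ⊕ C (+ 2 ℤ.* μ) ⊗ Z 3) ⊗ D ≈⟨ solve 3 (λ a z d → (con 1ℤ :+ a :* z) :* d := d :+ a :* (z :* d)) ≋-refl (C (+ 2 ℤ.* μ)) (Z 3) D ⟩
          D ⊕ C (+ 2 ℤ.* μ) ⊗ (Z 3 ⊗ D) ≈⟨ ⊕-cong ≋-refl (⊗-cong ≋-refl (≋-trans (Z3-⊗ D) (⊗-cong (C-cong₄ D-0) ≋-refl))) ⟩
          D ⊕ C (+ 2 ℤ.* μ) ⊗ (C (+ 2 ℤ.* L ‼ 0) ⊗ Z 3) ≈⟨ solve 4 (λ d a b z → d :+ a :* (b :* z) := d :+ a :* b :* z) ≋-refl D (C (+ 2 ℤ.* μ)) (C (+ 2 ℤ.* L ‼ 0)) (Z 3) ⟩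
          D ⊕ C (+ 2 ℤ.* μ) ⊗ C (+ 2 ℤ.* L ‼ 0) ⊗ Z 3 ≈⟨ ⊕-cong ≋-refl (⊗-cong (≋-sym (C-*₄ (+ 2 ℤ.* μ) (+ 2 ℤ.* L ‼ 0))) ≋-refl) ⟩
          D ⊕ C (+ 2 ℤ.* μ ℤ.* (+ 2 ℤ.* L ‼ 0)) ⊗ Z 3 ∎
        sign : ∀ λ′ a → ℤ.- (λ′ ℤ.* ℤ.- (+ 2 ℤ.* a)) ≡ + 2 ℤ.* (λ′ ℤ.* a)
        sign = ℤ-Solver.solve-∀
        st : s l ⊗ t ≋ C (+ 2 ℤ.* (+ lam l ℤ.* A ‼ 0)) ⊗ Z 3
        st = ≋-trans (s-⊗-low l t 1≤l t0) (⊗-cong (C-cong₄ (trans (cong (λ a → ℤ.- (+ lam l ℤ.* a)) t1) (sign (+ lam l) (A ‼ 0)))) ≋-refl)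
        st′ : s l′ ⊗ t′ ⊗ (C 1ℤ ⊕ Z e ⊗ y wk) ≋ C (+ 2 ℤ.* (+ lam l′ ℤ.* A′ ‼ 0)) ⊗ Z 3
        st′ = begin
          s l′ ⊗ t′ ⊗ (C 1ℤ ⊕ Z e ⊗ y wk)
            ≈⟨ ⊗-cong (≋-trans (s-⊗-low l′ t′ 1≤l′ t0′) (⊗-cong (C-cong₄ (trans (cong (λ a → ℤ.- (+ lam l′ ℤ.* a)) t1′) (sign (+ lam l′) (A′ ‼ 0)))) ≋-refl)) ≋-refl ⟩
          C (+ 2 ℤ.* (+ lam l′ ℤ.* A′ ‼ 0)) ⊗ Z 3 ⊗ (C 1ℤ ⊕ Z e ⊗ y wk)
            ≈⟨ solve 3 (λ a z h → a :* z :* h := a :* (z :* h)) ≋-refl (C (+ 2 ℤ.* (+ lam l′ ℤ.* A′ ‼ 0))) (Z 3) (C 1ℤ ⊕ Z e ⊗ y wk) ⟩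
          C (+ 2 ℤ.* (+ lam l′ ℤ.* A′ ‼ 0)) ⊗ (Z 3 ⊗ (C 1ℤ ⊕ Z e ⊗ y wk))
            ≈⟨ ⊗-cong ≋-refl (≋-trans (Z3-⊗ (C 1ℤ ⊕ Z e ⊗ y wk)) (⊗-cong (C-cong₄ (cong (λ a → 1ℤ ℤ.+ a ℤ.* y wk ‼ 0) Ze-0)) ≋-refl)) ⟩
          C (+ 2 ℤ.* (+ lam l′ ℤ.* A′ ‼ 0)) ⊗ (C 1ℤ ⊗ Z 3)
            ≈⟨ solve 2 (λ a z → a :* (con 1ℤ :* z) := a :* z) ≋-refl (C (+ 2 ℤ.* (+ lam l′ ℤ.* A′ ‼ 0))) (Z 3) ⟩
          C (+ 2 ℤ.* (+ lam l′ ℤ.* A′ ‼ 0)) ⊗ Z 3 ∎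
        sW : s l′ ⊗ (W ⊗ y wk) ≋ C 0ℤ
        sW = ≋-trans (s-⊗-low l′ (W ⊗ y wk) 1≤l′ (cong (ℤ._* y wk ‼ 0) W0))
          (≋-trans (⊗-cong (C-cong₄ (trans (cong₂ (λ a b → ℤ.- (+ lam l′ ℤ.* (a ℤ.* y wk ‼ 1 ℤ.+ b ℤ.* y wk ‼ 0))) W0 W1) (zero-lemma (+ lam l′) (y wk ‼ 1) (y wk ‼ 0)))) ≋-refl)
            (solve 1 (λ z → con 0ℤ :* z := con 0ℤ) ≋-refl (Z 3)))
          where
          zero-lemma : ∀ a b c → ℤ.- (a ℤ.* (0ℤ ℤ.* b ℤ.+ 0ℤ ℤ.* c)) ≡ 0ℤ
          zero-lemma = ℤ-Solver.solve-∀

    compare : (L ‼ 0 ≡ 0ℤ → G ≡ 0ℤ) → L ‼ 0 ≡ 0ℤ × L ‼ 3 ℤ.+ h ≡ 0ℤ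
    compare = all-vanish (leading-≐ shifted (leading-difference l l′ W W0 W1 W2)) E-low

Xs : List ℕ → Series
Xs []       = C 1ℤ
Xs (k ∷ ks) = X k ⊗ Xs ks

Y-0 : ∀ k → 3 ≤ k → Y k ‼ 0 ≡ 0ℤ
Y-0 k 3≤k = trans (cong (λ i → Y i ‼ 0) (sym (ℕ.+-identityʳ k)))
  (trans (coefficient (Y-split k 0) 0) (cong (λ t → 0ℤ ℤ.+ t) (Z-below k (Y-offset k 0) 0 (ℕ.≤-trans (s≤s z≤n) 3≤k))))

Y-1 : ∀ k → 3 ≤ k → Y k ‼ 1 ≡ ℤ.-1ℤ
Y-1 k 3≤k = trans (cong (λ i → Y i ‼ 1) (sym (ℕ.+-identityʳ k)))
  (trans (coefficient (Y-split k 0) 1) (cong (λ t → ℤ.-1ℤ ℤ.+ t) (Z-below k (Y-offset k 0) 1 (ℕ.≤-trans (s≤s (s≤s z≤n)) 3≤k))))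

X-0 : ∀ k → 3 ≤ k → X k ‼ 0 ≡ 1ℤ
X-0 k 3≤k = trans (cong (λ i → X i ‼ 0) (sym (ℕ.+-identityʳ k)))
  (trans (coefficient (X-split k 0) 0) (cong (λ t → 1ℤ ℤ.+ t) (Z-below k (C (+ 2) ⊗ (u ⊗ Z 0) ⊕ v ⊗ s-offset k 0) 0 (ℕ.≤-trans (s≤s z≤n) 3≤k))))

minimum : ∀ k ks → ∃ λ e → e ∈ k ∷ ks × All (e ≤_) (k ∷ ks)
minimum k []        = k , here refl , ℕ.≤-refl ∷ []
minimum k (j ∷ ks) with minimum j ks
... | e , e∈ , e≤ with ℕ.≤-total k e
...   | inj₁ k≤e = k , here refl , ℕ.≤-refl ∷ All.map (ℕ.≤-trans k≤e) e≤
...   | inj₂ e≤k = e , there e∈ , e≤k ∷ e≤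

offsets : ∀ e {ks} → All (e ≤_) ks → map (λ i → e + i) (map (_∸ e) ks) ≡ ks
offsets e []         = refl
offsets e (e≤k ∷ e≤) = cong₂ _∷_ (ℕ.m+[n∸m]≡n e≤k) (offsets e e≤)

pendants : ∀ e i j l → Δ (e + i) (e + j) l ≐ C 1ℤ ⊗ Xs (e + i ∷ e + j ∷ []) ⊕
  ⊝ (s l ⊗ (κ ⊗ κ ⊕ Z e ⊗ (⊝ (κ ⊗ (Y-offset e i ⊕ Y-offset e j)) ⊕ Z e ⊗ (Y-offset e i ⊗ Y-offset e j))))
pendants e i j l = exactly λ m → let open Truncated exact m in ≋-trans
  (⊕-cong ≋-refl (⊝-cong (⊗-cong ≋-refl (⊗-cong (mod (Y-split e i) m) (mod (Y-split e j) m)))))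
  (solve 7 (λ p q s k z a b → p :* q :- s :* ((:- k :+ z :* a) :* (:- k :+ z :* b)) :=
    con 1ℤ :* (p :* (q :* con 1ℤ)) :- s :* (k :* k :+ z :* (:- (k :* (a :+ b)) :+ z :* (a :* b)))) ≋-refl
    (X (e + i)) (X (e + j)) (s l) κ (Z e) (Y-offset e i) (Y-offset e j))

pendant : ∀ e n j l → Δ n (e + j) l ≐ X n ⊗ Xs (e + j ∷ []) ⊕ ⊝ (s l ⊗ (⊝ (κ ⊗ Y n) ⊕ Z e ⊗ (Y n ⊗ Y-offset e j)))
pendant e n j l = exactly λ m → let open Truncated exact m in ≋-trans
  (⊕-cong ≋-refl (⊝-cong (⊗-cong ≋-refl (⊗-cong ≋-refl (mod (Y-split e j) m)))))
  (solve 7 (λ p q s k z a y → p :* q :- s :* (y :* (:- k :+ z :* a)) := p :* (q :* con 1ℤ) :- s :* (:- (k :* y) :+ z :* (y :* a))) ≋-refl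
    (X n) (X (e + j)) (s l) κ (Z e) (Y-offset e j) (Y n))

module Counting (e : ℕ) (3≤e : 3 ≤ e) where
  open Window e 3≤e
  open LowOrder e 3≤e
  open Truncated exact 4
  open Win

  tally : List ℕ → ℕ → ℕ
  tally ks = count (map (_∸ e) ks)

  tally-member : ∀ {ks} → e ∈ ks → 1 ≤ tally ks 0
  tally-member {k ∷ ks} (here refl) rewrite ℕ.n∸n≡0 k = s≤s z≤n
  tally-member {k ∷ ks} (there e∈)  = ℕ.≤-trans (tally-member e∈) (ℕ.m≤n+m _ (ind (k ∸ e) 0))

  ind-+ : ∀ i t → ind i t ≡ 1 ⊎ ind i t ≡ 0
  ind-+ zero    zero    = inj₁ refl
  ind-+ zero    (suc t) = inj₂ refl
  ind-+ (suc i) zero    = inj₂ refl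
  ind-+ (suc i) (suc t) = ind-+ i t

  ind-≡ : ∀ i t → ind i t ≢ 0 → i ≡ t
  ind-≡ zero    zero    _ = refl
  ind-≡ zero    (suc t) p = contradiction refl p
  ind-≡ (suc i) zero    p = contradiction refl p
  ind-≡ (suc i) (suc t) p = cong suc (ind-≡ i t p)

  member-tally : ∀ {ks} t → All (e ≤_) ks → 1 ≤ tally ks t → e + t ∈ ks
  member-tally {k ∷ ks} t (e≤k ∷ e≤) 1≤ with ind-+ (k ∸ e) t
  ... | inj₁ p = here (trans (cong (λ i → e + i) (sym (ind-≡ (k ∸ e) t (λ q → contradiction (trans (sym p) q) λ ())))) (ℕ.m+[n∸m]≡n e≤k))
  ... | inj₂ p = there (member-tally t e≤ (subst (λ a → 1 ≤ a + tally ks t) p 1≤))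

  few : ∀ is → count is 0 + count is 1 + count is 2 + count is 3 ≤ length is
  few []       = z≤n
  few (i ∷ is) = ℕ.≤-trans (ℕ.≤-reflexive (regroup (ind i 0) (ind i 1) (ind i 2) (ind i 3) (count is 0) (count is 1) (count is 2) (count is 3))) (ℕ.+-mono-≤ (one i) (few is))
    where
    regroup : ∀ a b c d e f g h → a + e + (b + f) + (c + g) + (d + h) ≡ (a + b + c + d) + (e + f + g + h)
    regroup = ℕ-Solver.solve-∀
    one : ∀ i → ind i 0 + ind i 1 + ind i 2 + ind i 3 ≤ 1
    one 0 = ℕ.≤-refl
    one 1 = ℕ.≤-refl
    one 2 = ℕ.≤-refl
    one 3 = ℕ.≤-refl
    one (suc (suc (suc (suc i)))) = z≤n

  win-Xs : ∀ is → Win (Xs (map (λ i → e + i) is)) (u ⊗ total is) (second (count is 0))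
  win-Xs []       = win-cong (solve 1 (λ u → con 0ℤ := u :* con 0ℤ) ≋-refl u) refl win-1
  win-Xs (i ∷ is) = win-cong (solve 3 (λ u a b → u :* a :+ u :* b := u :* (a :+ b)) ≋-refl u (Z i) (total is))
    (trans (cong₂ (λ a b → a ℤ.+ second (count is 0) ℤ.+ b) (ind-second i)
      (cong₂ (λ a b → (+ 2 ℤ.* a) ℤ.* (+ 2 ℤ.* b)) (trans (ℤ.*-identityˡ _) (Z-ind i 0)) (trans (ℤ.*-identityˡ _) (total-count is 0))))
      (sym (second-+ (ind i 0) (count is 0)))) (win-mul (win-X i) (win-Xs is))

  Y-offset-0 : ∀ i → Y-offset e i ‼ 0 ≡ + 2 ℤ.* Z i ‼ 0
  Y-offset-0 i = trans (cong₂ ℤ._+_ (C-⊗ (+ 2) (u ⊗ Z i) 0) (trans (cong (w ‼ 0 ℤ.*_) (trans (cong (sgn (e + i) ℤ.*_) (Z-lt (e + (i + i)) 0 (ℕ.≤-trans (s≤s z≤n) (ℕ.≤-trans 3≤e (ℕ.m≤m+n e _)))))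
    (ℤ.*-zeroʳ (sgn (e + i))))) (ℤ.*-zeroʳ (w ‼ 0)))) (trans (ℤ.+-identityʳ _) (cong (+ 2 ℤ.*_) (ℤ.*-identityˡ _)))

  Ze-1 : Z e ‼ 1 ≡ 0ℤ
  Ze-1 = Z-lt e 1 (ℕ.≤-trans (s≤s (s≤s z≤n)) 3≤e)

  module Pendants (i j : ℕ) where
    correction : Series
    correction = ⊝ (κ ⊗ (Y-offset e i ⊕ Y-offset e j)) ⊕ Z e ⊗ (Y-offset e i ⊗ Y-offset e j)

    correction-0 : correction ‼ 0 ≡ 0ℤ
    correction-0 = cong (λ a → 0ℤ ℤ.+ a ℤ.* (Y-offset e i ‼ 0 ℤ.* Y-offset e j ‼ 0)) Ze-0

    correction-1 : correction ‼ 1 ≡ ℤ.- (+ 2 ℤ.* total (i ∷ j ∷ []) ‼ 0)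
    correction-1 = trans (cong₂ (λ a b → ℤ.- (0ℤ ℤ.* p₁ ℤ.+ 1ℤ ℤ.* (Y-offset e i ‼ 0 ℤ.+ Y-offset e j ‼ 0)) ℤ.+ (a ℤ.* q₁ ℤ.+ b ℤ.* q₀)) Ze-0 Ze-1)
      (trans (cong₂ (λ a b → ℤ.- (0ℤ ℤ.* p₁ ℤ.+ 1ℤ ℤ.* (a ℤ.+ b)) ℤ.+ (0ℤ ℤ.* q₁ ℤ.+ 0ℤ ℤ.* q₀)) (Y-offset-0 i) (Y-offset-0 j))
        (lemma p₁ q₁ q₀ (Z i ‼ 0) (Z j ‼ 0)))
      where
      p₁ = (Y-offset e i ⊕ Y-offset e j) ‼ 1
      q₁ = (Y-offset e i ⊗ Y-offset e j) ‼ 1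
      q₀ = (Y-offset e i ⊗ Y-offset e j) ‼ 0
      lemma : ∀ p q r a b → ℤ.- (0ℤ ℤ.* p ℤ.+ 1ℤ ℤ.* (+ 2 ℤ.* a ℤ.+ + 2 ℤ.* b)) ℤ.+ (0ℤ ℤ.* q ℤ.+ 0ℤ ℤ.* r) ≡ ℤ.- (+ 2 ℤ.* (a ℤ.+ (b ℤ.+ 0ℤ)))
      lemma = ℤ-Solver.solve-∀

  module Pendant (n j : ℕ) (3≤n : 3 ≤ n) where
    correction : Series
    correction = Y n ⊗ Y-offset e j

    correction-0 : correction ‼ 0 ≡ 0ℤ
    correction-0 = cong (ℤ._* Y-offset e j ‼ 0) (Y-0 n 3≤n)

    correction-1 : correction ‼ 1 ≡ ℤ.- (+ 2 ℤ.* total (j ∷ []) ‼ 0)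
    correction-1 = trans (cong₂ (λ a b → a ℤ.* Y-offset e j ‼ 1 ℤ.+ b ℤ.* Y-offset e j ‼ 0) (Y-0 n 3≤n) (Y-1 n 3≤n))
      (trans (cong (λ a → 0ℤ ℤ.* Y-offset e j ‼ 1 ℤ.+ ℤ.-1ℤ ℤ.* a) (Y-offset-0 j)) (lemma (Y-offset e j ‼ 1) (Z j ‼ 0)))
      where
      lemma : ∀ p a → 0ℤ ℤ.* p ℤ.+ ℤ.-1ℤ ℤ.* (+ 2 ℤ.* a) ≡ ℤ.- (+ 2 ℤ.* (a ℤ.+ 0ℤ))
      lemma = ℤ-Solver.solve-∀

    base : Series
    base = ⊝ (κ ⊗ Y n)

    base-0 : base ‼ 0 ≡ 0ℤ
    base-0 = refl

    base-1 : base ‼ 1 ≡ 0ℤ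
    base-1 = cong (λ a → ℤ.- (0ℤ ℤ.* Y n ‼ 1 ℤ.+ 1ℤ ℤ.* a)) (Y-0 n 3≤n)

    base-2 : base ‼ 2 ≡ 1ℤ
    base-2 = cong₂ (λ a b → ℤ.- (0ℤ ℤ.* Y n ‼ 2 ℤ.+ (1ℤ ℤ.* a ℤ.+ 0ℤ ℤ.* b))) (Y-1 n 3≤n) (Y-0 n 3≤n)

    X-low : X n ≋ C 1ℤ ⊕ C (+ 2 ℤ.* Z n ‼ 3) ⊗ Z 3
    X-low = ≋-trans (≋-reflexive (cong X (sym (ℕ.+-identityʳ n)))) (≋-trans (mod (X-split n 0) 4) (⊕-cong ≋-refl
      (≋-trans (Window.Ze-⊗ n 3≤n (C (+ 2) ⊗ (u ⊗ Z 0) ⊕ v ⊗ s-offset n 0)) (≋-trans (⊗-cong (C-cong₄ value) Z-low)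
        (≋-trans (solve 3 (λ a b z → a :* (b :* z) := a :* b :* z) ≋-refl (C (+ 2)) (C (Z n ‼ 3)) (Z 3)) (⊗-cong (≋-sym (C-*₄ (+ 2) (Z n ‼ 3))) ≋-refl))))))
      where
      value : (C (+ 2) ⊗ (u ⊗ Z 0) ⊕ v ⊗ s-offset n 0) ‼ 0 ≡ + 2
      value = cong₂ (λ a b → + 2 ℤ.+ 1ℤ ℤ.* (a ℤ.* b)) (refl {x = sgn (n + 0)}) (Z-lt (n + 0) 0 (ℕ.≤-trans (s≤s z≤n) (ℕ.≤-trans 3≤n (ℕ.m≤m+n n 0))))
        ∙ cong (λ a → + 2 ℤ.+ 1ℤ ℤ.* a) (ℤ.*-zeroʳ (sgn (n + 0)))
        where
        _∙_ : ∀ {a b c : ℤ} → a ≡ b → b ≡ c → a ≡ c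
        _∙_ = trans
      Z-low : Z n ≋ C (Z n ‼ 3) ⊗ Z 3
      Z-low = eqs λ
        { 0 _ → trans (Z-lt n 0 (ℕ.≤-trans (s≤s z≤n) 3≤n)) (sym (trans (C-⊗ (Z n ‼ 3) (Z 3) 0) (ℤ.*-zeroʳ (Z n ‼ 3))))
        ; 1 _ → trans (Z-lt n 1 (ℕ.≤-trans (s≤s (s≤s z≤n)) 3≤n)) (sym (trans (C-⊗ (Z n ‼ 3) (Z 3) 1) (ℤ.*-zeroʳ (Z n ‼ 3))))
        ; 2 _ → trans (Z-lt n 2 3≤n) (sym (trans (C-⊗ (Z n ‼ 3) (Z 3) 2) (ℤ.*-zeroʳ (Z n ‼ 3))))
        ; 3 _ → sym (trans (C-⊗ (Z n ‼ 3) (Z 3) 3) (ℤ.*-identityʳ (Z n ‼ 3)))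
        ; (suc (suc (suc (suc _)))) (s≤s (s≤s (s≤s (s≤s ())))) }

  -- The coefficient of zᵉ⁺³ in Xₖ is too small when a free cycle of length e has to be matched.

  no-free : ∀ {a₀ a₂ a₃ a₀′ a₂′ a₃′ k₀ k₃ λ₁ λ₂} → a₀ ≡ a₀′ + k₀ → λ₂ ≤ 1 → a₀ + a₂ + a₃ ≤ 2 →
    a₃ + a₂ + 2 * a₀′ + λ₂ * a₀′ ≡ a₃′ + a₂′ + k₃ + 2 * a₀ + λ₁ * a₀ → k₀ ≡ 0
  no-free {k₀ = zero} _ _ _ _ = refl
  no-free {a₀} {a₂} {a₃} {a₀′} {a₂′} {a₃′} {suc k} {k₃} {λ₁} {λ₂} refl λ≤1 few eq = ⊥-elim (ℕ.<⇒≱ enough few)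
    where
    lower : 2 * (a₀′ + suc k) ≤ a₃ + a₂ + 2 * a₀′ + a₀′
    lower = ℕ.≤-trans (ℕ.≤-trans (ℕ.m≤n+m _ (a₃′ + a₂′ + k₃)) (ℕ.m≤m+n _ (λ₁ * (a₀′ + suc k))))
      (ℕ.≤-trans (ℕ.≤-reflexive (sym eq)) (ℕ.+-monoʳ-≤ (a₃ + a₂ + 2 * a₀′) (ℕ.≤-trans (ℕ.*-monoˡ-≤ a₀′ λ≤1) (ℕ.≤-reflexive (ℕ.*-identityˡ a₀′)))))
    lower′ : 2 * suc k ≤ a₃ + a₂ + a₀′
    lower′ = ℕ.+-cancelˡ-≤ (2 * a₀′) _ _ (ℕ.≤-trans (ℕ.≤-reflexive (sym (ℕ.*-distribˡ-+ 2 a₀′ (suc k)))) (ℕ.≤-trans lower (ℕ.≤-reflexive (regroup a₃ a₂ a₀′))))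
      where
      regroup : ∀ a b c → a + b + 2 * c + c ≡ 2 * c + (a + b + c)
      regroup = ℕ-Solver.solve-∀
    enough : 3 ≤ a₀′ + suc k + a₂ + a₃
    enough = ℕ.≤-trans (ℕ.≤-trans (s≤s (s≤s (s≤s z≤n))) (ℕ.≤-reflexive (three k))) (ℕ.≤-trans (ℕ.+-monoˡ-≤ (suc k) lower′) (ℕ.≤-reflexive (regroup a₃ a₂ a₀′ (suc k))))
      where
      three : ∀ k → 3 + 3 * k ≡ 2 * suc k + suc k
      three = ℕ-Solver.solve-∀
      regroup : ∀ a b c k → a + b + c + k ≡ c + k + b + a
      regroup = ℕ-Solver.solve-∀

  zero-balance : ∀ is is′ ks → (u ⊗ total is ⊕ ⊝ (u ⊗ total is′ ⊕ total ks)) ‼ 0 ≡ 0ℤ → count is 0 ≡ count is′ 0 + count ks 0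
  zero-balance is is′ ks first = ℤ.+-injective (trans (lemma (+ count is 0) (+ count is′ 0) (+ count ks 0)) (trans (cong (λ a → a ℤ.+ + (count is′ 0 + count ks 0))
    (trans (cong₂ (λ a b → 1ℤ ℤ.* a ℤ.+ ℤ.- b) (sym (total-count is 0)) (cong₂ (λ a b → 1ℤ ℤ.* a ℤ.+ b) (sym (total-count is′ 0)) (sym (total-count ks 0)))) first)) (ℤ.+-identityˡ _)))
    where
    lemma : ∀ a b c → a ≡ (1ℤ ℤ.* a ℤ.+ ℤ.- (1ℤ ℤ.* b ℤ.+ c)) ℤ.+ (b ℤ.+ c)
    lemma = ℤ-Solver.solve-∀

  module Conclude (is is′ ks : List ℕ) (small : length is ≤ 2) (l l′ : ℕ) (μ : ℤ)
    (first : (u ⊗ total is ⊕ ⊝ (u ⊗ total is′ ⊕ total ks)) ‼ 0 ≡ 0ℤ)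
    (third : (u ⊗ total is ⊕ ⊝ (u ⊗ total is′ ⊕ total ks)) ‼ 3 ℤ.+
      (+ 2 ℤ.* (μ ℤ.* (u ⊗ total is ⊕ ⊝ (u ⊗ total is′ ⊕ total ks)) ‼ 0) ℤ.- + lam l ℤ.* total is ‼ 0 ℤ.+ + lam l′ ℤ.* total is′ ‼ 0) ≡ 0ℤ) where

    balance : count is 0 ≡ count is′ 0 + count ks 0
    balance = zero-balance is is′ ks first

    free-none : count ks 0 ≡ 0
    free-none = no-free {a₂′ = count is′ 2} {a₃′ = count is′ 3} {k₃ = count ks 3} {λ₁ = lam l} balance (lam≤1 l′) (ℕ.≤-trans (ℕ.+-monoˡ-≤ (count is 3) (ℕ.+-monoˡ-≤ (count is 2) (ℕ.m≤m+n (count is 0) (count is 1)))) (ℕ.≤-trans (few is) small)) (ℤ.+-injective (trans (cast (count is 3 + count is 2) (count is′ 0) (lam l′) (count is′ 0)) (trans (sides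
      (+ count is 0) (+ count is 1) (+ count is 2) (+ count is 3) (+ count is′ 0) (+ count is′ 1) (+ count is′ 2) (+ count is′ 3) (+ count ks 3) (+ lam l) (+ lam l′) counted)
      (sym (cast (count is′ 3 + count is′ 2 + count ks 3) (count is 0) (lam l) (count is 0))))))
      where
      cast : ∀ a c q d → + (a + 2 * c + q * d) ≡ + a ℤ.+ + 2 ℤ.* + c ℤ.+ + q ℤ.* + d
      cast a c q d = cong₂ (λ s t → + a ℤ.+ s ℤ.+ t) (ℤ.pos-* 2 c) (ℤ.pos-* q d)
      value : ℤ → ℤ → ℤ → ℤ → ℤ → ℤ → ℤ → ℤ → ℤ → ℤ → ℤ → ℤ
      value a₀ a₁ a₂ a₃ b₀ b₁ b₂ b₃ k₃ p q = (1ℤ ℤ.* a₃ ℤ.+ (1ℤ ℤ.* a₂ ℤ.+ (0ℤ ℤ.* a₁ ℤ.+ -[1+ 1 ] ℤ.* a₀)) ℤ.+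
        ℤ.- (1ℤ ℤ.* b₃ ℤ.+ (1ℤ ℤ.* b₂ ℤ.+ (0ℤ ℤ.* b₁ ℤ.+ -[1+ 1 ] ℤ.* b₀)) ℤ.+ k₃)) ℤ.+ (+ 2 ℤ.* (μ ℤ.* 0ℤ) ℤ.- p ℤ.* a₀ ℤ.+ q ℤ.* b₀)
      counted : value (+ count is 0) (+ count is 1) (+ count is 2) (+ count is 3) (+ count is′ 0) (+ count is′ 1) (+ count is′ 2) (+ count is′ 3) (+ count ks 3) (+ lam l) (+ lam l′) ≡ 0ℤ
      counted = trans (sym (trans (cong (λ t → (u ⊗ total is ⊕ ⊝ (u ⊗ total is′ ⊕ total ks)) ‼ 3 ℤ.+ (+ 2 ℤ.* (μ ℤ.* t) ℤ.- + lam l ℤ.* total is ‼ 0 ℤ.+ + lam l′ ℤ.* total is′ ‼ 0)) first)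
        evaluate)) third
        where
        evaluate : (u ⊗ total is ⊕ ⊝ (u ⊗ total is′ ⊕ total ks)) ‼ 3 ℤ.+ (+ 2 ℤ.* (μ ℤ.* 0ℤ) ℤ.- + lam l ℤ.* total is ‼ 0 ℤ.+ + lam l′ ℤ.* total is′ ‼ 0) ≡
          value (+ count is 0) (+ count is 1) (+ count is 2) (+ count is 3) (+ count is′ 0) (+ count is′ 1) (+ count is′ 2) (+ count is′ 3) (+ count ks 3) (+ lam l) (+ lam l′)
        evaluate = convert
          where
          convert : value (total is ‼ 0) (total is ‼ 1) (total is ‼ 2) (total is ‼ 3) (total is′ ‼ 0) (total is′ ‼ 1) (total is′ ‼ 2) (total is′ ‼ 3) (total ks ‼ 3) (+ lam l) (+ lam l′) ≡
            value (+ count is 0) (+ count is 1) (+ count is 2) (+ count is 3) (+ count is′ 0) (+ count is′ 1) (+ count is′ 2) (+ count is′ 3) (+ count ks 3) (+ lam l) (+ lam l′)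
          convert rewrite total-count is 0 | total-count is 2 | total-count is 3
            | total-count is′ 0 | total-count is′ 2 | total-count is′ 3 | total-count ks 3 = refl
      sides : ∀ a₀ a₁ a₂ a₃ b₀ b₁ b₂ b₃ k₃ p q → value a₀ a₁ a₂ a₃ b₀ b₁ b₂ b₃ k₃ p q ≡ 0ℤ →
        a₃ ℤ.+ a₂ ℤ.+ + 2 ℤ.* b₀ ℤ.+ q ℤ.* b₀ ≡ b₃ ℤ.+ b₂ ℤ.+ k₃ ℤ.+ + 2 ℤ.* a₀ ℤ.+ p ℤ.* a₀
      sides a₀ a₁ a₂ a₃ b₀ b₁ b₂ b₃ k₃ p q e₀ = trans (lemma a₀ a₁ a₂ a₃ b₀ b₁ b₂ b₃ k₃ p q μ)
        (trans (cong (λ t → t ℤ.+ (b₃ ℤ.+ b₂ ℤ.+ k₃ ℤ.+ + 2 ℤ.* a₀ ℤ.+ p ℤ.* a₀)) e₀) (ℤ.+-identityˡ _))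
        where
        lemma : ∀ a₀ a₁ a₂ a₃ b₀ b₁ b₂ b₃ k₃ p q μ → a₃ ℤ.+ a₂ ℤ.+ + 2 ℤ.* b₀ ℤ.+ q ℤ.* b₀ ≡
          (1ℤ ℤ.* a₃ ℤ.+ (1ℤ ℤ.* a₂ ℤ.+ (0ℤ ℤ.* a₁ ℤ.+ -[1+ 1 ] ℤ.* a₀)) ℤ.+
            ℤ.- (1ℤ ℤ.* b₃ ℤ.+ (1ℤ ℤ.* b₂ ℤ.+ (0ℤ ℤ.* b₁ ℤ.+ -[1+ 1 ] ℤ.* b₀)) ℤ.+ k₃)) ℤ.+ (+ 2 ℤ.* (μ ℤ.* 0ℤ) ℤ.- p ℤ.* a₀ ℤ.+ q ℤ.* b₀)
          ℤ.+ (b₃ ℤ.+ b₂ ℤ.+ k₃ ℤ.+ + 2 ℤ.* a₀ ℤ.+ p ℤ.* a₀)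
        lemma = ℤ-Solver.solve-∀

  second-order-gap : ∀ is is′ ks → (u ⊗ total is ⊕ ⊝ (u ⊗ total is′ ⊕ total ks)) ‼ 0 ≡ 0ℤ →
    second (count is 0) ℤ.- (second (count is′ 0) ℤ.+ second (count ks 0) ℤ.+ (+ 2 ℤ.* (u ⊗ total is′) ‼ 0) ℤ.* (+ 2 ℤ.* total ks ‼ 0)) ≡ 0ℤ
  second-order-gap is is′ ks first = trans (cong₂ (λ a b → second a ℤ.- b) (zero-balance is is′ ks first)
      (trans (cong₂ (λ a b → second (count is′ 0) ℤ.+ second (count ks 0) ℤ.+ (+ 2 ℤ.* a) ℤ.* (+ 2 ℤ.* b)) (trans (ℤ.*-identityˡ _) (total-count is′ 0)) (total-count ks 0))
        (sym (second-+ (count is′ 0) (count ks 0))))) (ℤ.+-inverseʳ (second (count is′ 0 + count ks 0)))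

-- Comparison of dumbbells

module DumbbellComparison {p q p′ q′ l l′ : ℕ} {ks : List ℕ}
  (3≤p : 3 ≤ p) (3≤q : 3 ≤ q) (3≤p′ : 3 ≤ p′) (3≤q′ : 3 ≤ q′) (1≤l : 1 ≤ l) (1≤l′ : 1 ≤ l′) (3≤ks : All (3 ≤_) ks)
  (p≤q : p ≤ q) (p′≤q′ : p′ ≤ q′) (equation : Δ p q l ≐ Δ p′ q′ l′ ⊗ cycles ks) where

  private
    bounded : ∀ {e k ks} → All (3 ≤_) (k ∷ ks) → e ∈ k ∷ ks → 3 ≤ e
    bounded 3≤ e∈ = All.lookup 3≤ e∈

    zero-gap : ∀ {a b c : ℕ} → a ≡ b + c → c ≡ 0 → a ≡ b
    zero-gap {b = b} p refl = trans p (ℕ.+-identityʳ b)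

  same-first : p ≡ p′
  same-first = go (minimum p (p′ ∷ ks))
    where
    go : (∃ λ e → e ∈ p ∷ p′ ∷ ks × All (e ≤_) (p ∷ p′ ∷ ks)) → p ≡ p′
    go (e , e∈ , e≤p ∷ e≤p′ ∷ e≤ks) = finish e∈
      where
      3≤e : 3 ≤ e
      3≤e = bounded (3≤p ∷ 3≤p′ ∷ 3≤ks) e∈
      e≤q : e ≤ q
      e≤q = ℕ.≤-trans e≤p p≤q
      e≤q′ : e ≤ q′
      e≤q′ = ℕ.≤-trans e≤p′ p′≤q′
      open Window e 3≤e
      open Counting e 3≤e
      open LowOrder e 3≤e
      i j i′ j′ : ℕ
      i = p ∸ e
      j = q ∸ e
      i′ = p′ ∸ e
      j′ = q′ ∸ e
      is : List ℕ
      is = map (_∸ e) ks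
      equation′ : C 1ℤ ⊗ Xs (e + i ∷ e + j ∷ []) ⊕ ⊝ (s l ⊗ (κ ⊗ κ ⊕ Z e ⊗ Pendants.correction i j)) ≐
        (C 1ℤ ⊗ Xs (e + i′ ∷ e + j′ ∷ []) ⊕ ⊝ (s l′ ⊗ (κ ⊗ κ ⊕ Z e ⊗ Pendants.correction i′ j′))) ⊗ cycles (map (λ i → e + i) is)
      equation′ = exactly λ m → let open Truncated exact m in ≋-trans (≋-sym (mod (pendants e i j l) m))
        (≋-trans (≋-reflexive (cong₂ (λ a b → Δ a b l) (ℕ.m+[n∸m]≡n e≤p) (ℕ.m+[n∸m]≡n e≤q)))
        (≋-trans (mod equation m)
        (≋-trans (≋-reflexive (cong₂ _⊗_ (cong₂ (λ a b → Δ a b l′) (sym (ℕ.m+[n∸m]≡n e≤p′)) (sym (ℕ.m+[n∸m]≡n e≤q′))) (cong cycles (sym (offsets e e≤ks)))))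
          (⊗-cong (mod (pendants e i′ j′ l′) m) ≋-refl))))
      open Truncated exact 4
      module Cmp = Compare {W = κ ⊗ κ} {μ = 0ℤ} l l′ 1≤l 1≤l′ (solve 1 (λ z → con 1ℤ := con 1ℤ :+ con 0ℤ :* z) ≋-refl (Z 3)) refl refl refl
        (win-Xs (i ∷ j ∷ [])) (win-Xs (i′ ∷ j′ ∷ [])) (win-cycles is)
        (Pendants.correction-0 i j) (Pendants.correction-1 i j) (Pendants.correction-0 i′ j′) (Pendants.correction-1 i′ j′) equation′
      result = Cmp.compare (second-order-gap (i ∷ j ∷ []) (i′ ∷ j′ ∷ []) is)
      open Conclude (i ∷ j ∷ []) (i′ ∷ j′ ∷ []) is ℕ.≤-refl l l′ 0ℤ (proj₁ result) (proj₂ result)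
      same : tally (p ∷ q ∷ []) 0 ≡ tally (p′ ∷ q′ ∷ []) 0
      same = zero-gap balance free-none
      only : ∀ {k k′} → e ≤ k → k ≤ k′ → 1 ≤ tally (k ∷ k′ ∷ []) 0 → k ≡ e
      only e≤k k≤k′ 1≤ with member-tally {_ ∷ _ ∷ []} 0 (e≤k ∷ ℕ.≤-trans e≤k k≤k′ ∷ []) 1≤
      ... | here r         = trans (sym r) (ℕ.+-identityʳ e)
      ... | there (here r) = ℕ.≤-antisym (ℕ.≤-trans k≤k′ (ℕ.≤-reflexive (trans (sym r) (ℕ.+-identityʳ e)))) e≤k
      finish : e ∈ p ∷ p′ ∷ ks → p ≡ p′
      finish (here e≡p)          = trans (sym e≡p) (sym (only e≤p′ p′≤q′ (subst (1 ≤_) same (tally-member {p ∷ q ∷ []} (here e≡p)))))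
      finish (there (here e≡p′)) = trans (only e≤p p≤q (subst (1 ≤_) (sym same) (tally-member {p′ ∷ q′ ∷ []} (here e≡p′)))) e≡p′
      finish (there (there e∈)) = contradiction (subst (1 ≤_) free-none (tally-member e∈)) λ ()

  same-second : q ≡ q′
  same-second = go (minimum q (q′ ∷ ks))
    where
    go : (∃ λ e → e ∈ q ∷ q′ ∷ ks × All (e ≤_) (q ∷ q′ ∷ ks)) → q ≡ q′
    go (e , e∈ , e≤q ∷ e≤q′ ∷ e≤ks) = finish e∈
      where
      3≤e : 3 ≤ e
      3≤e = bounded (3≤q ∷ 3≤q′ ∷ 3≤ks) e∈
      open Window e 3≤e
      open Counting e 3≤e
      open LowOrder e 3≤e
      j j′ : ℕ
      j = q ∸ e
      j′ = q′ ∸ e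
      is : List ℕ
      is = map (_∸ e) ks
      module L = Pendant p j 3≤p
      module R = Pendant p j′ 3≤p
      equation′ : X p ⊗ Xs (e + j ∷ []) ⊕ ⊝ (s l ⊗ (L.base ⊕ Z e ⊗ L.correction)) ≐
        (X p ⊗ Xs (e + j′ ∷ []) ⊕ ⊝ (s l′ ⊗ (L.base ⊕ Z e ⊗ R.correction))) ⊗ cycles (map (λ i → e + i) is)
      equation′ = exactly λ m → let open Truncated exact m in ≋-trans (≋-sym (mod (pendant e p j l) m))
        (≋-trans (≋-reflexive (cong (λ b → Δ p b l) (ℕ.m+[n∸m]≡n e≤q)))
        (≋-trans (mod equation m)
        (≋-trans (≋-reflexive (cong₂ _⊗_ (cong₂ (λ a b → Δ a b l′) (sym same-first) (sym (ℕ.m+[n∸m]≡n e≤q′))) (cong cycles (sym (offsets e e≤ks)))))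
          (⊗-cong (mod (pendant e p j′ l′) m) ≋-refl))))
      open Truncated exact 4
      module Cmp = Compare {W = L.base} {μ = Z p ‼ 3} l l′ 1≤l 1≤l′ L.X-low L.base-0 L.base-1 L.base-2
        (win-Xs (j ∷ [])) (win-Xs (j′ ∷ [])) (win-cycles is) L.correction-0 L.correction-1 R.correction-0 R.correction-1 equation′
      result = Cmp.compare (second-order-gap (j ∷ []) (j′ ∷ []) is)
      open Conclude (j ∷ []) (j′ ∷ []) is (s≤s z≤n) l l′ (Z p ‼ 3) (proj₁ result) (proj₂ result)
      same : tally (q ∷ []) 0 ≡ tally (q′ ∷ []) 0
      same = zero-gap balance free-none
      only : ∀ {k} → e ≤ k → 1 ≤ tally (k ∷ []) 0 → k ≡ e
      only e≤k 1≤ with member-tally {_ ∷ []} 0 (e≤k ∷ []) 1≤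
      ... | here r = trans (sym r) (ℕ.+-identityʳ e)
      finish : e ∈ q ∷ q′ ∷ ks → q ≡ q′
      finish (here e≡q)          = trans (sym e≡q) (sym (only e≤q′ (subst (1 ≤_) same (tally-member {q ∷ []} (here e≡q)))))
      finish (there (here e≡q′)) = trans (only e≤q (subst (1 ≤_) (sym same) (tally-member {q′ ∷ []} (here e≡q′)))) e≡q′
      finish (there (there e∈)) = contradiction (subst (1 ≤_) free-none (tally-member e∈)) λ ()

  no-cycles : ks ≡ []
  no-cycles = go ks refl 3≤ks
    where
    go : ∀ ks′ → ks ≡ ks′ → All (3 ≤_) ks′ → ks′ ≡ []
    go []       _  _   = refl
    go (k ∷ ks′) refl 3≤ks′ = from (minimum k ks′)
      where
      from : (∃ λ e → e ∈ k ∷ ks′ × All (e ≤_) (k ∷ ks′)) → k ∷ ks′ ≡ []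
      from (e , e∈ , e≤) = contradiction (subst (1 ≤_) none (tally-member e∈)) λ ()
        where
        3≤e : 3 ≤ e
        3≤e = All.lookup 3≤ks′ e∈
        open Window e 3≤e
        open Counting e 3≤e
        open LowOrder e 3≤e
        open Win
        is : List ℕ
        is = map (_∸ e) (k ∷ ks′)
        wk : Win (cycles (map (λ i → e + i) is)) (total is) (second (count is 0))
        wk = win-cycles is
        W E : Series
        W = Y p ⊗ Y q
        E = y wk ⊗ Δ p q l′
        shifted : Z e ⊗ E ≐ s l′ ⊗ W ⊕ ⊝ (s l ⊗ W)
        shifted = exactly λ m → let open Truncated exact m in ≋-trans
          (solve 6 (λ z y a s s′ w → z :* (y :* (a :- s′ :* w)) := (a :- s′ :* w) :* (con 1ℤ :+ z :* y) :+ (:- (a :- s :* w) :+ (s′ :* w :- s :* w))) ≋-refl (Z e) (y wk) (X p ⊗ X q) (s l) (s l′) W)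
          (≋-trans (⊕-cong (≋-trans (⊗-cong (≋-reflexive (cong₂ (λ a b → Δ a b l′) same-first same-second)) (≋-trans (≋-sym (mod (expand wk) m)) (≋-reflexive (cong cycles (offsets e e≤)))))
              (≋-sym (mod equation m))) ≋-refl)
            (solve 2 (λ a b → a :+ (:- a :+ b) := b) ≋-refl (Δ p q l) (s l′ ⊗ W ⊕ ⊝ (s l ⊗ W))))
        W-1 : W ‼ 1 ≡ 0ℤ
        W-1 = trans (cong₂ (λ a b → a ℤ.* Y q ‼ 1 ℤ.+ Y p ‼ 1 ℤ.* b) (Y-0 p 3≤p) (Y-0 q 3≤q)) (trans (ℤ.+-identityˡ _) (ℤ.*-zeroʳ (Y p ‼ 1)))
        W-2 : W ‼ 2 ≡ 1ℤ
        W-2 = trans (cong₂ (λ a b → a ℤ.* Y q ‼ 2 ℤ.+ (b ℤ.* Y q ‼ 1 ℤ.+ Y p ‼ 2 ℤ.* Y q ‼ 0)) (Y-0 p 3≤p) (Y-1 p 3≤p))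
          (trans (cong₂ (λ a b → 0ℤ ℤ.* Y q ‼ 2 ℤ.+ (ℤ.-1ℤ ℤ.* a ℤ.+ Y p ‼ 2 ℤ.* b)) (Y-1 q 3≤q) (Y-0 q 3≤q)) (cong (λ a → 0ℤ ℤ.+ (1ℤ ℤ.+ a)) (ℤ.*-zeroʳ (Y p ‼ 2))))
        E-0 : E ‼ 0 ≡ + 2 ℤ.* + count is 0
        E-0 = trans (cong₂ (λ a b → a ℤ.* (b ℤ.+ ℤ.- (s l′ ‼ 0 ℤ.* W ‼ 0))) (y-0 wk) (cong₂ ℤ._*_ (X-0 p 3≤p) (X-0 q 3≤q)))
          (trans (cong₂ (λ a b → + 2 ℤ.* a ℤ.* (1ℤ ℤ.+ ℤ.- (s l′ ‼ 0 ℤ.* b))) (total-count is 0) (cong (ℤ._* Y q ‼ 0) (Y-0 p 3≤p)))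
          (trans (cong (λ a → + 2 ℤ.* + count is 0 ℤ.* (1ℤ ℤ.+ ℤ.- a)) (ℤ.*-zeroʳ (s l′ ‼ 0))) (ℤ.*-identityʳ _)))
        none : tally (k ∷ ks′) 0 ≡ 0
        none = ℤ.+-injective (twice-zero (trans (sym E-0) (climb E (leading-≐ shifted (leading-difference l′ l W (cong (ℤ._* Y q ‼ 0) (Y-0 p 3≤p)) W-1 W-2))
          0 (λ _ ()) (subst Even (sym E-0) (twice-even (+ count is 0))))))

-- Exclusion of theta graphs

s-+ : ∀ j k → s (j + k) ≐ s j ⊗ s k
s-+ j k = exactly λ m → go m j k
  where
  go : ∀ m j k → Truncated._≋_ exact m (s (j + k)) (s j ⊗ s k)
  go m zero    k = let open Truncated exact m in solve 1 (λ a → a := con 1ℤ :* a) ≋-refl (s k)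
  go m (suc j) k = let open Truncated exact m in ≋-trans (⊝-cong (⊗-cong ≋-refl (go m j k)))
    (solve 3 (λ z a b → :- (z :* (a :* b)) := :- (z :* a) :* b) ≋-refl z² (s j) (s k))

theta-split : ∀ e i j k {o₁ o₂ o₃} → i + j ≡ e + o₁ → i + k ≡ e + o₂ → j + k ≡ e + o₃ →
  Θ i j k ⊕ κ ⊗ κ ⊗ (s i ⊕ s j ⊕ s k) ≐ C 1ℤ ⊕ Z e ⊗
    (v ⊗ v ⊗ (s-offset e o₁ ⊕ s-offset e o₂ ⊕ s-offset e o₃) ⊕ ⊝ (w ⊗ w ⊗ (s-offset e o₁ ⊗ s k))
      ⊕ C (+ 2) ⊗ (u ⊗ u) ⊗ (Z o₁ ⊗ (C 1ℤ ⊕ ⊝ s k) ⊕ Z o₂ ⊗ (C 1ℤ ⊕ ⊝ s j) ⊕ Z o₃ ⊗ (C 1ℤ ⊕ ⊝ s i)))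
theta-split e i j k {o₁} {o₂} {o₃} p₁ p₂ p₃ = exactly λ m → let open Truncated exact m in ≋-trans
  (≋-trans (solve 13 (λ k v w u si sj sk zi zj zk s₁ s₂ s₃ →
      (con 1ℤ :- k :* k :* (si :+ sj :+ sk) :+ v :* v :* (si :* sj :+ si :* sk :+ sj :* sk) :- w :* w :* (si :* sj :* sk)
        :+ con (+ 2) :* (u :* u) :* (zi :* zj :* (con 1ℤ :- sk) :+ zi :* zk :* (con 1ℤ :- sj) :+ zj :* zk :* (con 1ℤ :- si))) :+ k :* k :* (si :+ sj :+ sk) :=
      con 1ℤ :+ (v :* v :* (si :* sj :+ si :* sk :+ sj :* sk) :- w :* w :* (si :* sj :* sk)
        :+ con (+ 2) :* (u :* u) :* (zi :* zj :* (con 1ℤ :- sk) :+ zi :* zk :* (con 1ℤ :- sj) :+ zj :* zk :* (con 1ℤ :- si)))) ≋-refl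
      κ v w u (s i) (s j) (s k) (Z i) (Z j) (Z k) (s i) (s i) (s i))
    (⊕-cong ≋-refl (⊕-cong (⊕-cong (⊗-cong ≋-refl (⊕-cong (⊕-cong (S m i j p₁) (S m i k p₂)) (S m j k p₃)))
      (⊝-cong (⊗-cong ≋-refl (⊗-cong (S m i j p₁) ≋-refl))))
      (⊗-cong ≋-refl (⊕-cong (⊕-cong (⊗-cong (M m i j p₁) ≋-refl) (⊗-cong (M m i k p₂) ≋-refl)) (⊗-cong (M m j k p₃) ≋-refl))))))
  (solve 13 (λ z v w u si sj sk z₁ z₂ z₃ s₁ s₂ s₃ →
      con 1ℤ :+ (v :* v :* (z :* s₁ :+ z :* s₂ :+ z :* s₃) :- w :* w :* (z :* s₁ :* sk)
        :+ con (+ 2) :* (u :* u) :* (z :* z₁ :* (con 1ℤ :- sk) :+ z :* z₂ :* (con 1ℤ :- sj) :+ z :* z₃ :* (con 1ℤ :- si))) :=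
      con 1ℤ :+ z :* (v :* v :* (s₁ :+ s₂ :+ s₃) :- w :* w :* (s₁ :* sk)
        :+ con (+ 2) :* (u :* u) :* (z₁ :* (con 1ℤ :- sk) :+ z₂ :* (con 1ℤ :- sj) :+ z₃ :* (con 1ℤ :- si)))) ≋-refl
      (Z e) v w u (s i) (s j) (s k) (Z o₁) (Z o₂) (Z o₃) (s-offset e o₁) (s-offset e o₂) (s-offset e o₃))
  where
  S : ∀ m i j {o} → i + j ≡ e + o → Truncated._≋_ exact m (s i ⊗ s j) (Z e ⊗ s-offset e o)
  S m i j {o} p = let open Truncated exact m in ≋-trans (≋-sym (mod (s-+ i j) m)) (≋-trans (≋-reflexive (cong s p)) (mod (s-split e o) m))
  M : ∀ m i j {o} → i + j ≡ e + o → Truncated._≋_ exact m (Z i ⊗ Z j) (Z e ⊗ Z o)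
  M m i j {o} p = let open Truncated exact m in ≋-trans (≋-sym (Z-hom i j)) (≋-trans (≋-reflexive (cong Z p)) (Z-hom e o))

theta-difference : ∀ e l t S {f f′ k y y′ q} → f ≐ C 1ℤ ⊕ Z e ⊗ y → f′ ⊗ k ≐ C 1ℤ ⊕ Z e ⊗ y′ → k ≐ C 1ℤ ⊕ Z e ⊗ q →
  C 1ℤ ⊗ f ⊕ ⊝ (s l ⊗ (κ ⊗ κ ⊕ Z e ⊗ t)) ≐ (f′ ⊕ ⊝ (κ ⊗ κ ⊗ S)) ⊗ k →
  Z e ⊗ (y ⊕ ⊝ y′ ⊕ ⊝ (s l ⊗ t) ⊕ κ ⊗ κ ⊗ S ⊗ q) ≐ s l ⊗ (κ ⊗ κ) ⊕ ⊝ (κ ⊗ κ ⊗ S)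
theta-difference e l t S {f′ = f′} {k} {y} {y′} {q} pf pf′k pk equation = exactly λ m → let open Truncated exact m in ≋-trans
  (solve 8 (λ z y y′ s t k S q → z :* (y :- y′ :- s :* t :+ k :* S :* q) :=
     (con 1ℤ :* (con 1ℤ :+ z :* y) :- s :* (k :+ z :* t)) :- ((con 1ℤ :+ z :* y′) :- k :* S :* (con 1ℤ :+ z :* q)) :+ (s :* k :- k :* S)) ≋-refl
     (Z e) y y′ (s l) t (κ ⊗ κ) S q)
  (≋-trans (⊕-cong (⊕-cong (≋-trans (⊕-cong (⊗-cong ≋-refl (≋-sym (mod pf m))) ≋-refl) (mod equation m))
     (⊝-cong (⊕-cong (≋-sym (mod pf′k m)) (⊝-cong (⊗-cong ≋-refl (≋-sym (mod pk m))))))) ≋-refl)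
  (solve 5 (λ f k S q r → (f :- k :* S) :* q :- (f :* q :- k :* S :* q) :+ r := r) ≋-refl f′ (κ ⊗ κ) S k _))

module ThetaWindow (e : ℕ) (3≤e : 3 ≤ e) where
  open Window e 3≤e
  open LowOrder e 3≤e
  open Truncated exact 4
  open SetoidReasoning setoid
  open Win

  s-vanishes : ∀ k → 2 ≤ k → s k ≋ C 0ℤ
  s-vanishes k 2≤k = ≋-trans (mod (s-Z k) 4) (≋-trans (⊗-cong ≋-refl (Z≋0-from (k + k) (ℕ.+-mono-≤ 2≤k 2≤k)))
    (solve 1 (λ a → a :* con 0ℤ := con 0ℤ) ≋-refl (C (sgn k))))

  win-Θ : ∀ i j k {o₁ o₂ o₃} → 2 ≤ j → 2 ≤ k → i + j ≡ e + o₁ → i + k ≡ e + o₂ → j + k ≡ e + o₃ →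
    Win (Θ i j k ⊕ κ ⊗ κ ⊗ (s i ⊕ s j ⊕ s k)) (u ⊗ u ⊗ (total (o₁ ∷ o₂ ∷ o₃ ∷ []) ⊕ ⊝ (Z o₃ ⊗ s i))) (sgn e ℤ.* + count (o₁ ∷ o₂ ∷ o₃ ∷ []) 0)
  win-Θ i j k {o₁} {o₂} {o₃} 2≤j 2≤k p₁ p₂ p₃ = record
    { expand = theta-split e i j k p₁ p₂ p₃
    ; low = begin
        v ⊗ v ⊗ (s-offset e o₁ ⊕ s-offset e o₂ ⊕ s-offset e o₃) ⊕ ⊝ (w ⊗ w ⊗ (s-offset e o₁ ⊗ s k))
          ⊕ C (+ 2) ⊗ (u ⊗ u) ⊗ (Z o₁ ⊗ (C 1ℤ ⊕ ⊝ s k) ⊕ Z o₂ ⊗ (C 1ℤ ⊕ ⊝ s j) ⊕ Z o₃ ⊗ (C 1ℤ ⊕ ⊝ s i))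
          ≈⟨ ⊕-cong (⊕-cong (≋-trans (solve 4 (λ v a b c → v :* (a :+ b :+ c) := v :* a :+ v :* b :+ v :* c) ≋-refl (v ⊗ v) _ _ _)
               (⊕-cong (⊕-cong (second-order o₁ (v ⊗ v) refl) (second-order o₂ (v ⊗ v) refl)) (second-order o₃ (v ⊗ v) refl)))
               (⊝-cong (⊗-cong ≋-refl (⊗-cong ≋-refl (s-vanishes k 2≤k)))))
               (⊗-cong ≋-refl (⊕-cong (⊕-cong (⊗-cong ≋-refl (⊕-cong ≋-refl (⊝-cong (s-vanishes k 2≤k)))) (⊗-cong ≋-refl (⊕-cong ≋-refl (⊝-cong (s-vanishes j 2≤j))))) ≋-refl)) ⟩
        C (g o₁) ⊗ Z e ⊕ C (g o₂) ⊗ Z e ⊕ C (g o₃) ⊗ Z e ⊕ ⊝ (w ⊗ w ⊗ (s-offset e o₁ ⊗ C 0ℤ))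
          ⊕ C (+ 2) ⊗ (u ⊗ u) ⊗ (Z o₁ ⊗ (C 1ℤ ⊕ ⊝ C 0ℤ) ⊕ Z o₂ ⊗ (C 1ℤ ⊕ ⊝ C 0ℤ) ⊕ Z o₃ ⊗ (C 1ℤ ⊕ ⊝ s i))
          ≈⟨ solve 11 (λ a b c z w σ u x₁ x₂ x₃ t → a :* z :+ b :* z :+ c :* z :- w :* (σ :* con 0ℤ)
                 :+ con (+ 2) :* u :* (x₁ :* (con 1ℤ :- con 0ℤ) :+ x₂ :* (con 1ℤ :- con 0ℤ) :+ x₃ :* (con 1ℤ :- t)) :=
               con (+ 2) :* (u :* (x₁ :+ (x₂ :+ (x₃ :+ con 0ℤ)) :- x₃ :* t)) :+ (a :+ (b :+ (c :+ con 0ℤ))) :* z) ≋-refl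
               (C (g o₁)) (C (g o₂)) (C (g o₃)) (Z e) (w ⊗ w) (s-offset e o₁) (u ⊗ u) (Z o₁) (Z o₂) (Z o₃) (s i) ⟩
        C (+ 2) ⊗ (u ⊗ u ⊗ (total (o₁ ∷ o₂ ∷ o₃ ∷ []) ⊕ ⊝ (Z o₃ ⊗ s i))) ⊕ (C (g o₁) ⊕ (C (g o₂) ⊕ (C (g o₃) ⊕ C 0ℤ))) ⊗ Z e
          ≈⟨ ⊕-cong ≋-refl (⊗-cong (≗⇒≋ λ { zero → lemma (sgn e) (+ ind o₁ 0) (+ ind o₂ 0) (+ ind o₃ 0) ; (suc _) → refl }) ≋-refl) ⟩
        C (+ 2) ⊗ (u ⊗ u ⊗ (total (o₁ ∷ o₂ ∷ o₃ ∷ []) ⊕ ⊝ (Z o₃ ⊗ s i))) ⊕ C (sgn e ℤ.* + count (o₁ ∷ o₂ ∷ o₃ ∷ []) 0) ⊗ Z e ∎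
    }
    where
    g : ℕ → ℤ
    g o = sgn e ℤ.* + ind o 0
    lemma : ∀ s a b c → s ℤ.* a ℤ.+ (s ℤ.* b ℤ.+ (s ℤ.* c ℤ.+ 0ℤ)) ≡ s ℤ.* (a ℤ.+ (b ℤ.+ (c ℤ.+ 0ℤ)))
    lemma = ℤ-Solver.solve-∀

  module _ {f f′ k A T K t S g g′ gk} (l : ℕ) (1≤l : 1 ≤ l) (wf : Win f (u ⊗ A) g) (wf′ : Win f′ T g′) (wk : Win k K gk)
    (t0 : t ‼ 0 ≡ 0ℤ) (t1 : t ‼ 1 ≡ ℤ.- (+ 2 ℤ.* A ‼ 0)) (S0 : S ‼ 0 ≡ 0ℤ) (S1 : S ‼ 1 ≡ 0ℤ)
    (equation : C 1ℤ ⊗ f ⊕ ⊝ (s l ⊗ (κ ⊗ κ ⊕ Z e ⊗ t)) ≐ (f′ ⊕ ⊝ (κ ⊗ κ ⊗ S)) ⊗ k) where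

    private
      wf′k : Win (f′ ⊗ k) (T ⊕ K) (g′ ℤ.+ gk ℤ.+ (+ 2 ℤ.* T ‼ 0) ℤ.* (+ 2 ℤ.* K ‼ 0))
      wf′k = win-mul wf′ wk

    theta-gap : Series
    theta-gap = y wf ⊕ ⊝ y wf′k ⊕ ⊝ (s l ⊗ t) ⊕ κ ⊗ κ ⊗ S ⊗ y wk

    theta-gap-shifted : Z e ⊗ theta-gap ≐ s l ⊗ (κ ⊗ κ) ⊕ ⊝ (κ ⊗ κ ⊗ S)
    theta-gap-shifted = theta-difference e l t S (expand wf) (expand wf′k) (expand wk) equation

    theta-gap-low : LowForm theta-gap (u ⊗ A ⊕ ⊝ (T ⊕ K)) (g ℤ.- (g′ ℤ.+ gk ℤ.+ (+ 2 ℤ.* T ‼ 0) ℤ.* (+ 2 ℤ.* K ‼ 0))) (ℤ.- (+ lam l ℤ.* A ‼ 0))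
    theta-gap-low = lowForm (begin
      y wf ⊕ ⊝ y wf′k ⊕ ⊝ (s l ⊗ t) ⊕ κ ⊗ κ ⊗ S ⊗ y wk
        ≈⟨ ⊕-cong (⊕-cong (difference-low wf wf′k) (⊝-cong (s-⊗-low l t 1≤l t0))) (⊗-cong κκS ≋-refl) ⟩
      C (+ 2) ⊗ (u ⊗ A ⊕ ⊝ (T ⊕ K)) ⊕ C G ⊗ Z e ⊕ ⊝ (C (ℤ.- (+ lam l ℤ.* t ‼ 1)) ⊗ Z 3) ⊕ C 0ℤ ⊗ y wk
        ≈⟨ solve 5 (λ a g x z y → a :+ g :- x :* z :+ con 0ℤ :* y := a :+ g :+ :- x :* z) ≋-refl _ (C G ⊗ Z e) (C (ℤ.- (+ lam l ℤ.* t ‼ 1))) (Z 3) (y wk) ⟩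
      C (+ 2) ⊗ (u ⊗ A ⊕ ⊝ (T ⊕ K)) ⊕ C G ⊗ Z e ⊕ ⊝ C (ℤ.- (+ lam l ℤ.* t ‼ 1)) ⊗ Z 3
        ≈⟨ ⊕-cong ≋-refl (⊗-cong (≗⇒≋ λ { zero → trans (cong (λ a → ℤ.- (ℤ.- (+ lam l ℤ.* a))) t1) (lemma (+ lam l) (A ‼ 0)) ; (suc _) → refl }) ≋-refl) ⟩
      C (+ 2) ⊗ (u ⊗ A ⊕ ⊝ (T ⊕ K)) ⊕ C G ⊗ Z e ⊕ C (+ 2 ℤ.* ℤ.- (+ lam l ℤ.* A ‼ 0)) ⊗ Z 3 ∎)
      where
      G : ℤ
      G = g ℤ.- (g′ ℤ.+ gk ℤ.+ (+ 2 ℤ.* T ‼ 0) ℤ.* (+ 2 ℤ.* K ‼ 0))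
      lemma : ∀ a b → ℤ.- (ℤ.- (a ℤ.* ℤ.- (+ 2 ℤ.* b))) ≡ + 2 ℤ.* ℤ.- (a ℤ.* b)
      lemma = ℤ-Solver.solve-∀
      κκS : κ ⊗ κ ⊗ S ≋ C 0ℤ
      κκS = eqs λ
        { 0 _ → refl
        ; 1 _ → zero-1 (S ‼ 1) (S ‼ 0)
        ; 2 _ → trans (cong (λ a → 0ℤ ℤ.* S ‼ 2 ℤ.+ (0ℤ ℤ.* S ‼ 1 ℤ.+ 1ℤ ℤ.* a)) S0) (zero-2 (S ‼ 2) (S ‼ 1))
        ; 3 _ → trans (cong₂ (λ a b → 0ℤ ℤ.* S ‼ 3 ℤ.+ (0ℤ ℤ.* S ‼ 2 ℤ.+ (1ℤ ℤ.* a ℤ.+ 0ℤ ℤ.* b))) S1 S0) (zero-2 (S ‼ 3) (S ‼ 2))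
        ; (suc (suc (suc (suc _)))) (s≤s (s≤s (s≤s (s≤s ())))) }
        where
        zero-1 : ∀ a b → 0ℤ ℤ.* a ℤ.+ 0ℤ ℤ.* b ≡ 0ℤ
        zero-1 = ℤ-Solver.solve-∀
        zero-2 : ∀ a b → 0ℤ ℤ.* a ℤ.+ (0ℤ ℤ.* b ℤ.+ 0ℤ) ≡ 0ℤ
        zero-2 = ℤ-Solver.solve-∀

module Parity (N : ℕ) where
  open Truncated mod2 N

  τ : ℕ → Series
  τ k = Z (k + k)

  exactly⇒≋ : ∀ {f g} → f ≐ g → f ≋ g
  exactly⇒≋ p = ≗⇒≋ (coefficient p)

  drop-even : ∀ {f g} h → f ≋ g ⊕ C (+ 2) ⊗ h → f ≋ g
  drop-even {f} {g} h p = ≋-trans p (≋-trans (⊕-cong ≋-refl (⊗-cong two ≋-refl)) (solve 2 (λ g h → g :+ con 0ℤ :* h := g) ≋-refl g h))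
    where
    two : C (+ 2) ≋ C 0ℤ
    two = eqs λ { zero _ → 1ℤ , refl ; (suc i) _ → reflex refl }

  s-parity : ∀ k → s k ≋ τ k
  s-parity k = ≋-trans (exactly⇒≋ (s-Z k)) (sign (sgn-cases k))
    where
    sign : Unit (sgn k) → C (sgn k) ⊗ τ k ≋ τ k
    sign (inj₁ p) = ≋-trans (⊗-cong (≋-reflexive (cong C p)) ≋-refl) (solve 1 (λ t → con 1ℤ :* t := t) ≋-refl (τ k))
    sign (inj₂ p) = drop-even (⊝ τ k) (≋-trans (⊗-cong (≋-reflexive (cong C p)) ≋-refl)
      (solve 1 (λ t → con ℤ.-1ℤ :* t := t :+ con (+ 2) :* :- t) ≋-refl (τ k)))

  κ-parity : κ ≋ Z 1
  κ-parity = drop-even (⊝ (Z 1 ⊗ z² ⊗ b)) (≋-trans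
    (solve 2 (λ z b → (z :- z :* z) :* b := z :* ((con 1ℤ :- z :+ con (+ 2) :* (z :* z)) :* b) :+ con (+ 2) :* :- (z :* (z :* z) :* b)) ≋-refl (Z 1) b)
    (⊕-cong (≋-trans (⊗-cong ≋-refl (exactly⇒≋ (exactly λ m → SpecialSeries.b-inverse m))) (solve 1 (λ z → z :* con 1ℤ := z) ≋-refl (Z 1))) ≋-refl))

  X-parity : ∀ k → X k ≋ C 1ℤ ⊕ τ k
  X-parity k = drop-even (u ⊗ Z k ⊕ (u ⊕ ⊝ C 1ℤ) ⊗ s k) (≋-trans
    (solve 3 (λ u z s → con 1ℤ :+ con (+ 2) :* u :* z :+ (con (+ 2) :* u :- con 1ℤ) :* s := con 1ℤ :+ s :+ con (+ 2) :* (u :* z :+ (u :- con 1ℤ) :* s)) ≋-refl u (Z k) (s k))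
    (⊕-cong (⊕-cong ≋-refl (s-parity k)) ≋-refl))

  Y-parity : ∀ k → Y k ≋ Z 1 ⊗ (C 1ℤ ⊕ τ k)
  Y-parity k = drop-even (⊝ κ ⊕ u ⊗ Z k ⊕ u ⊗ s k) (≋-trans
    (solve 4 (λ k u z s → :- k :+ con (+ 2) :* u :* z :+ (con (+ 2) :* u :+ k) :* s := k :* (con 1ℤ :+ s) :+ con (+ 2) :* (:- k :+ u :* z :+ u :* s)) ≋-refl κ u (Z k) (s k))
    (⊕-cong (⊗-cong κ-parity (⊕-cong ≋-refl (s-parity k))) ≋-refl))

  c-parity : ∀ k → c k ≋ C 1ℤ ⊕ τ k
  c-parity k = drop-even (Z k) (≋-trans (solve 2 (λ z s → con 1ℤ :+ con (+ 2) :* z :+ s := con 1ℤ :+ s :+ con (+ 2) :* z) ≋-refl (Z k) (s k))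
    (⊕-cong (⊕-cong ≋-refl (s-parity k)) ≋-refl))

  Δ-parity : ∀ p q l → Δ p q l ≋ (C 1ℤ ⊕ τ p) ⊗ (C 1ℤ ⊕ τ q) ⊗ (C 1ℤ ⊕ z² ⊗ τ l)
  Δ-parity p q l = drop-even (⊝ (z² ⊗ τ l ⊗ (C 1ℤ ⊕ τ p) ⊗ (C 1ℤ ⊕ τ q))) (≋-trans
    (⊕-cong (⊗-cong (X-parity p) (X-parity q)) (⊝-cong (⊗-cong (s-parity l) (⊗-cong (Y-parity p) (Y-parity q)))))
    (solve 4 (λ z p q l → p :* q :- l :* (z :* p :* (z :* q)) := p :* q :* (con 1ℤ :+ z :* z :* l) :+ con (+ 2) :* :- (z :* z :* l :* p :* q)) ≋-refl
      (Z 1) (C 1ℤ ⊕ τ p) (C 1ℤ ⊕ τ q) (τ l)))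

  Θ-parity : ∀ i j k → Θ i j k ≋ C 1ℤ ⊕ z² ⊗ (τ i ⊕ τ j ⊕ τ k) ⊕ (τ i ⊗ τ j ⊕ τ i ⊗ τ k ⊕ τ j ⊗ τ k) ⊕ z² ⊗ (τ i ⊗ τ j ⊗ τ k)
  Θ-parity i j k = drop-even
    (⊝ (κ ⊗ κ ⊗ S₁) ⊕ (C (+ 2) ⊗ κ ⊕ C (+ 2) ⊗ (κ ⊗ κ)) ⊗ S₂ ⊕ ⊝ ((C (+ 2) ⊕ C (+ 6) ⊗ κ ⊕ C (+ 5) ⊗ (κ ⊗ κ)) ⊗ S₃) ⊕ u ⊗ u ⊗ F)
    (≋-trans (solve 5 (λ k s₁ s₂ s₃ f →
        con 1ℤ :- k :* k :* s₁ :+ (con (+ 2) :* (con 1ℤ :+ k) :- con 1ℤ) :* (con (+ 2) :* (con 1ℤ :+ k) :- con 1ℤ) :* s₂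
          :- (con (+ 2) :* (con 1ℤ :+ k) :+ k) :* (con (+ 2) :* (con 1ℤ :+ k) :+ k) :* s₃ :+ con (+ 2) :* ((con 1ℤ :+ k) :* (con 1ℤ :+ k)) :* f :=
        con 1ℤ :+ k :* k :* s₁ :+ s₂ :+ k :* k :* s₃ :+ con (+ 2) :* (:- (k :* k :* s₁) :+ (con (+ 2) :* k :+ con (+ 2) :* (k :* k)) :* s₂
          :- (con (+ 2) :+ con (+ 6) :* k :+ con (+ 5) :* (k :* k)) :* s₃ :+ (con 1ℤ :+ k) :* (con 1ℤ :+ k) :* f)) ≋-refl κ S₁ S₂ S₃ F)
      (⊕-cong (⊕-cong (⊕-cong (⊕-cong ≋-refl (⊗-cong κκ (⊕-cong (⊕-cong (s-parity i) (s-parity j)) (s-parity k))))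
        (⊕-cong (⊕-cong (⊗-cong (s-parity i) (s-parity j)) (⊗-cong (s-parity i) (s-parity k))) (⊗-cong (s-parity j) (s-parity k))))
        (⊗-cong κκ (⊗-cong (⊗-cong (s-parity i) (s-parity j)) (s-parity k)))) ≋-refl))
    where
    κκ : κ ⊗ κ ≋ z²
    κκ = ⊗-cong κ-parity κ-parity
    S₁ S₂ S₃ F : Series
    S₁ = s i ⊕ s j ⊕ s k
    S₂ = s i ⊗ s j ⊕ s i ⊗ s k ⊕ s j ⊗ s k
    S₃ = s i ⊗ s j ⊗ s k
    F = Z i ⊗ Z j ⊗ (C 1ℤ ⊕ ⊝ s k) ⊕ Z i ⊗ Z k ⊗ (C 1ℤ ⊕ ⊝ s j) ⊕ Z j ⊗ Z k ⊗ (C 1ℤ ⊕ ⊝ s i)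

  Z-product : ∀ a b → N ≤ a + b → Z a ⊗ Z b ≋ C 0ℤ
  Z-product a b N≤ = ≋-trans (≋-sym (Z-hom a b)) (Z≋0 (a + b) N≤)

-- Modulo 2 and z²ᵉ⁺¹, a factor coming from a cycle of length k ≥ e is 1, or 1 + z²ᵉ if k = e.

module TopParity (e : ℕ) (1≤e : 1 ≤ e) where
  open Parity (suc (e + e)) public
  open Truncated mod2 (suc (e + e))

  top : ∀ k → e ≤ k → τ k ≋ C (+ ind (k ∸ e) 0) ⊗ τ e
  top k e≤k with k ∸ e in eq
  ... | zero  = ≋-trans (≋-reflexive (cong τ (ℕ.≤-antisym (ℕ.m∸n≡0⇒m≤n eq) e≤k))) (solve 1 (λ t → t := con 1ℤ :* t) ≋-refl (τ e))
  ... | suc x = ≋-trans (Z≋0 (k + k) (ℕ.+-mono-<-≤ (ℕ.m∸n≢0⇒n<m λ z → contradiction (trans (sym eq) z) λ ()) e≤k)) (solve 1 (λ t → con 0ℤ := con 0ℤ :* t) ≋-refl (τ e))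

  τ-square : τ e ⊗ τ e ≋ C 0ℤ
  τ-square = Z-product (e + e) (e + e) (ℕ.+-mono-≤ (ℕ.≤-trans 1≤e (ℕ.m≤m+n e e)) ℕ.≤-refl)

  τ-z² : τ e ⊗ z² ≋ C 0ℤ
  τ-z² = ≋-trans (solve 2 (λ t z → t :* (z :* z) := z :* t :* z) ≋-refl (τ e) (Z 1)) (≋-trans (⊗-cong (Z-product 1 (e + e) ℕ.≤-refl) ≋-refl)
    (solve 1 (λ z → con 0ℤ :* z := con 0ℤ) ≋-refl (Z 1)))

  cycles-parity : ∀ {ks} → All (e ≤_) ks → cycles ks ≋ C 1ℤ ⊕ C (+ count (map (_∸ e) ks) 0) ⊗ τ e
  cycles-parity {[]}     []           = solve 1 (λ t → con 1ℤ := con 1ℤ :+ con 0ℤ :* t) ≋-refl (τ e)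
  cycles-parity {k ∷ ks} (e≤k ∷ e≤ks) = ≋-trans (⊗-cong (≋-trans (c-parity k) (⊕-cong ≋-refl (top k e≤k))) (cycles-parity e≤ks))
    (≋-trans (solve 3 (λ a b t → (con 1ℤ :+ a :* t) :* (con 1ℤ :+ b :* t) := con 1ℤ :+ (a :+ b) :* t :+ a :* b :* (t :* t)) ≋-refl
      (C (+ ind (k ∸ e) 0)) (C (+ count (map (_∸ e) ks) 0)) (τ e))
    (≋-trans (⊕-cong (⊕-cong ≋-refl (⊗-cong (≗⇒≋ λ { zero → refl ; (suc _) → refl }) ≋-refl)) (⊗-cong ≋-refl τ-square))
      (solve 3 (λ a b t → con 1ℤ :+ a :* t :+ b :* con 0ℤ := con 1ℤ :+ a :* t) ≋-refl (C (+ (ind (k ∸ e) 0 + count (map (_∸ e) ks) 0))) _ (τ e))))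

ind-same : ∀ k → ind k k ≡ 1
ind-same zero    = refl
ind-same (suc k) = ind-same k

ind-other : ∀ {j k} → j ≢ k → ind j k ≡ 0
ind-other {zero}  {zero}  j≢k = contradiction refl j≢k
ind-other {zero}  {suc k} j≢k = refl
ind-other {suc j} {zero}  j≢k = refl
ind-other {suc j} {suc k} j≢k = ind-other (j≢k ∘ cong suc)

Z-same : ∀ k → Z k ‼ k ≡ 1ℤ
Z-same k = trans (Z-ind k k) (cong +_ (ind-same k))

Z-other : ∀ {j k} → j ≢ k → Z j ‼ k ≡ 0ℤ
Z-other {j} {k} j≢k = trans (Z-ind j k) (cong +_ (ind-other j≢k))

module ParityCoefficients (N : ℕ) where
  open Parity N
  open Truncated mod2 N

  τ-same : ∀ k → τ k ‼ (k + k) ≡ 1ℤ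
  τ-same k = Z-same (k + k)

  τ-other : ∀ {j k} → j ≢ k → τ j ‼ (k + k) ≡ 0ℤ
  τ-other j≢k = Z-other (j≢k ∘ double-injective _ _)
    where
    double-injective : ∀ j k → j + j ≡ k + k → j ≡ k
    double-injective zero    zero    _ = refl
    double-injective (suc j) (suc k) p = cong suc (double-injective j k
      (ℕ.suc-injective (trans (sym (ℕ.+-suc j j)) (trans (ℕ.suc-injective p) (ℕ.+-suc k k)))))

  odd-gap : ¬ (1ℤ ~ 0ℤ)
  odd-gap (k , p) = odd-1 (k , trans p (ℤ.+-identityˡ (k ℤ.+ k)))

  z²-τ : ∀ k → z² ⊗ τ k ≋ τ (1 + k)
  z²-τ k = ≋-trans (solve 2 (λ z t → z :* z :* t := z :* (z :* t)) ≋-refl (Z 1) (τ k)) (≋-trans (⊗-cong ≋-refl (≋-sym (Z-hom 1 (k + k))))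
    (≋-trans (≋-sym (Z-hom 1 (suc (k + k)))) (≋-reflexive (cong (Z ∘ suc) (sym (ℕ.+-suc k k))))))

  τ-+ : ∀ j k → τ j ⊗ τ k ≋ τ (j + k)
  τ-+ j k = ≋-trans (≋-sym (Z-hom (j + j) (k + k))) (≋-reflexive (cong Z (lemma j k)))
    where
    lemma : ∀ j k → j + j + (k + k) ≡ j + k + (j + k)
    lemma = ℕ-Solver.solve-∀

  τ-vanish : ∀ k → N ≤ k + k → τ k ≋ C 0ℤ
  τ-vanish k = Z≋0 (k + k)

unequal-arcs : ∀ {p q l i j k ks} → 1 ≤ i → i < j → j < k → i + j ≤ p → i + j ≤ q → All (i + j ≤_) ks →
  count (p ∸ (i + j) ∷ q ∸ (i + j) ∷ []) 0 ≡ 1 + count (map (_∸ (i + j)) ks) 0 → ¬ Δ p q l ≐ Θ i j k ⊗ cycles ks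
unequal-arcs {p} {q} {l} {i} {j} {k} {ks} 1≤i i<j j<k e≤p e≤q e≤ks balance equation = second (l ℕ.≟ i)
  where
  n m : ℕ
  n = i + j
  m = count (map (_∸ n) ks) 0
  1≤e : 1 ≤ n
  1≤e = ℕ.≤-trans 1≤i (ℕ.m≤m+n i j)
  open TopParity n 1≤e
  open ParityCoefficients (suc (n + n))
  open Truncated mod2 (suc (n + n))
  above : ∀ a → n < a → suc (n + n) ≤ a + a
  above a e<a = ℕ.+-mono-<-≤ e<a (ℕ.<⇒≤ e<a)
  pₙ qₙ : Series
  pₙ = C (+ ind (p ∸ n) 0)
  qₙ = C (+ ind (q ∸ n) 0)
  left : Δ p q l ≋ C (+ (1 + m)) ⊗ τ n ⊕ (C 1ℤ ⊕ z² ⊗ τ l)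
  left = ≋-trans (Δ-parity p q l) (≋-trans (⊗-cong (⊗-cong (⊕-cong ≋-refl (top p e≤p)) (⊕-cong ≋-refl (top q e≤q))) ≋-refl)
    (≋-trans (solve 5 (λ a b t z l → (con 1ℤ :+ a :* t) :* (con 1ℤ :+ b :* t) :* (con 1ℤ :+ z :* l) :=
        (a :+ (b :+ con 0ℤ)) :* t :+ (con 1ℤ :+ z :* l) :+ ((t :* t) :* (a :* b :* (con 1ℤ :+ z :* l)) :+ (t :* z) :* ((a :+ b) :* l))) ≋-refl pₙ qₙ (τ n) z² (τ l))
    (≋-trans (⊕-cong (⊕-cong (⊗-cong (≋-trans (≗⇒≋ {g = C (+ count (p ∸ n ∷ q ∸ n ∷ []) 0)} λ { zero → refl ; (suc _) → refl }) (≋-reflexive (cong (C ∘ +_) balance))) ≋-refl) ≋-refl)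
        (⊕-cong (⊗-cong τ-square ≋-refl) (⊗-cong τ-z² ≋-refl)))
      (solve 3 (λ x a b → x :+ (con 0ℤ :* a :+ con 0ℤ :* b) := x) ≋-refl _ _ _))))
  right : Θ i j k ⊗ cycles ks ≋ C (+ (1 + m)) ⊗ τ n ⊕ (C 1ℤ ⊕ z² ⊗ (τ i ⊕ τ j ⊕ τ k))
  right = ≋-trans (⊗-cong (≋-trans (Θ-parity i j k) (⊕-cong (⊕-cong ≋-refl (⊕-cong (⊕-cong (τ-+ i j) ik) jk))
      (⊗-cong ≋-refl (≋-trans (⊗-cong (τ-+ i j) ≋-refl) (≋-trans (τ-+ (i + j) k) (τ-vanish (i + j + k) (above _ (ℕ.m<m+n n (ℕ.≤-trans (s≤s z≤n) j<k))))))))) (cycles-parity e≤ks))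
    (≋-trans (solve 4 (λ z s t m → (con 1ℤ :+ z :* s :+ (t :+ con 0ℤ :+ con 0ℤ) :+ z :* con 0ℤ) :* (con 1ℤ :+ m :* t) :=
        (con 1ℤ :+ m) :* t :+ (con 1ℤ :+ z :* s) :+ ((t :* z) :* (m :* s) :+ (t :* t) :* m)) ≋-refl z² (τ i ⊕ τ j ⊕ τ k) (τ n) (C (+ m)))
    (≋-trans (⊕-cong (⊕-cong (⊗-cong (≗⇒≋ λ { zero → refl ; (suc _) → refl }) ≋-refl) ≋-refl) (⊕-cong (⊗-cong τ-z² ≋-refl) (⊗-cong τ-square ≋-refl)))
      (solve 3 (λ x a b → x :+ (con 0ℤ :* a :+ con 0ℤ :* b) := x) ≋-refl _ _ _)))
    where
    ik : τ i ⊗ τ k ≋ C 0ℤ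
    ik = ≋-trans (τ-+ i k) (τ-vanish (i + k) (above _ (ℕ.+-monoʳ-< i j<k)))
    jk : τ j ⊗ τ k ≋ C 0ℤ
    jk = ≋-trans (τ-+ j k) (τ-vanish (j + k) (above _ (ℕ.+-mono-< i<j j<k)))
  core : τ (1 + l) ≋ τ (1 + i) ⊕ τ (1 + j) ⊕ τ (1 + k)
  core = ≋-trans (≋-sym (z²-τ l)) (≋-trans (cancel (≋-trans (≋-sym left) (≋-trans (exactly⇒≋ equation) right)))
    (≋-trans (solve 4 (λ z a b c → z :* (a :+ b :+ c) := z :* a :+ z :* b :+ z :* c) ≋-refl z² (τ i) (τ j) (τ k))
      (⊕-cong (⊕-cong (z²-τ i) (z²-τ j)) (z²-τ k))))
    where
    cancel : ∀ {f g h} → f ⊕ (C 1ℤ ⊕ g) ≋ f ⊕ (C 1ℤ ⊕ h) → g ≋ h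
    cancel {f} {g} {h} p = ≋-trans (solve 2 (λ f g → g := :- (f :+ con 1ℤ) :+ (f :+ (con 1ℤ :+ g))) ≋-refl f g)
      (≋-trans (⊕-cong ≋-refl p) (solve 2 (λ f g → :- (f :+ con 1ℤ) :+ (f :+ (con 1ℤ :+ g)) := g) ≋-refl f h))
  coefficient-at : ∀ t → t < n → τ (1 + l) ‼ (suc t + suc t) ~ (τ (1 + i) ⊕ τ (1 + j) ⊕ τ (1 + k)) ‼ (suc t + suc t)
  coefficient-at t t<e = at core (suc t + suc t) (s≤s (ℕ.+-mono-≤ t<e t<e))
  j<e : j < n
  j<e = subst (j <_) (ℕ.+-comm j i) (ℕ.m<m+n j 1≤i)
  apart : ∀ {a b} → a ≢ b → suc a ≢ suc b
  apart a≢b = a≢b ∘ ℕ.suc-injective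
  i<k : i < k
  i<k = ℕ.<-trans i<j j<k
  second : Dec (l ≡ i) → ⊥
  second (no l≢i) = odd-gap (symm (subst₂ _~_ (τ-other (apart l≢i))
    (cong₂ ℤ._+_ (cong₂ ℤ._+_ (τ-same (1 + i)) (τ-other (apart (ℕ.>⇒≢ i<j)))) (τ-other (apart (ℕ.>⇒≢ i<k)))) (coefficient-at i (ℕ.<-trans i<j j<e))))
  second (yes refl) = odd-gap (symm (subst₂ _~_ (τ-other (apart (ℕ.<⇒≢ i<j)))
    (cong₂ ℤ._+_ (cong₂ ℤ._+_ (τ-other (apart (ℕ.<⇒≢ i<j))) (τ-same (1 + j))) (τ-other (apart (ℕ.>⇒≢ j<k)))) (coefficient-at j j<e)))

equal-arcs-parity : ∀ {l i k ks} → 2 ≤ i → 1 ≤ l → All (2 + (i + i) ≤_) ks → count (map (_∸ (2 + (i + i))) ks) 0 ≡ 1 →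
  Δ (i + i) (1 + (i + i)) l ≐ Θ i i k ⊗ cycles ks → (l ≡ i + i × k ≡ 1 + (i + i)) ⊎ (k ≡ i + i × l ≡ 1 + (i + i))
equal-arcs-parity {l} {i} {k} {ks} 2≤i 1≤l f≤ks one equation = solution (k ℕ.≟ n) (l ℕ.≟ n)
  where
  n f : ℕ
  n = i + i
  f = 2 + n
  3≤e : 3 ≤ n
  3≤e = ℕ.≤-trans (ℕ.n≤1+n 3) (ℕ.+-mono-≤ 2≤i 2≤i)
  open TopParity (2 + n) (s≤s z≤n)
  open ParityCoefficients (suc (2 + n + (2 + n)))
  open Truncated mod2 (suc (2 + n + (2 + n)))
  bound : suc (f + f) ≤ n + n + (n + n)
  bound = ℕ.≤-trans (ℕ.≤-reflexive (lemma₁ n)) (ℕ.≤-trans (ℕ.+-monoʳ-≤ (n + n) (ℕ.≤-trans (ℕ.n≤1+n 5) (ℕ.+-mono-≤ 3≤e 3≤e))) ℕ.≤-refl)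
    where
    lemma₁ : ∀ n → suc (2 + n + (2 + n)) ≡ n + n + 5
    lemma₁ = ℕ-Solver.solve-∀
  left : Δ n (1 + n) l ≋ (C 1ℤ ⊕ τ n) ⊗ (C 1ℤ ⊕ (τ (1 + n) ⊕ τ (1 + l)))
  left = ≋-trans (Δ-parity n (1 + n) l) (≋-trans (⊗-cong ≋-refl (⊕-cong ≋-refl (z²-τ l)))
    (≋-trans (solve 3 (λ a b d → (con 1ℤ :+ a) :* (con 1ℤ :+ b) :* (con 1ℤ :+ d) := (con 1ℤ :+ a) :* (con 1ℤ :+ (b :+ d)) :+ (con 1ℤ :+ a) :* (b :* d)) ≋-refl (τ n) (τ (1 + n)) (τ (1 + l)))
    (≋-trans (⊕-cong ≋-refl (⊗-cong ≋-refl (≋-trans (τ-+ (1 + n) (1 + l)) (τ-vanish (1 + n + (1 + l)) (ℕ.+-mono-<-≤ (subst (f <_) (lemma₂ n l) (ℕ.m<m+n f 1≤l)) (ℕ.<⇒≤ (subst (f <_) (lemma₂ n l) (ℕ.m<m+n f 1≤l))))))))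
      (solve 2 (λ x y → x :+ y :* con 0ℤ := x) ≋-refl _ _))))
    where
    lemma₂ : ∀ n l → 2 + n + l ≡ 1 + n + (1 + l)
    lemma₂ = ℕ-Solver.solve-∀
  right : Θ i i k ⊗ cycles ks ≋ (C 1ℤ ⊕ τ n) ⊗ (C 1ℤ ⊕ (τ (1 + k) ⊕ τ f))
  right = ≋-trans (⊗-cong theta (≋-trans (cycles-parity f≤ks) (⊕-cong ≋-refl (⊗-cong (≋-reflexive (cong (C ∘ +_) one)) ≋-refl))))
    (≋-trans (solve 4 (λ a z k f → (con 1ℤ :+ a) :* (con 1ℤ :+ z :* k) :* (con 1ℤ :+ con 1ℤ :* f) := (con 1ℤ :+ a) :* (con 1ℤ :+ (z :* k :+ f)) :+ (con 1ℤ :+ a) :* k :* (f :* z)) ≋-refl (τ n) z² (τ k) (τ f))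
    (≋-trans (⊕-cong (⊗-cong ≋-refl (⊕-cong ≋-refl (⊕-cong (z²-τ k) ≋-refl))) (⊗-cong ≋-refl τ-z²)) (solve 2 (λ x y → x :+ y :* con 0ℤ := x) ≋-refl _ _)))
    where
    theta : Θ i i k ≋ (C 1ℤ ⊕ τ n) ⊗ (C 1ℤ ⊕ z² ⊗ τ k)
    theta = drop-even (z² ⊗ τ i ⊕ τ i ⊗ τ k) (≋-trans (Θ-parity i i k) (≋-trans
      (solve 3 (λ z i k → con 1ℤ :+ z :* (i :+ i :+ k) :+ (i :* i :+ i :* k :+ i :* k) :+ z :* (i :* i :* k) :=
         (con 1ℤ :+ i :* i) :* (con 1ℤ :+ z :* k) :+ con (+ 2) :* (z :* i :+ i :* k)) ≋-refl z² (τ i) (τ k))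
      (⊕-cong (⊗-cong (⊕-cong ≋-refl (τ-+ i i)) ≋-refl) ≋-refl)))
  core : τ (1 + n) ⊕ τ (1 + l) ≋ τ (1 + k) ⊕ τ f
  core = cancel (≋-trans (≋-sym left) (≋-trans (exactly⇒≋ equation) right))
    where
    strip : ∀ g → g ≋ (C 1ℤ ⊕ ⊝ τ n) ⊗ ((C 1ℤ ⊕ τ n) ⊗ (C 1ℤ ⊕ g)) ⊕ ⊝ C 1ℤ
    strip g = ≋-sym (≋-trans (solve 2 (λ a g → (con 1ℤ :- a) :* ((con 1ℤ :+ a) :* (con 1ℤ :+ g)) :- con 1ℤ := g :+ (a :* a) :* :- (con 1ℤ :+ g)) ≋-refl (τ n) g)
      (≋-trans (⊕-cong ≋-refl (⊗-cong (Z-product (n + n) (n + n) bound) ≋-refl)) (solve 2 (λ g h → g :+ con 0ℤ :* h := g) ≋-refl g _)))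
    cancel : ∀ {g h} → (C 1ℤ ⊕ τ n) ⊗ (C 1ℤ ⊕ g) ≋ (C 1ℤ ⊕ τ n) ⊗ (C 1ℤ ⊕ h) → g ≋ h
    cancel {g} {h} p = ≋-trans (strip g) (≋-trans (⊕-cong (⊗-cong ≋-refl p) ≋-refl) (≋-sym (strip h)))
  coefficient-at : ∀ t → t ≤ f → (τ (1 + n) ⊕ τ (1 + l)) ‼ (t + t) ~ (τ (1 + k) ⊕ τ f) ‼ (t + t)
  coefficient-at t t≤f = at core (t + t) (s≤s (ℕ.+-mono-≤ t≤f t≤f))
  apart : ∀ {a b} → a ≢ b → suc a ≢ suc b
  apart a≢b = a≢b ∘ ℕ.suc-injective
  e≢1+e : n ≢ 1 + n
  e≢1+e = ℕ.<⇒≢ (ℕ.n<1+n n)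
  at-1+e : ∀ {x y} → τ (1 + l) ‼ (1 + n + (1 + n)) ≡ x → τ (1 + k) ‼ (1 + n + (1 + n)) ≡ y → 1ℤ ℤ.+ x ~ y ℤ.+ 0ℤ
  at-1+e p q = subst₂ _~_ (cong₂ ℤ._+_ (τ-same (1 + n)) p) (cong₂ ℤ._+_ q (τ-other (apart (e≢1+e ∘ sym)))) (coefficient-at (1 + n) (ℕ.n≤1+n (1 + n)))
  at-2+e : ∀ {x y} → τ (1 + l) ‼ (f + f) ≡ x → τ (1 + k) ‼ (f + f) ≡ y → 0ℤ ℤ.+ x ~ y ℤ.+ 1ℤ
  at-2+e p q = subst₂ _~_ (cong₂ ℤ._+_ (τ-other (apart e≢1+e)) p) (cong₂ ℤ._+_ q (τ-same f)) (coefficient-at f ℕ.≤-refl)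
  two-gap : ¬ (+ 2 ~ 1ℤ)
  two-gap (m , p) = odd-1 (m , trans (cong (λ t → ℤ.-1ℤ ℤ.+ t) p) (lemma (m ℤ.+ m)))
    where
    lemma : ∀ a → ℤ.-1ℤ ℤ.+ (1ℤ ℤ.+ a) ≡ a
    lemma = ℤ-Solver.solve-∀
  solution : Dec (k ≡ n) → Dec (l ≡ n) → (l ≡ n × k ≡ 1 + n) ⊎ (k ≡ n × l ≡ 1 + n)
  solution (yes refl) (yes refl) = ⊥-elim (two-gap (at-1+e (τ-same (1 + n)) (τ-same (1 + n))))
  solution (no k≢e)   (no l≢e)   = ⊥-elim (odd-gap (at-1+e (τ-other (apart l≢e)) (τ-other (apart k≢e))))
  solution (yes refl) (no l≢e) with l ℕ.≟ 1 + n
  ... | yes l≡  = inj₂ (refl , l≡)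
  ... | no l≢   = ⊥-elim (odd-gap (symm (at-2+e (τ-other (apart l≢)) (τ-other (apart e≢1+e)))))
  solution (no k≢e) (yes refl) with k ℕ.≟ 1 + n
  ... | yes k≡  = inj₁ (refl , k≡)
  ... | no k≢   = ⊥-elim (odd-gap (symm (at-2+e (τ-other (apart e≢1+e)) (τ-other (apart k≢)))))

module TopExact (n : ℕ) (1≤n : 1 ≤ n) where
  open Truncated exact (suc n)

  Z-top : ∀ k → n ≤ k → Z k ≋ C (+ ind (k ∸ n) 0) ⊗ Z n
  Z-top k n≤k with k ∸ n in eq
  ... | zero  = ≋-trans (≋-reflexive (cong Z (ℕ.≤-antisym (ℕ.m∸n≡0⇒m≤n eq) n≤k))) (solve 1 (λ t → t := con 1ℤ :* t) ≋-refl (Z n))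
  ... | suc x = ≋-trans (Z≋0 k (ℕ.m∸n≢0⇒n<m λ z → contradiction (trans (sym eq) z) λ ())) (solve 1 (λ t → con 0ℤ := con 0ℤ :* t) ≋-refl (Z n))

  s-top : ∀ k → n < k + k → s k ≋ C 0ℤ
  s-top k n< = ≋-trans (mod (s-Z k) (suc n)) (≋-trans (⊗-cong ≋-refl (Z≋0 (k + k) n<)) (solve 1 (λ a → a :* con 0ℤ := con 0ℤ) ≋-refl (C (sgn k))))

  Z-square : Z n ⊗ Z n ≋ C 0ℤ
  Z-square = ≋-trans (≋-sym (Z-hom n n)) (Z≋0 (n + n) (ℕ.+-monoˡ-≤ n 1≤n))

  cycles-top : ∀ {ks} → All (n ≤_) ks → cycles ks ≋ C 1ℤ ⊕ C (+ 2 ℤ.* + count (map (_∸ n) ks) 0) ⊗ Z n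
  cycles-top {[]}     []           = solve 1 (λ t → con 1ℤ := con 1ℤ :+ con 0ℤ :* t) ≋-refl (Z n)
  cycles-top {k ∷ ks} (n≤k ∷ n≤ks) = ≋-trans (⊗-cong (⊕-cong (⊕-cong ≋-refl (⊗-cong ≋-refl (Z-top k n≤k))) (s-top k (ℕ.+-mono-≤ (ℕ.≤-trans 1≤n n≤k) n≤k))) (cycles-top n≤ks))
    (≋-trans (solve 3 (λ a b t → (con 1ℤ :+ con (+ 2) :* (a :* t) :+ con 0ℤ) :* (con 1ℤ :+ b :* t) := con 1ℤ :+ (con (+ 2) :* a :+ b) :* t :+ con (+ 2) :* a :* b :* (t :* t)) ≋-refl
      (C (+ ind (k ∸ n) 0)) (C (+ 2 ℤ.* + count (map (_∸ n) ks) 0)) (Z n))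
    (≋-trans (⊕-cong (⊕-cong ≋-refl (⊗-cong (≗⇒≋ λ
        { zero → sym (ℤ.*-distribˡ-+ (+ 2) (+ ind (k ∸ n) 0) (+ count (map (_∸ n) ks) 0))
        ; (suc i) → trans (ℤ.+-identityʳ _) (C-⊗ (+ 2) (C (+ ind (k ∸ n) 0)) (suc i)) }) ≋-refl)) (⊗-cong ≋-refl Z-square))
      (solve 3 (λ a b t → con 1ℤ :+ a :* t :+ b :* con 0ℤ := con 1ℤ :+ a :* t) ≋-refl (C (+ 2 ℤ.* + (ind (k ∸ n) 0 + count (map (_∸ n) ks) 0))) _ (Z n))))

-- Both sides are (1 + w)²(1 + v w)² up to the first exponent among i + k and ks, with w = z²ⁱ.

equal-arcs-exact : ∀ {l i k ks} → 1 ≤ i → sgn i ≡ 1ℤ → 2 + i ≤ k → k ≤ l → All (3 ≤_) ks → ¬ Δ (i + i) (i + i) l ≐ Θ i i k ⊗ (c (i + i) ⊗ cycles ks)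
equal-arcs-exact {l} {i@(suc i-1)} {k} {ks} 1≤i sgn≡1 i+2≤k k≤l 3≤ks equation = from (minimum (i + k) ks)
  where
  i<k : i < k
  i<k = ℕ.≤-trans (ℕ.n≤1+n _) i+2≤k
  from : ¬ (∃ λ n → n ∈ i + k ∷ ks × All (n ≤_) (i + k ∷ ks))
  from (n , n∈ , n≤ik ∷ n≤ks) = contradiction total≡0 (ℕ.>⇒≢ (Counting.tally-member n 3≤n n∈))
    where
    3≤n : 3 ≤ n
    3≤n = All.lookup (ℕ.≤-trans (s≤s (s≤s (s≤s z≤n))) (ℕ.≤-trans i+2≤k (ℕ.m≤n+m k i)) ∷ 3≤ks) n∈
    open TopExact n (ℕ.≤-trans (s≤s z≤n) 3≤n)
    open Truncated exact (suc n)
    open SetoidReasoning setoid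
    ε K : ℕ
    ε = ind (i + k ∸ n) 0
    K = count (map (_∸ n) ks) 0
    W P : Series
    W = Z (i + i)
    P = C 1ℤ ⊕ v ⊗ W
    s-i : s i ≋ W
    s-i = ≋-trans (mod (s-Z i) (suc n)) (≋-trans (⊗-cong (≋-reflexive (cong C sgn≡1)) ≋-refl) (solve 1 (λ w → con 1ℤ :* w := w) ≋-refl W))
    s-2i : s (i + i) ≋ W ⊗ W
    s-2i = ≋-trans (mod (s-+ i i) (suc n)) (⊗-cong s-i s-i)
    s-k : s k ≋ C 0ℤ
    s-k = s-top k (ℕ.≤-<-trans n≤ik (ℕ.+-monoˡ-< k i<k))
    s-l : s l ≋ C 0ℤ
    s-l = s-top l (ℕ.≤-<-trans n≤ik (ℕ.+-mono-<-≤ (ℕ.<-≤-trans i<k k≤l) k≤l))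
    left : Δ (i + i) (i + i) l ≋ (C 1ℤ ⊕ W) ⊗ (C 1ℤ ⊕ W) ⊗ (P ⊗ P)
    left = ≋-trans (⊕-cong (⊗-cong (⊕-cong ≋-refl (⊗-cong ≋-refl s-2i)) (⊕-cong ≋-refl (⊗-cong ≋-refl s-2i))) (⊝-cong (⊗-cong s-l ≋-refl)))
      (solve 3 (λ u w y → (con 1ℤ :+ con (+ 2) :* u :* w :+ (con (+ 2) :* u :- con 1ℤ) :* (w :* w)) :* (con 1ℤ :+ con (+ 2) :* u :* w :+ (con (+ 2) :* u :- con 1ℤ) :* (w :* w)) :- con 0ℤ :* y :=
        (con 1ℤ :+ w) :* (con 1ℤ :+ w) :* ((con 1ℤ :+ (con (+ 2) :* u :- con 1ℤ) :* w) :* (con 1ℤ :+ (con (+ 2) :* u :- con 1ℤ) :* w))) ≋-refl u W _)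
    theta : Θ i i k ≋ P ⊗ P ⊕ C (+ 4) ⊗ (u ⊗ u) ⊗ (C 1ℤ ⊕ ⊝ W) ⊗ C (+ ε) ⊗ Z n
    theta = begin
      Θ i i k
        ≈⟨ ⊕-cong (⊕-cong (⊕-cong (⊕-cong ≋-refl (⊝-cong (⊗-cong ≋-refl (⊕-cong (⊕-cong s-i s-i) s-k))))
             (⊗-cong ≋-refl (⊕-cong (⊕-cong (⊗-cong s-i s-i) (⊗-cong s-i s-k)) (⊗-cong s-i s-k)))) (⊝-cong (⊗-cong ≋-refl (⊗-cong ≋-refl s-k))))
             (⊗-cong ≋-refl (⊕-cong (⊕-cong (⊗-cong (≋-sym (Z-hom i i)) (⊕-cong ≋-refl (⊝-cong s-k))) (⊗-cong ω (⊕-cong ≋-refl (⊝-cong s-i)))) (⊗-cong ω (⊕-cong ≋-refl (⊝-cong s-i))))) ⟩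
      C 1ℤ ⊕ ⊝ (κ ⊗ κ ⊗ (W ⊕ W ⊕ C 0ℤ)) ⊕ v ⊗ v ⊗ (W ⊗ W ⊕ W ⊗ C 0ℤ ⊕ W ⊗ C 0ℤ) ⊕ ⊝ (w ⊗ w ⊗ (s i ⊗ s i ⊗ C 0ℤ))
        ⊕ C (+ 2) ⊗ (u ⊗ u) ⊗ (W ⊗ (C 1ℤ ⊕ ⊝ C 0ℤ) ⊕ C (+ ε) ⊗ Z n ⊗ (C 1ℤ ⊕ ⊝ W) ⊕ C (+ ε) ⊗ Z n ⊗ (C 1ℤ ⊕ ⊝ W))
        ≈⟨ solve 6 (λ k W q t ε z → con 1ℤ :- k :* k :* (W :+ W :+ con 0ℤ) :+ (con (+ 2) :* (con 1ℤ :+ k) :- con 1ℤ) :* (con (+ 2) :* (con 1ℤ :+ k) :- con 1ℤ) :* (W :* W :+ W :* con 0ℤ :+ W :* con 0ℤ)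
               :- q :* (t :* con 0ℤ) :+ con (+ 2) :* ((con 1ℤ :+ k) :* (con 1ℤ :+ k)) :* (W :* (con 1ℤ :- con 0ℤ) :+ ε :* z :* (con 1ℤ :- W) :+ ε :* z :* (con 1ℤ :- W)) :=
             (con 1ℤ :+ (con (+ 2) :* (con 1ℤ :+ k) :- con 1ℤ) :* W) :* (con 1ℤ :+ (con (+ 2) :* (con 1ℤ :+ k) :- con 1ℤ) :* W)
               :+ con (+ 4) :* ((con 1ℤ :+ k) :* (con 1ℤ :+ k)) :* (con 1ℤ :- W) :* ε :* z) ≋-refl κ W (w ⊗ w) (s i ⊗ s i) (C (+ ε)) (Z n) ⟩
      P ⊗ P ⊕ C (+ 4) ⊗ (u ⊗ u) ⊗ (C 1ℤ ⊕ ⊝ W) ⊗ C (+ ε) ⊗ Z n ∎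
      where
      ω : Z i ⊗ Z k ≋ C (+ ε) ⊗ Z n
      ω = ≋-trans (≋-sym (Z-hom i k)) (Z-top (i + k) n≤ik)
    Q : Series
    Q = (C 1ℤ ⊕ W) ⊗ (C 1ℤ ⊕ W) ⊗ (C (+ 4) ⊗ (u ⊗ u) ⊗ (C 1ℤ ⊕ ⊝ W) ⊗ C (+ ε) ⊕ P ⊗ P ⊗ C (+ 2 ℤ.* + K))
    right : Θ i i k ⊗ (c (i + i) ⊗ cycles ks) ≋ (C 1ℤ ⊕ W) ⊗ (C 1ℤ ⊕ W) ⊗ (P ⊗ P) ⊕ Z n ⊗ Q
    right = ≋-trans (⊗-cong theta (⊗-cong (⊕-cong ≋-refl s-2i) (cycles-top n≤ks)))
      (≋-trans (solve 5 (λ p x w z κ → (p :+ x :* z) :* ((con 1ℤ :+ con (+ 2) :* w :+ w :* w) :* (con 1ℤ :+ κ :* z)) :=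
          (con 1ℤ :+ w) :* (con 1ℤ :+ w) :* p :+ z :* ((con 1ℤ :+ w) :* (con 1ℤ :+ w) :* (x :+ p :* κ)) :+ (con 1ℤ :+ w) :* (con 1ℤ :+ w) :* x :* κ :* (z :* z)) ≋-refl
          (P ⊗ P) (C (+ 4) ⊗ (u ⊗ u) ⊗ (C 1ℤ ⊕ ⊝ W) ⊗ C (+ ε)) W (Z n) (C (+ 2 ℤ.* + K)))
        (≋-trans (⊕-cong ≋-refl (⊗-cong ≋-refl Z-square)) (solve 2 (λ a b → a :+ b :* con 0ℤ := a) ≋-refl _ _)))
    vanishing : Z n ⊗ Q ≋ C 0ℤ
    vanishing = ≋-trans (solve 2 (λ a z → z := :- a :+ (a :+ z)) ≋-refl ((C 1ℤ ⊕ W) ⊗ (C 1ℤ ⊕ W) ⊗ (P ⊗ P)) (Z n ⊗ Q))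
      (≋-trans (⊕-cong ≋-refl (≋-trans (≋-sym right) (≋-trans (≋-sym (mod equation (suc n))) left))) (solve 1 (λ a → :- a :+ a := con 0ℤ) ≋-refl _))
    Q-0 : Q ‼ 0 ≡ 0ℤ
    Q-0 = trans (sym (trans (Z-coefficient n Q n ℕ.≤-refl) (cong (Q ‼_) (ℕ.n∸n≡0 n)))) (trans (at vanishing n ℕ.≤-refl) (C0 n))
      where
      C0 : ∀ n → C 0ℤ ‼ n ≡ 0ℤ
      C0 zero    = refl
      C0 (suc n) = refl
    four : 4 * ε + 2 * K ≡ 0
    four = ℤ.+-injective (trans (cong₂ ℤ._+_ (ℤ.pos-* 4 ε) (ℤ.pos-* 2 K)) (trans (lemma (+ ε) (+ K)) Q-0))
      where
      lemma : ∀ a b → + 4 ℤ.* a ℤ.+ + 2 ℤ.* b ≡ 1ℤ ℤ.* (+ 4 ℤ.* a ℤ.+ 1ℤ ℤ.* (+ 2 ℤ.* b))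
      lemma = ℤ-Solver.solve-∀
    total≡0 : ε + K ≡ 0
    total≡0 = ℕ.n≤0⇒n≡0 (ℕ.≤-trans (ℕ.+-mono-≤ (ℕ.m≤n*m ε 4) (ℕ.m≤n*m K 2)) (ℕ.≤-reflexive four))

Z-s-below : ∀ o i t → t < o + (i + i) → (Z o ⊗ s i) ‼ t ≡ 0ℤ
Z-s-below o i t t< = trans (coefficient (exactly λ m → let open Truncated exact m in ≋-trans (⊗-cong ≋-refl (mod (s-Z i) m))
  (≋-trans (solve 3 (λ y a z → y :* (a :* z) := y :* z :* a) ≋-refl (Z o) (C (sgn i)) (Z (i + i))) (⊗-cong (≋-sym (Z-hom o (i + i))) ≋-refl))) t)
  (Z-below (o + (i + i)) (C (sgn i)) t t<)

s-0 : ∀ k → 1 ≤ k → s k ‼ 0 ≡ 0ℤ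
s-0 (suc k) _ = refl

s-1 : ∀ k → 1 ≤ k → s k ‼ 1 ≡ 0ℤ
s-1 (suc k) _ = refl

s-factor : ∀ e j → e ≤ j + j → s j ≐ Z e ⊗ (C (sgn j) ⊗ Z (j + j ∸ e))
s-factor e j e≤ = exactly λ m → let open Truncated exact m in ≋-trans (mod (s-Z j) m)
  (≋-trans (⊗-cong ≋-refl (≋-trans (≋-reflexive (cong Z (sym (ℕ.m+[n∸m]≡n e≤)))) (Z-hom e (j + j ∸ e))))
    (solve 3 (λ a z y → a :* (z :* y) := z :* (a :* y)) ≋-refl (C (sgn j)) (Z e) (Z (j + j ∸ e))))

sum-difference : ∀ {a b : ℕ} → + a ℤ.- + b ≡ 0ℤ → a ≡ b
sum-difference {a} {b} p = ℤ.+-injective (ℤ.i-j≡0⇒i≡j (+ a) (+ b) p)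

unit-above : ∀ {a} → a ≡ 0ℤ ⊎ Unit a → ℤ.- a ℤ.≤ 1ℤ
unit-above (inj₁ refl)        = ℤ.+≤+ z≤n
unit-above (inj₂ (inj₁ refl)) = ℤ.-≤+
unit-above (inj₂ (inj₂ refl)) = ℤ.+≤+ ℕ.≤-refl

sgn-bound : ∀ k x → sgn k ℤ.* + x ℤ.≤ + x
sgn-bound k x with sgn-cases k
... | inj₁ p = ℤ.≤-reflexive (trans (cong (ℤ._* + x) p) (ℤ.*-identityˡ (+ x)))
... | inj₂ p = ℤ.≤-trans (ℤ.≤-reflexive (trans (cong (ℤ._* + x) p) (ℤ.-1*i≡-i (+ x)))) ℤ.neg-≤-pos

private
  value-2 : ∀ f g k {a₂ a₁ a₀ t₂ t₁ t₀ k₂} → f ‼ 2 ≡ a₂ → f ‼ 1 ≡ a₁ → f ‼ 0 ≡ a₀ → g ‼ 2 ≡ t₂ → g ‼ 1 ≡ t₁ → g ‼ 0 ≡ t₀ → k ‼ 2 ≡ k₂ →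
    (u ⊗ f ⊕ ⊝ (u ⊗ u ⊗ g ⊕ k)) ‼ 2 ≡ a₂ ℤ.+ a₁ ℤ.- (t₂ ℤ.+ + 2 ℤ.* t₁ ℤ.+ t₀ ℤ.+ k₂)
  value-2 f g k refl refl refl refl refl refl refl = lemma (f ‼ 2) (f ‼ 1) (f ‼ 0) (g ‼ 2) (g ‼ 1) (g ‼ 0) (k ‼ 2)
    where
    lemma : ∀ a b c t r s k → 1ℤ ℤ.* a ℤ.+ (1ℤ ℤ.* b ℤ.+ 0ℤ ℤ.* c) ℤ.+ ℤ.- (1ℤ ℤ.* t ℤ.+ (+ 2 ℤ.* r ℤ.+ 1ℤ ℤ.* s) ℤ.+ k) ≡ a ℤ.+ b ℤ.- (t ℤ.+ + 2 ℤ.* r ℤ.+ s ℤ.+ k)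
    lemma = ℤ-Solver.solve-∀

  value-3 : ∀ f g k {a₃ a₂ a₁ a₀ t₃ t₂ t₁ t₀ k₃} → f ‼ 3 ≡ a₃ → f ‼ 2 ≡ a₂ → f ‼ 1 ≡ a₁ → f ‼ 0 ≡ a₀ → g ‼ 3 ≡ t₃ → g ‼ 2 ≡ t₂ → g ‼ 1 ≡ t₁ → g ‼ 0 ≡ t₀ → k ‼ 3 ≡ k₃ →
    (u ⊗ f ⊕ ⊝ (u ⊗ u ⊗ g ⊕ k)) ‼ 3 ≡ a₃ ℤ.+ a₂ ℤ.+ + 4 ℤ.* t₀ ℤ.- (+ 2 ℤ.* a₀ ℤ.+ (t₃ ℤ.+ + 2 ℤ.* t₂ ℤ.+ t₁ ℤ.+ k₃))
  value-3 f g k refl refl refl refl refl refl refl refl refl = lemma (f ‼ 3) (f ‼ 2) (f ‼ 1) (f ‼ 0) (g ‼ 3) (g ‼ 2) (g ‼ 1) (g ‼ 0) (k ‼ 3)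
    where
    lemma : ∀ a b c d t₃ t₂ t₁ t₀ k → 1ℤ ℤ.* a ℤ.+ (1ℤ ℤ.* b ℤ.+ (0ℤ ℤ.* c ℤ.+ -[1+ 1 ] ℤ.* d)) ℤ.+ ℤ.- (1ℤ ℤ.* t₃ ℤ.+ (+ 2 ℤ.* t₂ ℤ.+ (1ℤ ℤ.* t₁ ℤ.+ -[1+ 3 ] ℤ.* t₀)) ℤ.+ k) ≡
      a ℤ.+ b ℤ.+ + 4 ℤ.* t₀ ℤ.- (+ 2 ℤ.* d ℤ.+ (t₃ ℤ.+ + 2 ℤ.* t₂ ℤ.+ t₁ ℤ.+ k))
    lemma = ℤ-Solver.solve-∀

module ThetaExclusion {p q l i j k : ℕ} {ks : List ℕ} (3≤p : 3 ≤ p) (p≤q : p ≤ q) (1≤l : 1 ≤ l) (3≤ks : All (3 ≤_) ks)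
  (1≤i : 1 ≤ i) (2≤j : 2 ≤ j) (i≤j : i ≤ j) (j≤k : j ≤ k) (equation : Δ p q l ≐ Θ i j k ⊗ cycles ks) where

  2≤k : 2 ≤ k
  2≤k = ℕ.≤-trans 2≤j j≤k

  module Girth (n : ℕ) (n∈ : n ∈ p ∷ i + j ∷ ks) (n≤p : n ≤ p) (n≤ij : n ≤ i + j) (n≤ks : All (n ≤_) ks) where
    3≤n : 3 ≤ n
    3≤n = All.lookup (3≤p ∷ ℕ.+-mono-≤ 1≤i 2≤j ∷ 3≤ks) n∈
    n≤q : n ≤ q
    n≤q = ℕ.≤-trans n≤p p≤q
    n≤ik : n ≤ i + k
    n≤ik = ℕ.≤-trans n≤ij (ℕ.+-monoʳ-≤ i j≤k)
    n≤jk : n ≤ j + k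
    n≤jk = ℕ.≤-trans n≤ik (ℕ.+-monoˡ-≤ k i≤j)
    n≤jj : n ≤ j + j
    n≤jj = ℕ.≤-trans n≤ij (ℕ.+-monoˡ-≤ j i≤j)
    n≤kk : n ≤ k + k
    n≤kk = ℕ.≤-trans n≤jj (ℕ.+-mono-≤ j≤k j≤k)

    open Window n 3≤n
    open LowOrder n 3≤n
    open Counting n 3≤n
    open ThetaWindow n 3≤n

    o₁ o₂ o₃ : ℕ
    o₁ = i + j ∸ n
    o₂ = i + k ∸ n
    o₃ = j + k ∸ n

    as os is : List ℕ
    as = p ∸ n ∷ q ∸ n ∷ []
    os = o₁ ∷ o₂ ∷ o₃ ∷ []
    is = map (_∸ n) ks

    A T K : ℕ → ℕ
    A = count as
    T = count os
    K = count is

    S g : Series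
    S = s i ⊕ s j ⊕ s k
    g = total os ⊕ ⊝ (Z o₃ ⊗ s i)

    private
      S-0 : S ‼ 0 ≡ 0ℤ
      S-0 = cong₂ ℤ._+_ (cong₂ ℤ._+_ (s-0 i 1≤i) (s-0 j (ℕ.<⇒≤ 2≤j))) (s-0 k (ℕ.<⇒≤ 2≤k))

      S-1 : S ‼ 1 ≡ 0ℤ
      S-1 = cong₂ ℤ._+_ (cong₂ ℤ._+_ (s-1 i 1≤i) (s-1 j (ℕ.<⇒≤ 2≤j))) (s-1 k (ℕ.<⇒≤ 2≤k))

      equation′ : C 1ℤ ⊗ Xs (map (λ i → n + i) as) ⊕ ⊝ (s l ⊗ (κ ⊗ κ ⊕ Z n ⊗ Pendants.correction (p ∸ n) (q ∸ n))) ≐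
        (Θ i j k ⊕ κ ⊗ κ ⊗ S ⊕ ⊝ (κ ⊗ κ ⊗ S)) ⊗ cycles (map (λ i → n + i) is)
      equation′ = exactly λ m → let open Truncated exact m in ≋-trans (≋-sym (mod (pendants n (p ∸ n) (q ∸ n) l) m))
        (≋-trans (≋-reflexive (cong₂ (λ a b → Δ a b l) (ℕ.m+[n∸m]≡n n≤p) (ℕ.m+[n∸m]≡n n≤q)))
        (≋-trans (mod equation m)
          (⊗-cong (solve 2 (λ a b → a := a :+ b :- b) ≋-refl (Θ i j k) (κ ⊗ κ ⊗ S)) (≋-reflexive (cong cycles (sym (offsets n n≤ks)))))))

    E F L R : Series
    E = theta-gap l 1≤l (win-Xs as) (win-Θ i j k 2≤j 2≤k (sym (ℕ.m+[n∸m]≡n n≤ij)) (sym (ℕ.m+[n∸m]≡n n≤ik)) (sym (ℕ.m+[n∸m]≡n n≤jk)))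
      (win-cycles is) (Pendants.correction-0 (p ∸ n) (q ∸ n)) (Pendants.correction-1 (p ∸ n) (q ∸ n)) S-0 S-1 equation′
    R = (C (sgn j) ⊗ Z (j + j ∸ n) ⊕ C (sgn k) ⊗ Z (k + k ∸ n)) ⊗ (κ ⊗ κ)
    F = E ⊕ R
    L = u ⊗ total as ⊕ ⊝ (u ⊗ u ⊗ g ⊕ total is)

    G h : ℤ
    G = second (A 0) ℤ.- (sgn n ℤ.* + T 0 ℤ.+ second (K 0) ℤ.+ (+ 2 ℤ.* (u ⊗ u ⊗ g) ‼ 0) ℤ.* (+ 2 ℤ.* total is ‼ 0))
    h = ℤ.- (+ lam l ℤ.* total as ‼ 0)

    E-low : LowForm E L G h
    E-low = theta-gap-low l 1≤l (win-Xs as) (win-Θ i j k 2≤j 2≤k (sym (ℕ.m+[n∸m]≡n n≤ij)) (sym (ℕ.m+[n∸m]≡n n≤ik)) (sym (ℕ.m+[n∸m]≡n n≤jk)))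
      (win-cycles is) (Pendants.correction-0 (p ∸ n) (q ∸ n)) (Pendants.correction-1 (p ∸ n) (q ∸ n)) S-0 S-1 equation′

    shifted : Z n ⊗ F ≐ s l ⊗ (κ ⊗ κ) ⊕ ⊝ (s i ⊗ (κ ⊗ κ))
    shifted = exactly λ m → let open Truncated exact m in ≋-trans
      (solve 5 (λ z e a b k → z :* (e :+ (a :+ b) :* k) := z :* e :+ (z :* a :+ z :* b) :* k) ≋-refl (Z n) E (C (sgn j) ⊗ Z (j + j ∸ n)) (C (sgn k) ⊗ Z (k + k ∸ n)) (κ ⊗ κ))
      (≋-trans (⊕-cong (mod (theta-gap-shifted l 1≤l (win-Xs as) (win-Θ i j k 2≤j 2≤k (sym (ℕ.m+[n∸m]≡n n≤ij)) (sym (ℕ.m+[n∸m]≡n n≤ik)) (sym (ℕ.m+[n∸m]≡n n≤jk)))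
          (win-cycles is) (Pendants.correction-0 (p ∸ n) (q ∸ n)) (Pendants.correction-1 (p ∸ n) (q ∸ n)) S-0 S-1 equation′) m)
          (⊗-cong (⊕-cong (≋-sym (mod (s-factor n j n≤jj) m)) (≋-sym (mod (s-factor n k n≤kk) m))) ≋-refl))
        (solve 5 (λ l k a b c → l :* k :- k :* (a :+ b :+ c) :+ (b :+ c) :* k := l :* k :- a :* k) ≋-refl (s l) (κ ⊗ κ) (s i) (s j) (s k)))

    -- The right-hand side starts with a unit coefficient while the low coefficients of F are mostly even,
    -- so they vanish one after the other; each vanishing coefficient is an equation between A, T and K.

    lead : Leading (Z n ⊗ F)
    lead = leading-≐ shifted (leading-difference l i (κ ⊗ κ) refl refl refl)

    R-value : ∀ t → t ≤ 1 → R ‼ (2 + t) ≡ sgn j ℤ.* + ind (j + j ∸ n) t ℤ.+ sgn k ℤ.* + ind (k + k ∸ n) t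
    R-value t t≤1 = trans (shape t t≤1) (cong₂ ℤ._+_ (trans (C-⊗ (sgn j) (Z (j + j ∸ n)) t) (cong (sgn j ℤ.*_) (Z-ind (j + j ∸ n) t)))
      (trans (C-⊗ (sgn k) (Z (k + k ∸ n)) t) (cong (sgn k ℤ.*_) (Z-ind (k + k ∸ n) t))))
      where
      r : Series
      r = C (sgn j) ⊗ Z (j + j ∸ n) ⊕ C (sgn k) ⊗ Z (k + k ∸ n)
      shape : ∀ t → t ≤ 1 → (r ⊗ (κ ⊗ κ)) ‼ (2 + t) ≡ r ‼ t
      shape zero       _ = lemma (r ‼ 0) (r ‼ 1) (r ‼ 2)
        where
        lemma : ∀ a b c → a ℤ.* 1ℤ ℤ.+ (b ℤ.* 0ℤ ℤ.+ c ℤ.* 0ℤ) ≡ a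
        lemma = ℤ-Solver.solve-∀
      shape (suc zero) _ = lemma (r ‼ 0) (r ‼ 1) (r ‼ 2) (r ‼ 3)
        where
        lemma : ∀ a b c d → a ℤ.* 0ℤ ℤ.+ (b ℤ.* 1ℤ ℤ.+ (c ℤ.* 0ℤ ℤ.+ d ℤ.* 0ℤ)) ≡ b
        lemma = ℤ-Solver.solve-∀
      shape (suc (suc t)) (s≤s ())

    F-low : ∀ t → t < 2 → F ‼ t ≡ + 2 ℤ.* L ‼ t
    F-low t t<2 = trans (cong₂ ℤ._+_ (at-i E-low t (ℕ.m≤n⇒m≤1+n t<2)) (R-low t t<2)) (ℤ.+-identityʳ _)
      where
      R-low : ∀ t → t < 2 → R ‼ t ≡ 0ℤ
      R-low 0 _ = ℤ.*-zeroʳ ((C (sgn j) ⊗ Z (j + j ∸ n) ⊕ C (sgn k) ⊗ Z (k + k ∸ n)) ‼ 0)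
      R-low 1 _ = cong₂ ℤ._+_ (ℤ.*-zeroʳ ((C (sgn j) ⊗ Z (j + j ∸ n) ⊕ C (sgn k) ⊗ Z (k + k ∸ n)) ‼ 0)) (ℤ.*-zeroʳ ((C (sgn j) ⊗ Z (j + j ∸ n) ⊕ C (sgn k) ⊗ Z (k + k ∸ n)) ‼ 1))
      R-low (suc (suc t)) (s≤s (s≤s ()))

    g-count : ∀ t → t < o₃ + (i + i) → g ‼ t ≡ + T t
    g-count t t< = trans (cong₂ (λ a b → a ℤ.- b) (total-count os t) (Z-s-below o₃ i t t<)) (ℤ.+-identityʳ _)

    private
      low : ∀ t → t < 2 → t < o₃ + (i + i)
      low t t<2 = ℕ.<-≤-trans t<2 (ℕ.≤-trans (ℕ.+-mono-≤ 1≤i 1≤i) (ℕ.m≤n+m (i + i) o₃))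

    F-0 : F ‼ 0 ≡ 0ℤ
    F-0 = climb F lead 0 (λ _ ()) (subst Even (sym (F-low 0 (s≤s z≤n))) (twice-even (L ‼ 0)))

    F-1 : F ‼ 1 ≡ 0ℤ
    F-1 = climb F lead 1 (λ { 0 _ → F-0 ; (suc _) (s≤s ()) }) (subst Even (sym (F-low 1 (s≤s (s≤s z≤n)))) (twice-even (L ‼ 1)))

    balance-0 : A 0 ≡ T 0 + K 0
    balance-0 = sum-difference (trans (lemma (+ A 0) (+ T 0) (+ K 0)) (trans (sym value) (twice-zero (trans (sym (F-low 0 (s≤s z≤n))) F-0))))
      where
      lemma : ∀ a t k → a ℤ.- (t ℤ.+ k) ≡ 1ℤ ℤ.* a ℤ.+ ℤ.- (1ℤ ℤ.* t ℤ.+ k)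
      lemma = ℤ-Solver.solve-∀
      value : L ‼ 0 ≡ 1ℤ ℤ.* + A 0 ℤ.+ ℤ.- (1ℤ ℤ.* + T 0 ℤ.+ + K 0)
      value = cong₂ (λ a b → 1ℤ ℤ.* a ℤ.+ ℤ.- b) (total-count as 0) (cong₂ (λ a b → 1ℤ ℤ.* a ℤ.+ b) (g-count 0 (low 0 (s≤s z≤n))) (total-count is 0))

    balance-1 : A 1 + A 0 ≡ T 1 + 2 * T 0 + K 1
    balance-1 = sum-difference (trans (cong (λ x → + A 1 ℤ.+ + A 0 ℤ.- (+ T 1 ℤ.+ x ℤ.+ + K 1)) (ℤ.pos-* 2 (T 0)))
      (trans (lemma (+ A 1) (+ A 0) (+ T 1) (+ T 0) (+ K 1)) (trans (sym value) (twice-zero (trans (sym (F-low 1 (s≤s (s≤s z≤n)))) F-1)))))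
      where
      lemma : ∀ a b t s k → a ℤ.+ b ℤ.- (t ℤ.+ + 2 ℤ.* s ℤ.+ k) ≡ 1ℤ ℤ.* a ℤ.+ 1ℤ ℤ.* b ℤ.+ ℤ.- (1ℤ ℤ.* t ℤ.+ + 2 ℤ.* s ℤ.+ k)
      lemma = ℤ-Solver.solve-∀
      value : L ‼ 1 ≡ 1ℤ ℤ.* + A 1 ℤ.+ 1ℤ ℤ.* + A 0 ℤ.+ ℤ.- (1ℤ ℤ.* + T 1 ℤ.+ + 2 ℤ.* + T 0 ℤ.+ + K 1)
      value = cong₂ (λ a b → a ℤ.+ ℤ.- b) (cong₂ (λ a b → 1ℤ ℤ.* a ℤ.+ 1ℤ ℤ.* b) (total-count as 1) (total-count as 0))
        (cong₂ ℤ._+_ (cong₂ (λ a b → 1ℤ ℤ.* a ℤ.+ + 2 ℤ.* b) (g-count 1 (low 1 (s≤s (s≤s z≤n)))) (g-count 0 (low 0 (s≤s z≤n)))) (total-count is 1))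

    G-zero : T 0 ≤ 1 → G ≡ 0ℤ
    G-zero T≤1 = trans (cong₂ (λ a b → a ℤ.- b) (cong second balance-0)
      (trans (cong₂ (λ a b → a ℤ.+ second (K 0) ℤ.+ b) (single (T 0) T≤1)
          (cong₂ (λ a b → (+ 2 ℤ.* a) ℤ.* (+ 2 ℤ.* b)) (trans (ℤ.*-identityˡ (g ‼ 0)) (g-count 0 (low 0 (s≤s z≤n)))) (total-count is 0)))
        (sym (second-+ (T 0) (K 0))))) (ℤ.+-inverseʳ (second (T 0 + K 0)))
      where
      single : ∀ t → t ≤ 1 → sgn n ℤ.* + t ≡ second t
      single 0 _ = ℤ.*-zeroʳ (sgn n)
      single 1 _ = lemma (sgn n)
        where
        lemma : ∀ a → a ℤ.* 1ℤ ≡ 0ℤ ℤ.+ a ℤ.+ + 4 ℤ.* 0ℤ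
        lemma = ℤ-Solver.solve-∀
      single (suc (suc t)) (s≤s ())

    F-2 : F ‼ 2 ≡ + 2 ℤ.* L ‼ 2 ℤ.+ (sgn j ℤ.* + ind (j + j ∸ n) 0 ℤ.+ sgn k ℤ.* + ind (k + k ∸ n) 0)
    F-2 = cong₂ ℤ._+_ (at-i E-low 2 ℕ.≤-refl) (R-value 0 z≤n)

    F-3 : T 0 ≤ 1 → F ‼ 3 ≡ + 2 ℤ.* (L ‼ 3 ℤ.+ h) ℤ.+ (sgn j ℤ.* + ind (j + j ∸ n) 1 ℤ.+ sgn k ℤ.* + ind (k + k ∸ n) 1)
    F-3 T≤1 = cong₂ ℤ._+_ (at-3 E-low (G-zero T≤1)) (R-value 1 ℕ.≤-refl)

    module _ (4≤ : 4 ≤ o₃ + (i + i)) where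

      L-2 : L ‼ 2 ≡ + (A 2 + A 1) ℤ.- + (T 2 + 2 * T 1 + T 0 + K 2)
      L-2 = trans (value-2 (total as) g (total is) (total-count as 2) (total-count as 1) (total-count as 0)
          (g-count 2 (ℕ.<-≤-trans (s≤s (s≤s (s≤s z≤n))) 4≤)) (g-count 1 (ℕ.<-≤-trans (s≤s (s≤s z≤n)) 4≤)) (g-count 0 (ℕ.<-≤-trans (s≤s z≤n) 4≤)) (total-count is 2))
        (cong (λ x → + (A 2 + A 1) ℤ.- (+ T 2 ℤ.+ x ℤ.+ + T 0 ℤ.+ + K 2)) (sym (ℤ.pos-* 2 (T 1))))

      L-3+h : L ‼ 3 ℤ.+ h ≡ + (A 3 + A 2 + 4 * T 0) ℤ.- + (2 * A 0 + (T 3 + 2 * T 2 + T 1 + K 3) + lam l * A 0)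
      L-3+h = trans (cong₂ (λ x y → x ℤ.+ ℤ.- (+ lam l ℤ.* y)) (value-3 (total as) g (total is) (total-count as 3) (total-count as 2) (total-count as 1) (total-count as 0)
          (g-count 3 4≤) (g-count 2 (ℕ.<-≤-trans (s≤s (s≤s (s≤s z≤n))) 4≤)) (g-count 1 (ℕ.<-≤-trans (s≤s (s≤s z≤n)) 4≤)) (g-count 0 (ℕ.<-≤-trans (s≤s z≤n) 4≤)) (total-count is 3))
          (total-count as 0))
        (trans (lemma (+ A 3 ℤ.+ + A 2 ℤ.+ + 4 ℤ.* + T 0) (+ 2 ℤ.* + A 0 ℤ.+ (+ T 3 ℤ.+ + 2 ℤ.* + T 2 ℤ.+ + T 1 ℤ.+ + K 3)) (+ lam l ℤ.* + A 0))
        (cong₂ (λ x y → + A 3 ℤ.+ + A 2 ℤ.+ x ℤ.- y) (sym (ℤ.pos-* 4 (T 0)))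
          (cong₂ ℤ._+_ (cong₂ (λ x y → x ℤ.+ (+ T 3 ℤ.+ y ℤ.+ + T 1 ℤ.+ + K 3)) (sym (ℤ.pos-* 2 (A 0))) (sym (ℤ.pos-* 2 (T 2)))) (sym (ℤ.pos-* (lam l) (A 0))))))
        where
        lemma : ∀ a b c → a ℤ.- b ℤ.+ ℤ.- c ≡ a ℤ.- (b ℤ.+ c)
        lemma = ℤ-Solver.solve-∀

cycles-↭ : ∀ {ks ks′} → ks ↭ ks′ → cycles ks ≐ cycles ks′
cycles-↭ r = exactly λ m → go m r
  where
  go : ∀ m {ks ks′} → ks ↭ ks′ → Truncated._≋_ exact m (cycles ks) (cycles ks′)
  go m Perm.refl = let open Truncated exact m in ≋-refl
  go m (Perm.prep k r) = let open Truncated exact m in ⊗-cong ≋-refl (go m r)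
  go m (Perm.swap {xs} {ys} k j r) = let open Truncated exact m in ≋-trans (⊗-cong ≋-refl (⊗-cong ≋-refl (go m r)))
    (solve 3 (λ a b r → a :* (b :* r) := b :* (a :* r)) ≋-refl (c k) (c j) (cycles ys))
  go m (Perm.trans r r′) = let open Truncated exact m in ≋-trans (go m r) (go m r′)

member-≤-sum : ∀ {k} {ks : List ℕ} → k ∈ ks → k ≤ sum ks
member-≤-sum {ks = k ∷ ks} (here refl) = ℕ.m≤m+n k (sum ks)
member-≤-sum {ks = k ∷ ks} (there k∈)  = ℕ.≤-trans (member-≤-sum k∈) (ℕ.m≤n+m (sum ks) k)

both : ∀ x y → ind x 0 + (ind y 0 + 0) ≡ 2 → x ≡ 0 × y ≡ 0
both zero    zero    _ = refl , refl
both zero    (suc y) ()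
both (suc x) zero    ()
both (suc x) (suc y) ()

one-each : ∀ x y → x ≤ y → ind x 0 + (ind y 0 + 0) ≡ 1 → ind x 1 + (ind y 1 + 0) ≡ 1 → x ≡ 0 × y ≡ 1
one-each zero          zero          _ () _
one-each zero          (suc zero)    _ _  _ = refl , refl
one-each zero          (suc (suc y)) _ _  ()
one-each (suc x)       (suc y)       _ () _

beyond : ∀ x → ind x 0 ≡ 0 → ind x 1 ≡ 0 → ∃ λ y → x ≡ 2 + y
beyond 0             () _
beyond 1             _  ()
beyond (suc (suc y)) _  _ = y , refl

above-count : ∀ n {ks} → All (n ≤_) ks → count (map (_∸ n) ks) 0 ≡ 0 → count (map (_∸ n) ks) 1 ≡ 0 →
  All (2 + n ≤_) ks × count (map (_∸ (2 + n)) ks) 0 ≡ count (map (_∸ n) ks) 2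
above-count n []           _  _  = [] , refl
above-count n {k ∷ ks} (n≤k ∷ n≤ks) z₀ z₁ with above-count n n≤ks (ℕ.m+n≡0⇒n≡0 (ind (k ∸ n) 0) z₀) (ℕ.m+n≡0⇒n≡0 (ind (k ∸ n) 1) z₁)
... | f≤ks , same with beyond (k ∸ n) (ℕ.m+n≡0⇒m≡0 (ind (k ∸ n) 0) z₀) (ℕ.m+n≡0⇒m≡0 (ind (k ∸ n) 1) z₁)
...   | y , eq = subst (2 + n ≤_) (sym k≡) (s≤s (s≤s (ℕ.m≤m+n n y))) ∷ f≤ks , cong₂ _+_ (trans (cong (λ t → ind t 0) rest) (cong (λ t → ind t 2) (sym eq))) same
  where
  k≡ : k ≡ 2 + (n + y)
  k≡ = trans (sym (ℕ.m+[n∸m]≡n n≤k)) (trans (cong (λ x → n + x) eq) (trans (ℕ.+-suc n (suc y)) (cong suc (ℕ.+-suc n y))))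
  rest : k ∸ (2 + n) ≡ y
  rest = trans (cong (_∸ (2 + n)) k≡) (ℕ.m+n∸m≡n (2 + n) y)

near-counts : ∀ {a₀ a₁ t k₀ t₁ k₁} → a₀ ≡ suc t + k₀ → a₁ + a₀ ≡ t₁ + 2 * suc t + k₁ → a₀ + a₁ ≤ 2 →
  t ≡ 0 × t₁ ≡ 0 × k₁ ≡ 0 × a₀ + a₁ ≡ 2
near-counts {a₀} {a₁} {t} {k₀} {t₁} {k₁} _ eq a≤2 = t≡0 , ℕ.m+n≡0⇒m≡0 t₁ rest≡0 , ℕ.m+n≡0⇒n≡0 t₁ rest≡0 , sum≡2
  where
  shape : a₀ + a₁ ≡ 2 + (t + t + (t₁ + k₁))
  shape = trans (ℕ.+-comm a₀ a₁) (trans eq (lemma t t₁ k₁))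
    where
    lemma : ∀ t a b → a + 2 * suc t + b ≡ 2 + (t + t + (a + b))
    lemma = ℕ-Solver.solve-∀
  none : t + t + (t₁ + k₁) ≡ 0
  none = ℕ.n≤0⇒n≡0 (ℕ.+-cancelˡ-≤ 2 _ _ (subst (_≤ 2) shape a≤2))
  t≡0 : t ≡ 0
  t≡0 = ℕ.m+n≡0⇒m≡0 t (ℕ.m+n≡0⇒m≡0 (t + t) none)
  rest≡0 : t₁ + k₁ ≡ 0
  rest≡0 = ℕ.m+n≡0⇒n≡0 (t + t) none
  sum≡2 : a₀ + a₁ ≡ 2
  sum≡2 = trans shape (cong (λ x → 2 + x) none)

far-counts : ∀ {a₀ a₂ a₃ t₁ x y s} → 1 ≤ a₀ → a₀ + a₂ + a₃ ≤ 2 → x + y ≤ 2 * t₁ → 4 * a₀ + 2 * t₁ ≤ s → ¬ s ≤ 2 * (a₃ + a₂) + (x + y) + 1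
far-counts {a₀} {a₂} {a₃} {t₁} {x} {y} {s} 1≤a₀ few xy s≥ s≤ = ℕ.<⇒≱ (s≤s ℕ.≤-refl) (ℕ.≤-trans (ℕ.*-monoʳ-≤ 6 1≤a₀) 6a≤5)
  where
  4a≤ : 4 * a₀ ≤ 2 * (a₃ + a₂) + 1
  4a≤ = ℕ.+-cancelʳ-≤ (2 * t₁) _ _ (ℕ.≤-trans s≥ (ℕ.≤-trans s≤ (ℕ.≤-trans (ℕ.+-monoˡ-≤ 1 (ℕ.+-monoʳ-≤ (2 * (a₃ + a₂)) xy)) (ℕ.≤-reflexive (lemma (2 * (a₃ + a₂)) (2 * t₁))))))
    where
    lemma : ∀ a b → a + b + 1 ≡ a + 1 + b
    lemma = ℕ-Solver.solve-∀
  6a≤5 : 6 * a₀ ≤ 5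
  6a≤5 = ℕ.≤-trans (ℕ.≤-reflexive (lemma₁ a₀)) (ℕ.≤-trans (ℕ.+-monoʳ-≤ (2 * a₀) 4a≤) (ℕ.≤-trans (ℕ.≤-reflexive (lemma₂ a₀ a₂ a₃)) (ℕ.+-monoˡ-≤ 1 (ℕ.*-monoʳ-≤ 2 few))))
    where
    lemma₁ : ∀ a → 6 * a ≡ 2 * a + 4 * a
    lemma₁ = ℕ-Solver.solve-∀
    lemma₂ : ∀ a b c → 2 * a + (2 * (c + b) + 1) ≡ 2 * (a + b + c) + 1
    lemma₂ = ℕ-Solver.solve-∀

theta-excluded : ∀ {p q l i j k ks} → 3 ≤ p → p ≤ q → 1 ≤ l → All (3 ≤_) ks → 1 ≤ i → 2 ≤ j → i ≤ j → j ≤ k →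
  p + q + l ≡ i + j + k + sum ks → ¬ Δ p q l ≐ Θ i j k ⊗ cycles ks
theta-excluded {p} {q} {l} {i} {j} {k} {ks} 3≤p p≤q 1≤l 3≤ks 1≤i 2≤j i≤j j≤k order equation = from (minimum p (i + j ∷ ks))
  where
  open ThetaExclusion 3≤p p≤q 1≤l 3≤ks 1≤i 2≤j i≤j j≤k equation
  from : ¬ (∃ λ n → n ∈ p ∷ i + j ∷ ks × All (n ≤_) (p ∷ i + j ∷ ks))
  from (n , n∈ , n≤p ∷ n≤ij ∷ n≤ks) = split (o₁ ℕ.≟ 0)
    where
    open Girth n n∈ n≤p n≤ij n≤ks
    open Counting n 3≤n
    open LowOrder n 3≤n

    at-most-two : A 0 + A 1 + A 2 + A 3 ≤ 2
    at-most-two = few as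

    far : o₁ ≢ 0 → ⊥
    far o₁≢0 = far-counts {a₀ = A 0} {A 2} {A 3} {T 1} {x₁} {y₁} {2 * weight} 1≤A₀
      (ℕ.≤-trans (ℕ.+-monoˡ-≤ (A 3) (ℕ.+-monoˡ-≤ (A 2) (ℕ.m≤m+n (A 0) (A 1)))) at-most-two) xy≤ weight≥ weight≤
      where
      n<ij : n < i + j
      n<ij = ℕ.m∸n≢0⇒n<m o₁≢0
      x₁ y₁ weight : ℕ
      x₁ = ind (j + j ∸ n) 1
      y₁ = ind (k + k ∸ n) 1
      weight = 2 * A 0 + (T 3 + 2 * T 2 + T 1 + K 3) + lam l * A 0
      positive : ∀ {a} → n < a → a ∸ n ≢ 0
      positive n<a = ℕ.>⇒≢ (ℕ.m<n⇒0<n∸m n<a)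
      n<jj : n < j + j
      n<jj = ℕ.<-≤-trans n<ij (ℕ.+-monoˡ-≤ j i≤j)
      n<kk : n < k + k
      n<kk = ℕ.<-≤-trans n<jj (ℕ.+-mono-≤ j≤k j≤k)
      n<ik : n < i + k
      n<ik = ℕ.<-≤-trans n<ij (ℕ.+-monoʳ-≤ i j≤k)
      T₀≡0 : T 0 ≡ 0
      T₀≡0 = cong₂ _+_ (ind-other o₁≢0) (cong₂ _+_ (ind-other (positive n<ik)) (cong₂ _+_ (ind-other (positive (ℕ.<-≤-trans n<ik (ℕ.+-monoˡ-≤ k i≤j)))) refl))
      T≤1 : T 0 ≤ 1
      T≤1 = ℕ.≤-trans (ℕ.≤-reflexive T₀≡0) z≤n
      4≤ : 4 ≤ o₃ + (i + i)
      4≤ = ℕ.+-cancelˡ-≤ n _ _ (ℕ.≤-trans (ℕ.≤-reflexive (ℕ.+-suc n 3)) (ℕ.≤-trans (ℕ.+-mono-≤ n<ij (ℕ.+-mono-≤ 1≤i 2≤k)) (ℕ.≤-reflexive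
        (trans (regroup i j k) (trans (cong (_+ (i + i)) (sym (ℕ.m+[n∸m]≡n n≤jk))) (ℕ.+-assoc n o₃ (i + i)))))))
        where
        regroup : ∀ i j k → i + j + (i + k) ≡ j + k + (i + i)
        regroup = ℕ-Solver.solve-∀
      1≤A₀ : 1 ≤ A 0
      1≤A₀ = member n∈
        where
        member : n ∈ p ∷ i + j ∷ ks → 1 ≤ A 0
        member (here r)             = tally-member {p ∷ q ∷ []} (here r)
        member (there (here r))     = contradiction r (ℕ.<⇒≢ n<ij)
        member (there (there n∈ks)) = subst (1 ≤_) (sym balance-0) (ℕ.≤-trans (tally-member n∈ks) (ℕ.m≤n+m (K 0) (T 0)))
      even-zero : ∀ {a b} → a ≡ 0 → b ≡ 0 → Even (sgn j ℤ.* + a ℤ.+ sgn k ℤ.* + b)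
      even-zero refl refl = 0ℤ , cong₂ ℤ._+_ (ℤ.*-zeroʳ (sgn j)) (ℤ.*-zeroʳ (sgn k))
      F₂≡0 : F ‼ 2 ≡ 0ℤ
      F₂≡0 = climb F lead 2 (λ { 0 _ → F-0 ; 1 _ → F-1 ; (suc (suc _)) (s≤s (s≤s ())) })
        (subst Even (sym F-2) (even-+ (twice-even (L ‼ 2)) (even-zero (ind-other (positive n<jj)) (ind-other (positive n<kk)))))
      F₃ : F ‼ 3 ≡ 0ℤ ⊎ Unit (F ‼ 3)
      F₃ = subst (λ a → a ≡ 0ℤ ⊎ Unit a) (offset-at F 3)
        (unit lead (n + 3) (offset-zeros F 3 λ { 0 _ → F-0 ; 1 _ → F-1 ; 2 _ → F₂≡0 ; (suc (suc (suc _))) (s≤s (s≤s (s≤s ()))) }))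
      value : + (2 * weight) ≡ + (2 * (A 3 + A 2)) ℤ.+ (sgn j ℤ.* + x₁ ℤ.+ sgn k ℤ.* + y₁) ℤ.+ ℤ.- F ‼ 3
      value = trans (ℤ.pos-* 2 weight) (trans (lemma (+ (A 3 + A 2)) (+ weight) (sgn j ℤ.* + x₁ ℤ.+ sgn k ℤ.* + y₁))
        (cong₂ (λ a b → a ℤ.+ (sgn j ℤ.* + x₁ ℤ.+ sgn k ℤ.* + y₁) ℤ.+ ℤ.- b) (sym (ℤ.pos-* 2 (A 3 + A 2))) (sym F-value)))
        where
        lemma : ∀ x y s → + 2 ℤ.* y ≡ + 2 ℤ.* x ℤ.+ s ℤ.+ ℤ.- (+ 2 ℤ.* (x ℤ.- y) ℤ.+ s)
        lemma = ℤ-Solver.solve-∀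
        F-value : F ‼ 3 ≡ + 2 ℤ.* (+ (A 3 + A 2) ℤ.- + weight) ℤ.+ (sgn j ℤ.* + x₁ ℤ.+ sgn k ℤ.* + y₁)
        F-value = trans (F-3 T≤1) (cong (λ a → + 2 ℤ.* a ℤ.+ (sgn j ℤ.* + x₁ ℤ.+ sgn k ℤ.* + y₁)) (trans (L-3+h 4≤)
          (cong (λ a → + a ℤ.- + weight) (trans (cong (λ t → A 3 + A 2 + 4 * t) T₀≡0) (ℕ.+-identityʳ (A 3 + A 2))))))
      weight≤ : 2 * weight ≤ 2 * (A 3 + A 2) + (x₁ + y₁) + 1
      weight≤ = ℤ.drop‿+≤+ (ℤ.≤-trans (ℤ.≤-reflexive value) (ℤ.+-mono-≤ (ℤ.+-mono-≤ (ℤ.≤-refl {+ (2 * (A 3 + A 2))}) (ℤ.+-mono-≤ (sgn-bound j x₁) (sgn-bound k y₁))) (unit-above F₃)))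
      weight≥ : 4 * A 0 + 2 * T 1 ≤ 2 * weight
      weight≥ = ℕ.≤-trans (ℕ.≤-reflexive (lemma (A 0) (T 1))) (ℕ.*-monoʳ-≤ 2 (ℕ.≤-trans (ℕ.+-monoʳ-≤ (2 * A 0) (ℕ.≤-trans (ℕ.m≤n+m (T 1) (T 3 + 2 * T 2)) (ℕ.m≤m+n _ (K 3)))) (ℕ.m≤m+n _ (lam l * A 0))))
        where
        lemma : ∀ a t → 4 * a + 2 * t ≡ 2 * (2 * a + t)
        lemma = ℕ-Solver.solve-∀
      xy≤ : x₁ + y₁ ≤ 2 * T 1
      xy≤ with j + j ∸ n ℕ.≟ 1
      ... | no jj≢1 = ℕ.≤-trans (ℕ.≤-reflexive (cong₂ _+_ (ind-other jj≢1) (ind-other kk≢1))) z≤n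
        where
        kk≢1 : k + k ∸ n ≢ 1
        kk≢1 kk≡1 = jj≢1 (ℕ.≤-antisym (ℕ.≤-trans (ℕ.∸-monoˡ-≤ n (ℕ.+-mono-≤ j≤k j≤k)) (ℕ.≤-reflexive kk≡1)) (ℕ.m<n⇒0<n∸m n<jj))
      ... | yes jj≡1 = ℕ.≤-trans (ℕ.+-mono-≤ (ind≤1 (j + j ∸ n) 1) (ind≤1 (k + k ∸ n) 1)) (ℕ.*-monoʳ-≤ 2 (ℕ.≤-trans (ℕ.≤-reflexive (sym (cong (λ o → ind o 1) o₁≡1))) (ℕ.m≤m+n (ind o₁ 1) _)))
        where
        ind≤1 : ∀ i t → ind i t ≤ 1
        ind≤1 i t = [ ℕ.≤-reflexive , (λ p → ℕ.≤-trans (ℕ.≤-reflexive p) z≤n) ]′ (ind-+ i t)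
        o₁≡1 : o₁ ≡ 1
        o₁≡1 = ℕ.≤-antisym (ℕ.≤-trans (ℕ.∸-monoˡ-≤ n (ℕ.+-monoˡ-≤ j i≤j)) (ℕ.≤-reflexive jj≡1)) (ℕ.m<n⇒0<n∸m n<ij)

    near : o₁ ≡ 0 → ⊥
    near o₁≡0 = cases (ℕ.m≤n⇒m<n∨m≡n i≤j)
      where
      n≡ij : n ≡ i + j
      n≡ij = ℕ.≤-antisym n≤ij (ℕ.m∸n≡0⇒m≤n o₁≡0)
      T₀ : T 0 ≡ suc (ind o₂ 0 + (ind o₃ 0 + 0))
      T₀ = cong (λ o → ind o 0 + (ind o₂ 0 + (ind o₃ 0 + 0))) o₁≡0
      small : A 0 + A 1 ≤ 2
      small = ℕ.≤-trans (ℕ.≤-trans (ℕ.m≤m+n (A 0 + A 1) (A 2)) (ℕ.m≤m+n _ (A 3))) at-most-two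
      counts : ind o₂ 0 + (ind o₃ 0 + 0) ≡ 0 × T 1 ≡ 0 × K 1 ≡ 0 × A 0 + A 1 ≡ 2
      counts = near-counts (trans balance-0 (cong (_+ K 0) T₀)) (trans balance-1 (cong (λ t → T 1 + 2 * t + K 1) T₀)) small
      T₀≡1 : T 0 ≡ 1
      T₀≡1 = trans T₀ (cong suc (proj₁ counts))
      T₁≡0 : T 1 ≡ 0
      T₁≡0 = proj₁ (proj₂ counts)
      K₁≡0 : K 1 ≡ 0
      K₁≡0 = proj₁ (proj₂ (proj₂ counts))
      A₀₁ : A 0 + A 1 ≡ 2
      A₀₁ = proj₂ (proj₂ (proj₂ counts))
      A₀ : A 0 ≡ suc (K 0)
      A₀ = trans balance-0 (cong (_+ K 0) T₀≡1)
      gap : ∃ λ y → o₂ ≡ 2 + y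
      gap = beyond o₂ (ℕ.m+n≡0⇒m≡0 (ind o₂ 0) (proj₁ counts)) (ℕ.m+n≡0⇒m≡0 (ind o₂ 1) (ℕ.m+n≡0⇒n≡0 (ind o₁ 1) T₁≡0))
      k≡j+o₂ : k ≡ j + o₂
      k≡j+o₂ = ℕ.+-cancelˡ-≡ i _ _ (trans (sym (ℕ.m+[n∸m]≡n n≤ik)) (trans (cong (_+ o₂) n≡ij) (ℕ.+-assoc i j o₂)))
      2+j≤k : 2 + j ≤ k
      2+j≤k = ℕ.≤-trans (ℕ.≤-trans (ℕ.≤-reflexive (ℕ.+-comm 2 j)) (ℕ.+-monoʳ-≤ j (ℕ.≤-trans (ℕ.m≤m+n 2 (proj₁ gap)) (ℕ.≤-reflexive (sym (proj₂ gap)))))) (ℕ.≤-reflexive (sym k≡j+o₂))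

      equal : i ≡ j → ⊥
      equal i≡j = finish (sgn-cases j) (A 1) refl
        where
        n≡jj : n ≡ j + j
        n≡jj = trans n≡ij (cong (_+ j) i≡j)
        jj≡0 : j + j ∸ n ≡ 0
        jj≡0 = trans (cong (_∸ n) (sym n≡jj)) (ℕ.n∸n≡0 n)
        4≤kk : 4 ≤ k + k ∸ n
        4≤kk = ℕ.≤-trans (ℕ.≤-reflexive (sym (trans (cong₂ _∸_ (lemma j) n≡jj) (ℕ.m+n∸m≡n (j + j) 4)))) (ℕ.∸-monoˡ-≤ n (ℕ.+-mono-≤ 2+j≤k 2+j≤k))
          where
          lemma : ∀ j → 2 + j + (2 + j) ≡ j + j + 4
          lemma = ℕ-Solver.solve-∀
        4≤ : 4 ≤ o₃ + (i + i)
        4≤ = ℕ.≤-trans (ℕ.+-mono-≤ 2≤j 2≤j) (ℕ.≤-trans (ℕ.≤-reflexive (cong₂ _+_ (sym i≡j) (sym i≡j))) (ℕ.m≤n+m (i + i) o₃))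
        F′ : Series
        F′ = F ⊕ C (sgn j) ⊗ (κ ⊗ κ)
        shifted′ : Z n ⊗ F′ ≐ s l ⊗ (κ ⊗ κ)
        shifted′ = exactly λ m → let open Truncated exact m in ≋-trans
          (solve 4 (λ z f a k → z :* (f :+ a :* k) := z :* f :+ z :* (a :* con 1ℤ) :* k) ≋-refl (Z n) F (C (sgn j)) (κ ⊗ κ))
          (≋-trans (⊕-cong (mod shifted m) (⊗-cong (≋-trans (≋-reflexive (cong (λ t → Z n ⊗ (C (sgn j) ⊗ Z t)) (sym jj≡0))) (≋-trans (≋-sym (mod (s-factor n j n≤jj) m)) (≋-reflexive (cong s (sym i≡j))))) ≋-refl))
            (solve 3 (λ l i k → l :* k :- i :* k :+ i :* k := l :* k) ≋-refl (s l) (s i) (κ ⊗ κ)))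
        lead′ : Leading (Z n ⊗ F′)
        lead′ = leading-≐ shifted′ (leading-s l (κ ⊗ κ) refl refl refl)
        F′-at : ∀ t {a b} → F ‼ t ≡ a → (κ ⊗ κ) ‼ t ≡ b → F′ ‼ t ≡ a ℤ.+ sgn j ℤ.* b
        F′-at t p q = cong₂ ℤ._+_ p (trans (C-⊗ (sgn j) (κ ⊗ κ) t) (cong (sgn j ℤ.*_) q))
        F′-0 : F′ ‼ 0 ≡ 0ℤ
        F′-0 = trans (F′-at 0 F-0 refl) (cong (λ t → 0ℤ ℤ.+ t) (ℤ.*-zeroʳ (sgn j)))
        F′-1 : F′ ‼ 1 ≡ 0ℤ
        F′-1 = trans (F′-at 1 F-1 refl) (cong (λ t → 0ℤ ℤ.+ t) (ℤ.*-zeroʳ (sgn j)))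
        corrections : ∀ t → t ≤ 1 → sgn j ℤ.* + ind (j + j ∸ n) t ℤ.+ sgn k ℤ.* + ind (k + k ∸ n) t ≡ sgn j ℤ.* + ind 0 t
        corrections t t≤1 = trans (cong₂ (λ a b → sgn j ℤ.* + ind a t ℤ.+ sgn k ℤ.* + b) jj≡0 (ind-other (ℕ.>⇒≢ (ℕ.<-≤-trans (s≤s t≤1) (ℕ.≤-trans (s≤s (s≤s z≤n)) 4≤kk)))))
          (trans (cong (λ a → sgn j ℤ.* + ind 0 t ℤ.+ a) (ℤ.*-zeroʳ (sgn k))) (ℤ.+-identityʳ _))
        F′-2 : F′ ‼ 2 ≡ + 2 ℤ.* (L ‼ 2 ℤ.+ sgn j)
        F′-2 = trans (F′-at 2 (trans F-2 (cong (λ a → + 2 ℤ.* L ‼ 2 ℤ.+ a) (corrections 0 z≤n))) refl) (lemma (L ‼ 2) (sgn j))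
          where
          lemma : ∀ a s → + 2 ℤ.* a ℤ.+ s ℤ.* 1ℤ ℤ.+ s ℤ.* 1ℤ ≡ + 2 ℤ.* (a ℤ.+ s)
          lemma = ℤ-Solver.solve-∀
        F′-3 : F′ ‼ 3 ≡ + 2 ℤ.* (L ‼ 3 ℤ.+ h)
        F′-3 = trans (F′-at 3 (trans (F-3 (ℕ.≤-reflexive T₀≡1)) (cong (λ a → + 2 ℤ.* (L ‼ 3 ℤ.+ h) ℤ.+ a) (corrections 1 ℕ.≤-refl))) refl) (lemma (+ 2 ℤ.* (L ‼ 3 ℤ.+ h)) (sgn j))
          where
          lemma : ∀ a s → a ℤ.+ s ℤ.* 0ℤ ℤ.+ s ℤ.* 0ℤ ≡ a
          lemma = ℤ-Solver.solve-∀
        F′₂≡0 : F′ ‼ 2 ≡ 0ℤ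
        F′₂≡0 = climb F′ lead′ 2 (λ { 0 _ → F′-0 ; 1 _ → F′-1 ; (suc (suc _)) (s≤s (s≤s ())) }) (subst Even (sym F′-2) (twice-even (L ‼ 2 ℤ.+ sgn j)))
        F′₃≡0 : F′ ‼ 3 ≡ 0ℤ
        F′₃≡0 = climb F′ lead′ 3 (λ { 0 _ → F′-0 ; 1 _ → F′-1 ; 2 _ → F′₂≡0 ; (suc (suc (suc _))) (s≤s (s≤s (s≤s ()))) }) (subst Even (sym F′-3) (twice-even (L ‼ 3 ℤ.+ h)))
        rest : A 2 + A 3 ≡ 0
        rest = ℕ.n≤0⇒n≡0 (ℕ.+-cancelˡ-≤ 2 _ _ (subst (λ t → t + (A 2 + A 3) ≤ 2) A₀₁ (ℕ.≤-trans (ℕ.≤-reflexive (sym (ℕ.+-assoc (A 0 + A 1) (A 2) (A 3)))) at-most-two)))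
        A₂≡0 : A 2 ≡ 0
        A₂≡0 = ℕ.m+n≡0⇒m≡0 (A 2) rest
        A₃≡0 : A 3 ≡ 0
        A₃≡0 = ℕ.m+n≡0⇒n≡0 (A 2) rest
        level-2 : + A 1 ℤ.+ sgn j ≡ + (T 2 + 1 + K 2)
        level-2 = ℤ.i-j≡0⇒i≡j _ _ (trans (lemma (+ A 1) (sgn j) (+ (T 2 + 1 + K 2))) (trans (cong (ℤ._+ sgn j) (sym L₂)) (twice-zero (trans (sym F′-2) F′₂≡0))))
          where
          lemma : ∀ a s t → a ℤ.+ s ℤ.- t ≡ a ℤ.- t ℤ.+ s
          lemma = ℤ-Solver.solve-∀
          L₂ : L ‼ 2 ≡ + A 1 ℤ.- + (T 2 + 1 + K 2)
          L₂ = trans (L-2 4≤) (cong₂ (λ a b → + a ℤ.- + b) (cong (_+ A 1) A₂≡0)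
            (cong (_+ K 2) (cong₂ _+_ (trans (cong (λ t → T 2 + 2 * t) T₁≡0) (ℕ.+-identityʳ (T 2))) T₀≡1)))
        level-3 : 4 ≡ 2 * A 0 + (T 3 + 2 * T 2 + K 3) + lam l * A 0
        level-3 = trans (sym (cong₂ _+_ (cong₂ _+_ A₃≡0 A₂≡0) (cong (4 *_) T₀≡1))) (trans (sum-difference (trans (sym (L-3+h 4≤)) (twice-zero (trans (sym F′-3) F′₃≡0))))
          (cong (λ t → 2 * A 0 + (t + K 3) + lam l * A 0) (trans (cong (λ t → T 3 + 2 * T 2 + t) T₁≡0) (ℕ.+-identityʳ _))))
        A₁≤1 : A 1 ≤ 1
        A₁≤1 = ℕ.+-cancelˡ-≤ 1 _ _ (ℕ.≤-trans (ℕ.+-monoˡ-≤ (A 1) (ℕ.≤-trans (s≤s z≤n) (ℕ.≤-reflexive (sym A₀)))) (ℕ.≤-reflexive A₀₁))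
        n≡ii : n ≡ i + i
        n≡ii = trans n≡ij (cong (λ t → i + t) (sym i≡j))

        exact-case : sgn j ≡ 1ℤ → A 1 ≡ 0 → ⊥
        exact-case sgn≡1 A₁≡0 = equal-arcs-exact {l} {i} {k} {ks′} 1≤i (trans (cong sgn i≡j) sgn≡1) (subst (λ t → 2 + t ≤ k) (sym i≡j) 2+j≤k) k≤l
            (All.tail (Perm.All-resp-↭ split-ks 3≤ks))
            (exactly λ m → let open Truncated exact m in ≋-trans (≋-reflexive (cong₂ (λ a b → Δ a b l) (trans (sym n≡ii) (sym p≡n)) (trans (sym n≡ii) (sym q≡n))))
              (≋-trans (mod equation m) (⊗-cong (≋-reflexive (cong (λ t → Θ i t k) (sym i≡j))) (≋-trans (mod (cycles-↭ split-ks) m) (≋-reflexive (cong (λ t → cycles (t ∷ ks′)) n≡ii))))))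
          where
          A₀≡2 : A 0 ≡ 2
          A₀≡2 = trans (sym (ℕ.+-identityʳ (A 0))) (trans (cong (λ t → A 0 + t) (sym A₁≡0)) A₀₁)
          p≡n : p ≡ n
          p≡n = ℕ.≤-antisym (ℕ.m∸n≡0⇒m≤n (proj₁ (both (p ∸ n) (q ∸ n) A₀≡2))) n≤p
          q≡n : q ≡ n
          q≡n = ℕ.≤-antisym (ℕ.m∸n≡0⇒m≤n (proj₂ (both (p ∸ n) (q ∸ n) A₀≡2))) n≤q
          n∈ks : n ∈ ks
          n∈ks = subst (_∈ ks) (ℕ.+-identityʳ n) (member-tally 0 n≤ks (ℕ.≤-reflexive (ℕ.suc-injective (trans (sym A₀≡2) A₀))))
          ks′ : List ℕ
          ks′ = proj₁ (extract n∈ks)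
          split-ks : ks ↭ n ∷ ks′
          split-ks = proj₂ (extract n∈ks)
          k≤l : k ≤ l
          k≤l = ℕ.≤-trans (ℕ.m≤m+n k (sum ks′)) (ℕ.≤-reflexive (sym (ℕ.+-cancelˡ-≡ (n + n) _ _ (trans (cong (_+ l) (cong₂ _+_ (sym p≡n) (sym q≡n)))
            (trans order (trans (cong₂ (λ a b → a + k + b) (sym n≡ij) (sum-↭ split-ks)) (lemma n k (sum ks′))))))))
            where
            lemma : ∀ n k x → n + k + (n + x) ≡ n + n + (k + x)
            lemma = ℕ-Solver.solve-∀

        parity-case : sgn j ≡ 1ℤ → A 1 ≡ 1 → ⊥
        parity-case sgn≡1 A₁≡1 = conclude (equal-arcs-parity {l} {i} {k} {ks} (subst (2 ≤_) (sym i≡j) 2≤j) 1≤l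
            (subst (λ t → All (2 + t ≤_) ks) n≡ii (proj₁ aboves)) (trans (cong (λ t → count (map (_∸ (2 + t)) ks) 0) (sym n≡ii)) (trans (proj₂ aboves) K₂≡1))
            (exactly λ m → let open Truncated exact m in ≋-trans (≋-reflexive (cong₂ (λ a b → Δ a b l) (trans (sym n≡ii) (sym p≡n)) (trans (cong suc (sym n≡ii)) (sym q≡n))))
              (≋-trans (mod equation m) (⊗-cong (≋-reflexive (cong (λ t → Θ i t k) (sym i≡j))) ≋-refl))))
          where
          A₀≡1 : A 0 ≡ 1
          A₀≡1 = ℕ.+-cancelʳ-≡ 1 _ _ (trans (cong (λ t → A 0 + t) (sym A₁≡1)) A₀₁)
          K₀≡0 : K 0 ≡ 0
          K₀≡0 = ℕ.suc-injective (trans (sym A₀) A₀≡1)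
          aboves : All (2 + n ≤_) ks × count (map (_∸ (2 + n)) ks) 0 ≡ K 2
          aboves = above-count n n≤ks K₀≡0 K₁≡0
          offsets-pq : p ∸ n ≡ 0 × q ∸ n ≡ 1
          offsets-pq = one-each (p ∸ n) (q ∸ n) (ℕ.∸-monoˡ-≤ n p≤q) A₀≡1 A₁≡1
          p≡n : p ≡ n
          p≡n = ℕ.≤-antisym (ℕ.m∸n≡0⇒m≤n (proj₁ offsets-pq)) n≤p
          q≡n : q ≡ 1 + n
          q≡n = trans (sym (ℕ.m+[n∸m]≡n n≤q)) (trans (cong (λ t → n + t) (proj₂ offsets-pq)) (ℕ.+-comm n 1))
          T₂+K₂ : T 2 + K 2 ≡ 1
          T₂+K₂ = ℕ.suc-injective (trans (lemma (T 2) (K 2)) (sym (ℤ.+-injective (trans (sym (cong₂ (λ a b → + a ℤ.+ b) A₁≡1 sgn≡1)) level-2))))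
            where
            lemma : ∀ a b → suc (a + b) ≡ a + 1 + b
            lemma = ℕ-Solver.solve-∀
          doubled : ∀ t → T (suc t) ≡ ind o₂ (suc t) + ind o₂ (suc t)
          doubled t = cong₂ _+_ (cong (λ o → ind o (suc t)) o₁≡0) (cong (λ x → ind o₂ (suc t) + x) (trans (ℕ.+-identityʳ _) (cong (λ a → ind (a + k ∸ n) (suc t)) (sym i≡j))))
          T₂≡0 : T 2 ≡ 0
          T₂≡0 = [ (λ one → contradiction (ℕ.≤-trans (ℕ.≤-reflexive (sym (trans (doubled 1) (cong₂ _+_ one one)))) (ℕ.≤-trans (ℕ.m≤m+n (T 2) (K 2)) (ℕ.≤-reflexive T₂+K₂))) λ { (s≤s ()) })
            , (λ none → trans (doubled 1) (cong₂ _+_ none none)) ]′ (ind-+ o₂ 2)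
          K₂≡1 : K 2 ≡ 1
          K₂≡1 = trans (cong (_+ K 2) (sym T₂≡0)) T₂+K₂
          n+2∈ks : n + 2 ∈ ks
          n+2∈ks = member-tally 2 n≤ks (ℕ.≤-reflexive (sym K₂≡1))
          level : 2 ≡ T 3 + K 3 + lam l
          level = ℕ.+-cancelˡ-≡ 2 _ _ (trans level-3 (trans (cong₂ (λ a t → 2 * a + (T 3 + 2 * t + K 3) + lam l * a) A₀≡1 T₂≡0) (lemma (T 3) (K 3) (lam l))))
            where
            lemma : ∀ a b c → 2 * 1 + (a + 2 * 0 + b) + c * 1 ≡ 2 + (a + b + c)
            lemma = ℕ-Solver.solve-∀
          lengths : 1 + n + l ≡ k + sum ks
          lengths = ℕ.+-cancelˡ-≡ n _ _ (trans (sym (ℕ.+-assoc n (1 + n) l)) (trans (cong (_+ l) (cong₂ _+_ (sym p≡n) (sym q≡n))) (trans order (trans (cong (λ a → a + k + sum ks) (sym n≡ij)) (ℕ.+-assoc n k (sum ks))))))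
          conclude : (l ≡ i + i × k ≡ 1 + (i + i)) ⊎ (k ≡ i + i × l ≡ 1 + (i + i)) → ⊥
          conclude (inj₁ (l≡ , k≡)) = ℕ.<⇒≱ (ℕ.<-≤-trans (ℕ.m<m+n n (s≤s z≤n)) (member-≤-sum n+2∈ks))
            (ℕ.≤-reflexive (ℕ.+-cancelˡ-≡ (1 + n) _ _ (trans (cong (_+ sum ks) (trans (cong suc n≡ii) (sym k≡))) (trans (sym lengths) (cong (λ t → 1 + n + t) (trans l≡ (sym n≡ii)))))))
          conclude (inj₂ (k≡ , l≡)) = contradiction (trans (sym sgn≡1) (trans (cong sgn j≡3) refl)) λ ()
            where
            sum≡ : sum ks ≡ n + 2
            sum≡ = ℕ.+-cancelˡ-≡ n _ _ (trans (cong (_+ sum ks) (trans n≡ii (sym k≡))) (trans (sym lengths) (trans (cong (λ t → 1 + n + t) (trans l≡ (cong suc (sym n≡ii)))) (lemma n))))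
              where
              lemma : ∀ n → 1 + n + (1 + n) ≡ n + (n + 2)
              lemma = ℕ-Solver.solve-∀
            K₃≡0 : K 3 ≡ 0
            K₃≡0 = ℕ.n≤0⇒n≡0 (ℕ.≮⇒≥ λ 1≤K → ℕ.<⇒≱ (ℕ.+-monoʳ-< n (ℕ.n<1+n 2)) (ℕ.≤-trans (member-≤-sum (member-tally 3 n≤ks 1≤K)) (ℕ.≤-reflexive sum≡)))
            lam≡0 : ∀ x → 3 ≤ x → lam (suc x) ≡ 0
            lam≡0 (suc x) _ = refl
            T₃≡2 : T 3 ≡ 2
            T₃≡2 = sym (trans level (trans (cong₂ (λ a b → T 3 + a + b) K₃≡0 (trans (cong lam (trans l≡ (cong suc (sym n≡ii)))) (lam≡0 n 3≤n))) (trans (ℕ.+-identityʳ _) (ℕ.+-identityʳ _))))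
            o₂≡3 : o₂ ≡ 3
            o₂≡3 = ind-≡ o₂ 3 λ none → contradiction (trans (sym T₃≡2) (trans (doubled 2) (cong₂ _+_ none none))) λ ()
            j≡3 : j ≡ 3
            j≡3 = trans (ℕ.+-cancelˡ-≡ j _ _ (trans (sym n≡jj) (trans n≡ii (trans (sym k≡) k≡j+o₂)))) o₂≡3

        finish : Unit (sgn j) → ∀ a → A 1 ≡ a → ⊥
        finish (inj₁ sgn≡1)  0 A₁≡0 = exact-case sgn≡1 A₁≡0
        finish (inj₁ sgn≡1)  1 A₁≡1 = parity-case sgn≡1 A₁≡1
        finish (inj₁ sgn≡1)  (suc (suc a)) eq = contradiction (subst (_≤ 1) eq A₁≤1) λ { (s≤s ()) }
        finish (inj₂ sgn≡-1) a _ = contradiction (ℤ.drop‿+≤+ (ℤ.≤-trans (ℤ.≤-reflexive (trans (cong (λ b → b ℤ.+ 1ℤ) (sym (trans (cong (λ b → + A 1 ℤ.+ b) (sym sgn≡-1)) level-2))) (lemma (+ A 1)))) (ℤ.+≤+ A₁≤1)))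
            (ℕ.<⇒≱ (ℕ.≤-trans (s≤s (ℕ.≤-trans (ℕ.m≤n+m 1 (T 2)) (ℕ.m≤m+n (T 2 + 1) (K 2)))) (ℕ.≤-reflexive (ℕ.+-comm 1 (T 2 + 1 + K 2)))))
          where
          lemma : ∀ a → a ℤ.+ ℤ.-1ℤ ℤ.+ 1ℤ ≡ a
          lemma = ℤ-Solver.solve-∀

      cases : i < j ⊎ i ≡ j → ⊥
      cases (inj₂ i≡j) = equal i≡j
      cases (inj₁ i<j) = unequal-arcs {p} {q} {l} {i} {j} {k} {ks} 1≤i i<j (ℕ.≤-trans (ℕ.n≤1+n (suc j)) 2+j≤k) (subst (_≤ p) n≡ij n≤p) (subst (_≤ q) n≡ij n≤q)
        (subst (λ t → All (t ≤_) ks) n≡ij n≤ks) (subst (λ t → count (p ∸ t ∷ q ∸ t ∷ []) 0 ≡ 1 + count (map (_∸ t) ks) 0) n≡ij A₀) equation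

    split : Dec (o₁ ≡ 0) → ⊥
    split (yes o₁≡0) = near o₁≡0
    split (no o₁≢0)  = far o₁≢0

-- Isomorphism of dumbbells

module Relabel {n : ℕ} where

  relabel : List (Fin n) → List (Fin n) → Fin n → Fin n
  relabel (x ∷ xs) (y ∷ ys) t = if does (t Fin.≟ x) then y else relabel xs ys t
  relabel _        _        t = t

  map-relabel : ∀ {xs ys} → Unique xs → length xs ≡ length ys → map (relabel xs ys) xs ≡ ys
  map-relabel {[]}     {[]}     uq len = refl
  map-relabel {x ∷ xs} {y ∷ ys} uq len = cong₂ _∷_ head (trans (tail xs (∉-Unique uq)) (map-relabel (Unique-tail uq) (ℕ.suc-injective len)))
    where
    head : relabel (x ∷ xs) (y ∷ ys) x ≡ y
    head with x Fin.≟ x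
    ... | yes _  = refl
    ... | no x≢x = contradiction refl x≢x
    tail : ∀ zs → x ∉ zs → map (relabel (x ∷ xs) (y ∷ ys)) zs ≡ map (relabel xs ys) zs
    tail []       x∉ = refl
    tail (z ∷ zs) x∉ = cong₂ _∷_ later (tail zs (x∉ ∘ there))
      where
      later : relabel (x ∷ xs) (y ∷ ys) z ≡ relabel xs ys z
      later with z Fin.≟ x
      ... | yes refl = contradiction (here refl) x∉
      ... | no _     = refl

  map-fixes : ∀ (f : Fin n → Fin n) xs → map f xs ≡ xs → ∀ {t} → t ∈ xs → f t ≡ t
  map-fixes f (x ∷ xs) p (here refl) = List.∷-injectiveˡ p
  map-fixes f (x ∷ xs) p (there t∈)  = map-fixes f xs (List.∷-injectiveʳ p) t∈

  relabel-inverse : ∀ {xs ys} → Unique xs → Unique ys → length xs ≡ length ys → (∀ t → t ∈ xs) → ∀ t → relabel ys xs (relabel xs ys t) ≡ t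
  relabel-inverse {xs} {ys} ux uy len all t = map-fixes (relabel ys xs ∘ relabel xs ys) xs
    (trans (List.map-∘ xs) (trans (cong (map (relabel ys xs)) (map-relabel ux len)) (map-relabel uy (sym len)))) (all t)

++-split : ∀ {A : Set} (as cs : List A) {bs ds} → length as ≡ length cs → as ++ bs ≡ cs ++ ds → as ≡ cs × bs ≡ ds
++-split []       []       _   p = refl , p
++-split (a ∷ as) (c ∷ cs) len p with ++-split as cs (ℕ.suc-injective len) (List.∷-injectiveʳ p)
... | q , r = cong₂ _∷_ (List.∷-injectiveˡ p) q , r

data Link {V : Set} (a : V) : List V → V → V → V → Set where
  direct : ∀ {b} → Link a [] b a b
  first  : ∀ {x xs b} → Link a (x ∷ xs) b a x
  later  : ∀ {x xs b y z} → Link x xs b y z → Link a (x ∷ xs) b y z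

map-link : ∀ {V W : Set} (f : V → W) {a xs b y z} → Link a xs b y z → Link (f a) (map f xs) (f b) (f y) (f z)
map-link f direct    = direct
map-link f first     = first
map-link f (later l) = later (map-link f l)

link-start : ∀ {V : Set} {a : V} xs b → Link a xs b a (firstOf xs b)
link-start []       b = direct
link-start (x ∷ xs) b = first

link-end : ∀ {V : Set} {a : V} xs b → Link a xs b (lastOf xs a) b
link-end []       b = direct
link-end (x ∷ xs) b = later (link-end xs b)

module ArcLinks {n : ℕ} (G : Graph n) where
  open GraphArcs G

  link-edge : ∀ {a xs b y z} → Arc a xs b → Link a xs b y z → y ∼ z
  link-edge (edge e)       direct    = e
  link-edge (step e _ arc) first     = e
  link-edge (step _ _ arc) (later l) = link-edge arc l

  inner-link : ∀ {a xs b w t} → Arc a xs b → w ∈ xs → w ∼ t → Link a xs b w t ⊎ Link a xs b t w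
  inner-link {b = b} (step {xs = xs} _ thin _) (here refl) e with thin e
  ... | inj₁ refl = inj₂ first
  ... | inj₂ refl = inj₁ (later (link-start xs b))
  inner-link (step _ _ arc) (there w∈) e = [ inj₁ ∘ later , inj₂ ∘ later ]′ (inner-link arc w∈ e)

Linked : ∀ {V : Set} → V → V → List V → List V → List V → V → V → Set
Linked u v α β γ y z = Link u α u y z ⊎ Link u β v y z ⊎ Link v γ v y z

map-linked : ∀ {V W : Set} (f : V → W) {u v α β γ y z} → Linked u v α β γ y z → Linked (f u) (f v) (map f α) (map f β) (map f γ) (f y) (f z)
map-linked f (inj₁ l)        = inj₁ (map-link f l)
map-linked f (inj₂ (inj₁ l)) = inj₂ (inj₁ (map-link f l))
map-linked f (inj₂ (inj₂ l)) = inj₂ (inj₂ (map-link f l))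

module DumbbellLinks {n : ℕ} (G : Graph n) {u v α β γ} (D : GraphArcs.Dumbbell G u v α β γ) where
  open GraphArcs G
  open Dumbbell D
  open ArcLinks G

  linked-edge : ∀ {y z} → Linked u v α β γ y z → y ∼ z
  linked-edge (inj₁ l)        = link-edge arc-α l
  linked-edge (inj₂ (inj₁ l)) = link-edge arc-β l
  linked-edge (inj₂ (inj₂ l)) = link-edge arc-γ l

  edge-linked : (∀ t → t ∈ u ∷ α ++ β ++ v ∷ γ) → ∀ {y z} → y ∼ z → Linked u v α β γ y z ⊎ Linked u v α β γ z y
  edge-linked covers {y} {z} e = from (covers y)
    where
    in-α : y ∈ α → Linked u v α β γ y z ⊎ Linked u v α β γ z y
    in-α y∈ = [ inj₁ ∘ inj₁ , inj₂ ∘ inj₁ ]′ (inner-link arc-α y∈ e)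
    in-γ : y ∈ v ∷ γ → Linked u v α β γ y z ⊎ Linked u v α β γ z y
    in-γ (here refl) with at-v e
    ... | inj₁ z∈   = [ inj₂ ∘ inj₂ ∘ inj₂ , inj₁ ∘ inj₂ ∘ inj₂ ]′ (inner-link arc-γ z∈ (∼-sym e))
    ... | inj₂ refl = inj₂ (inj₂ (inj₁ (link-end β v)))
    in-γ (there y∈) = [ inj₁ ∘ inj₂ ∘ inj₂ , inj₂ ∘ inj₂ ∘ inj₂ ]′ (inner-link arc-γ y∈ e)
    from : y ∈ u ∷ α ++ β ++ v ∷ γ → Linked u v α β γ y z ⊎ Linked u v α β γ z y
    from (here refl) with at-u e
    ... | inj₁ z∈   = [ inj₂ ∘ inj₁ , inj₁ ∘ inj₁ ]′ (inner-link arc-α z∈ (∼-sym e))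
    ... | inj₂ refl = inj₁ (inj₂ (inj₁ (link-start β v)))
    from (there y∈) with ∈-++⁻ α y∈
    ... | inj₁ y∈α = in-α y∈α
    ... | inj₂ y∈′ with ∈-++⁻ β y∈′
    ...   | inj₁ y∈β = [ inj₁ ∘ inj₂ ∘ inj₁ , inj₂ ∘ inj₂ ∘ inj₁ ]′ (inner-link arc-β y∈β e)
    ...   | inj₂ y∈γ = in-γ y∈γ

module DumbbellIsomorphism {n : ℕ} (G H : Graph n) {u v α β γ u′ v′ α′ β′ γ′}
  (D : GraphArcs.Dumbbell G u v α β γ) (D′ : GraphArcs.Dumbbell H u′ v′ α′ β′ γ′)
  (covers : ∀ t → t ∈ u ∷ α ++ β ++ v ∷ γ) (covers′ : ∀ t → t ∈ u′ ∷ α′ ++ β′ ++ v′ ∷ γ′)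
  (len-α : length α ≡ length α′) (len-β : length β ≡ length β′) (len-γ : length γ ≡ length γ′) where
  open Relabel {n}

  private
    L L′ : List (Fin n)
    L = u ∷ α ++ β ++ v ∷ γ
    L′ = u′ ∷ α′ ++ β′ ++ v′ ∷ γ′

    len : length L ≡ length L′
    len = cong suc (trans (List.length-++ α) (trans (cong₂ _+_ len-α (trans (List.length-++ β) (trans (cong₂ _+_ len-β (cong suc len-γ)) (sym (List.length-++ β′))))) (sym (List.length-++ α′))))

    transport : ∀ (f : Fin n → Fin n) {u v α β γ u′ v′ α′ β′ γ′} → length α ≡ length α′ → length β ≡ length β′ → map f (u ∷ α ++ β ++ v ∷ γ) ≡ u′ ∷ α′ ++ β′ ++ v′ ∷ γ′ →
      ∀ {y z} → Linked u v α β γ y z → Linked u′ v′ α′ β′ γ′ (f y) (f z)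
    transport f {u} {v} {α} {β} {γ} {u′} {v′} {α′} {β′} {γ′} lα lβ p l with List.∷-injectiveˡ p
      | ++-split (map f α) α′ (trans (List.length-map f α) lα) (trans (sym (List.map-++ f α (β ++ v ∷ γ))) (List.∷-injectiveʳ p))
    ... | refl | refl , q with ++-split (map f β) β′ (trans (List.length-map f β) lβ) (trans (sym (List.map-++ f β (v ∷ γ))) q)
    ...   | refl , refl = map-linked f l

    half : ∀ (G H : Graph n) (f : Fin n → Fin n) {u v α β γ u′ v′ α′ β′ γ′} → GraphArcs.Dumbbell G u v α β γ → GraphArcs.Dumbbell H u′ v′ α′ β′ γ′ → (∀ t → t ∈ u ∷ α ++ β ++ v ∷ γ) →
      length α ≡ length α′ → length β ≡ length β′ → map f (u ∷ α ++ β ++ v ∷ γ) ≡ u′ ∷ α′ ++ β′ ++ v′ ∷ γ′ →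
      ∀ i j → adj G i j ≡ true → adj H (f i) (f j) ≡ true
    half G H f D D′ covers lα lβ p i j e with DumbbellLinks.edge-linked G D covers e
    ... | inj₁ l = DumbbellLinks.linked-edge H D′ (transport f lα lβ p l)
    ... | inj₂ l = GraphArcs.∼-sym H (DumbbellLinks.linked-edge H D′ (transport f lα lβ p l))

    ux : Unique L
    ux = let open GraphArcs G in Dumbbell.unique D

    uy : Unique L′
    uy = let open GraphArcs H in Dumbbell.unique D′

    f g : Fin n → Fin n
    f = relabel L L′
    g = relabel L′ L

    same : ∀ {b c : Bool} → (b ≡ true → c ≡ true) → (c ≡ true → b ≡ true) → c ≡ b
    same {true}  {c}     h k = h refl
    same {false} {false} h k = refl
    same {false} {true}  h k = sym (k refl)

  isomorphic : G ≅ H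
  isomorphic = permutation f g (relabel-inverse uy ux (sym len) covers′) (relabel-inverse ux uy len covers) , λ i j →
    same (half G H f D D′ covers len-α len-β (map-relabel ux len) i j)
      (λ e → subst₂ (λ s t → adj G s t ≡ true) (relabel-inverse ux uy len covers i) (relabel-inverse ux uy len covers j)
        (half H G g D′ D covers′ (sym len-α) (sym len-β) (map-relabel uy (sym len)) (f i) (f j) e))

firstOf-∷ʳ : ∀ {V : Set} (xs : List V) y a → firstOf (xs ∷ʳ y) a ≡ firstOf xs y
firstOf-∷ʳ []       y a = refl
firstOf-∷ʳ (x ∷ xs) y a = refl

firstOf-reverse : ∀ {V : Set} (xs : List V) a → firstOf (reverse xs) a ≡ lastOf xs a
firstOf-reverse []       a = refl
firstOf-reverse (x ∷ xs) a = trans (cong (λ ys → firstOf ys a) (List.unfold-reverse x xs)) (trans (firstOf-∷ʳ (reverse xs) x a) (firstOf-reverse xs x))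

lastOf-reverse : ∀ {V : Set} (xs : List V) a → lastOf (reverse xs) a ≡ firstOf xs a
lastOf-reverse xs a = trans (sym (firstOf-reverse (reverse xs) a)) (cong (λ ys → firstOf ys a) (List.reverse-involutive xs))

module Ordered {n : ℕ} (G : Graph n) where
  open GraphArcs G

  reverse-dumbbell : ∀ {x y α β γ} → Dumbbell x y α β γ → Dumbbell y x γ (reverse β) α
  reverse-dumbbell {x} {y} {α} {β} {γ} D = record
    { arc-α  = arc-γ
    ; arc-β  = arc-reverse arc-β
    ; arc-γ  = arc-α
    ; unique = Unique-resp-↭ (↭-trans (Perm.++-comm (x ∷ α) (β ++ y ∷ γ)) (↭-trans (Perm.++⁺ʳ (x ∷ α) (Perm.++-comm β (y ∷ γ)))
        (↭-trans (↭-reflexive (List.++-assoc (y ∷ γ) β (x ∷ α))) (Perm.++⁺ˡ (y ∷ γ) (Perm.++⁺ʳ (x ∷ α) (↭-sym (Perm.↭-reverse β))))))) unique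
    ; at-u   = λ e → [ inj₁ , (λ p → inj₂ (trans p (sym (firstOf-reverse β x)))) ]′ (at-v e)
    ; at-v   = λ e → [ inj₁ , (λ p → inj₂ (trans p (sym (lastOf-reverse β y)))) ]′ (at-u e)
    }
    where open Dumbbell D

  record OrderedDumbbell : Set where
    field
      {hub₁ hub₂} : Fin n
      {α β γ}     : List (Fin n)
      dumbbell    : Dumbbell hub₁ hub₂ α β γ
      2≤α         : 2 ≤ length α
      α≤γ         : length α ≤ length γ
    2≤γ : 2 ≤ length γ
    2≤γ = ℕ.≤-trans 2≤α α≤γ
    vertexList : List (Fin n)
    vertexList = hub₁ ∷ α ++ β ++ hub₂ ∷ γ
    p q l : ℕ
    p = suc (length α)
    q = suc (length γ)
    l = suc (length β)
    length-vertexList : suc (length vertexList) ≡ p + q + l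
    length-vertexList = trans (cong (λ t → 2 + t) (trans (List.length-++ α {β ++ hub₂ ∷ γ}) (cong (λ t → length α + t) (List.length-++ β {hub₂ ∷ γ})))) (lemma (length α) (length β) (length γ))
      where
      lemma : ∀ a b c → suc (suc (a + (b + suc c))) ≡ suc a + suc c + suc b
      lemma = ℕ-Solver.solve-∀

  order-dumbbell : ∀ {x y α β γ} → Dumbbell x y α β γ → 2 ≤ length α → 2 ≤ length γ → Σ[ O ∈ OrderedDumbbell ] OrderedDumbbell.p O + OrderedDumbbell.q O + OrderedDumbbell.l O ≡ suc (length α) + suc (length γ) + suc (length β)
  order-dumbbell {α = α} {β} {γ} D 2≤α 2≤γ with ℕ.≤-total (length α) (length γ)
  ... | inj₁ α≤γ = record { dumbbell = D ; 2≤α = 2≤α ; α≤γ = α≤γ } , refl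
  ... | inj₂ γ≤α = record { dumbbell = reverse-dumbbell D ; 2≤α = 2≤γ ; α≤γ = γ≤α } ,
    cong₂ (λ a b → a + suc b) (ℕ.+-comm (suc (length γ)) (suc (length α))) (List.length-reverse β)

  theta-swap : ∀ {u v xs ys zs} → Theta u v xs ys zs → Theta u v ys xs zs
  theta-swap {u} {v} {xs} {ys} {zs} D = record
    { arc-xs = arc-ys ; arc-ys = arc-xs ; arc-zs = arc-zs
    ; unique = Unique-resp-↭ (↭-prep u (↭-prep v (Perm.shifts xs ys))) unique
    ; at-u   = swap₁₂ ∘ at-u
    ; at-v   = swap₁₂ ∘ at-v
    }
    where
    open Theta D
    swap₁₂ : ∀ {A B C : Set} → A ⊎ B ⊎ C → B ⊎ A ⊎ C
    swap₁₂ = [ inj₂ ∘ inj₁ , [ inj₁ , inj₂ ∘ inj₂ ]′ ]′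

  theta-swap′ : ∀ {u v xs ys zs} → Theta u v xs ys zs → Theta u v xs zs ys
  theta-swap′ {u} {v} {xs} {ys} {zs} D = record
    { arc-xs = arc-xs ; arc-ys = arc-zs ; arc-zs = arc-ys
    ; unique = Unique-resp-↭ (↭-prep u (↭-prep v (Perm.++⁺ˡ xs (Perm.++-comm ys zs)))) unique
    ; at-u   = swap₂₃ ∘ at-u
    ; at-v   = swap₂₃ ∘ at-v
    }
    where
    open Theta D
    swap₂₃ : ∀ {A B C : Set} → A ⊎ B ⊎ C → A ⊎ C ⊎ B
    swap₂₃ = [ inj₁ , [ inj₂ ∘ inj₂ , inj₂ ∘ inj₁ ]′ ]′

  record OrderedTheta (u v : Fin n) : Set where
    field
      {xs ys zs} : List (Fin n)
      theta      : Theta u v xs ys zs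
      xs≤ys      : length xs ≤ length ys
      ys≤zs      : length ys ≤ length zs

  order-theta : ∀ {u v xs ys zs} → Theta u v xs ys zs → OrderedTheta u v
  order-theta {u} {v} {xs} {ys} D = [ insert-third D , insert-third (theta-swap D) ]′ (ℕ.≤-total (length xs) (length ys))
    where
    insert-third : ∀ {xs ys zs} → Theta u v xs ys zs → length xs ≤ length ys → OrderedTheta u v
    insert-third {xs} {ys} {zs} D x≤y with ℕ.≤-total (length ys) (length zs)
    ... | inj₁ y≤z = record { theta = D ; xs≤ys = x≤y ; ys≤zs = y≤z }
    ... | inj₂ z≤y with ℕ.≤-total (length xs) (length zs)
    ...   | inj₁ x≤z = record { theta = theta-swap′ D ; xs≤ys = x≤z ; ys≤zs = z≤y }
    ...   | inj₂ z≤x = record { theta = theta-swap (theta-swap′ D) ; xs≤ys = z≤x ; ys≤zs = x≤y }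

  open Degrees G

  theta-simple : ∀ {u v} → degree G u ≡ 3 → (O : OrderedTheta u v) → 0 < length (OrderedTheta.ys O)
  theta-simple {u} {v} deg record { xs = [] ; ys = [] ; zs = zs ; theta = D } with complement (neighbourList u) {v ∷ firstOf zs v ∷ []} (neighbours-unique u)
      (λ y∈ → [ here , [ here , there ∘ here ]′ ]′ (Theta.at-u D (neighbours-∈ y∈)))
  ... | rest , p = contradiction (ℕ.≤-trans (ℕ.≤-reflexive (trans (sym deg) (degree-length u)))
      (ℕ.≤-trans (ℕ.m≤m+n (length (neighbourList u)) (length rest)) (ℕ.≤-reflexive (sym (trans (Perm.↭-length p) (List.length-++ (neighbourList u))))))) λ { (s≤s (s≤s ())) }
  theta-simple deg record { ys = _ ∷ _ }                         = s≤s z≤n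
  theta-simple deg record { xs = _ ∷ _ ; ys = [] ; xs≤ys = () }

  open Decomposition G hiding (dumbbell; theta)

  cycleLengths-≥3 : ∀ {F} (fc : FreeCycles F) → All (3 ≤_) (cycleLengths fc)
  cycleLengths-≥3 (done _)               = []
  cycleLengths-≥3 (more x xs _ 2≤ _ _ fc) = s≤s 2≤ ∷ cycleLengths-≥3 fc

  cycleLengths-sum : ∀ {F} → Unique F → (fc : FreeCycles F) → length F + sum (cycleLengths fc) ≡ n
  cycleLengths-sum {F} uq (done h) = trans (ℕ.+-identityʳ _) (trans (Perm.↭-length (same-members uq (Unique.allFin⁺ n) (λ {x} _ → ∈-allFin x) (λ {x} _ → h x))) (List.length-tabulate {n = n} id))
  cycleLengths-sum {F} uq (more x xs _ _ uq-x fresh fc) = trans (lemma (length F) (length xs) (sum (cycleLengths fc)))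
    (trans (cong (λ t → suc t + sum (cycleLengths fc)) (sym (List.length-++ xs))) (cycleLengths-sum (Unique.++⁺ uq-x uq λ { (y∈ , y∈F) → proj₁ (fresh y∈) y∈F }) fc))
    where
    lemma : ∀ f x s → f + (suc x + s) ≡ suc (x + f) + s
    lemma = ℕ-Solver.solve-∀

  module _ (O : OrderedDumbbell) where
    open OrderedDumbbell O
    open DumbbellDegrees G

    charSeries-dumbbell : ∀ (fc : FreeCycles vertexList) → e ⊗ u ⊗ u ⊗ GraphSeries.charSeries 0 G ≐ Δ p q l ⊗ cycles (cycleLengths fc)
    charSeries-dumbbell fc = exactly λ m → let open Truncated exact m in ≋-trans
      (⊗-cong ≋-refl (CycleProduct.charSeries-main m G (Dumbbell.unique dumbbell) (dumbbell-saturated dumbbell) fc))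
      (≋-trans (solve 3 (λ e f g → e :* (f :* g) := e :* f :* g) ≋-refl (e ⊗ u ⊗ u) (GraphSeries.P m G vertexList) (cycles (cycleLengths fc)))
        (⊗-cong (GraphSeries.Δ-dumbbell m G dumbbell 2≤α 2≤γ (degree-hub₁ dumbbell 2≤α 2≤γ) (degree-hub₂ dumbbell 2≤α 2≤γ) (degree-inner dumbbell 2≤α 2≤γ)) ≋-refl))

  module _ {u₀ v₀ : Fin n} (O : OrderedTheta u₀ v₀) (deg-u : degree G u₀ ≡ 3) (deg-v : degree G v₀ ≡ 3) (deg-2 : ∀ t → t ≢ u₀ → t ≢ v₀ → degree G t ≡ 2) where
    open OrderedTheta O

    charSeries-theta : ∀ (fc : FreeCycles (u₀ ∷ v₀ ∷ xs ++ ys ++ zs)) →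
      e ⊗ u ⊗ u ⊗ GraphSeries.charSeries 0 G ≐ Θ (suc (length xs)) (suc (length ys)) (suc (length zs)) ⊗ cycles (cycleLengths fc)
    charSeries-theta fc = exactly λ m → let open Truncated exact m in ≋-trans
      (⊗-cong ≋-refl (CycleProduct.charSeries-main m G (Theta.unique theta) (theta-saturated theta) fc))
      (≋-trans (solve 3 (λ e f g → e :* (f :* g) := e :* f :* g) ≋-refl (e ⊗ u ⊗ u) (GraphSeries.P m G (u₀ ∷ v₀ ∷ xs ++ ys ++ zs)) (cycles (cycleLengths fc)))
        (⊗-cong (GraphSeries.Θ-theta m G (theta-simple deg-u O) (ℕ.<-≤-trans (theta-simple deg-u O) ys≤zs) theta deg-u deg-v inner) ≋-refl))
      where
      inner : ∀ {t} → t ∈ xs ++ ys ++ zs → degree G t ≡ 2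
      inner {t} t∈ = deg-2 t (λ { refl → ∉-Unique (Theta.unique theta) (there t∈) }) (λ { refl → ∉-Unique (Unique-tail (Theta.unique theta)) t∈ })

-- The characterisation

-- Homogenising in a degree larger than that of the polynomial introduces a factor z.

homog-start : ∀ {N M g} → Degree≤ N g → N < M → homog M g ‼ 0 ≡ 0ℤ
homog-start {M = suc M} {g} deg N<M = Truncated.at (Homogenise.homog-raise 1 M g (deg (suc M) N<M)) 0 (s≤s z≤n)

module _ {n n′ : ℕ} (G : Graph n) (H : Graph n′) (same : ∀ k → coeff (permanentalPoly (laplacian G)) k ≡ coeff (permanentalPoly (laplacian H)) k) where

  private
    not-smaller : ¬ n < n′
    not-smaller n<n′ = contradiction (trans (sym (LowCoefficients.charSeries-0 H)) (homog-start deg n<n′)) λ ()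
      where
      deg : Degree≤ n (coeff (permanentalPoly (laplacian H)))
      deg k n<k = trans (sym (same k)) (Homogenise.degree-per 1 (GraphSeries.coeff₀ 1 G) (GraphSeries.coeff₁ 1 G) k n<k)

  order-≥ : n′ ≤ n
  order-≥ = ℕ.≮⇒≥ not-smaller

same-order : ∀ {n n′} (G : Graph n) (H : Graph n′) → (∀ k → coeff (permanentalPoly (laplacian G)) k ≡ coeff (permanentalPoly (laplacian H)) k) → n ≡ n′
same-order G H same = ℕ.≤-antisym (order-≥ H G (λ k → sym (same k))) (order-≥ G H same)

module Characterisation {n : ℕ} (G H : Graph n) (same : ∀ k → coeff (permanentalPoly (laplacian H)) k ≡ coeff (permanentalPoly (laplacian G)) k)
  (O : Ordered.OrderedDumbbell G) (full : length (Ordered.OrderedDumbbell.vertexList O) ≡ n) where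

  private
    module G where
      open GraphArcs G public
      open Ordered G public
      open DumbbellDegrees G public
      open LowCoefficients G public
    module H where
      open GraphArcs H public
      open Ordered H public
      open DumbbellDegrees H public
      open LowCoefficients H public
      open Decomposition H public

    open G.OrderedDumbbell O

    charSeries-≐ : GraphSeries.charSeries 0 H ≐ GraphSeries.charSeries 0 G
    charSeries-≐ = exactly λ m → Homogenise.homog-cong m n same

    unique-G : Unique vertexList
    unique-G = G.Dumbbell.unique dumbbell

    length-allFin : length (allFin n) ≡ n
    length-allFin = List.length-tabulate {n = n} id

    covers : ∀ t → t ∈ vertexList
    covers t = subset-full unique-G (λ {x} _ → ∈-allFin x) (trans length-allFin (sym full)) (∈-allFin t)

    degree-cases : ∀ t → degree G t ≡ 2 ⊎ degree G t ≡ 3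
    degree-cases t with covers t
    ... | here refl = inj₂ (G.degree-hub₁ dumbbell 2≤α 2≤γ)
    ... | there t∈ with ∈-++⁻ α t∈
    ...   | inj₁ t∈α = inj₁ (G.degree-inner dumbbell 2≤α 2≤γ (∈-++⁺ˡ t∈α))
    ...   | inj₂ t∈′ with ∈-++⁻ β t∈′
    ...     | inj₁ t∈β         = inj₁ (G.degree-inner dumbbell 2≤α 2≤γ (∈-++⁺ʳ α (∈-++⁺ˡ t∈β)))
    ...     | inj₂ (here refl) = inj₂ (G.degree-hub₂ dumbbell 2≤α 2≤γ)
    ...     | inj₂ (there t∈γ) = inj₁ (G.degree-inner dumbbell 2≤α 2≤γ (∈-++⁺ʳ α (∈-++⁺ʳ β t∈γ)))

    square : (Fin n → ℤ) → ℤ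
    square f = ∑ (λ x → f x ℤ.* f x) (allFin n)

    sum-G : ∑ G.deficit (allFin n) ≡ ℤ.- + 2
    sum-G = trans (∑-↭ G.deficit (same-members (Unique.allFin⁺ n) unique-G (λ {x} _ → covers x) (λ {x} _ → ∈-allFin x)))
      (cong₂ ℤ._+_ (hub (G.degree-hub₁ dumbbell 2≤α 2≤γ)) (trans (∑-++ G.deficit α _) (cong₂ ℤ._+_ (inner α ∈-++⁺ˡ)
        (trans (∑-++ G.deficit β _) (cong₂ ℤ._+_ (inner β (∈-++⁺ʳ α ∘ ∈-++⁺ˡ))
          (cong₂ ℤ._+_ (hub (G.degree-hub₂ dumbbell 2≤α 2≤γ)) (inner γ (∈-++⁺ʳ α ∘ ∈-++⁺ʳ β))))))))
      where
      hub : ∀ {t} → degree G t ≡ 3 → G.deficit t ≡ ℤ.-1ℤ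
      hub p = cong (λ t → + 2 ℤ.- + t) p
      inner : ∀ xs → (∀ {t} → t ∈ xs → t ∈ α ++ β ++ γ) → ∑ G.deficit xs ≡ 0ℤ
      inner xs h = trans (∑-cong xs λ t∈ → cong (λ t → + 2 ℤ.- + t) (G.degree-inner dumbbell 2≤α 2≤γ (h t∈))) (∑-0 xs)

    squares-G : square G.deficit ℤ.+ ∑ G.deficit (allFin n) ≡ 0ℤ
    squares-G = trans (sym (∑-+ (λ x → G.deficit x ℤ.* G.deficit x) G.deficit (allFin n)))
      (trans (∑-cong (allFin n) λ {t} _ → [ cong term , cong term ]′ (degree-cases t)) (∑-0 (allFin n)))
      where
      term : ℕ → ℤ
      term k = (+ 2 ℤ.- + k) ℤ.* (+ 2 ℤ.- + k) ℤ.+ (+ 2 ℤ.- + k)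

    sum-H : ∑ H.deficit (allFin n) ≡ ℤ.- + 2
    sum-H = trans (sym H.charSeries-1) (trans (coefficient charSeries-≐ 1) (trans G.charSeries-1 sum-G))

    square-H : square H.deficit ≡ square G.deficit
    square-H = cancel {GraphSeries.charSeries 0 G ‼ 2 ℤ.+ GraphSeries.charSeries 0 G ‼ 2} (trans (cong (λ t → t ℤ.+ t ℤ.+ square H.deficit) (sym (coefficient charSeries-≐ 2)))
      (trans H.charSeries-2 (trans (cong (λ s → s ℤ.* s ℤ.- s) (trans sum-H (sym sum-G))) (sym G.charSeries-2))))
      where
      cancel : ∀ {a b c} → a ℤ.+ b ≡ a ℤ.+ c → b ≡ c
      cancel {a} {b} {c} p = trans (sym (lemma a b)) (trans (cong (λ t → ℤ.- a ℤ.+ t) p) (lemma a c))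
        where
        lemma : ∀ a b → ℤ.- a ℤ.+ (a ℤ.+ b) ≡ b
        lemma = ℤ-Solver.solve-∀

    degrees-H : ∀ t → degree H t ≡ 2 ⊎ degree H t ≡ 3
    degrees-H = H.degrees-2-3 (trans (cong₂ ℤ._+_ square-H (trans sum-H (sym sum-G))) squares-G)

    series-G : e ⊗ u ⊗ u ⊗ GraphSeries.charSeries 0 H ≐ Δ p q l
    series-G = exactly λ m → let open Truncated exact m in ≋-trans (⊗-cong ≋-refl (mod charSeries-≐ m))
      (≋-trans (mod (G.charSeries-dumbbell O (Decomposition.done covers)) m) (solve 1 (λ a → a :* con 1ℤ := a) ≋-refl (Δ p q l)))

    lengths-G : suc n ≡ p + q + l
    lengths-G = trans (cong suc (sym full)) length-vertexList

    ≐-join : ∀ {f g h} → f ≐ g → f ≐ h → g ≐ h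
    ≐-join p q = exactly λ m → let open Truncated exact m in ≋-trans (≋-sym (mod p m)) (mod q m)

    from-dumbbell : (O′ : H.OrderedDumbbell) → (∀ {t} → t ∉ H.OrderedDumbbell.vertexList O′ → degree H t ≡ 2) → H ≅ G
    from-dumbbell O′ deg-2 = DumbbellIsomorphism.isomorphic H G O′.dumbbell dumbbell covers′ covers
        (ℕ.suc-injective (sym same-first)) (ℕ.suc-injective (sym same-l)) (ℕ.suc-injective (sym same-second))
      where
      module O′ = H.OrderedDumbbell O′
      unique-H : Unique O′.vertexList
      unique-H = H.Dumbbell.unique O′.dumbbell
      fc : H.FreeCycles O′.vertexList
      fc = H.free-cycles O′.vertexList unique-H (H.dumbbell-saturated O′.dumbbell) deg-2
      open DumbbellComparison {p} {q} {O′.p} {O′.q} {l} {O′.l} {H.cycleLengths fc} (s≤s 2≤α) (s≤s 2≤γ) (s≤s O′.2≤α) (s≤s O′.2≤γ) (s≤s z≤n) (s≤s z≤n)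
        (H.cycleLengths-≥3 fc) (s≤s α≤γ) (s≤s O′.α≤γ) (≐-join series-G (H.charSeries-dumbbell O′ fc))
      full′ : length O′.vertexList ≡ n
      full′ = trans (sym (ℕ.+-identityʳ _)) (trans (cong (λ ks → length O′.vertexList + sum ks) (sym no-cycles)) (H.cycleLengths-sum unique-H fc))
      covers′ : ∀ t → t ∈ O′.vertexList
      covers′ t = subset-full unique-H (λ {x} _ → ∈-allFin x) (trans length-allFin (sym full′)) (∈-allFin t)
      same-l : l ≡ O′.l
      same-l = ℕ.+-cancelˡ-≡ (p + q) _ _ (trans (sym lengths-G) (trans (cong suc (sym full′)) (trans O′.length-vertexList (cong (_+ O′.l) (cong₂ _+_ (sym same-first) (sym same-second))))))

    not-theta : ∀ {x y} → degree H x ≡ 3 → degree H y ≡ 3 → (∀ t → t ≢ x → t ≢ y → degree H t ≡ 2) → ¬ H.OrderedTheta x y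
    not-theta {x} {y} deg-x deg-y deg-2 T = theta-excluded (s≤s 2≤α) (s≤s α≤γ) (s≤s z≤n) (H.cycleLengths-≥3 fc) (s≤s z≤n) (s≤s (H.theta-simple deg-x T)) (s≤s T.xs≤ys) (s≤s T.ys≤zs)
        lengths (≐-join series-G (H.charSeries-theta T deg-x deg-y deg-2 fc))
      where
      module T = H.OrderedTheta T
      F : List (Fin n)
      F = x ∷ y ∷ T.xs ++ T.ys ++ T.zs
      unique-F : Unique F
      unique-F = H.Theta.unique T.theta
      fc : H.FreeCycles F
      fc = H.free-cycles F unique-F (H.theta-saturated T.theta) λ {t} t∉ → deg-2 t (λ { refl → t∉ (here refl) }) λ { refl → t∉ (there (here refl)) }
      lengths : p + q + l ≡ suc (length T.xs) + suc (length T.ys) + suc (length T.zs) + sum (H.cycleLengths fc)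
      lengths = trans (sym lengths-G) (trans (cong suc (sym (H.cycleLengths-sum unique-F fc)))
        (trans (cong (λ t → 3 + t + sum (H.cycleLengths fc)) (trans (List.length-++ T.xs {T.ys ++ T.zs}) (cong (λ t → length T.xs + t) (List.length-++ T.ys {T.zs}))))
          (lemma (length T.xs) (length T.ys) (length T.zs) (sum (H.cycleLengths fc)))))
        where
        lemma : ∀ a b c s → 3 + (a + (b + c)) + s ≡ suc a + suc b + suc c + s
        lemma = ℕ-Solver.solve-∀

    from-main : ∀ {x y x≢y} {deg-x : degree H x ≡ 3} {deg-y : degree H y ≡ 3} {deg-2 : ∀ t → t ≢ x → t ≢ y → degree H t ≡ 2} → H.Main x y x≢y deg-x deg-y deg-2 → H ≅ G
    from-main {deg-x = deg-x} {deg-y} {deg-2} (H.theta T) = ⊥-elim (not-theta deg-x deg-y deg-2 (H.order-theta T))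
    from-main {x} {y} {deg-2 = deg-2} (H.dumbbell {α = α′} {β′} {γ′} D refl refl 2≤α′ 2≤γ′) =
      from-dumbbell (proj₁ ordered) λ {t} t∉ → deg-2 t (λ { refl → t∉ (proj₁ hubs) }) λ { refl → t∉ (proj₂ hubs) }
      where
      ordered : Σ[ O′ ∈ H.OrderedDumbbell ] H.OrderedDumbbell.p O′ + H.OrderedDumbbell.q O′ + H.OrderedDumbbell.l O′ ≡ suc (length α′) + suc (length γ′) + suc (length β′)
      ordered = H.order-dumbbell D 2≤α′ 2≤γ′
      hubs : x ∈ H.OrderedDumbbell.vertexList (proj₁ ordered) × y ∈ H.OrderedDumbbell.vertexList (proj₁ ordered)
      hubs with ℕ.≤-total (length α′) (length γ′)
      ... | inj₁ _ = here refl , there (∈-++⁺ʳ α′ (∈-++⁺ʳ β′ (here refl)))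
      ... | inj₂ _ = there (∈-++⁺ʳ γ′ (∈-++⁺ʳ (reverse β′) (here refl))) , here refl

  isomorphic-to-dumbbell : H ≅ G
  isomorphic-to-dumbbell = from-cubic (H.two-cubic degrees-H sum-H)
    where
    from-cubic : (∃₂ λ x y → x ≢ y × degree H x ≡ 3 × degree H y ≡ 3 × (∀ t → t ≢ x → t ≢ y → degree H t ≡ 2)) → H ≅ G
    from-cubic (x , y , x≢y , deg-x , deg-y , deg-2) = from-main (H.main x y x≢y deg-x deg-y deg-2)

theorem1p1 : ∀ (p q r : ℕ) (p≥3 : 3 ≤ p) (q≥3 : 3 ≤ q) (r≥2 : 2 ≤ r) →
  ∀ {n : ℕ} (H : Graph n) →
  permanentalPoly (laplacian H) D.≈ permanentalPoly (laplacian (d p q r p≥3 q≥3 r≥2)) →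
  H ≅ d p q r p≥3 q≥3 r≥2
theorem1p1 (suc (suc (suc p))) (suc (suc (suc q))) (suc (suc r)) (s≤s (s≤s (s≤s z≤n))) (s≤s (s≤s (s≤s z≤n))) (s≤s (s≤s z≤n)) H same =
  transported (same-order H G same) H same
  where
  module Dumb = DumbbellGraph p q r
  G : Graph (3 + p + suc r + (2 + q))
  G = Dumb.D
  ordered : Σ[ O ∈ Ordered.OrderedDumbbell G ] Ordered.OrderedDumbbell.p O + Ordered.OrderedDumbbell.q O + Ordered.OrderedDumbbell.l O ≡ suc (length Dumb.α) + suc (length Dumb.γ) + suc (length Dumb.β)
  ordered = Ordered.order-dumbbell G Dumb.structure (ℕ.≤-trans (s≤s (s≤s z≤n)) (ℕ.≤-reflexive (sym Dumb.length-α))) (ℕ.≤-trans (s≤s (s≤s z≤n)) (ℕ.≤-reflexive (sym Dumb.length-γ)))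
  full : length (Ordered.OrderedDumbbell.vertexList (proj₁ ordered)) ≡ 3 + p + suc r + (2 + q)
  full = ℕ.suc-injective (trans (Ordered.OrderedDumbbell.length-vertexList (proj₁ ordered)) (trans (proj₂ ordered)
    (trans (cong₂ (λ a b → a + suc b) (cong₂ (λ a b → suc a + suc b) Dumb.length-α Dumb.length-γ) Dumb.length-β) (lemma p q r))))
    where
    lemma : ∀ p q r → suc (2 + p) + suc (2 + q) + suc r ≡ suc (3 + p + suc r + (2 + q))
    lemma = ℕ-Solver.solve-∀
  transported : ∀ {n} → n ≡ 3 + p + suc r + (2 + q) → (H : Graph n) → permanentalPoly (laplacian H) D.≈ permanentalPoly (laplacian G) → H ≅ G
  transported refl H same = Characterisation.isomorphic-to-dumbbell G H same (proj₁ ordered) full
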